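{- Let $n=2^s$ or $n=3\cdot 2^s$ with $n\ge 8$. Then the map $\varphi_n$ is a group isomorphism from $\mathrm{PU}_2(R_n)$ onto $\widetilde{\mathcal M}_n^\times/\underline R_n^\times\subseteq \mathbb H_n^\times/F_n^\times$.
   Context: Notation: $\zeta_n=e^{2\pi i/n}$, $K_n={\mathbf Q}(\zeta_n)$, $F_n=K_n\cap{\mathbf R}$, $R_n={\mathbf Z}[\zeta_n,1/2]$, $\underline R_n=R_n\cap F_n={\mathbf Z}[\zeta_n+\zeta_n^{ -1},1/2]$. $\mathbb H_n=\mathbb H\otimes_{\mathbf Q}F_n$ with $\mathbb H$ the Hamilton quaternions over ${\mathbf Q}$ (basis $1,i,j,k$, $i^2=j^2=k^2=-1$, $ij=-ji=k$), and $\widetilde{\mathcal M}_n=\underline R_n\langle 1,i,j,(1+i+j+k)/2\rangle$. $\mathrm{PU}_2(R_n)$ is the group of $2\times2$ unitary matrices over $R_n$ modulo scalars. The map $\varphi_n$: for $A\in\mathrm U_2(K_n)$ with $\alpha=\det A$ (so $\alpha\bar\alpha=1$), choose $\beta\in K_n^\times$ with $\alpha=\bar\beta/\beta$; then $\beta A=\begin{pmatrix} r+s\sqrt{ -1}& t+u\sqrt{ -1}\\ -t+u\sqrt{ -1}& r-s\sqrt{ -1}\end{pmatrix}$ with $r,s,t,u\in F_n$, and $\varphi_n([A])$ is the class of $r-ui-tj-sk$ in $\mathbb H_n^\times/F_n^\times$. -}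

module Defs where

open import Data.Nat as ℕ using (ℕ; zero; suc; _^_; _∸_; _≡ᵇ_)
open import Data.Nat.DivMod using (_/_)
open import Data.Rational as ℚ using (ℚ; 0ℚ; 1ℚ; ½; ↧ₙ_)
open import Data.List as L using (List; []; _∷_)
open import Data.Vec as V using (Vec; []; _∷_)
open import Data.Fin using (Fin; toℕ)
open import Data.Bool using (if_then_else_)
open import Data.Product using (Σ; ∃; _×_; _,_)
open import Relation.Binary.PropositionalEquality using (_≡_)
open import Relation.Nullary using (¬_)

data Family : Set where
  pow2   : Family
  3pow2  : Family

level : Family → ℕ → ℕ
level pow2  s = 2 ^ s
level 3pow2 s = 3 ℕ.* 2 ^ s

-- degree φ(n) of the cyclotomic field K_n (valid for s ≥ 1)
deg : Family → ℕ → ℕ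
deg pow2  s = 2 ^ (s ∸ 1)
deg 3pow2 s = 2 ^ s

-- K_n = Q[x]/Φ_n(x), with ζ_n the class of x, where
--   Φ_{2^s}(x)   = x^d + 1                 (d = 2^(s-1))
--   Φ_{3·2^s}(x) = x^d - x^(d/2) + 1       (d = 2^s)
-- Elements are represented by their coefficient vectors in the power
-- basis 1, ζ, …, ζ^(d-1); equality in K_n is ≡ on these vectors.
K : Family → ℕ → Set
K f s = Vec ℚ (deg f s)

-- correction added when reducing the overflow coefficient o of x^d
correction : (f : Family) (s : ℕ) → ℚ → K f s
correction pow2  s o = V.tabulate λ i → if toℕ i ≡ᵇ 0 then ℚ.- o else 0ℚ
correction 3pow2 s o = V.tabulate λ i →
  (if toℕ i ≡ᵇ 0 then ℚ.- o else 0ℚ) ℚ.+ (if toℕ i ≡ᵇ 2 ^ (s ∸ 1) then o else 0ℚ)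

-- a + x·v, returning also the coefficient of x^d that falls off the top
shiftIn : ∀ {d} → ℚ → Vec ℚ d → Vec ℚ d × ℚ
shiftIn a [] = [] , a
shiftIn a (x ∷ xs) with shiftIn x xs
... | ys , o = (a ∷ ys) , o

-- reduction of an arbitrary polynomial (coefficient list, constant term
-- first) modulo Φ_n
reduce : (f : Family) (s : ℕ) → List ℚ → K f s
reduce f s [] = V.replicate _ 0ℚ
reduce f s (a ∷ p) with shiftIn a (reduce f s p)
... | ys , o = V.zipWith ℚ._+_ ys (correction f s o)

infixl 6 _+P_
infixl 7 _*P_
_+P_ : List ℚ → List ℚ → List ℚ
[] +P q = q
(a ∷ p) +P [] = a ∷ p
(a ∷ p) +P (b ∷ q) = (a ℚ.+ b) ∷ (p +P q)

_*P_ : List ℚ → List ℚ → List ℚ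
[] *P q = []
(a ∷ p) *P q = L.map (a ℚ.*_) q +P (0ℚ ∷ (p *P q))

monomial : ℕ → List ℚ
monomial k = L.replicate k 0ℚ L.++ (1ℚ ∷ [])

module _ (f : Family) (s : ℕ) where

  n : ℕ
  n = level f s

  infixl 6 _+K_ _-K_
  infixl 7 _*K_
  _+K_ : K f s → K f s → K f s
  _+K_ = V.zipWith ℚ._+_

  -K_ : K f s → K f s
  -K_ = V.map (λ q → ℚ.- q)

  _-K_ : K f s → K f s → K f s
  a -K b = a +K (-K b)

  _*K_ : K f s → K f s → K f s
  a *K b = reduce f s (V.toList a *P V.toList b)

  _·K_ : ℚ → K f s → K f s
  q ·K a = V.map (q ℚ.*_) a

  0K 1K : K f s
  0K = reduce f s []
  1K = reduce f s (1ℚ ∷ [])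

  -- complex conjugation:  ζ ↦ ζ^{-1} = ζ^(n-1)
  conjK : K f s → K f s
  conjK a = reduce f s (L.foldr (λ c acc → (c ∷ []) +P (monomial (n ∸ 1) *P acc)) [] (V.toList a))

  -- √-1 = ζ_n^(n/4) = e^{2πi/4}   (n ≥ 8 so 4 ∣ n)
  sqrt-1 : K f s
  sqrt-1 = reduce f s (monomial (n / 4))

  -- membership in R_n = Z[ζ_n, 1/2]: all power-basis coefficients lie in
  -- Z[1/2] (the power basis is an integral basis of Z[ζ_n])
  Dyadic : ℚ → Set
  Dyadic q = ∃ λ k → ↧ₙ q ≡ 2 ^ k

  InR : K f s → Set
  InR a = ∀ i → Dyadic (V.lookup a i)

  -- membership in F_n = K_n ∩ R
  InF : K f s → Set
  InF a = conjK a ≡ a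

  InRF : K f s → Set
  InRF a = InR a × InF a

  record Mat : Set where
    constructor mat
    field
      m11 m12 m21 m22 : K f s

  open Mat public

  _*M_ : Mat → Mat → Mat
  A *M B = mat (m11 A *K m11 B +K m12 A *K m21 B)
               (m11 A *K m12 B +K m12 A *K m22 B)
               (m21 A *K m11 B +K m22 A *K m21 B)
               (m21 A *K m12 B +K m22 A *K m22 B)

  scaleM : K f s → Mat → Mat
  scaleM c A = mat (c *K m11 A) (c *K m12 A) (c *K m21 A) (c *K m22 A)

  adj : Mat → Mat
  adj A = mat (conjK (m11 A)) (conjK (m21 A)) (conjK (m12 A)) (conjK (m22 A))

  detM : Mat → K f s
  detM A = m11 A *K m22 A -K m12 A *K m21 A

  idM : Mat
  idM = mat 1K 0K 0K 1K

  IsU2R : Mat → Set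
  IsU2R A = (InR (m11 A) × InR (m12 A) × InR (m21 A) × InR (m22 A))
          × (A *M adj A ≡ idM) × (adj A *M A ≡ idM)

  _≈PU_ : Mat → Mat → Set
  A ≈PU B = ∃ λ λ' → InR λ' × (λ' *K conjK λ' ≡ 1K) × (B ≡ scaleM λ' A)

  record Quat : Set where
    constructor quat
    field
      qa qb qc qd : K f s

  open Quat public

  InH : Quat → Set
  InH x = InF (qa x) × InF (qb x) × InF (qc x) × InF (qd x)

  _*H_ : Quat → Quat → Quat
  x *H y = quat (qa x *K qa y -K qb x *K qb y -K qc x *K qc y -K qd x *K qd y)
                (qa x *K qb y +K qb x *K qa y +K qc x *K qd y -K qd x *K qc y)
                (qa x *K qc y -K qb x *K qd y +K qc x *K qa y +K qd x *K qb y)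
                (qa x *K qd y +K qb x *K qc y -K qc x *K qb y +K qd x *K qa y)

  1H 0H : Quat
  1H = quat 1K 0K 0K 0K
  0H = quat 0K 0K 0K 0K

  scaleH : K f s → Quat → Quat
  scaleH c x = quat (c *K qa x) (c *K qb x) (c *K qc x) (c *K qd x)

  -- x ∈ H_n^×  (H_n is a division algebra, so this is x ≠ 0)
  InHx : Quat → Set
  InHx x = InH x × ¬ (x ≡ 0H)

  _≈HF_ : Quat → Quat → Set
  x ≈HF y = ∃ λ c → InF c × ¬ (c ≡ 0K) × (y ≡ scaleH c x)

  -- M̃_n = R̲_n⟨1, i, j, (1+i+j+k)/2⟩
  InM : Quat → Set
  InM x = ∃ λ a → ∃ λ b → ∃ λ c → ∃ λ d →
          InRF a × InRF b × InRF c × InRF d ×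
          (x ≡ quat (a +K (½ ·K d)) (b +K (½ ·K d)) (c +K (½ ·K d)) (½ ·K d))

  InMx : Quat → Set
  InMx x = InM x × ∃ λ y → InM y × (x *H y ≡ 1H) × (y *H x ≡ 1H)

  _≈MR_ : Quat → Quat → Set
  x ≈MR y = ∃ λ c → InRF c × (∃ λ c' → InRF c' × (c *K c' ≡ 1K)) × (y ≡ scaleH c x)

  -- The map φ_n, as its graph:  Phi A x  says that  φ_n([A]) = [x]  in
  -- H_n^×/F_n^×, i.e. for some β ∈ K_n^× with det A = β̄/β we have
  -- βA = [[r + s√-1, t + u√-1], [-t + u√-1, r - s√-1]]  with r,s,t,u ∈ F_n
  -- and [x] = [r - u i - t j - s k].
  Phi : Mat → Quat → Set
  Phi A x = ∃ λ β → ¬ (β ≡ 0K) × (β *K detM A ≡ conjK β) ×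
            ∃ λ r → ∃ λ t → ∃ λ u → ∃ λ v →   -- v plays the role of s
            InF r × InF t × InF u × InF v ×
            (scaleM β A ≡ mat (r +K v *K sqrt-1) (t +K u *K sqrt-1)
                              ((-K t) +K u *K sqrt-1) (r -K v *K sqrt-1)) ×
            (quat r (-K u) (-K t) (-K v) ≈HF x)

{-# OPTIONS --safe #-}
-- Let O = ℤ[ζ] and R = O[1/2]. Unitary elements of R lie in O, because 2 has a single prime above it and that prime
-- is stable under conjugation; the trace form then shows that they are roots of unity. Hence det A is a power of ζ,
-- and β can be taken to be a unit of R: ζ⁻ᵏ or ζ⁻ᵏ(1 + ζ⁻¹). This places the image of φ in M̃ˣ.
--
-- Surjectivity amounts to Weber's theorem: the reduced norm κ of a unit of M̃ is β β̄ for a unit β of R, i.e. κ or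
-- κ (2 + ζ + ζ⁻¹) is a square in F. Let F_j be the tower of real subfields, with D_j = 2 + z_j + z_j⁻¹ for z_j the root
-- of unity generating its j-th level, let κ ∈ F_{j+1} be a sum of norms that is a unit of R up to squares, and let φ
-- generate Gal(F_{j+1}/F_j). By induction κ φ(κ) is a square δ² in F_j (after replacing κ by κ D_{j+1} if necessary),
-- and κ (κ + φ(κ) + 2δ) = (κ + δ)² moves the class of κ down to F_j, whose exceptional class D_j is a square in F_{j+1}.
-- At the bottom the field is ℚ or ℚ(√3), where positivity and unramifiedness outside 2 leave only the classes of 1 and 2.

module Submission where

open import Algebra.Bundles using (CommutativeRing)
import Algebra.Properties.CommutativeSemiring.Exp
import Algebra.Properties.Ring
import Algebra.Solver.Ring
open import Algebra.Solver.Ring.AlmostCommutativeRing using (_-Raw-AlmostCommutative⟶_; fromCommutativeRing)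
open import Algebra.Structures using (IsCommutativeRing)
open import Data.Bool using (Bool; true; false; if_then_else_)
open import Data.Empty using (⊥; ⊥-elim)
open import Data.Fin using (Fin; zero; suc; toℕ)
open import Data.Integer as ℤ using (ℤ; -[1+_])
import Data.Integer.Properties as ℤ
import Data.Integer.Solver
open import Data.List as L using (List; []; _∷_)
import Data.List.Properties as L
open import Data.List.Relation.Unary.All as All using (All; []; _∷_)
import Data.List.Relation.Unary.All.Properties as All
open import Data.Maybe using (Maybe; just; nothing)
open import Data.Nat as ℕ using (ℕ; zero; suc; _∸_; _≡ᵇ_; _≤_)
open import Data.Nat.Coprimality as Coprimality using (Coprime; coprime-divisor; coprime-Bézout)
import Data.Nat.Divisibility as ℕ∣
import Data.Nat.DivMod as ℕ
open import Data.Nat.GCD using (module Bézout)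
open import Data.Nat.Induction using (<-rec)
open import Data.Nat.ListAction using (product)
open import Data.Nat.Primality as Primality using (prime[2]; euclidsLemma; prime⇒irreducible; prime⇒nonZero)
open import Data.Nat.Primality.Factorisation using (factorise; PrimeFactorisation)
import Data.Nat.Properties as ℕ
import Data.Nat.Solver
open import Data.Product using (∃; _×_; _,_; proj₁; proj₂)
open import Data.Rational as ℚ using (ℚ; mkℚ; 0ℚ; 1ℚ; ½; ↥_; ↧_; ↧ₙ_)
import Data.Rational.Properties as ℚ
import Data.Rational.Solver
import Data.Rational.Unnormalised as ℚᵘ
import Data.Rational.Unnormalised.Properties as ℚᵘ
import Data.Sum as Sum
open import Data.Sum using (_⊎_; inj₁; inj₂)
open import Data.Unit using (⊤; tt)
open import Data.Vec as V using (Vec; []; _∷_)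
import Data.Vec.Properties as V
open import Relation.Binary.Definitions using (DecidableEquality)
open import Relation.Binary.PropositionalEquality using (_≡_; _≢_; refl; sym; trans; cong; cong₂; subst; isEquivalence)
open import Relation.Nullary using (¬_; Dec; yes; no)
open import Relation.Nullary.Decidable using (toWitness)

open import Defs hiding (K; n)

-- At the outset K is only a commutative ring of coefficient vectors. That it has no zero divisors
-- comes from the prime above 2: an element of O divisible by too high a power of 2 has coefficients
-- too small to be nonzero. Inverses are then found by multiplying an element by its conjugates,
-- down the tower, until a rational number is reached. No embedding into ℂ is used, so total
-- positivity gives way to being of the form x x̄ + y ȳ, the reduced norm of a quaternion: this is
-- stable under products and automorphisms, and the trace form shows that a rational number of this
-- form is nonnegative. The descent leaves the units of R, since κ + φ(κ) + 2δ is a unit only up to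
-- a square; the induction therefore runs over all elements with this weaker property, and
-- integrality of the final square root is recovered at the end. Unramifiedness of an odd p enters
-- without prime ideals, as the statement that pR is a radical ideal; for 3, which ramifies when it
-- divides n, the element √3 plays this part.

private
  module ℕS = Data.Nat.Solver.+-*-Solver
  module ℤS = Data.Integer.Solver.+-*-Solver
  module ℚS = Data.Rational.Solver.+-*-Solver

infixr 5.5 _∙_
_∙_ : {A : Set} {x y z : A} → x ≡ y → y ≡ z → x ≡ z
_∙_ = trans

-- Integers and dyadic rationals inside ℚ.

int : ℤ → ℚ
int z = mkℚ z 0 (Coprimality.sym (Coprimality.1-coprimeTo _))

int-injective : ∀ {x y} → int x ≡ int y → x ≡ y
int-injective eq = cong ↥_ eq

int-+ : ∀ x y → int (x ℤ.+ y) ≡ int x ℚ.+ int y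
int-+ x y = ℚ.toℚᵘ-injective (ℚᵘ.≃-trans (ℚᵘ.*≡* lem) (ℚᵘ.≃-sym (ℚ.toℚᵘ-homo-+ (int x) (int y))))
  where
  lem : (x ℤ.+ y) ℤ.* ℤ.+ 1 ≡ (x ℤ.* ℤ.+ 1 ℤ.+ y ℤ.* ℤ.+ 1) ℤ.* ℤ.+ 1
  lem = cong (ℤ._* ℤ.+ 1) (sym (cong₂ ℤ._+_ (ℤ.*-identityʳ x) (ℤ.*-identityʳ y)))

int-* : ∀ x y → int (x ℤ.* y) ≡ int x ℚ.* int y
int-* x y = ℚ.toℚᵘ-injective (ℚᵘ.≃-sym (ℚ.toℚᵘ-homo-* (int x) (int y)))

int-neg : ∀ x → int (ℤ.- x) ≡ ℚ.- int x
int-neg (ℤ.+ zero)   = refl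
int-neg (ℤ.+ suc n)  = refl
int-neg -[1+ n ]   = refl

clear : ∀ q → q ℚ.* int (↧ q) ≡ int (↥ q)
clear q@(mkℚ a d _) = ℚ.toℚᵘ-injective (ℚᵘ.≃-trans (ℚ.toℚᵘ-homo-* q (int (↧ q))) (ℚᵘ.*≡* lem))
  where
  lem : (a ℤ.* ℤ.+ suc d) ℤ.* ℤ.+ 1 ≡ a ℤ.* (ℤ.+ suc (d ℕ.* 1))
  lem = ℤ.*-identityʳ _ ∙ cong (λ e → a ℤ.* ℤ.+ suc e) (sym (ℕ.*-identityʳ d))

IsInt : ℚ → Set
IsInt q = ∃ λ z → q ≡ int z

2^ : ℕ → ℚ
2^ k = int (ℤ.+ (2 ℕ.^ k))

2^-+ : ∀ j k → 2^ (j ℕ.+ k) ≡ 2^ j ℚ.* 2^ k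
2^-+ j k = cong (λ e → int (ℤ.+ e)) (ℕ.^-distribˡ-+-* 2 j k)
  ∙ cong int (ℤ.pos-* (2 ℕ.^ j) (2 ℕ.^ k)) ∙ int-* (ℤ.+ (2 ℕ.^ j)) (ℤ.+ (2 ℕ.^ k))

IsDyadic : ℚ → Set
IsDyadic q = ∃ λ k → ↧ₙ q ≡ 2 ℕ.^ k

-- Euclid's lemma at 2 finds a factor 2 in the cofactor or in `d`; cancelling it there lowers the
-- exponent.
∣2^⇒≡2^ : ∀ k {d} → d ℕ∣.∣ 2 ℕ.^ k → ∃ λ j → d ≡ 2 ℕ.^ j
∣2^⇒≡2^ zero d∣1 = 0 , ℕ∣.∣1⇒≡1 d∣1
∣2^⇒≡2^ (suc k) {d} (ℕ∣.divides q eq) with euclidsLemma q d prime[2]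
  (ℕ∣.divides (2 ℕ.^ k) (sym eq ∙ ℕ.*-comm 2 (2 ℕ.^ k)))
... | inj₁ (ℕ∣.divides q' refl) =
  ∣2^⇒≡2^ k (ℕ∣.divides q' (ℕ.*-cancelˡ-≡ _ _ 2 (eq ∙ cong (ℕ._* d) (ℕ.*-comm q' 2) ∙ ℕ.*-assoc 2 q' d)))
... | inj₂ (ℕ∣.divides d' refl) with ∣2^⇒≡2^ k {d'} (ℕ∣.divides q (ℕ.*-cancelˡ-≡ _ _ 2
        (eq ∙ sym (ℕ.*-assoc q d' 2) ∙ ℕ.*-comm (q ℕ.* d') 2)))
...   | j , refl = suc j , ℕ.*-comm (2 ℕ.^ j) 2

dyadic⇒ : ∀ {q} → IsDyadic q → ∃ λ k → IsInt (2^ k ℚ.* q)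
dyadic⇒ {q} (k , eq) = k , ↥ q , ℚ.*-comm (2^ k) q ∙ cong (λ e → q ℚ.* int (ℤ.+ e)) (sym eq) ∙ clear q

-- Clearing denominators gives 2ᵏ · `↥ q` = z · `↧ q`; since numerator and denominator are coprime,
-- the denominator divides 2ᵏ.
⇒dyadic : ∀ {q} k → IsInt (2^ k ℚ.* q) → IsDyadic q
⇒dyadic {q} k (z , eq) = ∣2^⇒≡2^ k (coprime-divisor (Coprimality.sym (ℚ-coprime q)) (ℕ∣.divides ℤ.∣ z ∣ absEq))
  where
  ℚ-coprime : ∀ r → Coprime ℤ.∣ ↥ r ∣ (↧ₙ r)
  ℚ-coprime (mkℚ _ _ c) = Coprimality.recompute c
  intEq : (ℤ.+ (2 ℕ.^ k)) ℤ.* ↥ q ≡ z ℤ.* ↧ q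
  intEq = int-injective (int-* (ℤ.+ (2 ℕ.^ k)) (↥ q) ∙ cong (2^ k ℚ.*_) (sym (clear q))
     ∙ sym (ℚ.*-assoc (2^ k) q (int (↧ q))) ∙ cong (ℚ._* int (↧ q)) eq ∙ sym (int-* z (↧ q)))
  absEq : ℤ.∣ ↥ q ∣ ℕ.* 2 ℕ.^ k ≡ ℤ.∣ z ∣ ℕ.* ↧ₙ q
  absEq = (ℕ.*-comm _ (2 ℕ.^ k)) ∙ sym (ℤ.abs-* (ℤ.+ (2 ℕ.^ k)) (↥ q)) ∙ cong ℤ.∣_∣ intEq ∙ ℤ.abs-* z (↧ q)

record IsSubring (P : ℚ → Set) : Set where
  field
    0∈   : P 0ℚ
    1∈   : P 1ℚ
    +∈   : ∀ {x y} → P x → P y → P (x ℚ.+ y)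
    *∈   : ∀ {x y} → P x → P y → P (x ℚ.* y)
    neg∈ : ∀ {x} → P x → P (ℚ.- x)

open IsSubring public

int-subring : IsSubring IsInt
int-subring .0∈ = ℤ.+ 0 , refl
int-subring .1∈ = ℤ.+ 1 , refl
int-subring .+∈ (x , refl) (y , refl) = x ℤ.+ y , sym (int-+ x y)
int-subring .*∈ (x , refl) (y , refl) = x ℤ.* y , sym (int-* x y)
int-subring .neg∈ (x , refl) = ℤ.- x , sym (int-neg x)

dyadic-subring : IsSubring IsDyadic
dyadic-subring .0∈ = 0 , refl
dyadic-subring .1∈ = 0 , refl
dyadic-subring .+∈ {x} {y} p q with dyadic⇒ {x} p | dyadic⇒ {y} q
... | j , a | k , b = ⇒dyadic {x ℚ.+ y} (j ℕ.+ k)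
  (subst IsInt (ℚS.solve 4 (λ u v x y →
    v ℚS.:* (u ℚS.:* x) ℚS.:+ u ℚS.:* (v ℚS.:* y) ℚS.:= (u ℚS.:* v) ℚS.:* (x ℚS.:+ y)) refl (2^ j) (2^ k) x y
       ∙ cong (ℚ._* (x ℚ.+ y)) (sym (2^-+ j k)))
     (int-subring .+∈ (int-subring .*∈ (ℤ.+ (2 ℕ.^ k) , refl) a) (int-subring .*∈ (ℤ.+ (2 ℕ.^ j) , refl) b)))
dyadic-subring .*∈ {x} {y} p q with dyadic⇒ {x} p | dyadic⇒ {y} q
... | j , a | k , b = ⇒dyadic {x ℚ.* y} (j ℕ.+ k)
  (subst IsInt (ℚS.solve 4 (λ u v x y → (u ℚS.:* x) ℚS.:* (v ℚS.:* y) ℚS.:= (u ℚS.:* v) ℚS.:* (x ℚS.:* y)) refl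
    (2^ j) (2^ k) x y
       ∙ cong (ℚ._* (x ℚ.* y)) (sym (2^-+ j k)))
     (int-subring .*∈ a b))
dyadic-subring .neg∈ {x} (k , eq) = k , ℤ.+-injective (ℚ.↧-neg x) ∙ eq

int⇒dyadic : ∀ {q} → IsInt q → IsDyadic q
int⇒dyadic (z , refl) = 0 , refl

-- Commutative ℚ-algebras, their ring solver and evaluation of polynomials.

record ℚ-Algebra : Set₁ where
  infixl 6 _+_
  infixl 7 _*_
  infix  8 -_
  field
    K                 : Set
    _+_ _*_           : K → K → K
    -_                : K → K
    0# 1#             : K
    isCommutativeRing : IsCommutativeRing _≡_ _+_ _*_ -_ 0# 1#
    ι                 : ℚ → K
    ι-+               : ∀ p q → ι (p ℚ.+ q) ≡ ι p + ι q
    ι-*               : ∀ p q → ι (p ℚ.* q) ≡ ι p * ι q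
    ι-1               : ι 1ℚ ≡ 1#

module Algebra′ (A : ℚ-Algebra) where
  open ℚ-Algebra A public

  commutativeRing : CommutativeRing _ _
  commutativeRing = record { isCommutativeRing = isCommutativeRing }

  open CommutativeRing commutativeRing public
    using (+-assoc; +-comm; +-identityˡ; +-identityʳ; -‿inverseˡ; -‿inverseʳ;
           *-assoc; *-comm; *-identityˡ; *-identityʳ; distribˡ; distribʳ; zeroˡ; zeroʳ; ring;
             commutativeSemiring)
  open Algebra.Properties.Ring ring public using (-0#≈0#; +-cancelˡ; +-inverseʳ-unique)
  open Algebra.Properties.CommutativeSemiring.Exp commutativeSemiring public
    using (_^_; ^-homo-*; ^-assocʳ; ^-distrib-*)

  infixl 6 _-_
  _-_ : K → K → K
  x - y = x + - y

  ι-0 : ι 0ℚ ≡ 0#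
  ι-0 = +-cancelˡ (ι 0ℚ) _ _ (sym (ι-+ 0ℚ 0ℚ) ∙ sym (+-identityʳ _))

  ι-neg : ∀ q → ι (ℚ.- q) ≡ - ι q
  ι-neg q = +-inverseʳ-unique (ι q) _ (sym (ι-+ q (ℚ.- q)) ∙ cong ι (ℚ.+-inverseʳ q) ∙ ι-0)

  -- The clauses for 0 and 1 make these two solver constants definitionally equal to `0#` and `1#`,
  -- so that goals written with them match the solver's output.
  num : ℤ → K
  num (ℤ.+ 0) = 0#
  num (ℤ.+ 1) = 1#
  num z     = ι (int z)

  num≡ι : ∀ z → num z ≡ ι (int z)
  num≡ι (ℤ.+ 0)             = sym ι-0
  num≡ι (ℤ.+ 1)             = sym ι-1
  num≡ι (ℤ.+ suc (suc n))   = refl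
  num≡ι -[1+ n ]          = refl

  num-+ : ∀ x y → num (x ℤ.+ y) ≡ num x + num y
  num-+ x y = num≡ι (x ℤ.+ y) ∙ cong ι (int-+ x y) ∙ ι-+ (int x) (int y) ∙ sym (cong₂ _+_ (num≡ι x) (num≡ι y))

  num-* : ∀ x y → num (x ℤ.* y) ≡ num x * num y
  num-* x y = num≡ι (x ℤ.* y) ∙ cong ι (int-* x y) ∙ ι-* (int x) (int y) ∙ sym (cong₂ _*_ (num≡ι x) (num≡ι y))

  num-neg : ∀ x → num (ℤ.- x) ≡ - num x
  num-neg x = num≡ι (ℤ.- x) ∙ cong ι (int-neg x) ∙ ι-neg (int x) ∙ sym (cong -_ (num≡ι x))

  morphism : ℤ.+-*-rawRing -Raw-AlmostCommutative⟶ fromCommutativeRing commutativeRing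
  morphism = record { ⟦_⟧ = num ; +-homo = num-+ ; *-homo = num-* ; -‿homo = num-neg ; 0-homo = refl ; 1-homo =
    refl }

  num-≟ : ∀ x y → Maybe (num x ≡ num y)
  num-≟ x y with x ℤ.≟ y
  ... | yes eq = just (cong num eq)
  ... | no _   = nothing

  open Algebra.Solver.Ring ℤ.+-*-rawRing (fromCommutativeRing commutativeRing) morphism num-≟ public
    using (Polynomial; solve; con; _:+_; _:*_; _:-_; :-_; _:^_; _:=_)

  :nat : ∀ {n} → ℕ → Polynomial n
  :nat k = con (ℤ.+ k)

  nat : ℕ → K
  nat k = num (ℤ.+ k)

  2# : K
  2# = nat 2

  h : K
  h = ι ½

  h*2 : h * 2# ≡ 1#
  h*2 = sym (ι-* ½ (int (ℤ.+ 2))) ∙ ι-1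

  ev : K → List ℚ → K
  ev z []      = 0#
  ev z (a ∷ p) = ι a + z * ev z p

  ev-+P : ∀ z p q → ev z (p +P q) ≡ ev z p + ev z q
  ev-+P z [] q = sym (+-identityˡ _)
  ev-+P z (a ∷ p) [] = sym (+-identityʳ _)
  ev-+P z (a ∷ p) (b ∷ q) = (cong₂ _+_ (ι-+ a b) (cong (z *_) (ev-+P z p q)))
    ∙ solve 5 (λ z a b p q → (a :+ b) :+ z :* (p :+ q) := (a :+ z :* p) :+ (b :+ z :* q)) refl z (ι a) (ι b)
      (ev z p) (ev z q)

  ev-map : ∀ z c p → ev z (L.map (c ℚ.*_) p) ≡ ι c * ev z p
  ev-map z c [] = sym (zeroʳ _)
  ev-map z c (a ∷ p) = (cong₂ _+_ (ι-* c a) (cong (z *_) (ev-map z c p)))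
    ∙ solve 4 (λ z c a p → c :* a :+ z :* (c :* p) := c :* (a :+ z :* p)) refl z (ι c) (ι a) (ev z p)

  ev-*P : ∀ z p q → ev z (p *P q) ≡ ev z p * ev z q
  ev-*P z [] q = sym (zeroˡ _)
  ev-*P z (a ∷ p) q = ev-+P z (L.map (a ℚ.*_) q) (0ℚ ∷ (p *P q))
    ∙ (cong₂ _+_ (ev-map z a q) (cong₂ _+_ ι-0 (cong (z *_) (ev-*P z p q))))
    ∙ solve 4 (λ z a p q → a :* q :+ (:nat 0 :+ z :* (p :* q)) := (a :+ z :* p) :* q) refl z (ι a) (ev z p)
      (ev z q)

-- Coefficient vectors and the linearity of shifting and correcting.

private
  variable
    dim : ℕ

infixl 6 _⊕_
infixr 7 _⊙_
_⊕_ : Vec ℚ dim → Vec ℚ dim → Vec ℚ dim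
_⊕_ = V.zipWith ℚ._+_

_⊙_ : ℚ → Vec ℚ dim → Vec ℚ dim
q ⊙ v = V.map (q ℚ.*_) v

0ⱽ : Vec ℚ dim
0ⱽ = V.replicate _ 0ℚ

⊙-distribˡ : ∀ q (u v : Vec ℚ dim) → q ⊙ (u ⊕ v) ≡ q ⊙ u ⊕ q ⊙ v
⊙-distribˡ q [] [] = refl
⊙-distribˡ q (x ∷ u) (y ∷ v) = cong₂ _∷_ (ℚ.*-distribˡ-+ q x y) (⊙-distribˡ q u v)

⊙-distribʳ : ∀ p q (v : Vec ℚ dim) → (p ℚ.+ q) ⊙ v ≡ p ⊙ v ⊕ q ⊙ v
⊙-distribʳ p q [] = refl
⊙-distribʳ p q (x ∷ v) = cong₂ _∷_ (ℚ.*-distribʳ-+ x p q) (⊙-distribʳ p q v)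

⊙-assoc : ∀ p q (v : Vec ℚ dim) → (p ℚ.* q) ⊙ v ≡ p ⊙ q ⊙ v
⊙-assoc p q [] = refl
⊙-assoc p q (x ∷ v) = cong₂ _∷_ (ℚ.*-assoc p q x) (⊙-assoc p q v)

⊙-comm : ∀ p q (v : Vec ℚ dim) → p ⊙ q ⊙ v ≡ q ⊙ p ⊙ v
⊙-comm p q v = sym (⊙-assoc p q v) ∙ cong (_⊙ v) (ℚ.*-comm p q) ∙ ⊙-assoc q p v

⊙-identity : (v : Vec ℚ dim) → 1ℚ ⊙ v ≡ v
⊙-identity [] = refl
⊙-identity (x ∷ v) = cong₂ _∷_ (ℚ.*-identityˡ x) (⊙-identity v)

⊙-zeroˡ : (v : Vec ℚ dim) → 0ℚ ⊙ v ≡ 0ⱽ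
⊙-zeroˡ [] = refl
⊙-zeroˡ (x ∷ v) = cong₂ _∷_ (ℚ.*-zeroˡ x) (⊙-zeroˡ v)

⊙-zeroʳ : ∀ q → q ⊙ 0ⱽ {dim} ≡ 0ⱽ
⊙-zeroʳ {zero} q = refl
⊙-zeroʳ {suc d} q = cong₂ _∷_ (ℚ.*-zeroʳ q) (⊙-zeroʳ q)

⊕-assoc : (u v w : Vec ℚ dim) → (u ⊕ v) ⊕ w ≡ u ⊕ (v ⊕ w)
⊕-assoc = V.zipWith-assoc ℚ.+-assoc

⊕-comm : (u v : Vec ℚ dim) → u ⊕ v ≡ v ⊕ u
⊕-comm = V.zipWith-comm ℚ.+-comm

⊕-identityˡ : (v : Vec ℚ dim) → 0ⱽ ⊕ v ≡ v
⊕-identityˡ = V.zipWith-identityˡ ℚ.+-identityˡ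

⊕-identityʳ : (v : Vec ℚ dim) → v ⊕ 0ⱽ ≡ v
⊕-identityʳ = V.zipWith-identityʳ ℚ.+-identityʳ

⊕-interchange : (a b c e : Vec ℚ dim) → (a ⊕ b) ⊕ (c ⊕ e) ≡ (a ⊕ c) ⊕ (b ⊕ e)
⊕-interchange a b c e = ⊕-assoc a b _ ∙ cong (a ⊕_) (sym (⊕-assoc b c e)
   ∙ cong (_⊕ e) (⊕-comm b c) ∙ ⊕-assoc c b e) ∙ sym (⊕-assoc a c _)

negⱽ : Vec ℚ dim → Vec ℚ dim
negⱽ = V.map (λ q → ℚ.- q)

⊕-inverseˡ : (v : Vec ℚ dim) → negⱽ v ⊕ v ≡ 0ⱽ
⊕-inverseˡ = V.zipWith-inverseˡ ℚ.+-inverseˡ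

⊕-inverseʳ : (v : Vec ℚ dim) → v ⊕ negⱽ v ≡ 0ⱽ
⊕-inverseʳ = V.zipWith-inverseʳ ℚ.+-inverseʳ

shift-⊕ : ∀ a b (u v : Vec ℚ dim) → shiftIn (a ℚ.+ b) (u ⊕ v) ≡
  (proj₁ (shiftIn a u) ⊕ proj₁ (shiftIn b v) , proj₂ (shiftIn a u) ℚ.+ proj₂ (shiftIn b v))
shift-⊕ a b [] [] = refl
shift-⊕ a b (x ∷ u) (y ∷ v) rewrite shift-⊕ x y u v = refl

shift-⊙ : ∀ q a (u : Vec ℚ dim) →
  shiftIn (q ℚ.* a) (q ⊙ u) ≡ (q ⊙ proj₁ (shiftIn a u) , q ℚ.* proj₂ (shiftIn a u))
shift-⊙ q a [] = refl
shift-⊙ q a (x ∷ u) rewrite shift-⊙ q x u = refl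

shift-toList : ∀ a (v : Vec ℚ dim) →
  a ∷ V.toList v ≡ V.toList (proj₁ (shiftIn a v)) L.++ (proj₂ (shiftIn a v) ∷ [])
shift-toList a [] = refl
shift-toList a (x ∷ v) = cong (a ∷_) (shift-toList x v)

zipWith-tabulate : ∀ {F G : Fin dim → ℚ} → V.tabulate F ⊕ V.tabulate G ≡ V.tabulate (λ i → F i ℚ.+ G i)
zipWith-tabulate {zero} = refl
zipWith-tabulate {suc d} {F} {G} = cong ((F zero ℚ.+ G zero) ∷_) zipWith-tabulate

δ : Bool → ℚ → ℚ
δ b x = if b then x else 0ℚ

δ-+ : ∀ b x y → δ b (x ℚ.+ y) ≡ δ b x ℚ.+ δ b y
δ-+ true x y = refl
δ-+ false x y = refl

δ-* : ∀ b q x → δ b (q ℚ.* x) ≡ q ℚ.* δ b x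
δ-* true q x = refl
δ-* false q x = sym (ℚ.*-zeroʳ q)

module _ where
  open ℚS using (solve; _:+_; _:*_; _:=_)

  correction-⊕ : ∀ f s a b → correction f s (a ℚ.+ b) ≡ correction f s a ⊕ correction f s b
  correction-⊕ pow2 s a b =
    (V.tabulate-cong λ i → cong (δ (toℕ i ≡ᵇ 0)) (ℚ.neg-distrib-+ a b) ∙ δ-+ (toℕ i ≡ᵇ 0) (ℚ.- a) (ℚ.- b))
     ∙ sym zipWith-tabulate
  correction-⊕ 3pow2 s a b = (V.tabulate-cong λ i →
        (cong₂ ℚ._+_ (cong (δ (toℕ i ≡ᵇ 0)) (ℚ.neg-distrib-+ a b) ∙ δ-+ (toℕ i ≡ᵇ 0) (ℚ.- a) (ℚ.- b))
          (δ-+ (toℕ i ≡ᵇ 2 ℕ.^ (s ∸ 1)) a b))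
          ∙ solve 4 (λ x y z w → (x :+ y) :+ (z :+ w) := (x :+ z) :+ (y :+ w)) refl (δ (toℕ i ≡ᵇ 0) (ℚ.- a))
            (δ (toℕ i ≡ᵇ 0) (ℚ.- b))
            (δ (toℕ i ≡ᵇ 2 ℕ.^ (s ∸ 1)) a) (δ (toℕ i ≡ᵇ 2 ℕ.^ (s ∸ 1)) b))
     ∙ sym zipWith-tabulate

  correction-⊙ : ∀ f s q a → correction f s (q ℚ.* a) ≡ q ⊙ correction f s a
  correction-⊙ pow2 s q a =
    (V.tabulate-cong λ i → cong (δ (toℕ i ≡ᵇ 0)) (ℚ.neg-distribʳ-* q a) ∙ δ-* (toℕ i ≡ᵇ 0) q (ℚ.- a))
     ∙ (V.tabulate-∘ (q ℚ.*_) _)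
  correction-⊙ 3pow2 s q a = (V.tabulate-cong λ i →
        (cong₂ ℚ._+_ (cong (δ (toℕ i ≡ᵇ 0)) (ℚ.neg-distribʳ-* q a) ∙ δ-* (toℕ i ≡ᵇ 0) q (ℚ.- a))
          (δ-* (toℕ i ≡ᵇ 2 ℕ.^ (s ∸ 1)) q a))
          ∙ sym (ℚ.*-distribˡ-+ q (δ (toℕ i ≡ᵇ 0) (ℚ.- a)) (δ (toℕ i ≡ᵇ 2 ℕ.^ (s ∸ 1)) a)))
     ∙ (V.tabulate-∘ (q ℚ.*_) _)

-- The ring ℚ[x]/Φₙ on coefficient vectors.

module Reduction (f : Family) (s : ℕ) where

  -- The recursion step of `reduce`, isolated because it is linear in both arguments; with constant
  -- term 0 it is multiplication by x.
  step : ℚ → Defs.K f s → Defs.K f s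
  step a v = proj₁ (shiftIn a v) ⊕ correction f s (proj₂ (shiftIn a v))

  step-⊕ : ∀ a b u v → step (a ℚ.+ b) (u ⊕ v) ≡ step a u ⊕ step b v
  step-⊕ a b u v = cong (λ (ys , o) → ys ⊕ correction f s o) (shift-⊕ a b u v)
    ∙ cong ((proj₁ (shiftIn a u) ⊕ proj₁ (shiftIn b v)) ⊕_) (correction-⊕ f s _ _)
      ∙ (⊕-interchange (proj₁ (shiftIn a u)) _ _ _)

  step-⊙ : ∀ q a u → step (q ℚ.* a) (q ⊙ u) ≡ q ⊙ step a u
  step-⊙ q a u = cong (λ (ys , o) → ys ⊕ correction f s o) (shift-⊙ q a u)
    ∙ cong ((q ⊙ proj₁ (shiftIn a u)) ⊕_) (correction-⊙ f s q _) ∙ sym (⊙-distribˡ q (proj₁ (shiftIn a u)) _)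

  X : Defs.K f s → Defs.K f s
  X = step 0ℚ

  X-⊕ : ∀ u v → X (u ⊕ v) ≡ X u ⊕ X v
  X-⊕ u v = step-⊕ 0ℚ 0ℚ u v

  X-⊙ : ∀ q u → X (q ⊙ u) ≡ q ⊙ X u
  X-⊙ q u = cong (λ e → step e (q ⊙ u)) (sym (ℚ.*-zeroʳ q)) ∙ step-⊙ q 0ℚ u

  X-0 : X 0ⱽ ≡ 0ⱽ
  X-0 = cong X (sym (⊙-zeroˡ 0ⱽ)) ∙ X-⊙ 0ℚ 0ⱽ ∙ (⊙-zeroˡ _)

  𝟙 : Defs.K f s
  𝟙 = step 1ℚ 0ⱽ

  step-X : ∀ a v → step a v ≡ a ⊙ 𝟙 ⊕ X v
  step-X a v = cong₂ step (sym (ℚ.+-identityʳ a)) (sym (⊕-identityˡ v))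
    ∙ step-⊕ a 0ℚ 0ⱽ v ∙ cong (_⊕ X v) (cong₂ step (sym (ℚ.*-identityʳ a)) (sym (⊙-zeroʳ a)) ∙ step-⊙ a 1ℚ 0ⱽ)

  -- A polynomial acts through the linear operator `X`. Such operators commute with one another, and
  -- the product of K is one of them applied to a vector, so commutativity and associativity require
  -- no comparison of remainders.
  act : List ℚ → Defs.K f s → Defs.K f s
  act []      v = 0ⱽ
  act (a ∷ p) v = a ⊙ v ⊕ X (act p v)

  act-⊕ : ∀ p u v → act p (u ⊕ v) ≡ act p u ⊕ act p v
  act-⊕ [] u v = sym (⊕-identityˡ _)
  act-⊕ (a ∷ p) u v = (cong₂ _⊕_ (⊙-distribˡ a u v) (cong X (act-⊕ p u v) ∙ X-⊕ (act p u) (act p v)))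
    ∙ (⊕-interchange (a ⊙ u) _ _ _)

  act-⊙ : ∀ p q v → act p (q ⊙ v) ≡ q ⊙ act p v
  act-⊙ [] q v = sym (⊙-zeroʳ q)
  act-⊙ (a ∷ p) q v = (cong₂ _⊕_ (⊙-comm a q v) (cong X (act-⊙ p q v) ∙ X-⊙ q (act p v)))
    ∙ sym (⊙-distribˡ q (a ⊙ v) _)

  act-X : ∀ p v → act p (X v) ≡ X (act p v)
  act-X [] v = sym X-0
  act-X (a ∷ p) v = (cong₂ _⊕_ (sym (X-⊙ a v)) (cong X (act-X p v))) ∙ sym (X-⊕ (a ⊙ v) (X (act p v)))

  act-0 : ∀ p → act p 0ⱽ ≡ 0ⱽ
  act-0 [] = refl
  act-0 (a ∷ p) = (cong₂ _⊕_ (⊙-zeroʳ a) (cong X (act-0 p) ∙ X-0)) ∙ (⊕-identityˡ _)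

  act-act : ∀ p q v → act p (act q v) ≡ act q (act p v)
  act-act p [] v = act-0 p
  act-act p (a ∷ q) v = act-⊕ p _ _ ∙ (cong₂ _⊕_ (act-⊙ p a v) (act-X p _ ∙ cong X (act-act p q v)))

  reduce-act : ∀ p → reduce f s p ≡ act p 𝟙
  reduce-act [] = refl
  reduce-act (a ∷ p) = step-X a (reduce f s p) ∙ cong (λ v → a ⊙ 𝟙 ⊕ X v) (reduce-act p)

  reduce-+P : ∀ p q → reduce f s (p +P q) ≡ reduce f s p ⊕ reduce f s q
  reduce-+P [] q = sym (⊕-identityˡ _)
  reduce-+P (a ∷ p) [] = sym (⊕-identityʳ _)
  reduce-+P (a ∷ p) (b ∷ q) = cong (step (a ℚ.+ b)) (reduce-+P p q) ∙ step-⊕ a b (reduce f s p) (reduce f s q)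

  reduce-map : ∀ c p → reduce f s (L.map (c ℚ.*_) p) ≡ c ⊙ reduce f s p
  reduce-map c [] = sym (⊙-zeroʳ c)
  reduce-map c (a ∷ p) = cong (step (c ℚ.* a)) (reduce-map c p) ∙ step-⊙ c a (reduce f s p)

  reduce-*P : ∀ p q → reduce f s (p *P q) ≡ act p (reduce f s q)
  reduce-*P [] q = refl
  reduce-*P (a ∷ p) q = reduce-+P (L.map (a ℚ.*_) q) (0ℚ ∷ (p *P q))
    ∙ (cong₂ _⊕_ (reduce-map a q) (cong X (reduce-*P p q)))

  correction-0 : correction f s 0ℚ ≡ 0ⱽ
  correction-0 = cong (correction f s) (sym (ℚ.*-zeroˡ 0ℚ)) ∙ correction-⊙ f s 0ℚ 0ℚ ∙ (⊙-zeroˡ _)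

  zeros : ℕ → List ℚ
  zeros k = L.replicate k 0ℚ

  zeros-snoc : ∀ j → zeros (suc j) ≡ zeros j L.++ (0ℚ ∷ [])
  zeros-snoc zero = refl
  zeros-snoc (suc j) = cong (0ℚ ∷_) (zeros-snoc j)

  -- As long as the length stays within the degree, the coefficient shifted out is one of the
  -- padding zeros, so no correction ever occurs.
  toList-reduce : ∀ p j → L.length p ℕ.+ j ≡ deg f s → V.toList (reduce f s p) ≡ p L.++ zeros j
  toList-reduce [] j refl = V.toList-replicate _ 0ℚ
  toList-reduce (a ∷ p) j eq =
    cong V.toList (cong (proj₁ (shiftIn a r) ⊕_) (cong (correction f s) overflow ∙ correction-0)
    ∙ (⊕-identityʳ _)) ∙ low
    where
    r : Defs.K f s
    r = reduce f s p
    ih : a ∷ V.toList r ≡ (a ∷ p L.++ zeros j) L.++ (0ℚ ∷ [])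
    ih = cong (a ∷_) (toList-reduce p (suc j) (ℕ.+-suc _ j ∙ eq) ∙ cong (p L.++_) (zeros-snoc j)
      ∙ sym (L.++-assoc p _ _))
    snoc : V.toList (proj₁ (shiftIn a r)) L.∷ʳ proj₂ (shiftIn a r) ≡ (a ∷ p L.++ zeros j) L.∷ʳ 0ℚ
    snoc = sym (shift-toList a r) ∙ ih
    low : V.toList (proj₁ (shiftIn a r)) ≡ a ∷ p L.++ zeros j
    low = proj₁ (L.∷ʳ-injective (V.toList (proj₁ (shiftIn a r))) (a ∷ p L.++ zeros j) snoc)
    overflow : proj₂ (shiftIn a r) ≡ 0ℚ
    overflow = proj₂ (L.∷ʳ-injective (V.toList (proj₁ (shiftIn a r))) (a ∷ p L.++ zeros j) snoc)

  reduce-toList : ∀ v → reduce f s (V.toList v) ≡ v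
  reduce-toList v = sym (V.cast-is-id refl _)
    ∙ (V.toList-injective refl _ v
    (toList-reduce (V.toList v) 0 (ℕ.+-identityʳ _ ∙ V.length-toList v) ∙ (L.++-identityʳ _)))

  infixl 7 _⊛_
  _⊛_ : Defs.K f s → Defs.K f s → Defs.K f s
  _⊛_ = _*K_ f s

  ⊛-act : ∀ u v → u ⊛ v ≡ act (V.toList u) v
  ⊛-act u v = reduce-*P (V.toList u) (V.toList v) ∙ cong (act (V.toList u)) (reduce-toList v)

  act-𝟙 : ∀ v → act (V.toList v) 𝟙 ≡ v
  act-𝟙 v = sym (reduce-act (V.toList v)) ∙ reduce-toList v

  ⊛-comm : ∀ u v → u ⊛ v ≡ v ⊛ u
  ⊛-comm u v = ⊛-act u v ∙ cong (act (V.toList u)) (sym (act-𝟙 v))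
     ∙ act-act (V.toList u) (V.toList v) 𝟙 ∙ cong (act (V.toList v)) (act-𝟙 u) ∙ sym (⊛-act v u)

  ⊛-assoc : ∀ u v w → (u ⊛ v) ⊛ w ≡ u ⊛ (v ⊛ w)
  ⊛-assoc u v w = ⊛-comm (u ⊛ v) w ∙ ⊛-act w _ ∙ cong (act (V.toList w)) (⊛-act u v)
    ∙ act-act (V.toList w) (V.toList u) v ∙ cong (act (V.toList u)) (sym (⊛-act w v) ∙ ⊛-comm w v)
      ∙ sym (⊛-act u _)

  ⊛-distribˡ : ∀ u v w → u ⊛ (v ⊕ w) ≡ u ⊛ v ⊕ u ⊛ w
  ⊛-distribˡ u v w = ⊛-act u _ ∙ act-⊕ (V.toList u) v w ∙ sym (cong₂ _⊕_ (⊛-act u v) (⊛-act u w))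

  ⊛-identityʳ : ∀ u → u ⊛ 𝟙 ≡ u
  ⊛-identityʳ u = ⊛-act u 𝟙 ∙ act-𝟙 u

  ⊛-⊙ : ∀ q u v → u ⊛ (q ⊙ v) ≡ q ⊙ (u ⊛ v)
  ⊛-⊙ q u v = ⊛-act u _ ∙ act-⊙ (V.toList u) q v ∙ cong (q ⊙_) (sym (⊛-act u v))

  ⊕-⊛-isCommutativeRing : IsCommutativeRing _≡_ (_+K_ f s) (_*K_ f s) (-K_ f s) (0K f s) (1K f s)
  ⊕-⊛-isCommutativeRing = record
    { isRing = record
      { +-isAbelianGroup = record
        { isGroup = record
          { isMonoid = record
            { isSemigroup = record { isMagma =
              record { isEquivalence = isEquivalence ; ∙-cong = cong₂ _ } ; assoc = ⊕-assoc }
            ; identity = ⊕-identityˡ , ⊕-identityʳ }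
          ; inverse = ⊕-inverseˡ , ⊕-inverseʳ
          ; ⁻¹-cong = cong _ }
        ; comm = ⊕-comm }
      ; *-cong = cong₂ _
      ; *-assoc = ⊛-assoc
      ; *-identity = (λ u → ⊛-comm 𝟙 u ∙ ⊛-identityʳ u) , ⊛-identityʳ
      ; distrib = ⊛-distribˡ , λ u v w → ⊛-comm _ u ∙ ⊛-distribˡ u v w ∙ (cong₂ _⊕_ (⊛-comm u v) (⊛-comm u w))
      }
    ; *-comm = ⊛-comm
    }

  algebra : ℚ-Algebra
  algebra = record
    { isCommutativeRing = ⊕-⊛-isCommutativeRing
    ; ι   = _⊙ 𝟙
    ; ι-+ = λ p q → ⊙-distribʳ p q 𝟙
    ; ι-* = λ p q → ⊙-assoc p q 𝟙 ∙ sym (⊛-⊙ q (p ⊙ 𝟙) 𝟙 ∙ cong (q ⊙_) (⊛-identityʳ _) ∙ ⊙-comm q p 𝟙)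
    ; ι-1 = ⊙-identity 𝟙
    }

  open Algebra′ algebra hiding (K)

  ζ : Defs.K f s
  ζ = X 𝟙

  ζ*≡X : ∀ v → ζ * v ≡ X v
  ζ*≡X v = ⊛-comm ζ v ∙ ⊛-act v ζ ∙ act-X (V.toList v) 𝟙 ∙ cong X (act-𝟙 v)

  step≡ζ* : ∀ a v → step a v ≡ ι a + ζ * v
  step≡ζ* a v = step-X a v ∙ cong (ι a ⊕_) (sym (ζ*≡X v))

  reduce≡ev : ∀ p → reduce f s p ≡ ev ζ p
  reduce≡ev [] = refl
  reduce≡ev (a ∷ p) = step≡ζ* a (reduce f s p) ∙ cong (λ v → ι a + ζ * v) (reduce≡ev p)

  toList-⊕ : ∀ {d} (u v : Vec ℚ d) → V.toList (u ⊕ v) ≡ V.toList u +P V.toList v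
  toList-⊕ [] [] = refl
  toList-⊕ (x ∷ u) (y ∷ v) = cong (_ ∷_) (toList-⊕ u v)

  ev-∷ʳ : ∀ z l o → ev z (l L.∷ʳ o) ≡ ev z l + z ^ L.length l * ι o
  ev-∷ʳ z [] o = solve 2 (λ z o → o :+ z :* :nat 0 := :nat 0 :+ :nat 1 :* o) refl z (ι o)
  ev-∷ʳ z (a ∷ l) o = cong (λ e → ι a + z * e) (ev-∷ʳ z l o)
    ∙ solve 5 (λ z a e w o → a :+ z :* (e :+ w :* o) := (a :+ z :* e) :+ (z :* w) :* o) refl z (ι a) (ev z l)
      (z ^ L.length l) (ι o)

  -- Provides a single step with overflow 1, from which `relation` reads off that ζ is a root of Φₙ.
  overflow-unit : ∀ {d} → 0 ℕ.< d → ∃ λ (v : Vec ℚ d) → ∀ a → proj₂ (shiftIn a v) ≡ 1ℚ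
  overflow-unit {suc zero} _ = 1ℚ ∷ [] , λ _ → refl
  overflow-unit {suc (suc d)} _ with overflow-unit {suc d} ℕ.z<s
  ... | v , eq = 0ℚ ∷ v , λ _ → eq 0ℚ

  ev-delta : ∀ z {d} k o → k ℕ.< d →
    ev z (V.toList (V.tabulate {n = d} (λ i → if toℕ i ≡ᵇ k then o else 0ℚ))) ≡ ι o * z ^ k
  ev-delta z {suc d} zero o _ = cong (λ e → ι o + z * e) (allZero d)
      ∙ solve 2 (λ z o → o :+ z :* :nat 0 := o :* :nat 1) refl z (ι o)
    where
    allZero : ∀ d → ev z (V.toList (V.tabulate {n = d} (λ _ → 0ℚ))) ≡ 0#
    allZero zero = refl
    allZero (suc d) = cong₂ (λ a e → a + z * e) ι-0 (allZero d) ∙ +-identityˡ _ ∙ zeroʳ z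
  ev-delta z {suc d} (suc k) o (ℕ.s≤s k<d) = cong₂ (λ a e → a + z * e) ι-0 (ev-delta z k o k<d)
      ∙ solve 3 (λ z o w → :nat 0 :+ z :* (o :* w) := o :* (z :* w)) refl z (ι o) (z ^ k)

  module Basis (m : ℕ) (m>0 : 0 ℕ.< m) (deg≡ : deg f s ≡ m ℕ.+ m) (c : ℚ)
    (ev-correction : ∀ z o → ev z (V.toList (correction f s o)) ≡ ι o * (ι c * z ^ m - 1#)) where

    -- Replacing the overflow o xᵈ by its correction changes the value at `z` by -o Φₙ(z); the last
    -- factor is -Φₙ(z).
    ev-step : ∀ z a v → ev z (V.toList (step a v)) ≡
      ι a + z * ev z (V.toList v) + ι (proj₂ (shiftIn a v)) * (ι c * z ^ m - 1# - z ^ m * z ^ m)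
    ev-step z a v = cong (ev z) (toList-⊕ ys (correction f s o)) ∙ (ev-+P z (V.toList ys) _)
       ∙ cong (ev z (V.toList ys) +_) (ev-correction z o)
       ∙ solve 4 (λ y o r w → y :+ o :* r := (y :+ w :* o) :+ o :* (r :- w)) refl (ev z (V.toList ys)) (ι o)
         (ι c * z ^ m - 1#) (z ^ m * z ^ m)
       ∙ cong (_+ ι o * (ι c * z ^ m - 1# - z ^ m * z ^ m)) (sym full)
      where
      ys = proj₁ (shiftIn a v)
      o = proj₂ (shiftIn a v)
      full : ι a + z * ev z (V.toList v) ≡ ev z (V.toList ys) + z ^ m * z ^ m * ι o
      full = cong (ev z) (shift-toList a v) ∙ ev-∷ʳ z (V.toList ys) o
        ∙ cong (λ e → ev z (V.toList ys) + e * ι o) (cong (z ^_) (V.length-toList ys ∙ deg≡) ∙ ^-homo-* z m m)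

    -- At `z` = ζ evaluation returns the vector itself, so the error term of `ev-step` must vanish;
    -- for overflow 1 that term is -Φₙ(ζ).
    relation : ζ ^ m * ζ ^ m ≡ ι c * ζ ^ m - 1#
    relation with overflow-unit {deg f s} (subst (0 ℕ.<_) (sym deg≡) (ℕ.≤-trans m>0 (ℕ.m≤m+n m m)))
    ... | v , eq = solve 2 (λ p q → p := q :- (q :- p)) refl (ζ ^ m * ζ ^ m) (ι c * ζ ^ m - 1#)
        ∙ cong (λ e → ι c * ζ ^ m - 1# - e) vanish ∙ solve 1 (λ q → q :- :nat 0 := q) refl (ι c * ζ ^ m - 1#)
      where
      D = ι c * ζ ^ m - 1# - ζ ^ m * ζ ^ m
      rep : ∀ u → ev ζ (V.toList u) ≡ u
      rep u = sym (reduce≡ev (V.toList u)) ∙ reduce-toList u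
      vanish : D ≡ 0#
      vanish = +-cancelˡ (ι 0ℚ + ζ * v) D 0# (cong₂ (λ e o → ι 0ℚ + ζ * e + o) (sym (rep v))
           (sym (*-identityˡ D) ∙ cong (_* D) (sym ι-1 ∙ cong ι (sym (eq 0ℚ))))
           ∙ sym (ev-step ζ 0ℚ v) ∙ rep (step 0ℚ v) ∙ step≡ζ* 0ℚ v ∙ sym (+-identityʳ _))

    -- The universal property of the quotient: evaluation at a root of Φₙ factors through reduction.
    -- Every automorphism used later comes from it.
    substitution : ∀ z → z ^ m * z ^ m ≡ ι c * z ^ m - 1# → ∀ p → ev z (V.toList (reduce f s p)) ≡ ev z p
    substitution z root [] = zeroes (deg f s)
      where
      zeroes : ∀ d → ev z (V.toList (V.replicate d 0ℚ)) ≡ 0#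
      zeroes zero = refl
      zeroes (suc d) = cong₂ (λ a e → a + z * e) ι-0 (zeroes d) ∙ +-identityˡ _ ∙ zeroʳ z
    substitution z root (a ∷ p) = ev-step z a (reduce f s p)
      ∙ cong (λ e → ι a + z * ev z (V.toList (reduce f s p)) + ι (proj₂ (shiftIn a (reduce f s p))) *
        (e - z ^ m * z ^ m)) (sym root)
      ∙ (solve 3 (λ x o w → x :+ o :* (w :- w) := x) refl _ (ι (proj₂ (shiftIn a (reduce f s p))))
        (z ^ m * z ^ m))
      ∙ cong (λ e → ι a + z * e) (substitution z root p)

  module _ {P : ℚ → Set} (sub : IsSubring P) where

    shift-all : ∀ {d a} {v : Vec ℚ d} → P a → (∀ i → P (V.lookup v i)) →
      (∀ i → P (V.lookup (proj₁ (shiftIn a v)) i)) × P (proj₂ (shiftIn a v))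
    shift-all {v = []} pa pv = (λ ()) , pa
    shift-all {v = x ∷ v} pa pv with shift-all {v = v} (pv zero) (λ i → pv (suc i))
    ... | ps , po = (λ { zero → pa ; (suc i) → ps i }) , po

    δ-all : ∀ b {o} → P o → P (if b then o else 0ℚ)
    δ-all true po = po
    δ-all false po = 0∈ sub

    correction-all : ∀ f {o} → P o → ∀ i → P (V.lookup (correction f s o) i)
    correction-all pow2 {o} po i = subst P (sym (V.lookup∘tabulate _ i)) (δ-all (toℕ i ≡ᵇ 0) (neg∈ sub po))
    correction-all 3pow2 {o} po i = subst P (sym (V.lookup∘tabulate _ i))
      (+∈ sub (δ-all (toℕ i ≡ᵇ 0) (neg∈ sub po)) (δ-all (toℕ i ≡ᵇ 2 ℕ.^ (s ∸ 1)) po))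

    -- Φₙ is monic with integer coefficients, so reduction stays inside any subring of ℚ. Applied to
    -- ℤ and to ℤ[1/2], this makes O and R subrings.
    reduce-all : ∀ {p} → All P p → ∀ i → P (V.lookup (reduce f s p) i)
    reduce-all [] i = subst P (sym (V.lookup-replicate i 0ℚ)) (0∈ sub)
    reduce-all {a ∷ p} (pa ∷ ps) i with shift-all {v = reduce f s p} pa (reduce-all ps)
    ... | ys , o = subst P (sym (V.lookup-zipWith ℚ._+_ i (proj₁ (shiftIn a (reduce f s p))) _))
      (+∈ sub (ys i) (correction-all f o i))

-- Φₙ = x²ᵐ - c xᵐ + 1 with n = 4m = 4·2ᴶ (c = 0) or n = 6m = 12·2ᴶ (c = 1).
data Shape (c : ℚ) (m J : ℕ) : Set where
  gaussian   : c ≡ 0ℚ → m ≡ 2 ℕ.^ J → Shape c m J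
  eisenstein : c ≡ 1ℚ → m ≡ 2 ℕ.^ J ℕ.+ 2 ℕ.^ J → Shape c m J

shape>0 : ∀ {c m J} → Shape c m J → 0 ℕ.< m
shape>0 {J = J} (gaussian _ eq)   = subst (0 ℕ.<_) (sym eq) (ℕ.m^n>0 2 J)
shape>0 {J = J} (eisenstein _ eq) = subst (0 ℕ.<_) (sym eq) (ℕ.≤-trans (ℕ.m^n>0 2 J) (ℕ.m≤m+n _ _))

-- The exponents n/2 and n/4, at which powers of ζ become -1 and a square root of -1.
halfOf quarterOf : ∀ {c m J} → Shape c m J → ℕ
halfOf {m = m} (gaussian _ _)   = m ℕ.+ m
halfOf {m = m} (eisenstein _ _) = m ℕ.+ (m ℕ.+ m)
quarterOf {m = m} (gaussian _ _)       = m
quarterOf {J = J} (eisenstein _ _) = 3 ℕ.* 2 ℕ.^ J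

-- ℚ[x]/(x²ᵐ - c xᵐ + 1) with its power basis 1, ζ, …, ζ²ᵐ⁻¹.
record Cyclotomic : Set₁ where
  field
    A : ℚ-Algebra
  open Algebra′ A public
  field
    _≟_            : DecidableEquality K
    c              : ℚ
    m J            : ℕ
    shape          : Shape c m J
    ζ              : K
    coeffs         : K → List ℚ
    coeffs-length  : ∀ x → L.length (coeffs x) ≡ m ℕ.+ m
    ev-coeffs      : ∀ x → ev ζ (coeffs x) ≡ x
    coeffs-ev      : ∀ p j → L.length p ℕ.+ j ≡ m ℕ.+ m → coeffs (ev ζ p) ≡ p L.++ L.replicate j 0ℚ
    coeffs-all     : ∀ {P} → IsSubring P → ∀ {p} → All P p → All P (coeffs (ev ζ p))
    relation       : ζ ^ m * ζ ^ m ≡ ι c * ζ ^ m - 1#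
    substitution   : ∀ z → z ^ m * z ^ m ≡ ι c * z ^ m - 1# → ∀ p → ev z (coeffs (ev ζ p)) ≡ ev z p

-- Endomorphisms, coefficient subrings and complex conjugation.

module Basics (C : Cyclotomic) where
  open Cyclotomic C public

  record Endo : Set where
    field
      ⟪_⟫ : K → K
      +-hom : ∀ x y → ⟪ x + y ⟫ ≡ ⟪ x ⟫ + ⟪ y ⟫
      *-hom : ∀ x y → ⟪ x * y ⟫ ≡ ⟪ x ⟫ * ⟪ y ⟫
      ι-hom : ∀ q → ⟪ ι q ⟫ ≡ ι q

    num-hom : ∀ z → ⟪ num z ⟫ ≡ num z
    num-hom z = cong ⟪_⟫ (num≡ι z) ∙ ι-hom _ ∙ sym (num≡ι z)

    1-hom : ⟪ 1# ⟫ ≡ 1#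
    1-hom = num-hom (ℤ.+ 1)

    0-hom : ⟪ 0# ⟫ ≡ 0#
    0-hom = num-hom (ℤ.+ 0)

    neg-hom : ∀ x → ⟪ - x ⟫ ≡ - ⟪ x ⟫
    neg-hom x = +-inverseʳ-unique ⟪ x ⟫ ⟪ - x ⟫ (sym (+-hom x (- x)) ∙ cong ⟪_⟫ (-‿inverseʳ x) ∙ 0-hom)

    −-hom : ∀ x y → ⟪ x - y ⟫ ≡ ⟪ x ⟫ - ⟪ y ⟫
    −-hom x y = +-hom x (- y) ∙ cong (⟪ x ⟫ +_) (neg-hom y)

    ^-hom : ∀ x k → ⟪ x ^ k ⟫ ≡ ⟪ x ⟫ ^ k
    ^-hom x zero = 1-hom
    ^-hom x (suc k) = *-hom x (x ^ k) ∙ cong (⟪ x ⟫ *_) (^-hom x k)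

    ev-hom : ∀ z p → ⟪ ev z p ⟫ ≡ ev ⟪ z ⟫ p
    ev-hom z [] = 0-hom
    ev-hom z (a ∷ p) = +-hom (ι a) (z * ev z p)
      ∙ (cong₂ _+_ (ι-hom a) (*-hom z (ev z p) ∙ cong (⟪ z ⟫ *_) (ev-hom z p)))

    coeffs-hom : ∀ x → ⟪ x ⟫ ≡ ev ⟪ ζ ⟫ (coeffs x)
    coeffs-hom x = cong ⟪_⟫ (sym (ev-coeffs x)) ∙ ev-hom ζ (coeffs x)

  open Endo public using (⟪_⟫; +-hom; *-hom; ι-hom; num-hom; 1-hom; 0-hom; neg-hom; −-hom; ^-hom; ev-hom;
    coeffs-hom)

  infixr 9 _∘ᴱ_
  _∘ᴱ_ : Endo → Endo → Endo
  φ ∘ᴱ ψ = record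
    { ⟪_⟫ = λ x → ⟪ φ ⟫ (⟪ ψ ⟫ x)
    ; +-hom = λ x y → cong ⟪ φ ⟫ (+-hom ψ x y) ∙ (+-hom φ _ _)
    ; *-hom = λ x y → cong ⟪ φ ⟫ (*-hom ψ x y) ∙ (*-hom φ _ _)
    ; ι-hom = λ q → cong ⟪ φ ⟫ (ι-hom ψ q) ∙ ι-hom φ q }

  idᴱ : Endo
  idᴱ = record { ⟪_⟫ = λ x → x ; +-hom = λ _ _ → refl ; *-hom = λ _ _ → refl ; ι-hom = λ _ → refl }

  Endo-ext : (φ ψ : Endo) → ⟪ φ ⟫ ζ ≡ ⟪ ψ ⟫ ζ → ∀ x → ⟪ φ ⟫ x ≡ ⟪ ψ ⟫ x
  Endo-ext φ ψ eq x = coeffs-hom φ x ∙ cong (λ z → ev z (coeffs x)) eq ∙ sym (coeffs-hom ψ x)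

  Root : K → Set
  Root z = z ^ m * z ^ m ≡ ι c * z ^ m - 1#

  σ : ∀ z → Root z → Endo
  σ z root = record
    { ⟪_⟫ = λ x → ev z (coeffs x)
    ; +-hom = λ x y → cong (λ e → ev z (coeffs e))
      (sym (cong₂ _+_ (ev-coeffs x) (ev-coeffs y)) ∙ sym (ev-+P ζ (coeffs x) (coeffs y)))
        ∙ substitution z root (coeffs x +P coeffs y) ∙ ev-+P z (coeffs x) (coeffs y)
    ; *-hom = λ x y → cong (λ e → ev z (coeffs e))
      (sym (cong₂ _*_ (ev-coeffs x) (ev-coeffs y)) ∙ sym (ev-*P ζ (coeffs x) (coeffs y)))
        ∙ substitution z root (coeffs x *P coeffs y) ∙ ev-*P z (coeffs x) (coeffs y)
    ; ι-hom = λ q → cong (λ e → ev z (coeffs e)) (sym (ev-const ζ q)) ∙ substitution z root (q ∷ [])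
      ∙ ev-const z q
    }
    where
    ev-const : ∀ z q → ev z (q ∷ []) ≡ ι q
    ev-const z q = cong (ι q +_) (zeroʳ z) ∙ (+-identityʳ _)

  σ-ζ : ∀ z root → ⟪ σ z root ⟫ ζ ≡ z
  σ-ζ z root = cong (λ e → ev z (coeffs e)) (sym (linear ζ)) ∙ substitution z root (0ℚ ∷ 1ℚ ∷ []) ∙ linear z
    where
    linear : ∀ z → ev z (0ℚ ∷ 1ℚ ∷ []) ≡ z
    linear z = cong₂ (λ a b → a + z * (b + z * 0#)) ι-0 ι-1
      ∙ solve 1 (λ z → :nat 0 :+ z :* (:nat 1 :+ z :* :nat 0) := z) refl z

  In : (ℚ → Set) → K → Set
  In P x = All P (coeffs x)

  record Subring (Q : K → Set) : Set where
    field
      0∈ˢ : Q 0#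
      1∈ˢ : Q 1#
      +∈ˢ : ∀ {x y} → Q x → Q y → Q (x + y)
      *∈ˢ : ∀ {x y} → Q x → Q y → Q (x * y)
      neg∈ˢ : ∀ {x} → Q x → Q (- x)

    −∈ˢ : ∀ {x y} → Q x → Q y → Q (x - y)
    −∈ˢ p q = +∈ˢ p (neg∈ˢ q)

    ^∈ˢ : ∀ {x} k → Q x → Q (x ^ k)
    ^∈ˢ zero p = 1∈ˢ
    ^∈ˢ (suc k) p = *∈ˢ p (^∈ˢ k p)

  module _ {P : ℚ → Set} (sub : IsSubring P) where

    +P-all : ∀ {p q} → All P p → All P q → All P (p +P q)
    +P-all [] qs = qs
    +P-all (x ∷ ps) [] = x ∷ ps
    +P-all (x ∷ ps) (y ∷ qs) = +∈ sub x y ∷ +P-all ps qs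

    map-all : ∀ {a q} → P a → All P q → All P (L.map (a ℚ.*_) q)
    map-all pa [] = []
    map-all pa (y ∷ qs) = *∈ sub pa y ∷ map-all pa qs

    *P-all : ∀ {p q} → All P p → All P q → All P (p *P q)
    *P-all [] qs = []
    *P-all (x ∷ ps) qs = +P-all (map-all x qs) (0∈ sub ∷ *P-all ps qs)

    In-ι : ∀ {q} → P q → In P (ι q)
    In-ι {q} pq = subst (In P) (cong (ι q +_) (zeroʳ ζ) ∙ (+-identityʳ _)) (coeffs-all sub (pq ∷ []))

    In-* : ∀ {x y} → In P x → In P y → In P (x * y)
    In-* {x} {y} px py = subst (In P) (ev-*P ζ (coeffs x) (coeffs y) ∙ (cong₂ _*_ (ev-coeffs x) (ev-coeffs y)))
      (coeffs-all sub (*P-all px py))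

    In-subring : Subring (In P)
    In-subring = record
      { 0∈ˢ = coeffs-all sub []
      ; 1∈ˢ = subst (In P) ι-1 (In-ι (1∈ sub))
      ; +∈ˢ = λ {x} {y} px py →
        subst (In P) (ev-+P ζ (coeffs x) (coeffs y) ∙ (cong₂ _+_ (ev-coeffs x) (ev-coeffs y)))
        (coeffs-all sub (+P-all px py))
      ; *∈ˢ = In-*
      ; neg∈ˢ = λ {x} px → subst (In P)
        (cong (_* x) (ι-neg 1ℚ) ∙ cong (λ e → - e * x) ι-1 ∙ solve 1 (λ x → (:- :nat 1) :* x := :- x) refl x)
                     (In-* (In-ι (neg∈ sub (1∈ sub))) px)
      }

    open Subring In-subring public renaming
      (0∈ˢ to In-0; 1∈ˢ to In-1; +∈ˢ to In-+; neg∈ˢ to In-neg; −∈ˢ to In-−; ^∈ˢ to In-^) using ()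

    In-ζ : In P ζ
    In-ζ = subst (In P) (cong₂ (λ a b → a + ζ * (b + ζ * 0#)) ι-0 ι-1
      ∙ solve 1 (λ z → :nat 0 :+ z :* (:nat 1 :+ z :* :nat 0) := z) refl ζ)
      (coeffs-all sub (0∈ sub ∷ 1∈ sub ∷ []))

    In-ev : ∀ {z p} → In P z → All P p → In P (ev z p)
    In-ev pz [] = In-0
    In-ev pz (a ∷ ps) = In-+ (In-ι a) (In-* pz (In-ev pz ps))

    In-Endo : ∀ φ → In P (⟪ φ ⟫ ζ) → ∀ {x} → In P x → In P (⟪ φ ⟫ x)
    In-Endo φ pz {x} px = subst (In P) (sym (coeffs-hom φ x)) (In-ev pz px)

  -- A root of x² - c x + 1: a primitive fourth root of unity for c = 0, a primitive sixth root of
  -- unity for c = 1.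
  ω : K
  ω = ζ ^ m

  ω²-gaussian : c ≡ 0ℚ → ω * ω ≡ - 1#
  ω²-gaussian refl = relation ∙ cong (λ e → e * ω - 1#) ι-0
    ∙ solve 1 (λ w → :nat 0 :* w :- :nat 1 := :- :nat 1) refl ω

  ω²-eisenstein : c ≡ 1ℚ → ω * ω ≡ ω - 1#
  ω²-eisenstein refl = relation ∙ cong (λ e → e * ω - 1#) ι-1 ∙ cong (_- 1#) (*-identityˡ ω)

  half : ℕ
  half = halfOf shape

  ζ^half : ζ ^ half ≡ - 1#
  ζ^half = go shape
    where
    go : ∀ sh → ζ ^ halfOf sh ≡ - 1#
    go (gaussian c≡ _)   = ^-homo-* ζ m m ∙ ω²-gaussian c≡
    go (eisenstein c≡ _) = ^-homo-* ζ m (m ℕ.+ m) ∙ cong (ω *_) (^-homo-* ζ m m ∙ ω²-eisenstein c≡)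
      ∙ solve 1 (λ w → w :* (w :- :nat 1) := w :* w :- w) refl ω ∙ cong (_- ω) (ω²-eisenstein c≡)
        ∙ solve 1 (λ w → (w :- :nat 1) :- w := :- :nat 1) refl ω

  1^k≡1 : ∀ k → 1# ^ k ≡ 1#
  1^k≡1 zero = refl
  1^k≡1 (suc k) = *-identityˡ _ ∙ 1^k≡1 k

  ord : ℕ
  ord = half ℕ.+ half

  ζ^ord : ζ ^ ord ≡ 1#
  ζ^ord = ^-homo-* ζ half half ∙ (cong₂ _*_ ζ^half ζ^half) ∙ solve 0 ((:- :nat 1) :* (:- :nat 1) := :nat 1) refl

  ζ̄ : K
  ζ̄ = ζ ^ (ord ℕ.∸ 1)

  m>0 : 0 ℕ.< m
  m>0 = shape>0 shape

  half>0 : 0 ℕ.< half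
  half>0 = go shape
    where
    go : ∀ (sh : Shape c m J) → 0 ℕ.< halfOf sh
    go (gaussian _ _)   = ℕ.≤-trans m>0 (ℕ.m≤m+n _ _)
    go (eisenstein _ _) = ℕ.≤-trans m>0 (ℕ.m≤m+n _ _)

  ζζ̄ : ζ * ζ̄ ≡ 1#
  ζζ̄ = cong (ζ ^_) (ℕ.m+[n∸m]≡n (ℕ.≤-trans half>0 (ℕ.m≤m+n _ _))) ∙ ζ^ord

  -- x² - c x + 1 is its own reciprocal polynomial, so the inverse of ω is a root together with ω.
  ζ̄-root : Root ζ̄
  ζ̄-root = solve 2 (λ u c → u :* u := c :* u :- (c :* u :- u :* u)) refl u (ι c) ∙ cong (λ e → ι c * u - e) inv
    where
    u = ζ̄ ^ m
    ωu : ω * u ≡ 1#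
    ωu = sym (^-distrib-* ζ ζ̄ m) ∙ cong (_^ m) ζζ̄ ∙ 1^k≡1 m
    inv : ι c * u - u * u ≡ 1#
    inv = cong (_- u * u) (sym (*-identityʳ _) ∙ cong (ι c * u *_) (sym ωu))
      ∙ solve 3 (λ w u c → c :* u :* (w :* u) :- u :* u := (c :* w :- :nat 1) :* (u :* u)) refl ω u (ι c)
      ∙ cong (_* (u * u)) (sym relation)
        ∙ solve 2 (λ w u → (w :* w) :* (u :* u) := (w :* u) :* (w :* u)) refl ω u ∙ (cong₂ _*_ ωu ωu)
        ∙ *-identityˡ 1#

  conj : Endo
  conj = σ ζ̄ ζ̄-root

  infix 9 _*̄
  _*̄ : K → K
  x *̄ = ⟪ conj ⟫ x

  conj-ζ : ζ *̄ ≡ ζ̄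
  conj-ζ = σ-ζ ζ̄ ζ̄-root

  inverse-unique : ∀ {x y z} → x * y ≡ 1# → x * z ≡ 1# → y ≡ z
  inverse-unique {x} {y} {z} xy xz = sym (*-identityˡ y) ∙ cong (_* y) (sym xz)
    ∙ solve 3 (λ x y z → (x :* z) :* y := (x :* y) :* z) refl x y z ∙ cong (_* z) xy ∙ *-identityˡ z

  conj-involutive : ∀ x → x *̄ *̄ ≡ x
  conj-involutive = Endo-ext (conj ∘ᴱ conj) idᴱ ((cong _*̄ conj-ζ) ∙ inverse-unique {ζ̄}
     (cong (_* (ζ̄ *̄)) (sym conj-ζ) ∙ sym (*-hom conj ζ ζ̄) ∙ (cong _*̄ ζζ̄) ∙ 1-hom conj) (*-comm ζ̄ ζ ∙ ζζ̄))

  -- Φₙ is a quadratic polynomial in xᵐ, so whether ζᵏ is a root depends on ωᵏ alone.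
  power-root : ∀ k → ω ^ k * ω ^ k ≡ ι c * ω ^ k - 1# → Root (ζ ^ k)
  power-root k eq = subst (λ e → e * e ≡ ι c * e - 1#)
    (^-assocʳ ζ m k ∙ cong (ζ ^_) (ℕ.*-comm m k) ∙ sym (^-assocʳ ζ k m)) eq

-- Coefficients and the positive definite trace form.

at : ℕ → List ℚ → ℚ
at k       []      = 0ℚ
at zero    (a ∷ p) = a
at (suc k) (a ∷ p) = at k p

at-zeros : ∀ k j → at k (L.replicate j 0ℚ) ≡ 0ℚ
at-zeros k zero = refl
at-zeros zero (suc j) = refl
at-zeros (suc k) (suc j) = at-zeros k j

at-++zeros : ∀ k p j → at k (p L.++ L.replicate j 0ℚ) ≡ at k p
at-++zeros k [] j = at-zeros k j
at-++zeros zero (a ∷ p) j = refl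
at-++zeros (suc k) (a ∷ p) j = at-++zeros k p j

at-+P : ∀ k p q → at k (p +P q) ≡ at k p ℚ.+ at k q
at-+P k [] q = sym (ℚ.+-identityˡ _)
at-+P k (a ∷ p) [] = sym (ℚ.+-identityʳ _)
at-+P zero (a ∷ p) (b ∷ q) = refl
at-+P (suc k) (a ∷ p) (b ∷ q) = at-+P k p q

at-map : ∀ k c p → at k (L.map (c ℚ.*_) p) ≡ c ℚ.* at k p
at-map k c [] = sym (ℚ.*-zeroʳ c)
at-map zero c (a ∷ p) = refl
at-map (suc k) c (a ∷ p) = at-map k c p

at-monomial-≢ : ∀ j k → j ≢ k → at j (monomial k) ≡ 0ℚ
at-monomial-≢ zero zero ne with () ← ne refl
at-monomial-≢ zero (suc k) ne = refl
at-monomial-≢ (suc j) zero ne = refl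
at-monomial-≢ (suc j) (suc k) ne = at-monomial-≢ j k λ eq → ne (cong suc eq)

at-monomial-≡ : ∀ k → at k (monomial k) ≡ 1ℚ
at-monomial-≡ zero = refl
at-monomial-≡ (suc k) = at-monomial-≡ k

at-all : ∀ {P : ℚ → Set} k {p} → P 0ℚ → All P p → P (at k p)
at-all k z [] = z
at-all zero z (a ∷ ps) = a
at-all (suc k) z (a ∷ ps) = at-all k z ps

length-+P : ∀ p q → L.length p ≡ L.length q → L.length (p +P q) ≡ L.length p
length-+P [] [] eq = refl
length-+P (a ∷ p) (b ∷ q) eq = cong suc (length-+P p q (ℕ.suc-injective eq))

length-monomial : ∀ k → L.length (monomial k) ≡ suc k
length-monomial k = L.length-++ (L.replicate k 0ℚ) ∙ cong (ℕ._+ 1) (L.length-replicate k) ∙ ℕ.+-comm k 1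

-- The form a² + c a b + b² is the norm of a + b ω.
form : ℚ → ℚ × ℚ → ℚ
form c (a , b) = a ℚ.* a ℚ.+ c ℚ.* (a ℚ.* b) ℚ.+ b ℚ.* b

sumForm : ℚ → List (ℚ × ℚ) → ℚ
sumForm c []      = 0ℚ
sumForm c (u ∷ l) = form c u ℚ.+ sumForm c l

square≥0 : ∀ q → 0ℚ ℚ.≤ q ℚ.* q
square≥0 q with ℚ.≤-total 0ℚ q
... | inj₁ q≥0 = subst (ℚ._≤ q ℚ.* q) (ℚ.*-zeroʳ q) (ℚ.*-monoˡ-≤-nonNeg q {{ℚ.nonNegative q≥0}} q≥0)
... | inj₂ q≤0 = subst (ℚ._≤ q ℚ.* q) (ℚ.*-zeroʳ q) (ℚ.*-monoˡ-≤-nonPos q {{ℚ.nonPositive q≤0}} q≤0)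

+≥0 : ∀ {p q} → 0ℚ ℚ.≤ p → 0ℚ ℚ.≤ q → 0ℚ ℚ.≤ p ℚ.+ q
+≥0 p≥0 q≥0 = ℚ.+-mono-≤ p≥0 q≥0

form≥0 : ∀ {c m J} → Shape c m J → ∀ u → 0ℚ ℚ.≤ form c u
form≥0 (gaussian refl _) (a , b) = subst (0ℚ ℚ.≤_)
    (solve 2 (λ a b → a :* a :+ b :* b := a :* a :+ con 0ℚ :* (a :* b) :+ b :* b) refl a b)
      (+≥0 (square≥0 a) (square≥0 b))
  where open ℚS
form≥0 (eisenstein refl _) (a , b) = subst (0ℚ ℚ.≤_)
    (solve 2 (λ a b → (a :+ con ½ :* b) :* (a :+ con ½ :* b) :+
      ((con ½ :* b) :* (con ½ :* b) :+ con ½ :* (b :* b)) := a :* a :+ con 1ℚ :* (a :* b) :+ b :* b) refl a b)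
    (+≥0 (square≥0 (a ℚ.+ ½ ℚ.* b))
      (+≥0 (square≥0 (½ ℚ.* b))
      (subst (ℚ._≤ ½ ℚ.* (b ℚ.* b)) (ℚ.*-zeroʳ ½) (ℚ.*-monoˡ-≤-nonNeg ½ (square≥0 b)))))
  where open ℚS

module TraceForm (C : Cyclotomic) where
  open Basics C

  coef : ℕ → K → ℚ
  coef k x = at k (coeffs x)

  coef-ev : ∀ k p → L.length p ℕ.≤ m ℕ.+ m → coef k (ev ζ p) ≡ at k p
  coef-ev k p le = cong (at k) (coeffs-ev p _ (ℕ.m+[n∸m]≡n le)) ∙ (at-++zeros k p _)

  coef-+ : ∀ k x y → coef k (x + y) ≡ coef k x ℚ.+ coef k y
  coef-+ k x y = cong (coef k)
    (sym (cong₂ _+_ (ev-coeffs x) (ev-coeffs y)) ∙ sym (ev-+P ζ (coeffs x) (coeffs y)))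
    ∙ coef-ev k (coeffs x +P coeffs y)
      (ℕ.≤-reflexive (length-+P (coeffs x) (coeffs y) (coeffs-length x ∙ sym (coeffs-length y))
      ∙ coeffs-length x))
    ∙ at-+P k (coeffs x) (coeffs y)

  coef-ι* : ∀ k q x → coef k (ι q * x) ≡ q ℚ.* coef k x
  coef-ι* k q x = cong (coef k) (cong (ι q *_) (sym (ev-coeffs x)) ∙ sym (ev-map ζ q (coeffs x)))
    ∙ coef-ev k (L.map (q ℚ.*_) (coeffs x)) (ℕ.≤-reflexive ((L.length-map _ (coeffs x)) ∙ coeffs-length x))
      ∙ at-map k q (coeffs x)

  ev-monomial : ∀ z k → ev z (monomial k) ≡ z ^ k
  ev-monomial z zero = (cong₂ _+_ ι-1 (zeroʳ z)) ∙ +-identityʳ 1#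
  ev-monomial z (suc k) = (cong₂ _+_ ι-0 (cong (z *_) (ev-monomial z k))) ∙ (+-identityˡ _)

  coef-ζ^ : ∀ j {k} → k ℕ.< m ℕ.+ m → coef j (ζ ^ k) ≡ at j (monomial k)
  coef-ζ^ j {k} lt = cong (coef j) (sym (ev-monomial ζ k))
    ∙ coef-ev j (monomial k) (subst (ℕ._≤ m ℕ.+ m) (sym (length-monomial k)) lt)

  2m>0 : 0 ℕ.< m ℕ.+ m
  2m>0 = ℕ.≤-trans m>0 (ℕ.m≤m+n m m)

  coef-ι : ∀ q → coef 0 (ι q) ≡ q
  coef-ι q = cong (coef 0) (sym (*-identityʳ (ι q))) ∙ coef-ι* 0 q 1# ∙ cong (q ℚ.*_) (coef-ζ^ 0 2m>0)
    ∙ ℚ.*-identityʳ q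

  ι-injective : ∀ {p q} → ι p ≡ ι q → p ≡ q
  ι-injective {p} {q} eq = sym (coef-ι p) ∙ cong (coef 0) eq ∙ coef-ι q

  In-ι⁻¹ : ∀ {P q} → P 0ℚ → In P (ι q) → P q
  In-ι⁻¹ {P} {q} z px = subst P (coef-ι q) (at-all 0 z px)

  ev-zeros : ∀ z p → (∀ k → at k p ≡ 0ℚ) → ev z p ≡ 0#
  ev-zeros z [] eq = refl
  ev-zeros z (a ∷ p) eq = cong₂ (λ a e → ι a + z * e) (eq 0) (ev-zeros z p (λ k → eq (suc k)))
    ∙ (cong₂ _+_ ι-0 (zeroʳ z)) ∙ +-identityˡ 0#

  coef-zero : ∀ {x} → (∀ k → coef k x ≡ 0ℚ) → x ≡ 0#
  coef-zero {x} eq = sym (ev-coeffs x) ∙ ev-zeros ζ (coeffs x) eq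

  -- Half the trace from ℚ(ω) to ℚ of the component in ℚ(ω); the ζᵏ with 0 < k < m span an orthogonal complement.
  tr : K → ℚ
  tr x = coef 0 x ℚ.+ (½ ℚ.* c) ℚ.* coef m x

  tr-+ : ∀ x y → tr (x + y) ≡ tr x ℚ.+ tr y
  tr-+ x y = cong₂ (λ a b → a ℚ.+ (½ ℚ.* c) ℚ.* b) (coef-+ 0 x y) (coef-+ m x y)
    ∙ solve′ 5 (λ a b p q e → (a :+′ b) :+′ e :*′ (p :+′ q) :=′ (a :+′ e :*′ p) :+′ (b :+′ e :*′ q)) refl
      (coef 0 x) (coef 0 y) (coef m x) (coef m y) (½ ℚ.* c)
    where open ℚS using () renaming (solve to solve′; _:+_ to _:+′_; _:*_ to _:*′_; _:=_ to _:=′_)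

  tr-ι* : ∀ q x → tr (ι q * x) ≡ q ℚ.* tr x
  tr-ι* q x = cong₂ (λ a b → a ℚ.+ (½ ℚ.* c) ℚ.* b) (coef-ι* 0 q x) (coef-ι* m q x)
    ∙ solve′ 4 (λ a b q e → q :*′ a :+′ e :*′ (q :*′ b) :=′ q :*′ (a :+′ e :*′ b)) refl (coef 0 x) (coef m x) q
      (½ ℚ.* c)
    where open ℚS using () renaming (solve to solve′; _:+_ to _:+′_; _:*_ to _:*′_; _:=_ to _:=′_)

  tr-0 : tr 0# ≡ 0ℚ
  tr-0 = cong tr (sym (zeroʳ (ι 0ℚ))) ∙ tr-ι* 0ℚ 0# ∙ ℚ.*-zeroˡ (tr 0#)

  tr-ζ^ : ∀ {k} → k ℕ.< m ℕ.+ m → k ≢ 0 → k ≢ m → tr (ζ ^ k) ≡ 0ℚ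
  tr-ζ^ {k} lt ne0 nem = cong₂ (λ a b → a ℚ.+ (½ ℚ.* c) ℚ.* b)
    (coef-ζ^ 0 lt ∙ (at-monomial-≢ 0 k λ eq → ne0 (sym eq)))
    (coef-ζ^ m lt ∙ (at-monomial-≢ m k λ eq → nem (sym eq))) ∙ ℚ.+-identityˡ _ ∙ ℚ.*-zeroʳ (½ ℚ.* c)

  tr-1 : tr 1# ≡ 1ℚ
  tr-1 = cong₂ (λ a b → a ℚ.+ (½ ℚ.* c) ℚ.* b) (coef-ζ^ 0 2m>0) (coef-ζ^ m 2m>0 ∙ at-monomial-≢ m 0 (ℕ.>⇒≢ m>0))
    ∙ cong (1ℚ ℚ.+_) (ℚ.*-zeroʳ (½ ℚ.* c)) ∙ refl

  tr-ι : ∀ q → tr (ι q) ≡ q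
  tr-ι q = cong tr (sym (*-identityʳ (ι q))) ∙ tr-ι* q 1# ∙ cong (q ℚ.*_) tr-1 ∙ ℚ.*-identityʳ q

  -- The letter U in the following names refers to the subfield ℚ(ω), over which 1, ζ, ..., ζᵐ⁻¹ is
  -- a basis of K.
  ⟦_⟧ᵘ : ℚ × ℚ → K
  ⟦ a , b ⟧ᵘ = ι a + ι b * ω

  IsU : K → Set
  IsU x = ∃ λ u → x ≡ ⟦ u ⟧ᵘ

  U-* : ∀ {x y} → IsU x → IsU y → IsU (x * y)
  U-* {x} {y} ((a , b) , refl) ((a' , b') , refl) =
    (a ℚ.* a' ℚ.- b ℚ.* b' , (a ℚ.* b' ℚ.+ b ℚ.* a') ℚ.+ c ℚ.* (b ℚ.* b')) ,
    solve 5 (λ a b a' b' w → (a :+ b :* w) :* (a' :+ b' :* w) :=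
      (a :* a' :+ (a :* b' :+ b :* a') :* w) :+ b :* b' :* (w :* w)) refl (ι a) (ι b) (ι a') (ι b') ω
    ∙ cong (λ e → (ι a * ι a' + (ι a * ι b' + ι b * ι a') * ω) + ι b * ι b' * e) relation
    ∙ solve 6 (λ a b a' b' w c → (a :* a' :+ (a :* b' :+ b :* a') :* w) :+ b :* b' :* (c :* w :- :nat 1) :=
              (a :* a' :- b :* b') :+ ((a :* b' :+ b :* a') :+ c :* (b :* b')) :* w) refl (ι a) (ι b) (ι a')
                (ι b') ω (ι c)
    ∙ sym (cong₂ (λ p q → p + q * ω)
      (ι-+ (a ℚ.* a') (ℚ.- (b ℚ.* b')) ∙ (cong₂ _+_ (ι-* a a') (ι-neg (b ℚ.* b') ∙ (cong -_ (ι-* b b')))))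
      (ι-+ (a ℚ.* b' ℚ.+ b ℚ.* a') (c ℚ.* (b ℚ.* b'))
        ∙ (cong₂ _+_ (ι-+ (a ℚ.* b') (b ℚ.* a') ∙ (cong₂ _+_ (ι-* a b') (ι-* b a')))
         (ι-* c (b ℚ.* b') ∙ cong (ι c *_) (ι-* b b')))))

  conj-ω : ω *̄ ≡ ι c - ω
  conj-ω = inverse-unique {ω}
    (cong (ω *_) (^-hom conj ζ m ∙ cong (_^ m) conj-ζ) ∙ sym (^-distrib-* ζ ζ̄ m) ∙ cong (_^ m) ζζ̄ ∙ 1^k≡1 m)
    (solve 2 (λ w c → w :* (c :- w) := c :* w :- w :* w) refl ω (ι c) ∙ cong (λ e → ι c * ω - e) relation
      ∙ solve 1 (λ x → x :- (x :- :nat 1) := :nat 1) refl (ι c * ω))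

  U-conj′ : ∀ u → (⟦ u ⟧ᵘ) *̄ ≡ (ι (proj₁ u) + ι (proj₂ u) * ι c) + (- ι (proj₂ u)) * ω
  U-conj′ (a , b) = (+-hom conj _ _)
    ∙ (cong₂ _+_ (ι-hom conj a) (*-hom conj _ _ ∙ (cong₂ _*_ (ι-hom conj b) conj-ω)))
    ∙ solve 4 (λ a b c w → a :+ b :* (c :- w) := (a :+ b :* c) :+ (:- b) :* w) refl (ι a) (ι b) (ι c) ω

  U-conj : ∀ {x} → IsU x → IsU (x *̄)
  U-conj ((a , b) , refl) = (a ℚ.+ b ℚ.* c , ℚ.- b) , U-conj′ (a , b)
    ∙ sym (cong₂ (λ p q → p + q * ω) (ι-+ a (b ℚ.* c) ∙ cong (ι a +_) (ι-* b c)) (ι-neg b))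

  U-norm : ∀ u → ⟦ u ⟧ᵘ * (⟦ u ⟧ᵘ) *̄ ≡ ι (form c u)
  U-norm (a , b) = cong (⟦ a , b ⟧ᵘ *_) (U-conj′ (a , b))
    ∙ solve 4 (λ a b c w → (a :+ b :* w) :* ((a :+ b :* c) :+ (:- b) :* w) :=
      (a :* a :+ c :* (a :* b) :+ b :* b) :+ b :* b :* (c :* w :- :nat 1 :- w :* w)) refl (ι a) (ι b) (ι c) ω
    ∙ cong (λ e → (ι a * ι a + ι c * (ι a * ι b) + ι b * ι b) + ι b * ι b * (ι c * ω - 1# - e)) relation
    ∙ solve 3 (λ x y z → x :+ y :* (z :- z) := x) refl (ι a * ι a + ι c * (ι a * ι b) + ι b * ι b) (ι b * ι b)
      (ι c * ω - 1#)
    ∙ sym (ι-+ (a ℚ.* a ℚ.+ c ℚ.* (a ℚ.* b)) (b ℚ.* b) ∙ (cong₂ _+_ (ι-+ (a ℚ.* a) (c ℚ.* (a ℚ.* b))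
       ∙ (cong₂ _+_ (ι-* a a) (ι-* c (a ℚ.* b) ∙ cong (ι c *_) (ι-* a b)))) (ι-* b b)))

  -- Multiplying a + b ω by ζᵏ yields a ζᵏ + b ζᵐ⁺ᵏ, two basis vectors different from 1 and ω, and
  -- `tr` sees only those two.
  tr-U : ∀ {x} k → IsU x → 0 ℕ.< k → k ℕ.< m → tr (x * ζ ^ k) ≡ 0ℚ
  tr-U k ((a , b) , refl) k>0 k<m =
    cong tr (solve 4 (λ a b w z → (a :+ b :* w) :* z := a :* z :+ b :* (w :* z)) refl (ι a) (ι b) ω (ζ ^ k)
       ∙ cong (λ e → ι a * ζ ^ k + ι b * e) (sym (^-homo-* ζ m k)))
     ∙ (tr-+ _ _) ∙ (cong₂ ℚ._+_
       ((tr-ι* a _) ∙ cong (a ℚ.*_) (tr-ζ^ (ℕ.<-≤-trans k<m (ℕ.m≤m+n m m)) (ℕ.>⇒≢ k>0) (ℕ.<⇒≢ k<m)))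
        ((tr-ι* b _) ∙ cong (b ℚ.*_)
          (tr-ζ^ (ℕ.+-monoʳ-< m k<m) (ℕ.>⇒≢ (ℕ.<-≤-trans m>0 (ℕ.m≤m+n m k)))
          (λ eq → ℕ.>⇒≢ k>0 (ℕ.+-cancelˡ-≡ m k 0 (eq ∙ sym (ℕ.+-identityʳ m)))))))
     ∙ (cong₂ ℚ._+_ (ℚ.*-zeroʳ a) (ℚ.*-zeroʳ b)) ∙ refl

  ω-U : IsU ω
  ω-U = (0ℚ , 1ℚ) , sym (cong₂ (λ a b → a + b * ω) ι-0 ι-1 ∙ +-identityˡ _ ∙ *-identityˡ ω)

  ζ^ζ̄^ : ∀ k → ζ ^ k * ζ̄ ^ k ≡ 1#
  ζ^ζ̄^ k = sym (^-distrib-* ζ ζ̄ k) ∙ cong (_^ k) ζζ̄ ∙ 1^k≡1 k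

  -- Since ζ̄ᵏ = ω̄ ζᵐ⁻ᵏ and ω̄ lies in ℚ(ω), this is the case of the positive exponent m - k.
  tr-Ū : ∀ {x} k → IsU x → 0 ℕ.< k → k ℕ.< m → tr (x * ζ̄ ^ k) ≡ 0ℚ
  tr-Ū {x} k u k>0 k<m = cong tr (cong (x *_) ζ̄^k ∙ sym (*-assoc x (ω *̄) _))
    ∙ tr-U (m ℕ.∸ k) (U-* u (U-conj ω-U)) (ℕ.m<n⇒0<n∸m k<m) (ℕ.∸-monoʳ-< k>0 (ℕ.<⇒≤ k<m))
    where
    ζ̄^k : ζ̄ ^ k ≡ (ω *̄) * ζ ^ (m ℕ.∸ k)
    ζ̄^k = inverse-unique {ζ ^ k} (ζ^ζ̄^ k)
      (solve 3 (λ a b d → a :* (b :* d) := b :* (a :* d)) refl (ζ ^ k) (ω *̄) (ζ ^ (m ℕ.∸ k))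
      ∙ cong ((ω *̄) *_) (sym (^-homo-* ζ k (m ℕ.∸ k)) ∙ cong (ζ ^_) (ℕ.m+[n∸m]≡n (ℕ.<⇒≤ k<m)))
      ∙ *-comm _ ω ∙ cong (ω *_) (^-hom conj ζ m ∙ cong (_^ m) conj-ζ) ∙ ζ^ζ̄^ m)

  -- Horner form of the element with the given ℚ(ω)-coordinates in the basis 1, ζ, ζ², ....
  X : List (ℚ × ℚ) → K
  X []      = 0#
  X (u ∷ l) = ⟦ u ⟧ᵘ + ζ * X l

  orthogonal : ∀ {x} k l → IsU x → 0 ℕ.< k → k ℕ.+ L.length l ℕ.≤ m → tr (x * ζ ^ k * X l) ≡ 0ℚ
  orthogonal {x} k [] _ _ _ = cong tr (zeroʳ _) ∙ tr-0
  orthogonal {x} k (u ∷ l) ux k>0 le =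
    cong tr (solve 5 (λ x z u y e → x :* z :* (u :+ y :* e) := x :* u :* z :+ x :* (y :* z) :* e) refl x (ζ ^ k)
    ⟦ u ⟧ᵘ ζ (X l))
    ∙ (tr-+ _ _) ∙ (cong₂ ℚ._+_ (tr-U k (U-* ux (u , refl)) k>0 (ℕ.<-≤-trans (ℕ.m<m+n k ℕ.z<s) le))
      (orthogonal (suc k) l ux ℕ.z<s (subst (ℕ._≤ m) (ℕ.+-suc k _) le)))

  orthogonal̄ : ∀ {x} k l → IsU x → 0 ℕ.< k → k ℕ.+ L.length l ℕ.≤ m → tr (x * ζ̄ ^ k * (X l) *̄) ≡ 0ℚ
  orthogonal̄ {x} k [] _ _ _ = cong tr (cong (x * ζ̄ ^ k *_) (0-hom conj) ∙ (zeroʳ _)) ∙ tr-0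
  orthogonal̄ {x} k (u ∷ l) ux k>0 le =
    cong tr (cong (x * ζ̄ ^ k *_)
    (+-hom conj _ _ ∙ cong (⟦ u ⟧ᵘ *̄ +_) (*-hom conj ζ (X l) ∙ cong (_* X l *̄) conj-ζ))
       ∙ solve 5 (λ x z u y e → x :* z :* (u :+ y :* e) := x :* u :* z :+ x :* (y :* z) :* e) refl x (ζ̄ ^ k)
         (⟦ u ⟧ᵘ *̄) ζ̄ (X l *̄))
    ∙ (tr-+ _ _) ∙ (cong₂ ℚ._+_ (tr-Ū k (U-* ux (U-conj (u , refl))) k>0 (ℕ.<-≤-trans (ℕ.m<m+n k ℕ.z<s) le))
      (orthogonal̄ (suc k) l ux ℕ.z<s (subst (ℕ._≤ m) (ℕ.+-suc k _) le)))

  -- The powers of ζ are orthogonal over ℚ(ω) for the pairing `tr` (x ȳ), so the mixed terms vanish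
  -- and only the norms of the coordinates remain.
  tr-norm-X : ∀ l → L.length l ℕ.≤ m → tr (X l * X l *̄) ≡ sumForm c l
  tr-norm-X [] _ = cong tr (zeroˡ _) ∙ tr-0
  tr-norm-X (u ∷ l) le = cong tr expand ∙ (tr-+ _ _) ∙ (cong₂ ℚ._+_
      ((tr-+ _ _) ∙ (cong₂ ℚ._+_
        ((tr-+ _ _) ∙ (cong₂ ℚ._+_ (cong tr (U-norm u) ∙ tr-ι (form c u))
        (orthogonal 1 l (U-conj (u , refl)) ℕ.z<s le)) ∙ ℚ.+-identityʳ (form c u))
          (orthogonal̄ 1 l (u , refl) ℕ.z<s le)) ∙ ℚ.+-identityʳ (form c u))
      (tr-norm-X l (ℕ.<⇒≤ le)))
    where
    w = ⟦ u ⟧ᵘ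
    expand : X (u ∷ l) * X (u ∷ l) *̄ ≡ ((w * w *̄) + w *̄ * ζ ^ 1 * X l + w * ζ̄ ^ 1 * X l *̄) + X l * X l *̄
    expand = cong (X (u ∷ l) *_)
      (+-hom conj _ _ ∙ cong (w *̄ +_) (*-hom conj ζ (X l) ∙ cong (_* X l *̄) conj-ζ))
      ∙ solve 6 (λ w w' z z' e e' → (w :+ z :* e) :* (w' :+ z' :* e') :=
        ((w :* w') :+ w' :* (z :^ 1) :* e :+ w :* (z' :^ 1) :* e') :+ (z :* z') :* (e :* e')) refl w (w *̄) ζ ζ̄
        (X l) (X l *̄)
      ∙ cong (λ e → ((w * w *̄) + w *̄ * ζ ^ 1 * X l + w * ζ̄ ^ 1 * X l *̄) + e)
        (cong (_* (X l * X l *̄)) ζζ̄ ∙ (*-identityˡ _))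

  ev-++ : ∀ p q → ev ζ (p L.++ q) ≡ ev ζ p + ζ ^ L.length p * ev ζ q
  ev-++ [] q = solve 1 (λ e → e := :nat 0 :+ :nat 1 :* e) refl (ev ζ q)
  ev-++ (a ∷ p) q = cong (λ e → ι a + ζ * e) (ev-++ p q)
    ∙ solve 5 (λ a z p w q → a :+ z :* (p :+ w :* q) := (a :+ z :* p) :+ (z :* w) :* q) refl (ι a) ζ (ev ζ p)
    (ζ ^ L.length p) (ev ζ q)

  X-zip : ∀ p q → L.length p ≡ L.length q → X (L.zip p q) ≡ ev ζ p + ω * ev ζ q
  X-zip [] [] eq = solve 1 (λ w → :nat 0 := :nat 0 :+ w :* :nat 0) refl ω
  X-zip (a ∷ p) (b ∷ q) eq = cong (λ e → ⟦ a , b ⟧ᵘ + ζ * e) (X-zip p q (ℕ.suc-injective eq))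
    ∙ solve 6 (λ a b w z p q → (a :+ b :* w) :+ z :* (p :+ w :* q) := (a :+ z :* p) :+ w :* (b :+ z :* q)) refl
      (ι a) (ι b) ω ζ (ev ζ p) (ev ζ q)

  coords : K → List (ℚ × ℚ)
  coords x = L.zip (L.take m (coeffs x)) (L.drop m (coeffs x))

  length-take : ∀ x → L.length (L.take m (coeffs x)) ≡ m
  length-take x = L.length-take m (coeffs x) ∙ cong (m ℕ.⊓_) (coeffs-length x) ∙ ℕ.m≤n⇒m⊓n≡m (ℕ.m≤m+n m m)

  length-drop : ∀ x → L.length (L.drop m (coeffs x)) ≡ m
  length-drop x = L.length-drop m (coeffs x) ∙ cong (ℕ._∸ m) (coeffs-length x) ∙ ℕ.m+n∸m≡n m m

  X-coords : ∀ x → X (coords x) ≡ x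
  X-coords x = X-zip (L.take m (coeffs x)) (L.drop m (coeffs x)) (length-take x ∙ sym (length-drop x))
    ∙ cong (λ k → ev ζ (L.take m (coeffs x)) + ζ ^ k * ev ζ (L.drop m (coeffs x))) (sym (length-take x))
    ∙ sym (ev-++ (L.take m (coeffs x)) (L.drop m (coeffs x))) ∙ cong (ev ζ) (L.take++drop≡id m (coeffs x))
      ∙ ev-coeffs x

  tr-norm : ∀ x → tr (x * x *̄) ≡ sumForm c (coords x)
  tr-norm x = cong (λ e → tr (e * e *̄)) (sym (X-coords x)) ∙ tr-norm-X (coords x)
    (subst (ℕ._≤ m) (sym ((L.length-zipWith _,_ (L.take m (coeffs x)) (L.drop m (coeffs x)))
      ∙ (cong₂ ℕ._⊓_ (length-take x) (length-drop x)))) (ℕ.m⊓n≤m m m))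

  sumForm≥0 : ∀ l → 0ℚ ℚ.≤ sumForm c l
  sumForm≥0 [] = ℚ.≤-refl
  sumForm≥0 (u ∷ l) = +≥0 (form≥0 shape u) (sumForm≥0 l)

  -- `tr` is the identity on ℚ and positive on norms. This is the only source of positivity; it
  -- stands in for the real embeddings.
  norm-sum≥0 : ∀ {q z w} → ι q ≡ z * z *̄ + w * w *̄ → 0ℚ ℚ.≤ q
  norm-sum≥0 {q} {z} {w} eq =
    subst (0ℚ ℚ.≤_) (sym ((tr-+ _ _) ∙ (cong₂ ℚ._+_ (tr-norm z) (tr-norm w))) ∙ cong tr (sym eq) ∙ tr-ι q)
     (+≥0 (sumForm≥0 (coords z)) (sumForm≥0 (coords w)))

-- Integers of absolute value 1 are roots of unity.

data Small : ℤ → Set where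
  is0 : Small (ℤ.+ 0)
  is1 : Small (ℤ.+ 1)
  is-1 : Small (-[1+ 0 ])

square-abs : ∀ a → a ℤ.* a ≡ ℤ.+ (ℤ.∣ a ∣ ℕ.* ℤ.∣ a ∣)
square-abs (ℤ.+ n)  = sym (ℤ.pos-* n n)
square-abs -[1+ n ] = refl

square-pos : ∀ a → ∃ λ k → a ℤ.* a ≡ ℤ.+ k
square-pos a = ℤ.∣ a ∣ ℕ.* ℤ.∣ a ∣ , square-abs a

small-abs : ∀ x {n k} → n ℕ.≤ 1 → 4 ℕ.* n ≡ 3 ℕ.* (suc (suc x) ℕ.* suc (suc x)) ℕ.+ k → ⊥
small-abs x {n} {k} n≤1 eq =
  ℕ.<⇒≱ {4} {12} (ℕ.m≤m+n 5 7) (ℕ.≤-trans (ℕ.*-monoʳ-≤ 3 (ℕ.*-mono-≤ {2} {suc (suc x)} {2} 2≤ 2≤))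
    (ℕ.≤-trans (ℕ.m≤m+n _ k) (ℕ.≤-trans (ℕ.≤-reflexive (sym eq)) (ℕ.*-monoʳ-≤ 4 n≤1))))
  where
  2≤ : 2 ℕ.≤ suc (suc x)
  2≤ = ℕ.s≤s (ℕ.s≤s ℕ.z≤n)

-- Both norm forms satisfy 4 (a² + c a b + b²) ≥ 3 a²: the excess `k` is a² + 4 b² for c = 0 and (a
-- + 2 b)² for c = 1. A norm of at most 1 therefore forces a² ≤ 1.
small : ∀ a {n k} → n ℕ.≤ 1 → ℤ.+ 4 ℤ.* ℤ.+ n ≡ ℤ.+ 3 ℤ.* (a ℤ.* a) ℤ.+ ℤ.+ k → Small a
small (ℤ.+ 0) _ _ = is0
small (ℤ.+ 1) _ _ = is1
small (ℤ.+ suc (suc x)) {n} {k} n≤1 eq = ⊥-elim (small-abs x {n} {k} n≤1 (ℤ.+-injective (ℤ.pos-* 4 n ∙ eq)))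
small -[1+ 0 ] _ _ = is-1
small -[1+ suc x ] {n} {k} n≤1 eq = ⊥-elim (small-abs x {n} {k} n≤1 (ℤ.+-injective (ℤ.pos-* 4 n ∙ eq)))

nonneg-int : ∀ {z} → 0ℚ ℚ.≤ int z → ∃ λ n → z ≡ ℤ.+ n
nonneg-int {ℤ.+ n} _ = n , refl
nonneg-int { -[1+ n ]} le with ℚ.drop-*≤* le
... | ()

module RootsOfUnity (C : Cyclotomic) where
  open Basics C
  open TraceForm C

  IsRoot : K → Set
  IsRoot x = ∃ λ j → x ≡ ζ ^ j

  root-* : ∀ {x y} → IsRoot x → IsRoot y → IsRoot (x * y)
  root-* (j , refl) (k , refl) = j ℕ.+ k , sym (^-homo-* ζ j k)

  root-neg : ∀ {x} → IsRoot x → IsRoot (- x)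
  root-neg {x} rx = subst IsRoot (solve 1 (λ x → (:- :nat 1) :* x := :- x) refl x)
    (root-* (half , sym ζ^half) rx)

  pairᶻ : ℤ → ℤ → ℚ × ℚ
  pairᶻ a b = int a , int b

  ⟦⟧-num : ∀ a b → ⟦ pairᶻ a b ⟧ᵘ ≡ num a + num b * ω
  ⟦⟧-num a b = sym (cong₂ (λ p q → p + q * ω) (num≡ι a) (num≡ι b))

  NormInfo : ℤ → ℤ → ℕ → Set
  NormInfo a b n = form c (pairᶻ a b) ≡ int (ℤ.+ n) × (n ≡ 0 → ⟦ pairᶻ a b ⟧ᵘ ≡ 0#) ×
    (n ≡ 1 → IsRoot ⟦ pairᶻ a b ⟧ᵘ)

  form-gaussian : c ≡ 0ℚ → ∀ a b → form c (pairᶻ a b) ≡ int (a ℤ.* a ℤ.+ b ℤ.* b)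
  form-gaussian refl a b = cong (ℚ._+ int b ℚ.* int b)
    (cong (int a ℚ.* int a ℚ.+_) (ℚ.*-zeroˡ (int a ℚ.* int b)) ∙ ℚ.+-identityʳ (int a ℚ.* int a))
    ∙ sym (int-+ (a ℤ.* a) (b ℤ.* b) ∙ (cong₂ ℚ._+_ (int-* a a) (int-* b b)))

  form-eisenstein : c ≡ 1ℚ → ∀ a b → form c (pairᶻ a b) ≡ int (a ℤ.* a ℤ.+ a ℤ.* b ℤ.+ b ℤ.* b)
  form-eisenstein refl a b =
    cong (λ e → int a ℚ.* int a ℚ.+ e ℚ.+ int b ℚ.* int b) (ℚ.*-identityˡ (int a ℚ.* int b))
    ∙ sym (int-+ (a ℤ.* a ℤ.+ a ℤ.* b) (b ℤ.* b)
      ∙ (cong₂ ℚ._+_ (int-+ (a ℤ.* a) (a ℤ.* b) ∙ (cong₂ ℚ._+_ (int-* a a) (int-* a b))) (int-* b b)))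

  root-1 : IsRoot 1#
  root-1 = 0 , refl

  root-ω : IsRoot ω
  root-ω = m , refl

  root-≡ : ∀ {x} → IsRoot x → ∀ {y} → x ≡ y → IsRoot y
  root-≡ r refl = r

  classify-gaussian : c ≡ 0ℚ → ∀ {a b n} → n ℕ.≤ 1 → Small a → Small b → a ℤ.* a ℤ.+ b ℤ.* b ≡ ℤ.+ n →
    (n ≡ 0 → num a + num b * ω ≡ 0#) × (n ≡ 1 → IsRoot (num a + num b * ω))
  classify-gaussian c≡ _ is0 is0 refl = (λ _ → solve 1 (λ w → :nat 0 :+ :nat 0 :* w := :nat 0) refl ω) , λ ()
  classify-gaussian c≡ _ is0 is1 refl = (λ ()) , λ _ →
    root-≡ root-ω (solve 1 (λ w → w := :nat 0 :+ :nat 1 :* w) refl ω)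
  classify-gaussian c≡ _ is0 is-1 refl = (λ ()) , λ _ →
    root-≡ (root-neg root-ω) (solve 1 (λ w → :- w := :nat 0 :+ con -[1+ 0 ] :* w) refl ω)
  classify-gaussian c≡ _ is1 is0 refl = (λ ()) , λ _ →
    root-≡ root-1 (solve 1 (λ w → :nat 1 := :nat 1 :+ :nat 0 :* w) refl ω)
  classify-gaussian c≡ _ is-1 is0 refl = (λ ()) , λ _ →
    root-≡ (root-neg root-1) (solve 1 (λ w → :- :nat 1 := con -[1+ 0 ] :+ :nat 0 :* w) refl ω)
  classify-gaussian c≡ (ℕ.s≤s ()) is1 is1 refl
  classify-gaussian c≡ (ℕ.s≤s ()) is1 is-1 refl
  classify-gaussian c≡ (ℕ.s≤s ()) is-1 is1 refl
  classify-gaussian c≡ (ℕ.s≤s ()) is-1 is-1 refl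

  classify-eisenstein : c ≡ 1ℚ → ∀ {a b n} → n ℕ.≤ 1 → Small a → Small b →
    a ℤ.* a ℤ.+ a ℤ.* b ℤ.+ b ℤ.* b ≡ ℤ.+ n →
    (n ≡ 0 → num a + num b * ω ≡ 0#) × (n ≡ 1 → IsRoot (num a + num b * ω))
  classify-eisenstein c≡ _ is0 is0 refl = (λ _ → solve 1 (λ w → :nat 0 :+ :nat 0 :* w := :nat 0) refl ω) , λ ()
  classify-eisenstein c≡ _ is0 is1 refl = (λ ()) , λ _ →
    root-≡ root-ω (solve 1 (λ w → w := :nat 0 :+ :nat 1 :* w) refl ω)
  classify-eisenstein c≡ _ is0 is-1 refl = (λ ()) , λ _ →
    root-≡ (root-neg root-ω) (solve 1 (λ w → :- w := :nat 0 :+ con -[1+ 0 ] :* w) refl ω)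
  classify-eisenstein c≡ _ is1 is0 refl = (λ ()) , λ _ →
    root-≡ root-1 (solve 1 (λ w → :nat 1 := :nat 1 :+ :nat 0 :* w) refl ω)
  classify-eisenstein c≡ _ is-1 is0 refl = (λ ()) , λ _ →
    root-≡ (root-neg root-1) (solve 1 (λ w → :- :nat 1 := con -[1+ 0 ] :+ :nat 0 :* w) refl ω)
  classify-eisenstein c≡ (ℕ.s≤s ()) is1 is1 refl
  classify-eisenstein c≡ _ is1 is-1 refl = (λ ()) , λ _ →
    root-≡ (root-neg (root-* root-ω root-ω))
    ((cong -_ (ω²-eisenstein c≡)) ∙ solve 1 (λ w → :- (w :- :nat 1) := :nat 1 :+ con -[1+ 0 ] :* w) refl ω)
  classify-eisenstein c≡ _ is-1 is1 refl = (λ ()) , λ _ →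
    root-≡ (root-* root-ω root-ω)
    (ω²-eisenstein c≡ ∙ solve 1 (λ w → w :- :nat 1 := con -[1+ 0 ] :+ :nat 1 :* w) refl ω)
  classify-eisenstein c≡ (ℕ.s≤s ()) is-1 is-1 refl

  normInfo : ∀ a b → ∃ λ n → NormInfo a b n
  normInfo a b with shape
  ... | gaussian c≡ _ with nonneg-int {a ℤ.* a ℤ.+ b ℤ.* b}
    (subst (0ℚ ℚ.≤_) (form-gaussian c≡ a b) (form≥0 shape (pairᶻ a b)))
  ...   | n , eq = n , form-gaussian c≡ a b ∙ cong int eq ,
          (λ n≡0 → ⟦⟧-num a b ∙ proj₁ (info (ℕ.≤-trans (ℕ.≤-reflexive n≡0) ℕ.z≤n)) n≡0) ,
          (λ n≡1 → subst IsRoot (sym (⟦⟧-num a b)) (proj₂ (info (ℕ.≤-reflexive n≡1)) n≡1))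
    where
    excess : ∀ a b → a ℤ.* a ℤ.+ b ℤ.* b ≡ ℤ.+ n → ∃ λ k → ℤ.+ 4 ℤ.* ℤ.+ n ≡ ℤ.+ 3 ℤ.* (a ℤ.* a) ℤ.+ ℤ.+ k
    excess a b eq with square-pos a | square-pos b
    ... | x , a² | y , b² = x ℕ.+ 4 ℕ.* y , cong (λ e → ℤ.+ 4 ℤ.* e) (sym eq)
           ∙ ℤS.solve 2 (λ a b → ℤS.con (ℤ.+ 4) ℤS.:* (a ℤS.:+ b) ℤS.:= ℤS.con (ℤ.+ 3) ℤS.:* a ℤS.:+
             (a ℤS.:+ ℤS.con (ℤ.+ 4) ℤS.:* b)) refl (a ℤ.* a) (b ℤ.* b)
           ∙ cong (λ e → ℤ.+ 3 ℤ.* (a ℤ.* a) ℤ.+ e)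
             (cong₂ (λ p q → p ℤ.+ ℤ.+ 4 ℤ.* q) a² b² ∙ cong (λ e → ℤ.+ x ℤ.+ e) (sym (ℤ.pos-* 4 y)))
    info : n ℕ.≤ 1 → _
    info n≤1 = classify-gaussian c≡ n≤1 (small a n≤1 (proj₂ (excess a b eq)))
      (small b n≤1 (proj₂ (excess b a (ℤ.+-comm (b ℤ.* b) (a ℤ.* a) ∙ eq)))) eq
  normInfo a b | eisenstein c≡ _ with nonneg-int {a ℤ.* a ℤ.+ a ℤ.* b ℤ.+ b ℤ.* b}
    (subst (0ℚ ℚ.≤_) (form-eisenstein c≡ a b) (form≥0 shape (pairᶻ a b)))
  ...   | n , eq = n , form-eisenstein c≡ a b ∙ cong int eq ,
          (λ n≡0 → ⟦⟧-num a b ∙ proj₁ (info (ℕ.≤-trans (ℕ.≤-reflexive n≡0) ℕ.z≤n)) n≡0) ,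
          (λ n≡1 → subst IsRoot (sym (⟦⟧-num a b)) (proj₂ (info (ℕ.≤-reflexive n≡1)) n≡1))
    where
    excess : ∀ a b → a ℤ.* a ℤ.+ a ℤ.* b ℤ.+ b ℤ.* b ≡ ℤ.+ n → ∃ λ k →
      ℤ.+ 4 ℤ.* ℤ.+ n ≡ ℤ.+ 3 ℤ.* (a ℤ.* a) ℤ.+ ℤ.+ k
    excess a b eq with square-pos (a ℤ.+ ℤ.+ 2 ℤ.* b)
    ... | x , sq = x , cong (λ e → ℤ.+ 4 ℤ.* e) (sym eq)
           ∙ ℤS.solve 2 (λ a b → ℤS.con (ℤ.+ 4) ℤS.:* (a ℤS.:* a ℤS.:+ a ℤS.:* b ℤS.:+ b ℤS.:* b) ℤS.:=
                 ℤS.con (ℤ.+ 3) ℤS.:* (a ℤS.:* a) ℤS.:+ (a ℤS.:+ ℤS.con (ℤ.+ 2) ℤS.:* b) ℤS.:*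
                   (a ℤS.:+ ℤS.con (ℤ.+ 2) ℤS.:* b)) refl a b
           ∙ cong (λ e → ℤ.+ 3 ℤ.* (a ℤ.* a) ℤ.+ e) sq
    info : n ℕ.≤ 1 → _
    info n≤1 = classify-eisenstein c≡ n≤1 (small a n≤1 (proj₂ (excess a b eq)))
      (small b n≤1 (proj₂ (excess b a
        (ℤS.solve 2 (λ a b → b ℤS.:* b ℤS.:+ b ℤS.:* a ℤS.:+ a ℤS.:* a ℤS.:= a ℤS.:* a ℤS.:+ a ℤS.:* b ℤS.:+ b
        ℤS.:* b) refl a b ∙ eq)))) eq

  IntPair : ℚ × ℚ → Set
  IntPair (a , b) = IsInt a × IsInt b

  -- The norms of the coordinates are natural numbers. If they add up to 1, a single coordinate is
  -- nonzero and has norm 1, so the element is a root of unity of ℤ[ω] times a power of ζ.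
  sumInfo : ∀ {l} → All IntPair l → ∃ λ n →
    sumForm c l ≡ int (ℤ.+ n) × (n ≡ 0 → X l ≡ 0#) × (n ≡ 1 → IsRoot (X l))
  sumInfo [] = 0 , refl , (λ _ → refl) , λ ()
  sumInfo {_ ∷ l} (((a , refl) , (b , refl)) ∷ ps) with normInfo a b | sumInfo ps
  ... | n , eq , z , r | n' , eq' , z' , r' = n ℕ.+ n' , (cong₂ ℚ._+_ eq eq') ∙ sym (int-+ (ℤ.+ n) (ℤ.+ n')) ,
    (λ s≡0 → cong₂ (λ p q → p + ζ * q) (z (ℕ.m+n≡0⇒m≡0 n s≡0)) (z' (ℕ.m+n≡0⇒n≡0 n s≡0)) ∙ (+-identityˡ _)
      ∙ zeroʳ ζ) ,
    one-of n n' z r z' r'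
    where
    one-of : ∀ n n' → (n ≡ 0 → ⟦ pairᶻ a b ⟧ᵘ ≡ 0#) → (n ≡ 1 → IsRoot ⟦ pairᶻ a b ⟧ᵘ) → (n' ≡ 0 → X l ≡ 0#) →
      (n' ≡ 1 → IsRoot (X l)) →
      n ℕ.+ n' ≡ 1 → IsRoot (⟦ pairᶻ a b ⟧ᵘ + ζ * X l)
    one-of 0 n' z r z' r' eq =
      subst IsRoot (sym (+-identityˡ _) ∙ cong (_+ ζ * X l) (sym (z refl)))
      (root-* (1 , sym (*-identityʳ ζ)) (r' eq))
    one-of 1 n' z r z' r' eq =
      subst IsRoot (sym (+-identityʳ _)
      ∙ cong (λ e → ⟦ pairᶻ a b ⟧ᵘ + e) (sym (zeroʳ ζ) ∙ cong (ζ *_) (sym (z' (ℕ.suc-injective eq))))) (r refl)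

  zip-all : ∀ {p q} → All IsInt p → All IsInt q → All IntPair (L.zip p q)
  zip-all [] qs = []
  zip-all (_ ∷ _) [] = []
  zip-all (a ∷ ps) (b ∷ qs) = (a , b) ∷ zip-all ps qs

  -- The trace form gives the sum of coordinate norms the value `tr 1#`, which is 1. This takes the
  -- place of Kronecker's theorem on integers all of whose conjugates have absolute value 1.
  norm1⇒root : ∀ {x} → In IsInt x → x * x *̄ ≡ 1# → IsRoot x
  norm1⇒root {x} px eq with sumInfo (zip-all (All.take⁺ m px) (All.drop⁺ m px))
  ... | n , sum , _ , r = subst IsRoot (X-coords x)
    (r (ℤ.+-injective (int-injective (sym sum ∙ sym (tr-norm x) ∙ cong tr eq ∙ tr-1))))

-- Clearing denominators, and the prime above 2.

parityℕ : ∀ n → ∃ λ w → (n ≡ w ℕ.+ w) ⊎ (n ≡ suc (w ℕ.+ w))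
parityℕ zero = 0 , inj₁ refl
parityℕ (suc n) with parityℕ n
... | w , inj₁ refl = w , inj₂ refl
... | w , inj₂ refl = suc w , inj₁ (cong suc (sym (ℕ.+-suc w w)))

parity : ∀ z → ∃ λ w → (z ≡ w ℤ.+ w) ⊎ (z ≡ ℤ.+ 1 ℤ.+ (w ℤ.+ w))
parity (ℤ.+ n) with parityℕ n
... | w , inj₁ refl = ℤ.+ w , inj₁ refl
... | w , inj₂ refl = ℤ.+ w , inj₂ refl
-- `-[1+ n ]` stands for -n - 1, so the parity of `n` is reversed.
parity -[1+ n ] with parityℕ n
... | w , inj₁ refl = -[1+ w ] , inj₂ refl
... | w , inj₂ refl = -[1+ w ] , inj₁ refl

scale-int : ∀ {q} k → IsInt q → IsInt (int k ℚ.* q)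
scale-int k pq = *∈ int-subring (k , refl) pq

map-2^ : ∀ j k {p} → All IsInt (L.map (2^ k ℚ.*_) p) → All IsInt (L.map (2^ (j ℕ.+ k) ℚ.*_) p)
map-2^ j k {[]} [] = []
map-2^ j k {a ∷ p} (x ∷ ps) =
  subst IsInt (sym (ℚ.*-assoc (2^ j) (2^ k) a) ∙ cong (ℚ._* a) (sym (2^-+ j k))) (scale-int _ x) ∷ map-2^ j k ps

clear-dyadic : ∀ {p} → All IsDyadic p → ∃ λ k → All IsInt (L.map (2^ k ℚ.*_) p)
clear-dyadic [] = 0 , []
clear-dyadic {a ∷ p} (d ∷ ps) with dyadic⇒ {a} d | clear-dyadic ps
... | j , x | k , xs = k ℕ.+ j ,
  subst IsInt (sym (ℚ.*-assoc (2^ k) (2^ j) a) ∙ cong (ℚ._* a) (sym (2^-+ k j))) (scale-int _ x) ∷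
    subst (λ e → All IsInt (L.map (2^ e ℚ.*_) p)) (ℕ.+-comm j k) (map-2^ j k xs)

clear-all : ∀ p → ∃ λ n → 0 ℕ.< n × All IsInt (L.map (int (ℤ.+ n) ℚ.*_) p)
clear-all [] = 1 , ℕ.z<s , []
clear-all (a ∷ p) with clear-all p
... | n , n>0 , xs = n ℕ.* ↧ₙ a , ℕ.*-mono-< n>0 (ℕ.z<s {ℚ.denominator-1 a}) ,
    (ℤ.+ n ℤ.* ↥ a , cong (ℚ._* a) split ∙ ℚ.*-assoc (int (ℤ.+ n)) (int (↧ a)) a
        ∙ cong (int (ℤ.+ n) ℚ.*_) (ℚ.*-comm (int (↧ a)) a ∙ clear a) ∙ sym (int-* (ℤ.+ n) (↥ a))) ∷ rest p xs
  where
  split : int (ℤ.+ (n ℕ.* ↧ₙ a)) ≡ int (ℤ.+ n) ℚ.* int (↧ a)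
  split = cong int (ℤ.pos-* n (↧ₙ a)) ∙ int-* (ℤ.+ n) (↧ a)
  rest : ∀ p → All IsInt (L.map (int (ℤ.+ n) ℚ.*_) p) → All IsInt (L.map (int (ℤ.+ (n ℕ.* ↧ₙ a)) ℚ.*_) p)
  rest [] [] = []
  rest (b ∷ p) (x ∷ xs) = subst IsInt
    (sym (ℚ.*-assoc (int (↧ a)) (int (ℤ.+ n)) b)
    ∙ cong (ℚ._* b) (ℚ.*-comm (int (↧ a)) (int (ℤ.+ n)) ∙ sym split)) (scale-int (↧ a) x) ∷ rest p xs

bounded : ∀ {p} → All IsInt p → ∃ λ B → ∀ k → ∃ λ z → at k p ≡ int z × ℤ.∣ z ∣ ℕ.≤ B
bounded [] = 0 , λ k → ℤ.+ 0 , refl , ℕ.z≤n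
bounded ((z , refl) ∷ ps) with bounded ps
... | B , f = ℤ.∣ z ∣ ℕ.+ B ,
  λ { zero → z , refl , ℕ.m≤m+n _ B ; (suc k) → let (w , eq , le) = f k in w , eq , ℕ.≤-trans le (ℕ.m≤n+m B _) }

n<2^n : ∀ n → n ℕ.< 2 ℕ.^ n
n<2^n zero = ℕ.z<s
n<2^n (suc n) = ℕ.≤-trans (ℕ.+-mono-≤ (ℕ.m^n>0 2 n) (n<2^n n))
  (ℕ.≤-reflexive (cong (2 ℕ.^ n ℕ.+_) (sym (ℕ.+-identityʳ (2 ℕ.^ n)))))

module PrimeAbove2 (C : Cyclotomic) where
  open Basics C
  open TraceForm C
  open RootsOfUnity C

  O : K → Set
  O = In IsInt

  open Subring (In-subring int-subring) renaming
    (0∈ˢ to O-0; 1∈ˢ to O-1; +∈ˢ to O-+; *∈ˢ to O-*; neg∈ˢ to O-neg; −∈ˢ to O-−; ^∈ˢ to O-^) public using ()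

  O-num : ∀ z → O (num z)
  O-num z = subst O (sym (num≡ι z)) (In-ι int-subring (z , refl))

  O-ζ : O ζ
  O-ζ = In-ζ int-subring

  O-ζ̄ : O ζ̄
  O-ζ̄ = O-^ (ord ℕ.∸ 1) O-ζ

  O-conj : ∀ {x} → O x → O (x *̄)
  O-conj = In-Endo int-subring conj (subst O (sym conj-ζ) O-ζ̄)

  infix 4 _∣_
  _∣_ : K → K → Set
  x ∣ y = ∃ λ w → O w × y ≡ x * w

  ∣-refl : ∀ {x} → x ∣ x
  ∣-refl {x} = 1# , O-1 , sym (*-identityʳ x)

  ∣-trans : ∀ {x y z} → x ∣ y → y ∣ z → x ∣ z
  ∣-trans {x} (u , Ou , refl) (v , Ov , refl) = u * v , O-* Ou Ov , *-assoc x u v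

  ∣-+ : ∀ {x y z} → x ∣ y → x ∣ z → x ∣ y + z
  ∣-+ {x} (u , Ou , refl) (v , Ov , refl) = u + v , O-+ Ou Ov , sym (distribˡ x u v)

  ∣-*ʳ : ∀ {x y} z → O z → x ∣ y → x ∣ z * y
  ∣-*ʳ {x} z Oz (u , Ou , refl) = z * u , O-* Oz Ou ,
    solve 3 (λ x z u → z :* (x :* u) := x :* (z :* u)) refl x z u

  ∣-neg : ∀ {x y} → x ∣ y → x ∣ - y
  ∣-neg {x} (u , Ou , refl) = - u , O-neg Ou , solve 2 (λ x u → :- (x :* u) := x :* (:- u)) refl x u

  ∣-* : ∀ {x y x' y'} → x ∣ y → x' ∣ y' → x * x' ∣ y * y'
  ∣-* {x} {_} {x'} (u , Ou , refl) (v , Ov , refl) = u * v , O-* Ou Ov ,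
    solve 4 (λ x x' u v → (x :* u) :* (x' :* v) := (x :* x') :* (u :* v)) refl x x' u v

  ∣-^ : ∀ {x y} k → x ∣ y → x ^ k ∣ y ^ k
  ∣-^ zero _ = ∣-refl
  ∣-^ (suc k) d = ∣-* d (∣-^ k d)

  ∣-≡ : ∀ {x y y'} → y ≡ y' → x ∣ y → x ∣ y'
  ∣-≡ refl d = d

  ∣-x* : ∀ {x w} → O w → x ∣ x * w
  ∣-x* Ow = _ , Ow , refl

  geometric : ∀ {η} → O η → ∀ k → 1# - η ∣ 1# - η ^ k
  geometric {η} Oη zero = 0# , O-0 , solve 1 (λ e → :nat 1 :- :nat 1 := (:nat 1 :- e) :* :nat 0) refl η
  geometric {η} Oη (suc k) =
    ∣-≡ (solve 2 (λ e p → (:nat 1 :- e) :+ e :* (:nat 1 :- p) := :nat 1 :- e :* p) refl η (η ^ k))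
    (∣-+ ∣-refl (∣-*ʳ η Oη (geometric Oη k)))

  [-x]² : ∀ x k → (- x) ^ (2 ℕ.* k) ≡ x ^ (2 ℕ.* k)
  [-x]² x k = sym (^-assocʳ (- x) 2 k) ∙ cong (_^ k) (solve 1 (λ x → (:- x) :^ 2 := x :^ 2) refl x)
    ∙ ^-assocʳ x 2 k

  -- If ηᵏ = -1 then 1 + η = 1 - ηᵏ⁺¹, a geometric sum times 1 - η.
  1-η∣1+η : ∀ {η} → O η → ∀ k → η ^ k ≡ - 1# → 1# - η ∣ 1# + η
  1-η∣1+η {η} Oη k eq = ∣-≡
    (cong (λ e → 1# - η * e) eq ∙ solve 1 (λ e → :nat 1 :- e :* (:- :nat 1) := :nat 1 :+ e) refl η)
    (geometric Oη (suc k))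

  -- Induction through η²: 1 - η² = (1 - η)(1 + η), and the two factors divide each other, so (1 -
  -- η²) and (1 - η)² are associates. At the end η = -1 and 1 - η = 2.
  2~[1-η]^ : ∀ r {η} → O η → η ^ (2 ℕ.^ r) ≡ - 1# → (2# ∣ (1# - η) ^ (2 ℕ.^ r)) × ((1# - η) ^ (2 ℕ.^ r) ∣ 2#)
  2~[1-η]^ zero {η} Oη eq = ∣-≡ (sym two) ∣-refl , ∣-≡ two ∣-refl
    where
    two : (1# - η) ^ 1 ≡ 2#
    two = solve 1 (λ e → (:nat 1 :- e) :^ 1 := :nat 1 :- e :^ 1) refl η ∙ cong (λ e → 1# - e) eq
      ∙ solve 0 (:nat 1 :- (:- :nat 1) := :nat 2) refl
  2~[1-η]^ (suc r) {η} Oη eq = ∣-trans (proj₁ ih) there , ∣-trans back (proj₂ ih)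
    where
    k = 2 ℕ.^ r
    ih = 2~[1-η]^ r {η ^ 2} (O-^ 2 Oη) (^-assocʳ η 2 k ∙ eq)
    p = 1# - η
    q = 1# + η
    p∣q : p ∣ q
    p∣q = 1-η∣1+η Oη (2 ℕ.* k) eq
    q∣p : q ∣ p
    q∣p = subst (_∣ p) (solve 1 (λ e → :nat 1 :- (:- e) := :nat 1 :+ e) refl η)
      (1-η∣1+η (O-neg Oη) (2 ℕ.* k) ([-x]² η k ∙ eq))
    pq : 1# - η ^ 2 ≡ p * q
    pq = solve 1 (λ e → :nat 1 :- e :^ 2 := (:nat 1 :- e) :* (:nat 1 :+ e)) refl η
    p²≡ : p ^ (2 ℕ.* k) ≡ (p * p) ^ k
    p²≡ = sym (^-assocʳ p 2 k) ∙ cong (_^ k) (cong (p *_) (*-identityʳ p))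
    there : (1# - η ^ 2) ^ k ∣ p ^ (2 ℕ.* k)
    there = ∣-≡ (sym p²≡) (subst (λ e → e ^ k ∣ (p * p) ^ k) (sym pq) (∣-^ k (∣-* ∣-refl q∣p)))
    back : p ^ (2 ℕ.* k) ∣ (1# - η ^ 2) ^ k
    back = subst (_∣ (1# - η ^ 2) ^ k) (sym p²≡)
      (subst (λ e → (p * p) ^ k ∣ e ^ k) (sym pq) (∣-^ k (∣-* ∣-refl p∣q)))

  -- π generates the prime above 2: modulo π, every element of O is 0 or a power of ζ.
  record Uniformizer : Set where
    field
      π           : K
      e           : ℕ
      Oπ          : O π
      e>0         : 0 ℕ.< e
      2∣π^e       : 2# ∣ π ^ e
      π^e∣2       : π ^ e ∣ 2#
      π∣π̄         : π ∣ π *̄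
      residue-1+ζ : ∀ j → (π ∣ 1# + ζ ^ j) ⊎ ∃ λ k → π ∣ 1# + ζ ^ j - ζ ^ k

  2∤1 : ¬ 2# ∣ 1#
  2∤1 (w , Ow , eq) with at-all 0 (0∈ int-subring) Ow
  ... | z , wz = odd z (int-injective
    (sym (coef-ι 1ℚ) ∙ cong (coef 0) (ι-1 ∙ eq) ∙ (coef-ι* 0 _ w) ∙ cong (int (ℤ.+ 2) ℚ.*_) wz
    ∙ sym (int-* (ℤ.+ 2) z)))
    where
    odd : ∀ z → ℤ.+ 1 ≢ ℤ.+ 2 ℤ.* z
    odd (ℤ.+ zero) ()
    odd (ℤ.+ suc n) eq with ℤ.+-injective eq ∙ cong suc (ℕ.+-suc n (n ℕ.+ 0))
    ... | ()
    odd -[1+ n ] ()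

  2-cancel : ∀ {x y} → 2# * x ≡ 2# * y → x ≡ y
  2-cancel {x} {y} eq = lem x ∙ cong (h *_) eq ∙ sym (lem y)
    where
    lem : ∀ x → x ≡ h * (2# * x)
    lem x = sym (*-identityˡ x) ∙ cong (_* x) (sym h*2) ∙ *-assoc h 2# x

  2^-cancel : ∀ k {x y} → 2# ^ k * x ≡ 2# ^ k * y → x ≡ y
  2^-cancel zero eq = sym (*-identityˡ _) ∙ eq ∙ (*-identityˡ _)
  2^-cancel (suc k) eq = 2^-cancel k (2-cancel (sym (*-assoc 2# (2# ^ k) _) ∙ eq ∙ (*-assoc 2# (2# ^ k) _)))

  2^≡ : ∀ k → 2# ^ k ≡ ι (2^ k)
  2^≡ zero = sym ι-1
  2^≡ (suc k) = cong (2# *_) (2^≡ k) ∙ sym (ι-* (int (ℤ.+ 2)) (2^ k)) ∙ cong ι (sym (2^-+ 1 k))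

  ev-scale : ∀ q x → ev ζ (L.map (q ℚ.*_) (coeffs x)) ≡ ι q * x
  ev-scale q x = ev-map ζ q (coeffs x) ∙ cong (ι q *_) (ev-coeffs x)

  R : K → Set
  R = In IsDyadic

  clear-R : ∀ {x} → R x → ∃ λ k → O (2# ^ k * x)
  clear-R {x} Rx with clear-dyadic Rx
  ... | k , ps = k , subst O (ev-scale (2^ k) x ∙ cong (_* x) (sym (2^≡ k))) (coeffs-all int-subring ps)

  clear-K : ∀ x → ∃ λ n → 0 ℕ.< n × O (nat n * x)
  clear-K x with clear-all (coeffs x)
  ... | n , n>0 , ps = n , n>0 ,
    subst O (ev-scale (int (ℤ.+ n)) x ∙ cong (_* x) (sym (num≡ι (ℤ.+ n)))) (coeffs-all int-subring ps)

  -- A coefficient of absolute value at most B < 2ᴮ that is divisible by 2ᴶ with J ≥ B is zero.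
  2-adically-bounded : ∀ {x} → O x → ∃ λ B → ∀ J → B ℕ.≤ J → 2# ^ J ∣ x → x ≡ 0#
  2-adically-bounded {x} Ox with bounded Ox
  ... | B , f = B , λ J B≤J (w , Ow , eq) → coef-zero λ k → vanish J B≤J w Ow eq k
    where
    vanish : ∀ J → B ℕ.≤ J → ∀ w → O w → x ≡ 2# ^ J * w → ∀ k → coef k x ≡ 0ℚ
    vanish J B≤J w Ow eq k with f k | at-all k (0∈ int-subring) Ow
    ... | z , xz , z≤B | v , wv = xz
      ∙ cong int (ℤ.∣i∣≡0⇒i≡0 (multiple ℤ.∣ z ∣ ℤ.∣ v ∣ absEq
      (ℕ.<-≤-trans (ℕ.≤-<-trans z≤B (n<2^n B)) (ℕ.^-monoʳ-≤ 2 B≤J))))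
      where
      zEq : z ≡ ℤ.+ (2 ℕ.^ J) ℤ.* v
      zEq = int-injective (sym xz ∙ cong (coef k) (eq ∙ cong (_* w) (2^≡ J)) ∙ coef-ι* k (2^ J) w
         ∙ cong (2^ J ℚ.*_) wv ∙ sym (int-* (ℤ.+ (2 ℕ.^ J)) v))
      absEq : ℤ.∣ z ∣ ≡ 2 ℕ.^ J ℕ.* ℤ.∣ v ∣
      absEq = cong ℤ.∣_∣ zEq ∙ ℤ.abs-* (ℤ.+ (2 ℕ.^ J)) v
      multiple : ∀ a b → a ≡ 2 ℕ.^ J ℕ.* b → a ℕ.< 2 ℕ.^ J → a ≡ 0
      multiple a zero eq _ = eq ∙ ℕ.*-zeroʳ (2 ℕ.^ J)
      multiple a (suc b) eq lt = ⊥-elim (ℕ.<⇒≱ lt (subst (2 ℕ.^ J ℕ.≤_) (sym eq) (ℕ.m≤m*n (2 ℕ.^ J) (suc b))))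

  -- The π-adic valuation, integrality of unitary elements and absence of zero divisors.

  module Valuation (U : Uniformizer) where
    open Uniformizer U

    π∣2 : π ∣ 2#
    π∣2 = ∣-trans (π∣π^ e e>0) π^e∣2
      where
      π∣π^ : ∀ k → 0 ℕ.< k → π ∣ π ^ k
      π∣π^ (suc k) _ = ∣-x* (O-^ k Oπ)

    π⁻¹ : K
    π⁻¹ = proj₁ π∣2 * h

    ππ⁻¹ : π * π⁻¹ ≡ 1#
    ππ⁻¹ = sym (*-assoc π _ h) ∙ cong (_* h) (sym (proj₂ (proj₂ π∣2))) ∙ *-comm 2# h ∙ h*2

    π-cancel : ∀ {x y} → π * x ≡ π * y → x ≡ y
    π-cancel {x} {y} eq = lem x ∙ cong (π⁻¹ *_) eq ∙ sym (lem y)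
      where
      lem : ∀ x → x ≡ π⁻¹ * (π * x)
      lem x = sym (*-identityˡ x) ∙ cong (_* x) (sym ππ⁻¹ ∙ *-comm π π⁻¹) ∙ *-assoc π⁻¹ π x

    π∤1 : ¬ π ∣ 1#
    π∤1 d = 2∤1 (∣-trans 2∣π^e (∣-≡ (1^k≡1 e) (∣-^ e d)))

    π∤ζ^ : ∀ k → ¬ π ∣ ζ ^ k
    π∤ζ^ k d = π∤1 (∣-≡ (*-comm _ _ ∙ ζ^ζ̄^ k) (∣-*ʳ (ζ̄ ^ k) (O-^ k O-ζ̄) d))

    Residue : K → Set
    Residue x = (π ∣ x) ⊎ ∃ λ k → π ∣ x - ζ ^ k

    residue-shift : ∀ {x} y → π ∣ y - x → Residue x → Residue y
    residue-shift {x} y d (inj₁ p) = inj₁ (∣-≡ (solve 2 (λ x y → (y :- x) :+ x := y) refl x y) (∣-+ d p))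
    residue-shift {x} y d (inj₂ (k , p)) =
      inj₂ (k , ∣-≡ (solve 3 (λ x y z → (y :- x) :+ (x :- z) := y :- z) refl x y (ζ ^ k)) (∣-+ d p))

    residue-ζ* : ∀ {x} → Residue x → Residue (ζ * x)
    residue-ζ* (inj₁ p) = inj₁ (∣-*ʳ ζ O-ζ p)
    residue-ζ* {x} (inj₂ (k , p)) =
      inj₂ (suc k , ∣-≡ (solve 3 (λ x z w → z :* (x :- w) := z :* x :- z :* w) refl x ζ (ζ ^ k)) (∣-*ʳ ζ O-ζ p))

    residue-1+ : ∀ {x} → Residue x → Residue (1# + x)
    residue-1+ {x} (inj₁ p) = inj₂ (0 , ∣-≡ (solve 1 (λ x → x := (:nat 1 :+ x) :- :nat 1) refl x) p)
    residue-1+ {x} (inj₂ (k , p)) =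
      residue-shift (1# + x) (∣-≡ (solve 2 (λ x z → x :- z := (:nat 1 :+ x) :- (:nat 1 :+ z)) refl x (ζ ^ k)) p)
      (residue-1+ζ k)

    -- Horner's scheme modulo π: an integer coefficient counts as 0 or 1, and the classes of 0 and
    -- of the powers of ζ are closed under multiplication by ζ and, by `residue-1+ζ`, under adding
    -- 1.
    residue-ev : ∀ {p} → All IsInt p → Residue (ev ζ p)
    residue-ev [] = inj₁ (0# , O-0 , sym (zeroʳ π))
    residue-ev {_ ∷ p} ((z , refl) ∷ ps) with parity z
    ... | w , inj₁ refl = residue-shift _
      (∣-≡ (even w ∙ solve 2 (λ a x → a := (a :+ x) :- x) refl (ι (int (w ℤ.+ w))) (ζ * ev ζ p))
      (∣-*ʳ (num w) (O-num w) π∣2)) (residue-ζ* (residue-ev ps))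
      where
      even : ∀ w → num w * 2# ≡ ι (int (w ℤ.+ w))
      even w = solve 1 (λ x → x :* :nat 2 := x :+ x) refl (num w) ∙ sym (num-+ w w) ∙ num≡ι (w ℤ.+ w)
    ... | w , inj₂ refl = residue-shift _
      (∣-≡ (odd w ∙ solve 2 (λ a x → a :- :nat 1 := (a :+ x) :- (:nat 1 :+ x)) refl
      (ι (int (ℤ.+ 1 ℤ.+ (w ℤ.+ w)))) (ζ * ev ζ p))
           (∣-*ʳ (num w) (O-num w) π∣2)) (residue-1+ (residue-ζ* (residue-ev ps)))
      where
      odd : ∀ w → num w * 2# ≡ ι (int (ℤ.+ 1 ℤ.+ (w ℤ.+ w))) - 1#
      odd w = solve 1 (λ x → x :* :nat 2 := (:nat 1 :+ (x :+ x)) :- :nat 1) refl (num w)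
        ∙ cong (_- 1#) (cong (1# +_) (sym (num-+ w w)) ∙ sym (num-+ (ℤ.+ 1) (w ℤ.+ w))
          ∙ num≡ι (ℤ.+ 1 ℤ.+ (w ℤ.+ w)))

    residue : ∀ {x} → O x → Residue x
    residue {x} Ox = subst Residue (ev-coeffs x) (residue-ev Ox)

    -- If neither factor is 0 modulo π, both are powers of ζ there, and so is the product; but a
    -- power of ζ is a unit and hence not divisible by π.
    π-prime : ∀ {x y} → O x → O y → π ∣ x * y → (π ∣ x) ⊎ (π ∣ y)
    π-prime {x} {y} Ox Oy d with residue Ox | residue Oy
    ... | inj₁ p | _ = inj₁ p
    ... | inj₂ _ | inj₁ q = inj₂ q
    ... | inj₂ (j , p) | inj₂ (k , q) =
      ⊥-elim (π∤ζ^ (j ℕ.+ k) (∣-≡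
      (solve 4 (λ x y a b → x :* y :+ :- (y :* (x :- a) :+ a :* (y :- b)) := a :* b) refl x y (ζ ^ j) (ζ ^ k)
      ∙ sym (^-homo-* ζ j k))
           (∣-+ d (∣-neg (∣-+ (∣-*ʳ y Oy p) (∣-*ʳ (ζ ^ j) (O-^ j O-ζ) q))))))

    ∣-conj : ∀ {x y} → x ∣ y → x *̄ ∣ y *̄
    ∣-conj {x} (w , Ow , refl) = w *̄ , O-conj Ow , *-hom conj x w

    π̄∣π : π *̄ ∣ π
    π̄∣π = ∣-≡ (conj-involutive π) (∣-conj π∣π̄)

    -- π and π̄ are associates, so π divides x as soon as it divides x̄. Removing one π from x
    -- removes π π̄, hence two factors π, from the norm.
    norm-∣ : ∀ j {x} → O x → π ^ (j ℕ.+ j) ∣ x * x *̄ → π ^ j ∣ x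
    norm-∣ zero {x} Ox _ = x , Ox , sym (*-identityˡ x)
    norm-∣ (suc j) {x} Ox d = split (π∣x (π-prime Ox (O-conj Ox) (∣-trans (∣-x* (O-^ (j ℕ.+ suc j) Oπ)) d))) d
      where
      π∣x : (π ∣ x) ⊎ (π ∣ x *̄) → π ∣ x
      π∣x (inj₁ p) = p
      π∣x (inj₂ p) = ∣-trans π∣π̄ (∣-≡ (conj-involutive x) (∣-conj p))
      split : π ∣ x → π ^ (suc j ℕ.+ suc j) ∣ x * x *̄ → π ^ suc j ∣ x
      split (y , Oy , refl) (w , Ow , eq) =
        subst (π * π ^ j ∣_) refl (∣-* ∣-refl (norm-∣ j Oy (v * w , O-* Ov Ow , eq')))
        where
        u = proj₁ π∣π̄
        v = proj₁ π̄∣π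
        Ov = proj₁ (proj₂ π̄∣π)
        -- π̄ = π u and π = π̄ v, so cancelling π makes u and v inverse units.
        uv : u * v ≡ 1#
        uv = π-cancel (sym (*-assoc π u v) ∙ cong (_* v) (sym (proj₂ (proj₂ π∣π̄))) ∙ sym (proj₂ (proj₂ π̄∣π))
          ∙ sym (*-identityʳ π))
        E = y * y *̄
        step : π * (π * (u * E)) ≡ π * (π * (π ^ (j ℕ.+ j) * w))
        step = solve 4 (λ p u y z → p :* (p :* (u :* (y :* z))) := (p :* y) :* ((p :* u) :* z)) refl π u y
          (y *̄)
          ∙ cong (λ e → (π * y) * (e * y *̄)) (sym (proj₂ (proj₂ π∣π̄)))
            ∙ cong ((π * y) *_) (sym (*-hom conj π y))
          ∙ eq ∙ cong (λ k → π * π ^ k * w) (ℕ.+-suc j j)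
            ∙ solve 3 (λ p q w → p :* (p :* q) :* w := p :* (p :* (q :* w))) refl π (π ^ (j ℕ.+ j)) w
        eq' : E ≡ π ^ (j ℕ.+ j) * (v * w)
        eq' = sym (*-identityˡ E) ∙ cong (_* E) (sym uv)
          ∙ solve 3 (λ u v e → (u :* v) :* e := v :* (u :* e)) refl u v E
          ∙ cong (v *_) (π-cancel (π-cancel step))
            ∙ solve 3 (λ v p w → v :* (p :* w) := p :* (v :* w)) refl v (π ^ (j ℕ.+ j)) w

    π^[e*k]∣2^k : ∀ k → π ^ (e ℕ.* k) ∣ 2# ^ k
    π^[e*k]∣2^k k = subst (_∣ 2# ^ k) (^-assocʳ π e k) (∣-^ k π^e∣2)

    2^k∣π^[e*k] : ∀ k → 2# ^ k ∣ π ^ (e ℕ.* k)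
    2^k∣π^[e*k] k = ∣-≡ (^-assocʳ π e k) (∣-^ k 2∣π^e)

    -- For y = 2ᵏ x in O the norm is 4ᵏ, which has even π-valuation 2 e k. Hence πᵉᵏ divides y, and
    -- with it 2ᵏ does.
    norm1-integral : ∀ {x} → R x → x * x *̄ ≡ 1# → O x
    norm1-integral {x} Rx eq = finish (proj₁ (clear-R Rx)) (proj₂ (clear-R Rx))
      where
      norm : ∀ k → (2# ^ k * x) * (2# ^ k * x) *̄ ≡ 2# ^ k * 2# ^ k
      norm k = cong (2# ^ k * x *_)
        (*-hom conj (2# ^ k) x ∙ cong (_* x *̄) (^-hom conj 2# k ∙ cong (_^ k) (num-hom conj (ℤ.+ 2))))
        ∙ solve 3 (λ t x z → (t :* x) :* (t :* z) := (t :* t) :* (x :* z)) refl (2# ^ k) x (x *̄)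
          ∙ cong (2# ^ k * 2# ^ k *_) eq ∙ (*-identityʳ _)
      divides : ∀ k → π ^ (e ℕ.* k ℕ.+ e ℕ.* k) ∣ 2# ^ k * 2# ^ k
      divides k = subst (_∣ 2# ^ k * 2# ^ k) (sym (^-homo-* π (e ℕ.* k) (e ℕ.* k)))
        (∣-* (π^[e*k]∣2^k k) (π^[e*k]∣2^k k))
      integral : ∀ k → 2# ^ k ∣ 2# ^ k * x → O x
      integral k (w , Ow , eq') = subst O (sym (2^-cancel k eq')) Ow
      finish : ∀ k → O (2# ^ k * x) → O x
      finish k Oy = integral k (∣-trans (2^k∣π^[e*k] k) (norm-∣ (e ℕ.* k) Oy (∣-≡ (sym (norm k)) (divides k))))

    norm1-root : ∀ {x} → R x → x * x *̄ ≡ 1# → IsRoot x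
    norm1-root Rx eq = norm1⇒root (norm1-integral Rx eq) eq

    π^-cancel : ∀ k {z} → π ^ k * z ≡ 0# → z ≡ 0#
    π^-cancel zero eq = sym (*-identityˡ _) ∙ eq
    π^-cancel (suc k) eq = π^-cancel k (π-cancel (sym (*-assoc π (π ^ k) _) ∙ eq ∙ sym (zeroʳ π)))

    -- π-valuations at least `a` and `b` with prescribed sum; for a product that is zero this sum
    -- can be made arbitrarily large.
    Divided : K → K → ℕ → Set
    Divided x y n = ∃ λ a → ∃ λ b → a ℕ.+ b ≡ n × (π ^ a ∣ x) × (π ^ b ∣ y)

    divide-once : ∀ {x y n} → x * y ≡ 0# → Divided x y n → Divided x y (suc n)
    divide-once {x} {y} {n} eq (a , b , sum , dx@(x' , Ox' , x≡) , dy@(y' , Oy' , y≡)) =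
      either (π-prime Ox' Oy' (0# , O-0 , x'y' ∙ sym (zeroʳ π)))
      where
      x'y' : x' * y' ≡ 0#
      x'y' = π^-cancel a (π^-cancel b
        (solve 4 (λ p q x y → q :* (p :* (x :* y)) := (p :* x) :* (q :* y)) refl (π ^ a) (π ^ b) x' y'
        ∙ sym (cong₂ _*_ x≡ y≡) ∙ eq))
      absorb : ∀ k {x x'} → x ≡ π ^ k * x' → π ∣ x' → π ^ suc k ∣ x
      absorb k x≡ (w , Ow , x'≡) = w , Ow , x≡ ∙ cong (π ^ k *_) x'≡
        ∙ solve 3 (λ q p w → q :* (p :* w) := p :* q :* w) refl (π ^ k) π w
      either : (π ∣ x') ⊎ (π ∣ y') → Divided x y (suc n)
      either (inj₁ d) = suc a , b , cong suc sum , absorb a x≡ d , dy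
      either (inj₂ d) = a , suc b , ℕ.+-suc a b ∙ cong suc sum , dx , absorb b y≡ d

    divisions : ∀ {x y} → O x → O y → x * y ≡ 0# → ∀ n → Divided x y n
    divisions {x} {y} Ox Oy eq zero = 0 , 0 , refl , (x , Ox , sym (*-identityˡ x)) ,
      (y , Oy , sym (*-identityˡ y))
    divisions Ox Oy eq (suc n) = divide-once eq (divisions Ox Oy eq n)

    π^-mono : ∀ {a b x} → b ℕ.≤ a → π ^ a ∣ x → π ^ b ∣ x
    π^-mono {a} {b} le d = ∣-trans
      (∣-≡ (sym (^-homo-* π b (a ℕ.∸ b)) ∙ cong (π ^_) (ℕ.m+[n∸m]≡n le)) (∣-x* (O-^ (a ℕ.∸ b) Oπ))) d

    O-domain : ∀ {x y} → O x → O y → x * y ≡ 0# → (x ≡ 0#) ⊎ (y ≡ 0#)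
    O-domain {x} {y} Ox Oy eq = finish (2-adically-bounded Ox) (2-adically-bounded Oy)
      where
      finish : (∃ λ B → ∀ J → B ℕ.≤ J → 2# ^ J ∣ x → x ≡ 0#) → (∃ λ B → ∀ J → B ℕ.≤ J → 2# ^ J ∣ y → y ≡ 0#) →
        (x ≡ 0#) ⊎ (y ≡ 0#)
      finish (B , f) (B' , g) = compare (divisions Ox Oy eq (k ℕ.+ k))
        where
        -- Of two exponents with sum k + k one is at least k, and πᵏ is divisible by 2^(B + B'),
        -- beyond the coefficient bounds of both factors.
        k = e ℕ.* (B ℕ.+ B')
        compare : Divided x y (k ℕ.+ k) → (x ≡ 0#) ⊎ (y ≡ 0#)
        compare (a , b , sum , dx , dy) = cases (ℕ.≤-total k a)
          where
          cases : k ℕ.≤ a ⊎ a ℕ.≤ k → (x ≡ 0#) ⊎ (y ≡ 0#)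
          cases (inj₁ le) = inj₁ (f (B ℕ.+ B') (ℕ.m≤m+n B B')
            (∣-trans (2^k∣π^[e*k] (B ℕ.+ B')) (π^-mono le dx)))
          cases (inj₂ ge) = inj₂ (g (B ℕ.+ B') (ℕ.m≤n+m B' B)
            (∣-trans (2^k∣π^[e*k] (B ℕ.+ B'))
            (π^-mono (ℕ.+-cancelˡ-≤ k _ _ (ℕ.≤-trans (ℕ.≤-reflexive (sym sum)) (ℕ.+-monoˡ-≤ b ge))) dy)))

    nat-cancel : ∀ {n x} → 0 ℕ.< n → nat n * x ≡ 0# → x ≡ 0#
    nat-cancel {suc n} {x} _ eq = sym (*-identityˡ x) ∙ cong (_* x) (sym inv) ∙ *-assoc (ι q⁻¹) (nat (suc n)) x
      ∙ cong (ι q⁻¹ *_) eq ∙ (zeroʳ _)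
      where
      q = int (ℤ.+ suc n)
      q⁻¹ = ℚ.1/ q
      inv : ι q⁻¹ * nat (suc n) ≡ 1#
      inv = cong (ι q⁻¹ *_) (num≡ι (ℤ.+ suc n)) ∙ sym (ι-* q⁻¹ q) ∙ cong ι (ℚ.*-inverseˡ q) ∙ ι-1

    domain : ∀ {x y} → x * y ≡ 0# → (x ≡ 0#) ⊎ (y ≡ 0#)
    domain {x} {y} eq = finish (clear-K x) (clear-K y)
      where
      finish : (∃ λ n → 0 ℕ.< n × O (nat n * x)) → (∃ λ n → 0 ℕ.< n × O (nat n * y)) → (x ≡ 0#) ⊎ (y ≡ 0#)
      finish (n , n>0 , Ox) (n' , n'>0 , Oy) = Sum.map (nat-cancel n>0) (nat-cancel n'>0)
        (O-domain Ox Oy (solve 4 (λ n x n' y → (n :* x) :* (n' :* y) := (n :* n') :* (x :* y)) refl (nat n) x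
          (nat n') y ∙ cong (nat n * nat n' *_) eq ∙ (zeroʳ _)))

  1-x∣1-x̄ : ∀ {η} → O η → η * η *̄ ≡ 1# → 1# - η ∣ (1# - η) *̄
  1-x∣1-x̄ {η} Oη eq = - η *̄ , O-neg (O-conj Oη) , −-hom conj 1# η ∙ (cong₂ _-_ (1-hom conj ∙ sym eq) refl)
    ∙ solve 2 (λ x y → x :* y :- y := :- y :* (:nat 1 :- x)) refl η (η *̄) ∙ (*-comm _ _)

  unitary-^ : ∀ {x} k → x * x *̄ ≡ 1# → x ^ k * (x ^ k) *̄ ≡ 1#
  unitary-^ {x} k eq = cong (x ^ k *_) (^-hom conj x k) ∙ sym (^-distrib-* x (x *̄) k) ∙ cong (_^ k) eq
    ∙ 1^k≡1 k

  ζ-unitary : ζ * ζ *̄ ≡ 1#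
  ζ-unitary = cong (ζ *_) conj-ζ ∙ ζζ̄

  -- n is a power of 2, so 2 is totally ramified with residue field 𝔽₂: every power of ζ is 1 modulo
  -- 1 - ζ, and 1 + ζʲ is 0.
  uniformizer-gaussian : c ≡ 0ℚ → m ≡ 2 ℕ.^ J → Uniformizer
  uniformizer-gaussian c≡ m≡ = record
    { π = 1# - ζ
    ; e = 2 ℕ.^ suc J
    ; Oπ = O-− O-1 O-ζ
    ; e>0 = ℕ.m^n>0 2 (suc J)
    ; 2∣π^e = proj₁ ramified
    ; π^e∣2 = proj₂ ramified
    ; π∣π̄ = 1-x∣1-x̄ O-ζ ζ-unitary
    ; residue-1+ζ = λ j → inj₁
      (∣-≡ (solve 1 (λ x → :nat 2 :- (:nat 1 :- x) := :nat 1 :+ x) refl (ζ ^ j))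
      (∣-+ π∣2 (∣-neg (geometric O-ζ j))))
    }
    where
    ramified = 2~[1-η]^ (suc J) O-ζ
      (cong (ζ ^_) (cong₂ ℕ._+_ (sym m≡) (ℕ.+-identityʳ _ ∙ sym m≡)) ∙ ^-homo-* ζ m m ∙ ω²-gaussian c≡)
    π∣2 : 1# - ζ ∣ 2#
    π∣2 = ∣-≡ (solve 0 (:nat 1 :- (:- :nat 1) := :nat 2) refl)
      (∣-≡ (cong (λ e → 1# - e) ζ^half) (geometric O-ζ half))

  2^-mod-3 : ∀ k → ∃ λ a → (2 ℕ.^ k ≡ 1 ℕ.+ 3 ℕ.* a) ⊎ (2 ℕ.^ k ≡ 2 ℕ.+ 3 ℕ.* a)
  2^-mod-3 zero = 0 , inj₁ refl
  2^-mod-3 (suc k) = double (2^-mod-3 k)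
    where
    double : (∃ λ a → (2 ℕ.^ k ≡ 1 ℕ.+ 3 ℕ.* a) ⊎ (2 ℕ.^ k ≡ 2 ℕ.+ 3 ℕ.* a)) → ∃ λ a →
      (2 ℕ.^ suc k ≡ 1 ℕ.+ 3 ℕ.* a) ⊎ (2 ℕ.^ suc k ≡ 2 ℕ.+ 3 ℕ.* a)
    double (a , inj₁ eq) = 2 ℕ.* a ,
      inj₂ (cong (2 ℕ.*_) eq ∙ ℕS.solve 1
      (λ a → ℕS.con 2 ℕS.:* (ℕS.con 1 ℕS.:+ ℕS.con 3 ℕS.:* a) ℕS.:= ℕS.con 2 ℕS.:+ ℕS.con 3 ℕS.:*
      (ℕS.con 2 ℕS.:* a)) refl a)
    double (a , inj₂ eq) = 1 ℕ.+ 2 ℕ.* a ,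
      inj₁ (cong (2 ℕ.*_) eq ∙ ℕS.solve 1
      (λ a → ℕS.con 2 ℕS.:* (ℕS.con 2 ℕS.:+ ℕS.con 3 ℕS.:* a) ℕS.:= ℕS.con 1 ℕS.:+ ℕS.con 3 ℕS.:*
      (ℕS.con 1 ℕS.:+ ℕS.con 2 ℕS.:* a)) refl a)

  -- ζ³ has 2-power order, so 1 - ζ³ carries the ramification. The residue field is 𝔽₄: modulo π, ζ
  -- is a primitive cube root of unity, and its powers are all the nonzero classes.
  uniformizer-eisenstein : c ≡ 1ℚ → m ≡ 2 ℕ.^ J ℕ.+ 2 ℕ.^ J → Uniformizer
  uniformizer-eisenstein c≡ m≡ = record
    { π = π
    ; e = 2 ℕ.^ suc J
    ; Oπ = O-− O-1 Oη
    ; e>0 = ℕ.m^n>0 2 (suc J)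
    ; 2∣π^e = proj₁ ramified
    ; π^e∣2 = proj₂ ramified
    ; π∣π̄ = 1-x∣1-x̄ Oη (unitary-^ 3 ζ-unitary)
    ; residue-1+ζ = residue-1+ζ
    }
    where
    η = ζ ^ 3
    π = 1# - η
    Oη : O η
    Oη = O-^ 3 O-ζ
    m≡2^ : m ≡ 2 ℕ.^ suc J
    m≡2^ = m≡ ∙ cong (2 ℕ.^ J ℕ.+_) (sym (ℕ.+-identityʳ _))
    ω³ : ω ^ 3 ≡ - 1#
    ω³ = solve 1 (λ w → w :^ 3 := w :* (w :* w)) refl ω ∙ cong (ω *_) (ω²-eisenstein c≡)
      ∙ solve 1 (λ w → w :* (w :- :nat 1) := w :* w :- w) refl ω
      ∙ cong (_- ω) (ω²-eisenstein c≡) ∙ solve 1 (λ w → (w :- :nat 1) :- w := :- :nat 1) refl ω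
    η^2^ : η ^ (2 ℕ.^ suc J) ≡ - 1#
    η^2^ = cong (η ^_) (sym m≡2^) ∙ ^-assocʳ ζ 3 m ∙ cong (ζ ^_) (ℕ.*-comm 3 m) ∙ sym (^-assocʳ ζ m 3) ∙ ω³
    ramified = 2~[1-η]^ (suc J) Oη η^2^
    π∣2 : π ∣ 2#
    π∣2 = ∣-≡ (solve 0 (:nat 1 :- (:- :nat 1) := :nat 2) refl)
      (∣-≡ (cong (λ e → 1# - e) η^2^) (geometric Oη (2 ℕ.^ suc J)))
    π∣ζ^[r+3a]-ζ^r : ∀ r a → π ∣ ζ ^ (r ℕ.+ 3 ℕ.* a) - ζ ^ r
    π∣ζ^[r+3a]-ζ^r r a = ∣-≡ (solve 2 (λ z p → :- (z :* (:nat 1 :- p)) := z :* p :- z) refl (ζ ^ r) (η ^ a)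
      ∙ cong (_- ζ ^ r) (cong (ζ ^ r *_) (^-assocʳ ζ 3 a) ∙ sym (^-homo-* ζ r (3 ℕ.* a))))
      (∣-neg (∣-*ʳ (ζ ^ r) (O-^ r O-ζ) (geometric Oη a)))
    relation′ : ω * ω - ω + 1# ≡ 0#
    relation′ = cong (λ e → e - ω + 1#) (ω²-eisenstein c≡)
      ∙ solve 1 (λ w → (w :- :nat 1) :- w :+ :nat 1 := :nat 0) refl ω
    Oω : O ω
    Oω = O-^ m O-ζ
    -- The exponent m = 2^(J + 1) is not divisible by 3 and ζ³ ≡ 1, so ω = ζᵐ is ζ or ζ² modulo π.
    -- Then ω² - ω + 1 = 0 becomes 1 + ζ + ζ² ≡ 0, as -1 ≡ 1.
    cyclic : (∃ λ a → (2 ℕ.^ suc J ≡ 1 ℕ.+ 3 ℕ.* a) ⊎ (2 ℕ.^ suc J ≡ 2 ℕ.+ 3 ℕ.* a)) → π ∣ 1# + ζ ^ 1 + ζ ^ 2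
    cyclic (a , inj₁ eq) = ∣-≡
      (sym (+-identityʳ _) ∙ cong (((ω - ζ ^ 1) * (1# - ω - ζ ^ 1) + ζ * 2#) +_) (sym relation′)
        ∙ solve 2 (λ w z → (w :- z :^ 1) :* (:nat 1 :- w :- z :^ 1) :+ z :* :nat 2 :+ (w :* w :- w :+ :nat 1) :=
          :nat 1 :+ z :^ 1 :+ z :^ 2) refl ω ζ)
        (∣-+ (∣-≡ (*-comm _ _) (∣-*ʳ (1# - ω - ζ ^ 1) (O-− (O-− O-1 Oω) (O-^ 1 O-ζ)) ω≡)) (∣-*ʳ ζ O-ζ π∣2))
      where
      ω≡ : π ∣ ω - ζ ^ 1
      ω≡ = ∣-≡ (cong (λ k → ζ ^ k - ζ ^ 1) (sym eq ∙ sym m≡2^)) (π∣ζ^[r+3a]-ζ^r 1 a)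
    cyclic (a , inj₂ eq) = ∣-≡
      (sym (+-identityʳ _) ∙ cong (((ω - ζ ^ 2) * (1# - ω - ζ ^ 2) + (ζ * π + ζ ^ 2 * 2#)) +_) (sym relation′)
        ∙ solve 2 (λ w z → (w :- z :^ 2) :* (:nat 1 :- w :- z :^ 2) :+
          (z :* (:nat 1 :- z :^ 3) :+ z :^ 2 :* :nat 2) :+ (w :* w :- w :+ :nat 1) :=
          :nat 1 :+ z :^ 1 :+ z :^ 2) refl ω ζ)
        (∣-+ (∣-≡ (*-comm _ _) (∣-*ʳ (1# - ω - ζ ^ 2) (O-− (O-− O-1 Oω) (O-^ 2 O-ζ)) ω≡))
          (∣-+ (∣-*ʳ ζ O-ζ ∣-refl) (∣-*ʳ (ζ ^ 2) (O-^ 2 O-ζ) π∣2)))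
      where
      ω≡ : π ∣ ω - ζ ^ 2
      ω≡ = ∣-≡ (cong (λ k → ζ ^ k - ζ ^ 2) (sym eq ∙ sym m≡2^)) (π∣ζ^[r+3a]-ζ^r 2 a)
    1+ζ+ζ² : π ∣ 1# + ζ ^ 1 + ζ ^ 2
    1+ζ+ζ² = cyclic (2^-mod-3 (suc J))
    -ζ^ : ∀ k → ζ ^ (half ℕ.+ k) ≡ - ζ ^ k
    -ζ^ k = ^-homo-* ζ half k ∙ cong (_* ζ ^ k) ζ^half ∙ solve 1 (λ x → (:- :nat 1) :* x := :- x) refl (ζ ^ k)
    residue-1+ζ : ∀ j → (π ∣ 1# + ζ ^ j) ⊎ ∃ λ k → π ∣ 1# + ζ ^ j - ζ ^ k
    residue-1+ζ 0 = inj₁ (∣-≡ (solve 0 (:nat 2 := :nat 1 :+ :nat 1) refl) π∣2)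
    -- 1 + ζ ≡ -ζ², and -1 = ζ^`half`.
    residue-1+ζ 1 = inj₂ (half ℕ.+ 2 ,
      ∣-≡ (solve 2 (λ a b → :nat 1 :+ a :+ b := :nat 1 :+ a :- (:- b)) refl (ζ ^ 1) (ζ ^ 2)
      ∙ cong (λ e → 1# + ζ ^ 1 - e) (sym (-ζ^ 2))) 1+ζ+ζ²)
    residue-1+ζ 2 = inj₂ (half ℕ.+ 1 ,
      ∣-≡ (solve 2 (λ a b → :nat 1 :+ a :+ b := :nat 1 :+ b :- (:- a)) refl (ζ ^ 1) (ζ ^ 2)
      ∙ cong (λ e → 1# + ζ ^ 2 - e) (sym (-ζ^ 1))) 1+ζ+ζ²)
    -- Only the exponent modulo 3 matters, because ζ³ = 1 - π.
    residue-1+ζ (suc (suc (suc j))) =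
      Sum.map (∣-shift _ _ eq) (λ (k , d) → k ,
      ∣-shift _ _ (cong (_- ζ ^ k) eq
      ∙ solve 3 (λ a b z → (a :+ b) :- z := (a :- z) :+ b) refl (1# + p) ((- p) * π) (ζ ^ k)) d) (residue-1+ζ j)
      where
      p = ζ ^ j
      eq : 1# + ζ ^ (3 ℕ.+ j) ≡ (1# + p) + (- p) * π
      eq = solve 2 (λ z p → :nat 1 :+ z :* (z :* (z :* p)) := (:nat 1 :+ p) :+ (:- p) :* (:nat 1 :- z :^ 3))
        refl ζ p
      ∣-shift : ∀ x y → y ≡ x + (- p) * π → π ∣ x → π ∣ y
      ∣-shift x y eq d = ∣-≡ (sym eq) (∣-+ d (∣-*ʳ (- p) (O-neg (O-^ j O-ζ)) ∣-refl))

  uniformizer : Uniformizer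
  uniformizer = choose shape
    where
    choose : Shape c m J → Uniformizer
    choose (gaussian c≡ m≡) = uniformizer-gaussian c≡ m≡
    choose (eisenstein c≡ m≡) = uniformizer-eisenstein c≡ m≡

-- The tower of fields generated by the z j, and its automorphisms.

module TowerOf (C : Cyclotomic) where
  open Basics C public
  open TraceForm C public
  open RootsOfUnity C public
  open PrimeAbove2 C public
  open Valuation uniformizer public using (domain; norm1-root; nat-cancel)

  -- For j ≤ J a root of unity of order 4·2ʲ (c = 0) or 12·2ʲ (c = 1), each the square of the next.
  z : ℕ → K
  z j = ζ ^ (2 ℕ.^ (J ℕ.∸ j))

  ^2 : ∀ x → x ^ 2 ≡ x * x
  ^2 x = cong (x *_) (*-identityʳ x)

  z² : ∀ {j} → j ℕ.< J → z (suc j) * z (suc j) ≡ z j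
  z² {j} j<J = sym (^-homo-* ζ k k)
    ∙ cong (ζ ^_) (cong (k ℕ.+_) (sym (ℕ.+-identityʳ k)) ∙ cong (2 ℕ.^_) (sym (ℕ.+-∸-assoc 1 j<J)))
    where k = 2 ℕ.^ (J ℕ.∸ suc j)

  z-top : z J ≡ ζ
  z-top = cong (λ k → ζ ^ (2 ℕ.^ k)) (ℕ.n∸n≡0 J) ∙ *-identityʳ ζ

  z₀ : K
  z₀ = z 0

  z₀≡ω : c ≡ 0ℚ → m ≡ 2 ℕ.^ J → z₀ ≡ ω
  z₀≡ω _ m≡ = cong (ζ ^_) (sym m≡)

  z₀²≡ω : m ≡ 2 ℕ.^ J ℕ.+ 2 ℕ.^ J → z₀ * z₀ ≡ ω
  z₀²≡ω m≡ = sym (^-homo-* ζ (2 ℕ.^ J) (2 ℕ.^ J)) ∙ cong (ζ ^_) (sym m≡)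

  z₀²-gaussian : c ≡ 0ℚ → m ≡ 2 ℕ.^ J → z₀ * z₀ ≡ - 1#
  z₀²-gaussian c≡ m≡ = (cong₂ _*_ (z₀≡ω c≡ m≡) (z₀≡ω c≡ m≡)) ∙ ω²-gaussian c≡

  z₀⁴-eisenstein : c ≡ 1ℚ → m ≡ 2 ℕ.^ J ℕ.+ 2 ℕ.^ J → z₀ ^ 4 ≡ z₀ * z₀ - 1#
  z₀⁴-eisenstein c≡ m≡ = solve 1 (λ x → x :^ 4 := (x :* x) :* (x :* x)) refl z₀
    ∙ (cong₂ _*_ (z₀²≡ω m≡) (z₀²≡ω m≡))
    ∙ ω²-eisenstein c≡ ∙ cong (_- 1#) (sym (z₀²≡ω m≡))

  -- Valid for order 4 and for order 12 alike, so that most of the tower argument is uniform in the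
  -- shape.
  z₀⁶ : z₀ ^ 6 ≡ - 1#
  z₀⁶ = go shape
    where
    go : Shape c m J → z₀ ^ 6 ≡ - 1#
    go (gaussian c≡ m≡) = solve 1 (λ x → x :^ 6 := (x :* x) :* ((x :* x) :* (x :* x))) refl z₀
      ∙ cong (λ e → e * (e * e)) (z₀²-gaussian c≡ m≡)
      ∙ solve 0 ((:- :nat 1) :* ((:- :nat 1) :* (:- :nat 1)) := :- :nat 1) refl
    go (eisenstein c≡ m≡) = solve 1 (λ x → x :^ 6 := (x :* x) :* (x :^ 4)) refl z₀
      ∙ cong (z₀ * z₀ *_) (z₀⁴-eisenstein c≡ m≡)
      ∙ solve 1 (λ x → (x :* x) :* (x :* x :- :nat 1) := x :^ 4 :- x :* x) refl z₀
        ∙ cong (_- z₀ * z₀) (z₀⁴-eisenstein c≡ m≡)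
        ∙ solve 1 (λ x → (x :- :nat 1) :- x := :- :nat 1) refl (z₀ * z₀)

  I : K
  I = ζ ^ quarterOf shape

  I-power : ∃ λ k → I ≡ z₀ ^ k
  I-power = go shape
    where
    go : ∀ sh → ∃ λ k → ζ ^ quarterOf sh ≡ z₀ ^ k
    go (gaussian c≡ m≡)   = 1 , sym (z₀≡ω c≡ m≡) ∙ sym (*-identityʳ z₀)
    go (eisenstein c≡ m≡) = 3 , cong (ζ ^_) (ℕ.*-comm 3 (2 ℕ.^ J)) ∙ sym (^-assocʳ ζ (2 ℕ.^ J) 3)

  I² : I * I ≡ - 1#
  I² = go shape
    where
    go : ∀ sh → ζ ^ quarterOf sh * ζ ^ quarterOf sh ≡ - 1#
    go (gaussian c≡ _)    = ω²-gaussian c≡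
    go (eisenstein c≡ m≡) = cong (λ e → e * e)
      (cong (ζ ^_) (ℕ.*-comm 3 (2 ℕ.^ J)) ∙ sym (^-assocʳ ζ (2 ℕ.^ J) 3))
      ∙ solve 1 (λ x → (x :^ 3) :* (x :^ 3) := x :^ 6) refl z₀ ∙ z₀⁶

  ζ^-unitary : ∀ k → ζ ^ k * (ζ ^ k) *̄ ≡ 1#
  ζ^-unitary k = unitary-^ k ζ-unitary

  conj-I : I *̄ ≡ - I
  conj-I = inverse-unique {I} (ζ^-unitary (quarterOf shape))
    (solve 1 (λ x → x :* (:- x) := :- (x :* x)) refl I ∙ (cong -_ I²) ∙ solve 0 (:- (:- :nat 1) := :nat 1) refl)

  commute : ∀ φ ψ a b → ⟪ φ ⟫ ζ ≡ ζ ^ a → ⟪ ψ ⟫ ζ ≡ ζ ^ b → ∀ x → ⟪ φ ⟫ (⟪ ψ ⟫ x) ≡ ⟪ ψ ⟫ (⟪ φ ⟫ x)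
  commute φ ψ a b eqa eqb =
    Endo-ext (φ ∘ᴱ ψ) (ψ ∘ᴱ φ) (cong ⟪ φ ⟫ eqb ∙ ^-hom φ ζ b ∙ cong (_^ b) eqa ∙ ^-assocʳ ζ a b
    ∙ sym (cong ⟪ ψ ⟫ eqa ∙ ^-hom ψ ζ a ∙ cong (_^ a) eqb ∙ ^-assocʳ ζ b a ∙ cong (ζ ^_) (ℕ.*-comm b a)))

  ω¹² : ω ^ 12 ≡ 1#
  ω¹² = solve 1 (λ w → w :^ 12 := (w :* w) :^ 6) refl ω ∙ go shape
    where
    go : Shape c m J → (ω * ω) ^ 6 ≡ 1#
    go (gaussian c≡ _) = cong (_^ 6) (ω²-gaussian c≡) ∙ solve 0 ((:- :nat 1) :^ 6 := :nat 1) refl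
    go (eisenstein c≡ m≡) = cong (λ w → (w * w) ^ 6) (sym (z₀²≡ω m≡))
      ∙ solve 1 (λ x → ((x :* x) :* (x :* x)) :^ 6 := (x :^ 6) :^ 4) refl z₀
      ∙ cong (_^ 4) z₀⁶ ∙ solve 0 ((:- :nat 1) :^ 4 := :nat 1) refl

  g-root : Root (ζ ^ 13)
  g-root = power-root 13 (subst (λ e → e * e ≡ ι c * e - 1#) (sym (cong (ω *_) ω¹² ∙ *-identityʳ ω)) relation)

  -- The exponent 13 is 1 modulo 12, so z₀ is fixed, and 5 modulo 8, so that the map generates the
  -- Galois group of K over ℚ(z₀).
  g : Endo
  g = σ (ζ ^ 13) g-root

  g-ζ : ⟪ g ⟫ ζ ≡ ζ ^ 13
  g-ζ = σ-ζ (ζ ^ 13) g-root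

  g-ζ^ : ∀ k → ⟪ g ⟫ (ζ ^ k) ≡ (ζ ^ k) ^ 13
  g-ζ^ k = ^-hom g ζ k ∙ cong (_^ k) g-ζ ∙ ^-assocʳ ζ 13 k ∙ cong (ζ ^_) (ℕ.*-comm 13 k) ∙ sym (^-assocʳ ζ k 13)

  -- G j is the 2ʲ-fold iterate of g; its fixed field is ℚ(z j).
  G : ℕ → Endo
  G zero    = g
  G (suc j) = G j ∘ᴱ G j

  G-conj : ∀ j x → ⟪ G j ⟫ (x *̄) ≡ (⟪ G j ⟫ x) *̄
  G-conj zero x = commute g conj 13 (ord ℕ.∸ 1) g-ζ conj-ζ x
  G-conj (suc j) x = cong ⟪ G j ⟫ (G-conj j x) ∙ (G-conj j _)

  R-ζ : R ζ
  R-ζ = In-ζ dyadic-subring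

  open Subring (In-subring dyadic-subring) renaming
    (0∈ˢ to R-0; 1∈ˢ to R-1; +∈ˢ to R-+; *∈ˢ to R-*; neg∈ˢ to R-neg; −∈ˢ to R-−; ^∈ˢ to R-^) public using ()

  R-ι : ∀ {q} → IsDyadic q → R (ι q)
  R-ι = In-ι dyadic-subring

  R-num : ∀ k → R (num k)
  R-num k = subst R (sym (num≡ι k)) (R-ι (int⇒dyadic (k , refl)))

  R-h : R h
  R-h = R-ι (1 , refl)

  G-R : ∀ j {x} → R x → R (⟪ G j ⟫ x)
  G-R zero = In-Endo dyadic-subring g (subst R (sym g-ζ) (R-^ 13 R-ζ))
  G-R (suc j) Rx = G-R j (G-R j Rx)

  R-conj : ∀ {x} → R x → R (x *̄)
  R-conj = In-Endo dyadic-subring conj (subst R (sym conj-ζ) (R-^ (ord ℕ.∸ 1) R-ζ))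

  G-z₀ : ∀ j → ⟪ G j ⟫ z₀ ≡ z₀
  G-z₀ zero = g-ζ^ (2 ℕ.^ J) ∙ solve 1 (λ x → x :^ 13 := (x :^ 6 :* x :^ 6) :* x) refl z₀
    ∙ cong (λ e → (e * e) * z₀) z₀⁶
    ∙ solve 1 (λ x → ((:- :nat 1) :* (:- :nat 1)) :* x := x) refl z₀
  G-z₀ (suc j) = cong ⟪ G j ⟫ (G-z₀ j) ∙ G-z₀ j

  G-I : ∀ j → ⟪ G j ⟫ I ≡ I
  G-I j = cong ⟪ G j ⟫ (proj₂ I-power) ∙ ^-hom (G j) z₀ (proj₁ I-power) ∙ cong (_^ proj₁ I-power) (G-z₀ j)
    ∙ sym (proj₂ I-power)

  square-roots : ∀ {x y} → x * x ≡ y * y → (x ≡ y) ⊎ (x ≡ - y)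
  square-roots {x} {y} eq =
    Sum.map difference sum (domain
    (solve 2 (λ x y → (x :- y) :* (x :+ y) := x :* x :- y :* y) refl x y ∙ cong (_- y * y) eq ∙ (-‿inverseʳ _)))
    where
    difference : x - y ≡ 0# → x ≡ y
    difference eq = solve 2 (λ x y → x := (x :- y) :+ y) refl x y ∙ cong (_+ y) eq ∙ +-identityˡ y
    sum : x + y ≡ 0# → x ≡ - y
    sum eq = solve 2 (λ x y → x := (x :+ y) :- y) refl x y ∙ cong (_- y) eq ∙ +-identityˡ (- y)

  -- On w = z (j + 2) the map `G j` has square -w² by the previous level, so it sends w to I w or -I
  -- w. As I is fixed, a second application multiplies by I² = -1. The induction starts from z₁¹³ =
  -- z₀⁶ z₁.
  G-neg : ∀ j → j ℕ.< J → ⟪ G j ⟫ (z (suc j)) ≡ - z (suc j)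
  G-neg zero 0<J = g-ζ^ (2 ℕ.^ (J ℕ.∸ 1)) ∙ solve 1 (λ x → x :^ 13 := (x :* x) :^ 6 :* x) refl (z 1)
    ∙ cong (λ e → e ^ 6 * z 1) (z² 0<J)
    ∙ cong (_* z 1) z₀⁶ ∙ solve 1 (λ x → (:- :nat 1) :* x := :- x) refl (z 1)
  G-neg (suc j) j+1<J = finish (square-roots {hw} {I * w} squares)
    where
    w = z (suc (suc j))
    hw = ⟪ G j ⟫ w
    squares : hw * hw ≡ (I * w) * (I * w)
    squares = sym (*-hom (G j) w w) ∙ cong ⟪ G j ⟫ (z² j+1<J) ∙ G-neg j (ℕ.<⇒≤ j+1<J)
      ∙ (cong -_ (sym (z² j+1<J)))
      ∙ solve 1 (λ x → :- x := (:- :nat 1) :* x) refl (w * w) ∙ cong (_* (w * w)) (sym I²)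
        ∙ solve 2 (λ i w → (i :* i) :* (w :* w) := (i :* w) :* (i :* w)) refl I w
    finish : (hw ≡ I * w) ⊎ (hw ≡ - (I * w)) → ⟪ G j ⟫ hw ≡ - w
    finish (inj₁ eq) = cong ⟪ G j ⟫ eq ∙ *-hom (G j) I w ∙ (cong₂ _*_ (G-I j) eq) ∙ sym (*-assoc I I w)
      ∙ cong (_* w) I² ∙ solve 1 (λ x → (:- :nat 1) :* x := :- x) refl w
    finish (inj₂ eq) = cong ⟪ G j ⟫ eq ∙ (neg-hom (G j) _) ∙ (cong -_ (*-hom (G j) I w))
      ∙ (cong -_ (cong₂ _*_ (G-I j) eq))
      ∙ solve 2 (λ i w → :- (i :* (:- (i :* w))) := (i :* i) :* w) refl I w ∙ cong (_* w) I²
        ∙ solve 1 (λ x → (:- :nat 1) :* x := :- x) refl w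

  G-z : ∀ j → j ℕ.≤ J → ⟪ G j ⟫ (z j) ≡ z j
  G-z zero _ = G-z₀ 0
  G-z (suc j) j<J = cong ⟪ G j ⟫ (G-neg j j<J) ∙ (neg-hom (G j) _) ∙ (cong -_ (G-neg j j<J))
    ∙ solve 1 (λ x → :- (:- x) := x) refl (z (suc j))

  G-top : ∀ x → ⟪ G J ⟫ x ≡ x
  G-top = Endo-ext (G J) idᴱ (cong ⟪ G J ⟫ (sym z-top) ∙ G-z J ℕ.≤-refl ∙ z-top)

  -- Fixed fields, and the real field at the bottom of the tower.

  Fixed : ℕ → K → Set
  Fixed j x = ⟪ G j ⟫ x ≡ x

  Fixed-suc : ∀ j {x} → Fixed j x → Fixed (suc j) x
  Fixed-suc j eq = cong ⟪ G j ⟫ eq ∙ eq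

  Real : K → Set
  Real x = x *̄ ≡ x

  halve : ∀ {x y} → x + x ≡ y → x ≡ h * y
  halve {x} eq = sym (*-identityˡ x) ∙ cong (_* x) (sym h*2) ∙ *-assoc h 2# x
    ∙ cong (h *_) (solve 1 (λ x → :nat 2 :* x := x :+ x) refl x ∙ eq)

  even-odd : ∀ p → ∃ λ a → ∃ λ b → ∀ w → ev w p ≡ ev (w * w) a + w * ev (w * w) b
  even-odd [] = [] , [] , λ w → solve 1 (λ w → :nat 0 := :nat 0 :+ w :* :nat 0) refl w
  even-odd (x ∷ p) = go (even-odd p)
    where
    go : (∃ λ a → ∃ λ b → ∀ w → ev w p ≡ ev (w * w) a + w * ev (w * w) b) → ∃ λ a → ∃ λ b → ∀ w →
      ev w (x ∷ p) ≡ ev (w * w) a + w * ev (w * w) b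
    go (a , b , eq) = x ∷ b , a , λ w → cong (λ e → ι x + w * e) (eq w)
      ∙ solve 4 (λ x w a b → x :+ w :* (a :+ w :* b) := (x :+ (w :* w) :* b) :+ w :* a) refl (ι x) w
        (ev (w * w) a) (ev (w * w) b)

  -- Downward from the top, with `k` the remaining distance. A polynomial in w = z (j + 1) splits
  -- into even and odd part; `G j` negates w, so averaging a fixed element with its image removes
  -- the odd part and leaves a polynomial in w² = z j.
  fixed-poly : ∀ k j → j ℕ.+ k ≡ J → ∀ {x} → Fixed j x → ∃ λ p → x ≡ ev (z j) p
  fixed-poly zero j eq {x} fx = coeffs x , sym (ev-coeffs x)
    ∙ cong (λ e → ev e (coeffs x)) (sym (cong z (sym (ℕ.+-identityʳ j) ∙ eq) ∙ z-top))
  fixed-poly (suc k) j eq {x} fx = go (fixed-poly k (suc j) (sym (ℕ.+-suc j k) ∙ eq) (Fixed-suc j fx))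
    where
    j<J : j ℕ.< J
    j<J = subst (j ℕ.<_) eq (ℕ.m<m+n j ℕ.z<s)
    w = z (suc j)
    go : (∃ λ p → x ≡ ev w p) → ∃ λ p → x ≡ ev (z j) p
    go (p , x≡) = a , halve doubled ∙ solve 2 (λ h a → h :* (a :+ a) := (h :* :nat 2) :* a) refl h Ae
      ∙ cong (_* Ae) h*2 ∙ *-identityˡ Ae
      where
      a = proj₁ (even-odd p)
      b = proj₁ (proj₂ (even-odd p))
      split = proj₂ (proj₂ (even-odd p))
      Ae = ev (z j) a
      Bo = ev (z j) b
      x≡₁ : x ≡ Ae + w * Bo
      x≡₁ = x≡ ∙ split w ∙ cong (λ e → ev e a + w * ev e b) (z² j<J)
      x≡₂ : x ≡ Ae + (- w) * Bo
      x≡₂ = sym fx ∙ cong ⟪ G j ⟫ x≡ ∙ ev-hom (G j) w p ∙ cong (λ e → ev e p) (G-neg j j<J)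
        ∙ split (- w) ∙ cong (λ e → ev e a + (- w) * ev e b)
          (solve 1 (λ w → (:- w) :* (:- w) := w :* w) refl w ∙ z² j<J)
      doubled : x + x ≡ Ae + Ae
      doubled = (cong₂ _+_ x≡₁ x≡₂)
        ∙ solve 3 (λ a b w → (a :+ w :* b) :+ (a :+ (:- w) :* b) := a :+ a) refl Ae Bo w

  -- z₀ + z̄₀ is √3 in the eisenstein case (and 0 in the gaussian one).
  √3 : K
  √3 = z₀ + z₀ *̄

  z₀-unitary : z₀ * z₀ *̄ ≡ 1#
  z₀-unitary = ζ^-unitary (2 ℕ.^ J)

  conj-z₀-gaussian : c ≡ 0ℚ → m ≡ 2 ℕ.^ J → z₀ *̄ ≡ - z₀
  conj-z₀-gaussian c≡ m≡ = inverse-unique {z₀} z₀-unitary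
    (solve 1 (λ x → x :* (:- x) := :- (x :* x)) refl z₀ ∙ (cong -_ (z₀²-gaussian c≡ m≡))
    ∙ solve 0 (:- (:- :nat 1) := :nat 1) refl)

  quadratic : c ≡ 0ℚ → m ≡ 2 ℕ.^ J → ∀ p → ∃ λ a → ∃ λ b → ev z₀ p ≡ ι a + ι b * z₀
  quadratic c≡ m≡ [] = 0ℚ , 0ℚ ,
    sym (cong₂ (λ a b → a + b * z₀) ι-0 ι-0 ∙ solve 1 (λ x → :nat 0 :+ :nat 0 :* x := :nat 0) refl z₀)
  quadratic c≡ m≡ (x ∷ p) = go (quadratic c≡ m≡ p)
    where
    go : (∃ λ a → ∃ λ b → ev z₀ p ≡ ι a + ι b * z₀) → ∃ λ a → ∃ λ b → ev z₀ (x ∷ p) ≡ ι a + ι b * z₀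
    go (a , b , eq) = x ℚ.- b , a , cong (λ e → ι x + z₀ * e) eq
      ∙ solve 4 (λ x z a b → x :+ z :* (a :+ b :* z) := (x :+ b :* (z :* z)) :+ a :* z) refl (ι x) z₀ (ι a)
      (ι b)
      ∙ cong (λ e → (ι x + ι b * e) + ι a * z₀) (z₀²-gaussian c≡ m≡)
        ∙ cong (_+ ι a * z₀) (solve 2 (λ x b → x :+ b :* (:- :nat 1) := x :- b) refl (ι x) (ι b)
        ∙ sym (ι-+ x (ℚ.- b) ∙ cong (ι x +_) (ι-neg b)))

  F₀-gaussian : c ≡ 0ℚ → m ≡ 2 ℕ.^ J → ∀ {x} → Fixed 0 x → Real x → ∃ λ q → x ≡ ι q
  F₀-gaussian c≡ m≡ {x} fx rx = go (fixed-poly J 0 refl fx)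
    where
    go : (∃ λ p → x ≡ ev z₀ p) → ∃ λ q → x ≡ ι q
    go (p , x≡) = a , halve doubled ∙ solve 2 (λ h a → h :* (a :+ a) := (h :* :nat 2) :* a) refl h (ι a)
      ∙ cong (_* ι a) h*2 ∙ *-identityˡ (ι a)
      where
      a = proj₁ (quadratic c≡ m≡ p)
      b = proj₁ (proj₂ (quadratic c≡ m≡ p))
      x≡′ : x ≡ ι a + ι b * z₀
      x≡′ = x≡ ∙ proj₂ (proj₂ (quadratic c≡ m≡ p))
      doubled : x + x ≡ ι a + ι a
      doubled = (cong₂ _+_ x≡′ (sym rx ∙ (cong _*̄ x≡′) ∙ (+-hom conj _ _)
        ∙ (cong₂ _+_ (ι-hom conj a) (*-hom conj _ _ ∙ (cong₂ _*_ (ι-hom conj b) (conj-z₀-gaussian c≡ m≡))))))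
        ∙ solve 3 (λ a b z → (a :+ b :* z) :+ (a :+ b :* (:- z)) := a :+ a) refl (ι a) (ι b) z₀

  module Eisenstein (c≡ : c ≡ 1ℚ) (m≡ : m ≡ 2 ℕ.^ J ℕ.+ 2 ℕ.^ J) where

    z₀⁴ : z₀ ^ 4 ≡ z₀ * z₀ - 1#
    z₀⁴ = z₀⁴-eisenstein c≡ m≡

    conj-z₀ : z₀ *̄ ≡ z₀ - z₀ ^ 3
    conj-z₀ = inverse-unique {z₀} z₀-unitary
      (solve 1 (λ x → x :* (x :- x :^ 3) := x :* x :- x :^ 4) refl z₀ ∙ cong (λ e → z₀ * z₀ - e) z₀⁴
      ∙ solve 1 (λ x → x :- (x :- :nat 1) := :nat 1) refl (z₀ * z₀))

    √3≡ : √3 ≡ 2# * z₀ - z₀ ^ 3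
    √3≡ = cong (z₀ +_) conj-z₀ ∙ solve 1 (λ x → x :+ (x :- x :^ 3) := :nat 2 :* x :- x :^ 3) refl z₀

    √3² : √3 * √3 ≡ nat 3
    √3² = (cong₂ _*_ √3≡ √3≡)
      ∙ solve 1 (λ x → (:nat 2 :* x :- x :^ 3) :* (:nat 2 :* x :- x :^ 3) :=
      :nat 4 :* (x :* x) :- :nat 4 :* (x :^ 4) :+ x :^ 6) refl z₀
      ∙ cong₂ (λ a b → nat 4 * (z₀ * z₀) - nat 4 * a + b) z₀⁴ z₀⁶
        ∙ solve 1 (λ x → :nat 4 :* x :- :nat 4 :* (x :- :nat 1) :+ (:- :nat 1) := :nat 3) refl (z₀ * z₀)

    √3-real : Real √3
    √3-real = +-hom conj z₀ (z₀ *̄) ∙ cong (z₀ *̄ +_) (conj-involutive z₀) ∙ (+-comm _ _)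

    √3-fixed : ∀ j → Fixed j √3
    √3-fixed j = +-hom (G j) z₀ (z₀ *̄) ∙ (cong₂ _+_ (G-z₀ j) (G-conj j z₀ ∙ (cong _*̄ (G-z₀ j))))

    quartic : ∀ p → ∃ λ a → ∃ λ b → ∃ λ d → ∃ λ e → ev z₀ p ≡ ι a + ι b * z₀ + ι d * (z₀ * z₀) + ι e * z₀ ^ 3
    quartic [] = 0ℚ , 0ℚ , 0ℚ , 0ℚ ,
      sym (cong (λ o → o + o * z₀ + o * (z₀ * z₀) + o * z₀ ^ 3) ι-0
      ∙ solve 1 (λ x → :nat 0 :+ :nat 0 :* x :+ :nat 0 :* (x :* x) :+ :nat 0 :* x :^ 3 := :nat 0) refl z₀)
    quartic (x ∷ p) = go (quartic p)
      where
      go : (∃ λ a → ∃ λ b → ∃ λ d → ∃ λ e → ev z₀ p ≡ ι a + ι b * z₀ + ι d * (z₀ * z₀) + ι e * z₀ ^ 3) →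
           ∃ λ a → ∃ λ b → ∃ λ d → ∃ λ e → ev z₀ (x ∷ p) ≡ ι a + ι b * z₀ + ι d * (z₀ * z₀) + ι e * z₀ ^ 3
      go (a , b , d , e , eq) = x ℚ.- e , a , b ℚ.+ e , d , cong (λ y → ι x + z₀ * y) eq
        ∙ solve 6 (λ x z a b d e → x :+ z :* (a :+ b :* z :+ d :* (z :* z) :+ e :* z :^ 3) :=
          x :+ a :* z :+ b :* (z :* z) :+ d :* z :^ 3 :+ e :* z :^ 4) refl (ι x) z₀ (ι a) (ι b) (ι d) (ι e)
        ∙ cong (λ y → ι x + ι a * z₀ + ι b * (z₀ * z₀) + ι d * z₀ ^ 3 + ι e * y) z₀⁴
        ∙ solve 6 (λ x z a b d e → x :+ a :* z :+ b :* (z :* z) :+ d :* z :^ 3 :+ e :* (z :* z :- :nat 1) :=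
          (x :- e) :+ a :* z :+ (b :+ e) :* (z :* z) :+ d :* z :^ 3) refl (ι x) z₀ (ι a) (ι b) (ι d) (ι e)
        ∙ sym (cong₂ (λ p q → p + ι a * z₀ + q * (z₀ * z₀) + ι d * z₀ ^ 3)
          (ι-+ x (ℚ.- e) ∙ cong (ι x +_) (ι-neg e)) (ι-+ b e))

    -- Averaging with the complex conjugate replaces z₀, z₀², z₀³ by half their traces; the traces
    -- are √3, 1 and 0.
    F₀-eisenstein : ∀ {x} → Fixed 0 x → Real x → ∃ λ a → ∃ λ b → x ≡ ι a + ι b * √3
    F₀-eisenstein {x} fx rx = go (fixed-poly J 0 refl fx)
      where
      go : (∃ λ p → x ≡ ev z₀ p) → ∃ λ a → ∃ λ b → x ≡ ι a + ι b * √3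
      go (p , x≡) = a ℚ.+ ½ ℚ.* d , ½ ℚ.* b , halve doubled
        ∙ cong (λ e → h * e) (solve 4 (λ a b d s → (a :+ a) :+ d :+ b :* s := :nat 2 :* a :+ d :+ b :* s) refl
        (ι a) (ι b) (ι d) √3)
          ∙ solve 5 (λ h a b d s → h :* (:nat 2 :* a :+ d :+ b :* s) :=
            ((h :* :nat 2) :* a :+ h :* d) :+ (h :* b) :* s) refl h (ι a) (ι b) (ι d) √3
             ∙ cong (λ e → (e * ι a + h * ι d) + (h * ι b) * √3) h*2
          ∙ sym (cong₂ (λ p q → p + q * √3) (ι-+ a (½ ℚ.* d) ∙ (cong₂ _+_ (sym (*-identityˡ _)) (ι-* ½ d)))
            (ι-* ½ b))
        where
        Q = quartic p
        a = proj₁ Q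
        b = proj₁ (proj₂ Q)
        d = proj₁ (proj₂ (proj₂ Q))
        e = proj₁ (proj₂ (proj₂ (proj₂ Q)))
        x≡′ : x ≡ ι a + ι b * z₀ + ι d * (z₀ * z₀) + ι e * z₀ ^ 3
        x≡′ = x≡ ∙ proj₂ (proj₂ (proj₂ (proj₂ Q)))
        z̄ = z₀ *̄
        x̄≡ : x ≡ ι a + ι b * z̄ + ι d * (z̄ * z̄) + ι e * z̄ ^ 3
        x̄≡ = sym rx ∙ (cong _*̄ x≡′) ∙ (+-hom conj _ _)
          ∙ (cong₂ _+_ (+-hom conj _ _ ∙ (cong₂ _+_ ((+-hom conj _ _)
           ∙ (cong₂ _+_ (ι-hom conj a) (*-hom conj _ _ ∙ cong (_* z̄) (ι-hom conj b))))
             (*-hom conj _ _ ∙ (cong₂ _*_ (ι-hom conj d) (*-hom conj z₀ z₀)))))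
           (*-hom conj _ _ ∙ (cong₂ _*_ (ι-hom conj e) (^-hom conj z₀ 3))))
        sq : z₀ * z₀ + z̄ * z̄ ≡ 1#
        sq = solve 2 (λ x y → x :* x :+ y :* y := (x :+ y) :* (x :+ y) :- :nat 2 :* (x :* y)) refl z₀ z̄
          ∙ cong₂ (λ p q → p - 2# * q) √3² z₀-unitary ∙ solve 0 (:nat 3 :- :nat 2 :* :nat 1 := :nat 1) refl
        cube : z₀ ^ 3 + z̄ ^ 3 ≡ 0#
        cube = solve 2 (λ x y → x :^ 3 :+ y :^ 3 := (x :+ y) :* ((x :* x :+ y :* y) :- x :* y)) refl z₀ z̄
          ∙ cong₂ (λ p q → √3 * (p - q)) sq z₀-unitary
          ∙ solve 1 (λ s → s :* (:nat 1 :- :nat 1) := :nat 0) refl √3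
        doubled : x + x ≡ (ι a + ι a) + ι d + ι b * √3
        doubled = (cong₂ _+_ x≡′ x̄≡)
          ∙ solve 6 (λ a b d e x y →
          (a :+ b :* x :+ d :* (x :* x) :+ e :* x :^ 3) :+ (a :+ b :* y :+ d :* (y :* y) :+ e :* y :^ 3) :=
             (a :+ a) :+ d :* (x :* x :+ y :* y) :+ b :* (x :+ y) :+ e :* (x :^ 3 :+ y :^ 3)) refl (ι a) (ι b)
               (ι d) (ι e) z₀ z̄
             ∙ cong₂ (λ p q → (ι a + ι a) + ι d * p + ι b * √3 + ι e * q) sq cube
               ∙ solve 4 (λ a d t e → (a :+ a) :+ d :* :nat 1 :+ t :+ e :* :nat 0 := (a :+ a) :+ d :+ t) refl
               (ι a) (ι d) (ι b * √3) (ι e)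

    τ-root : Root (ζ ^ 5)
    τ-root = power-root 5 (subst (λ e → e * e ≡ ι c * e - 1#) (sym ω⁵)
       (solve 1 (λ w → (:nat 1 :- w) :* (:nat 1 :- w) := :nat 1 :- w :- w :+ w :* w) refl ω
         ∙ cong (λ e → 1# - ω - ω + e) ω²
         ∙ solve 1 (λ w → :nat 1 :- w :- w :+ (w :- :nat 1) := :nat 1 :* (:nat 1 :- w) :- :nat 1) refl ω
         ∙ cong (λ e → e * (1# - ω) - 1#) (sym ι-1 ∙ cong ι (sym c≡))))
      where
      ω² = ω²-eisenstein c≡
      ω⁵ : ω ^ 5 ≡ 1# - ω
      ω⁵ = solve 1 (λ w → w :^ 5 := (w :* w) :* (w :* w) :* w) refl ω ∙ cong (λ e → e * e * ω) ω²
        ∙ solve 1 (λ w → (w :- :nat 1) :* (w :- :nat 1) :* w := (w :* w) :* w :- :nat 2 :* (w :* w) :+ w) refl ω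
          ∙ cong (λ e → e * ω - 2# * e + ω) ω²
        ∙ solve 1 (λ w → (w :- :nat 1) :* w :- :nat 2 :* (w :- :nat 1) :+ w := w :* w :- :nat 2 :* w :+ :nat 2)
          refl ω ∙ cong (λ e → e - 2# * ω + 2#) ω²
          ∙ solve 1 (λ w → (w :- :nat 1) :- :nat 2 :* w :+ :nat 2 := :nat 1 :- w) refl ω

    -- The exponent 5 is 1 modulo 4 and 2 modulo 3: it fixes √-1 and sends z₀ to z₀⁵ = -z̄₀, hence
    -- √3 to -√3.
    τ : Endo
    τ = σ (ζ ^ 5) τ-root

    τ-ζ : ⟪ τ ⟫ ζ ≡ ζ ^ 5
    τ-ζ = σ-ζ (ζ ^ 5) τ-root

    τ-conj : ∀ x → ⟪ τ ⟫ (x *̄) ≡ (⟪ τ ⟫ x) *̄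
    τ-conj = commute τ conj 5 (ord ℕ.∸ 1) τ-ζ conj-ζ

    τ-g : ∀ x → ⟪ τ ⟫ (⟪ g ⟫ x) ≡ ⟪ g ⟫ (⟪ τ ⟫ x)
    τ-g = commute τ g 5 13 τ-ζ g-ζ

    τ-R : ∀ {x} → R x → R (⟪ τ ⟫ x)
    τ-R = In-Endo dyadic-subring τ (subst R (sym τ-ζ) (R-^ 5 R-ζ))

    τ-√3 : ⟪ τ ⟫ √3 ≡ - √3
    τ-√3 = +-hom τ z₀ (z₀ *̄)
      ∙ (cong₂ _+_ τz (τ-conj z₀ ∙ (cong _*̄ τz) ∙ neg-hom conj _ ∙ (cong -_ (conj-involutive z₀))))
      ∙ solve 2 (λ x y → (:- y) :+ (:- x) := :- (x :+ y)) refl z₀ (z₀ *̄)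
      where
      τz : ⟪ τ ⟫ z₀ ≡ - z₀ *̄
      τz = ^-hom τ ζ (2 ℕ.^ J) ∙ cong (_^ (2 ℕ.^ J)) τ-ζ ∙ ^-assocʳ ζ 5 (2 ℕ.^ J)
        ∙ cong (ζ ^_) (ℕ.*-comm 5 (2 ℕ.^ J)) ∙ sym (^-assocʳ ζ (2 ℕ.^ J) 5)
        ∙ sym (*-identityʳ _) ∙ cong (z₀ ^ 5 *_) (sym z₀-unitary)
          ∙ solve 2 (λ x y → x :^ 5 :* (x :* y) := x :^ 6 :* y) refl z₀ (z₀ *̄) ∙ cong (_* z₀ *̄) z₀⁶
          ∙ solve 1 (λ y → (:- :nat 1) :* y := :- y) refl (z₀ *̄)

    τ-F₀ : ∀ a b → ⟪ τ ⟫ (ι a + ι b * √3) ≡ ι a - ι b * √3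
    τ-F₀ a b = +-hom τ _ _ ∙ (cong₂ _+_ (ι-hom τ a) (*-hom τ _ _ ∙ (cong₂ _*_ (ι-hom τ b) τ-√3)))
      ∙ solve 3 (λ a b s → a :+ b :* (:- s) := a :- b :* s) refl (ι a) (ι b) √3

    τ-involutive : ∀ {x} → Fixed 0 x → Real x → ⟪ τ ⟫ (⟪ τ ⟫ x) ≡ x
    τ-involutive fx rx = go (F₀-eisenstein fx rx)
      where
      go : ∀ {x} → (∃ λ a → ∃ λ b → x ≡ ι a + ι b * √3) → ⟪ τ ⟫ (⟪ τ ⟫ x) ≡ x
      go (a , b , refl) = cong ⟪ τ ⟫ (τ-F₀ a b) ∙ (−-hom τ _ _)
        ∙ (cong₂ _-_ (ι-hom τ a) (*-hom τ _ _ ∙ (cong₂ _*_ (ι-hom τ b) τ-√3)))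
        ∙ solve 3 (λ a b s → a :- b :* (:- s) := a :+ b :* s) refl (ι a) (ι b) √3

    τ-rational : ∀ {x} → Fixed 0 x → Real x → ⟪ τ ⟫ x ≡ x → ∃ λ q → x ≡ ι q
    τ-rational fx rx τx = go (F₀-eisenstein fx rx) τx
      where
      go : ∀ {x} → (∃ λ a → ∃ λ b → x ≡ ι a + ι b * √3) → ⟪ τ ⟫ x ≡ x → ∃ λ q → x ≡ ι q
      go {x} (a , b , eq) τx = a ,
        halve ((cong₂ _+_ eq (sym τx ∙ cong ⟪ τ ⟫ eq ∙ τ-F₀ a b))
        ∙ solve 2 (λ a s → (a :+ s) :+ (a :- s) := a :+ a) refl (ι a) (ι b * √3))
        ∙ solve 2 (λ h a → h :* (a :+ a) := (h :* :nat 2) :* a) refl h (ι a) ∙ cong (_* ι a) h*2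
          ∙ *-identityˡ (ι a)

  -- Inverses through norms.

  Invertible : K → Set
  Invertible x = ∃ λ y → x * y ≡ 1#

  ≢0-* : ∀ {x y} → x ≢ 0# → y ≢ 0# → x * y ≢ 0#
  ≢0-* x≢0 y≢0 eq = Sum.[ x≢0 , y≢0 ]′ (domain eq)

  -- φ(x) divided by the norm x φ(x) inverts x. The norm lies in the fixed field of φ and is nonzero
  -- for want of zero divisors, so the question moves one field down.
  inverse-descent : ∀ φ {x} → x ≢ 0# → ⟪ φ ⟫ (⟪ φ ⟫ x) ≡ x →
    (x * ⟪ φ ⟫ x ≢ 0# → ⟪ φ ⟫ (x * ⟪ φ ⟫ x) ≡ x * ⟪ φ ⟫ x → Invertible (x * ⟪ φ ⟫ x)) → Invertible x
  inverse-descent φ {x} x≢0 inv next =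
    go (next (≢0-* x≢0 λ eq → x≢0 (sym inv ∙ cong ⟪ φ ⟫ eq ∙ 0-hom φ))
    (*-hom φ _ _ ∙ cong (⟪ φ ⟫ x *_) inv ∙ (*-comm _ _)))
    where
    go : Invertible (x * ⟪ φ ⟫ x) → Invertible x
    go (y , eq) = ⟪ φ ⟫ x * y , sym (*-assoc _ _ _) ∙ eq

  ι-invertible : ∀ q → ι q ≢ 0# → Invertible (ι q)
  ι-invertible q ne = ι (ℚ.1/ q) , sym (ι-* q (ℚ.1/ q)) ∙ cong ι (ℚ.*-inverseʳ q) ∙ ι-1
    where instance _ = ℚ.≢-nonZero {q} (λ { refl → ne ι-0 })

  F₀-invertible : ∀ {x} → x ≢ 0# → Fixed 0 x → Real x → Invertible x
  F₀-invertible = go shape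
    where
    rational : ∀ {x} → x ≢ 0# → (∃ λ q → x ≡ ι q) → Invertible x
    rational ne (q , refl) = ι-invertible q ne
    go : Shape c m J → ∀ {x} → x ≢ 0# → Fixed 0 x → Real x → Invertible x
    go (gaussian c≡ m≡) ne fx rx = rational ne (F₀-gaussian c≡ m≡ fx rx)
    go (eisenstein c≡ m≡) ne fx rx = inverse-descent τ ne (τ-involutive fx rx) λ ne' τx →
      rational ne' (τ-rational
        (*-hom g _ _ ∙ (cong₂ _*_ fx (sym (τ-g _) ∙ cong ⟪ τ ⟫ fx)))
          (*-hom conj _ _ ∙ (cong₂ _*_ rx (sym (τ-conj _) ∙ cong ⟪ τ ⟫ rx))) τx)
      where open Eisenstein c≡ m≡

  fixed-invertible : ∀ j {x} → x ≢ 0# → Fixed j x → Invertible x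
  fixed-invertible zero ne fx = inverse-descent conj ne (conj-involutive _) λ ne' rx →
    F₀-invertible ne' (*-hom g _ _ ∙ (cong₂ _*_ fx (G-conj 0 _ ∙ (cong _*̄ fx)))) rx
  fixed-invertible (suc j) ne fx = inverse-descent (G j) ne fx (λ ne' → fixed-invertible j ne')

  invertible : ∀ {x} → x ≢ 0# → Invertible x
  invertible ne = fixed-invertible J ne (G-top _)

-- Odd primes in R: divisibility, unramifiedness and square roots.

IsPrime : ℕ → Set
IsPrime = Primality.Prime

Odd : ℕ → Set
Odd n = Coprime n 2

prime∤⇒coprime : ∀ {p n} → IsPrime p → ¬ p ℕ∣.∣ n → Coprime p n
prime∤⇒coprime pp p∤n (d∣p , d∣n) with prime⇒irreducible pp d∣p
... | inj₁ d≡1 = d≡1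
... | inj₂ refl = ⊥-elim (p∤n d∣n)

prime≢⇒∤ : ∀ {p q} → IsPrime p → IsPrime q → p ≢ q → ¬ p ℕ∣.∣ q
prime≢⇒∤ pp qq ne p∣q with prime⇒irreducible qq p∣q
... | inj₁ refl = Primality.¬prime[1] pp
... | inj₂ eq = ne eq

odd-prime : ∀ {p} → IsPrime p → p ≢ 2 → Odd p
odd-prime pp ne = prime∤⇒coprime pp (prime≢⇒∤ pp prime[2] ne)

odd-^ : ∀ {p} k → Odd p → Odd (p ℕ.^ k)
odd-^ zero op (d∣1 , _) = ℕ∣.∣1⇒≡1 d∣1
odd-^ {p} (suc k) op {d} (d∣p^ , d∣2) =
  odd-^ k op (coprime-divisor (λ { (e∣d , e∣p) → op (e∣p , ℕ∣.∣-trans e∣d d∣2) }) d∣p^ , d∣2)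

odd-∣2^* : ∀ {M} → Odd M → ∀ k n → M ℕ∣.∣ 2 ℕ.^ k ℕ.* n → M ℕ∣.∣ n
odd-∣2^* {M} odd zero n d = subst (M ℕ∣.∣_) (ℕ.+-identityʳ n) d
odd-∣2^* {M} odd (suc k) n d =
  odd-∣2^* odd k n (coprime-divisor odd (subst (M ℕ∣.∣_) (ℕ.*-assoc 2 (2 ℕ.^ k) n) d))

prime[3] : IsPrime 3
prime[3] = toWitness {a? = Primality.prime? 3} _

module Ramification (C : Cyclotomic) where
  open TowerOf C public

  nat-+ : ∀ a b → nat (a ℕ.+ b) ≡ nat a + nat b
  nat-+ a b = num-+ (ℤ.+ a) (ℤ.+ b)

  nat-* : ∀ a b → nat (a ℕ.* b) ≡ nat a * nat b
  nat-* a b = cong num (ℤ.pos-* a b) ∙ num-* (ℤ.+ a) (ℤ.+ b)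

  nat-^ : ∀ a k → nat (a ℕ.^ k) ≡ nat a ^ k
  nat-^ a zero = refl
  nat-^ a (suc k) = nat-* a (a ℕ.^ k) ∙ cong (nat a *_) (nat-^ a k)

  R-nat : ∀ n → R (nat n)
  R-nat n = R-num (ℤ.+ n)

  O⇒R : ∀ {x} → O x → R x
  O⇒R = All.map int⇒dyadic

  num-real : ∀ k → Real (num k)
  num-real = num-hom conj

  infix 4 _∣ᴿ_
  _∣ᴿ_ : K → K → Set
  x ∣ᴿ y = ∃ λ w → R w × y ≡ x * w

  ∣ᴿ-refl : ∀ {x} → x ∣ᴿ x
  ∣ᴿ-refl {x} = 1# , R-1 , sym (*-identityʳ x)

  ∣ᴿ-+ : ∀ {x y w} → x ∣ᴿ y → x ∣ᴿ w → x ∣ᴿ y + w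
  ∣ᴿ-+ {x} (u , Ru , refl) (v , Rv , refl) = u + v , R-+ Ru Rv , sym (distribˡ x u v)

  ∣ᴿ-*ʳ : ∀ {x y} w → R w → x ∣ᴿ y → x ∣ᴿ w * y
  ∣ᴿ-*ʳ {x} w Rw (u , Ru , refl) = w * u , R-* Rw Ru ,
    solve 3 (λ x z u → z :* (x :* u) := x :* (z :* u)) refl x w u

  ∣ᴿ-neg : ∀ {x y} → x ∣ᴿ y → x ∣ᴿ - y
  ∣ᴿ-neg {x} (u , Ru , refl) = - u , R-neg Ru , solve 2 (λ x u → :- (x :* u) := x :* (:- u)) refl x u

  ∣ᴿ-* : ∀ {x y x' y'} → x ∣ᴿ y → x' ∣ᴿ y' → x * x' ∣ᴿ y * y'
  ∣ᴿ-* {x} {_} {x'} (u , Ru , refl) (v , Rv , refl) = u * v , R-* Ru Rv ,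
    solve 4 (λ x x' u v → (x :* u) :* (x' :* v) := (x :* x') :* (u :* v)) refl x x' u v

  ∣ᴿ-≡ : ∀ {x y y'} → y ≡ y' → x ∣ᴿ y → x ∣ᴿ y'
  ∣ᴿ-≡ refl d = d

  ∣ᴿ-trans : ∀ {x y w} → x ∣ᴿ y → y ∣ᴿ w → x ∣ᴿ w
  ∣ᴿ-trans {x} (u , Ru , refl) (v , Rv , refl) = u * v , R-* Ru Rv , *-assoc x u v

  ∣ᴿ-x* : ∀ {x w} → R w → x ∣ᴿ x * w
  ∣ᴿ-x* Rw = _ , Rw , refl

  Unit : K → Set
  Unit x = R x × ∃ λ y → R y × x * y ≡ 1#

  Unit-* : ∀ {x y} → Unit x → Unit y → Unit (x * y)
  Unit-* {x} {y} (Rx , x' , Rx' , ex) (Ry , y' , Ry' , ey) = R-* Rx Ry , x' * y' , R-* Rx' Ry' ,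
    solve 4 (λ x y x' y' → (x :* y) :* (x' :* y') := (x :* x') :* (y :* y')) refl x y x' y' ∙ (cong₂ _*_ ex ey)
      ∙ *-identityˡ 1#

  Unit-factor : ∀ {x y} → R x → R y → Unit (x * y) → Unit x
  Unit-factor {x} {y} Rx Ry (_ , w , Rw , eq) = Rx , y * w , R-* Ry Rw , sym (*-assoc x y w) ∙ eq

  Unit-conj : ∀ {x} → Unit x → Unit (x *̄)
  Unit-conj {x} (Rx , y , Ry , eq) = R-conj Rx , y *̄ , R-conj Ry , sym (*-hom conj x y) ∙ (cong _*̄ eq)
    ∙ 1-hom conj

  Unit-2 : Unit 2#
  Unit-2 = R-nat 2 , h , R-h , *-comm 2# h ∙ h*2

  Unit-cancel : ∀ {ϖ u y} → Unit u → R y → ϖ ∣ᴿ u * y → ϖ ∣ᴿ y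
  Unit-cancel {ϖ} {u} {y} (_ , v , Rv , uv) Ry d =
    ∣ᴿ-≡ (sym (*-assoc v u y) ∙ cong (_* y) (*-comm v u ∙ uv) ∙ *-identityˡ y) (∣ᴿ-*ʳ v Rv d)

  1≢0 : 1# ≢ 0#
  1≢0 eq = ℚ.1≢0 (ι-injective (ι-1 ∙ eq ∙ sym ι-0))

  Unit⇒≢0 : ∀ {x} → Unit x → x ≢ 0#
  Unit⇒≢0 (_ , y , _ , eq) refl = 1≢0 (sym eq ∙ zeroˡ y)

  unitary⇒Unit : ∀ {x} → R x → x * x *̄ ≡ 1# → Unit x
  unitary⇒Unit {x} Rx eq = Rx , x *̄ , R-conj Rx , eq

  R-z : ∀ j → R (z j)
  R-z j = R-^ (2 ℕ.^ (J ℕ.∸ j)) R-ζ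

  z-unitary : ∀ j → z j * z j *̄ ≡ 1#
  z-unitary j = ζ^-unitary (2 ℕ.^ (J ℕ.∸ j))

  -- Comparing constant coefficients gives a dyadic quotient; its denominator is a power of 2, which
  -- an odd `M` does not see.
  nat-∣ : ∀ {M n} → Odd M → nat M ∣ᴿ nat n → M ℕ∣.∣ n
  nat-∣ {M} {n} odd (w , Rw , eq) = go (dyadic⇒ {coef 0 w} (at-all 0 (0∈ dyadic-subring) Rw))
    where
    coef-eq : int (ℤ.+ n) ≡ int (ℤ.+ M) ℚ.* coef 0 w
    coef-eq = sym (coef-ι (int (ℤ.+ n)))
      ∙ cong (coef 0) (sym (num≡ι (ℤ.+ n)) ∙ eq ∙ cong (_* w) (num≡ι (ℤ.+ M))) ∙ coef-ι* 0 (int (ℤ.+ M)) w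
    go : (∃ λ k → IsInt (2^ k ℚ.* coef 0 w)) → M ℕ∣.∣ n
    go (k , b , eq') = odd-∣2^* odd k n
      (ℕ∣.divides ℤ.∣ b ∣ (sym (ℤ.abs-* (ℤ.+ (2 ℕ.^ k)) (ℤ.+ n)) ∙ cong ℤ.∣_∣ ints ∙ ℤ.abs-* (ℤ.+ M) b
      ∙ (ℕ.*-comm M ℤ.∣ b ∣)))
      where
      ints : ℤ.+ (2 ℕ.^ k) ℤ.* ℤ.+ n ≡ ℤ.+ M ℤ.* b
      ints = int-injective (int-* (ℤ.+ (2 ℕ.^ k)) (ℤ.+ n) ∙ cong (2^ k ℚ.*_) coef-eq
        ∙ sym (ℚ.*-assoc (2^ k) (int (ℤ.+ M)) (coef 0 w))
        ∙ cong (ℚ._* coef 0 w) (ℚ.*-comm (2^ k) (int (ℤ.+ M))) ∙ ℚ.*-assoc (int (ℤ.+ M)) (2^ k) (coef 0 w)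
          ∙ cong (int (ℤ.+ M) ℚ.*_) eq' ∙ sym (int-* (ℤ.+ M) b))

  coprime-cancel : ∀ {ϖ p k y} → ϖ ∣ᴿ nat p → Coprime p k → R y → ϖ ∣ᴿ nat k * y → ϖ ∣ᴿ y
  coprime-cancel {ϖ} {p} {k} {y} ϖ∣p cop Ry d = go (coprime-Bézout cop)
    where
    go : Bézout.Identity 1 p k → ϖ ∣ᴿ y
    go (Bézout.+- a b eq) = ∣ᴿ-≡
      (solve 4 (λ a p y bk → y :* a :* p :+ :- (bk :* y) := (a :* p :- bk) :* y) refl (nat a) (nat p) y
      (nat b * nat k)
        ∙ cong (_* y) (cong (_- nat b * nat k) (sym hom)
          ∙ solve 1 (λ x → (:nat 1 :+ x) :- x := :nat 1) refl (nat b * nat k)) ∙ *-identityˡ y)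
        (∣ᴿ-+ (∣ᴿ-*ʳ (y * nat a) (R-* Ry (R-nat a)) ϖ∣p)
          (∣ᴿ-neg (∣ᴿ-≡ (sym (*-assoc (nat b) (nat k) y)) (∣ᴿ-*ʳ (nat b) (R-nat b) d))))
      where
      hom : 1# + nat b * nat k ≡ nat a * nat p
      hom = cong (1# +_) (sym (nat-* b k)) ∙ sym (nat-+ 1 (b ℕ.* k)) ∙ cong nat eq ∙ nat-* a p
    go (Bézout.-+ a b eq) = ∣ᴿ-≡
      (solve 4 (λ a p y bk → bk :* y :+ :- (y :* a :* p) := (bk :- a :* p) :* y) refl (nat a) (nat p) y
      (nat b * nat k)
        ∙ cong (_* y) (cong (_- nat a * nat p) (sym hom)
          ∙ solve 1 (λ x → (:nat 1 :+ x) :- x := :nat 1) refl (nat a * nat p)) ∙ *-identityˡ y)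
        (∣ᴿ-+ (∣ᴿ-≡ (sym (*-assoc (nat b) (nat k) y)) (∣ᴿ-*ʳ (nat b) (R-nat b) d))
          (∣ᴿ-neg (∣ᴿ-*ʳ (y * nat a) (R-* Ry (R-nat a)) ϖ∣p)))
      where
      hom : 1# + nat a * nat p ≡ nat b * nat k
      hom = cong (1# +_) (sym (nat-* a p)) ∙ sym (nat-+ 1 (a ℕ.* p)) ∙ cong nat eq ∙ nat-* b k

  -- Says that ϖR is a radical ideal, the form in which ϖ being squarefree in R is used.
  Separable : K → Set
  Separable ϖ = ∀ {y} → R y → ϖ ∣ᴿ y * y → ϖ ∣ᴿ y

  module Separability (ϖ : K) (ϖ-fixed : Fixed 0 ϖ) (ϖ-real : Real ϖ) where

    ϖ-Fixed : ∀ j → Fixed j ϖ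
    ϖ-Fixed zero = ϖ-fixed
    ϖ-Fixed (suc j) = Fixed-suc j (ϖ-Fixed j)

    -- With a = (y + φ y)/2 and b = (y - φ y)/2, both a² + b² and a b lie in ϖR; hence so do a⁴ and then b².
    descend : ∀ (φ : Endo) (V : K → Set) → Subring V → V h → (∀ {x} → V x → V (⟪ φ ⟫ x)) →
      (∀ {x} → R x → R (⟪ φ ⟫ x)) → ⟪ φ ⟫ ϖ ≡ ϖ →
      ∀ s → R s → V s → ⟪ φ ⟫ s ≡ - s → (∀ {y} → R y → ϖ ∣ᴿ s * y → ϖ ∣ᴿ y) →
      (∀ {y} → R y → V y → ⟪ φ ⟫ y ≡ y → ϖ ∣ᴿ y * y → ϖ ∣ᴿ y) →
      ∀ {y} → R y → V y → ⟪ φ ⟫ (⟪ φ ⟫ y) ≡ y → ϖ ∣ᴿ y * y → ϖ ∣ᴿ y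
    descend φ V sub Vh Vφ Rφ φϖ s Rs Vs φs cancel-s lower {y} Ry Vy φφ (w , Rw , y²) =
      ∣ᴿ-≡ (sym y≡) (∣ᴿ-+ ϖ∣a (cancel-s Rb
        (lower (R-* Rs Rb) (*∈ˢ Vs Vb) φsb
        (∣ᴿ-≡ (solve 2 (λ s b → (s :* s) :* (b :* b) := (s :* b) :* (s :* b)) refl s b)
        (∣ᴿ-*ʳ (s * s) (R-* Rs Rs) ϖ∣b²)))))
      where
      open Subring sub
      y' = ⟪ φ ⟫ y
      a = h * (y + y')
      b = h * (y - y')
      Ry' : R y'
      Ry' = Rφ Ry
      Ra : R a
      Ra = R-* R-h (R-+ Ry Ry')
      Rb : R b
      Rb = R-* R-h (R-− Ry Ry')
      Va : V a
      Va = *∈ˢ Vh (+∈ˢ Vy (Vφ Vy))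
      Vb : V b
      Vb = *∈ˢ Vh (−∈ˢ Vy (Vφ Vy))
      y≡ : y ≡ a + b
      y≡ = sym (*-identityˡ y) ∙ cong (_* y) (sym h*2)
        ∙ solve 3 (λ h y y' → (h :* :nat 2) :* y := h :* (y :+ y') :+ h :* (y :- y')) refl h y y'
      φa : ⟪ φ ⟫ a ≡ a
      φa = *-hom φ _ _ ∙ (cong₂ _*_ (ι-hom φ ½) (+-hom φ y y' ∙ cong (y' +_) φφ ∙ +-comm y' y))
      φb : ⟪ φ ⟫ b ≡ - b
      φb = *-hom φ _ _ ∙ (cong₂ _*_ (ι-hom φ ½) (−-hom φ y y' ∙ cong (λ e → y' - e) φφ))
        ∙ solve 3 (λ h y y' → h :* (y' :- y) := :- (h :* (y :- y'))) refl h y y'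
      -- φ negates `b`, which puts it outside the fixed field; the factor `s`, negated as well,
      -- brings the product into the range of `lower`.
      φsb : ⟪ φ ⟫ (s * b) ≡ s * b
      φsb = *-hom φ s b ∙ (cong₂ _*_ φs φb) ∙ solve 2 (λ s b → (:- s) :* (:- b) := s :* b) refl s b
      ϖ∣y² : ϖ ∣ᴿ y * y
      ϖ∣y² = w , Rw , y²
      ϖ∣y'² : ϖ ∣ᴿ y' * y'
      ϖ∣y'² = ⟪ φ ⟫ w , Rφ Rw , sym (*-hom φ y y) ∙ cong ⟪ φ ⟫ y² ∙ *-hom φ ϖ w ∙ cong (_* ⟪ φ ⟫ w) φϖ
      ϖ∣a²+b² : ϖ ∣ᴿ a * a + b * b
      ϖ∣a²+b² = ∣ᴿ-≡ (solve 3 (λ h y y' → (:nat 2 :* (h :* h)) :* (y :* y :+ y' :* y') :=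
        (h :* (y :+ y')) :* (h :* (y :+ y')) :+ (h :* (y :- y')) :* (h :* (y :- y'))) refl h y y')
        (∣ᴿ-*ʳ (2# * (h * h)) (R-* (R-nat 2) (R-* R-h R-h)) (∣ᴿ-+ ϖ∣y² ϖ∣y'²))
      ϖ∣ab : ϖ ∣ᴿ a * b
      ϖ∣ab = ∣ᴿ-≡ (solve 3 (λ h y y' → (h :* h) :* (y :* y :+ :- (y' :* y')) :=
        (h :* (y :+ y')) :* (h :* (y :- y'))) refl h y y')
        (∣ᴿ-*ʳ (h * h) (R-* R-h R-h) (∣ᴿ-+ ϖ∣y² (∣ᴿ-neg ϖ∣y'²)))
      ϖ∣a⁴ : ϖ ∣ᴿ (a * a) * (a * a)
      ϖ∣a⁴ = ∣ᴿ-≡ (solve 2 (λ a b → (a :* a) :* (a :* a :+ b :* b) :+ :- ((a :* b) :* (a :* b)) :=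
        (a :* a) :* (a :* a)) refl a b)
        (∣ᴿ-+ (∣ᴿ-*ʳ (a * a) (R-* Ra Ra) ϖ∣a²+b²) (∣ᴿ-neg (∣ᴿ-*ʳ (a * b) (R-* Ra Rb) ϖ∣ab)))
      ϖ∣a² : ϖ ∣ᴿ a * a
      ϖ∣a² = lower (R-* Ra Ra) (*∈ˢ Va Va) (*-hom φ a a ∙ (cong₂ _*_ φa φa)) ϖ∣a⁴
      ϖ∣a : ϖ ∣ᴿ a
      ϖ∣a = lower Ra Va φa ϖ∣a²
      ϖ∣b² : ϖ ∣ᴿ b * b
      ϖ∣b² = ∣ᴿ-≡ (solve 2 (λ x y → (x :+ y) :+ :- x := y) refl (a * a) (b * b)) (∣ᴿ-+ ϖ∣a²+b² (∣ᴿ-neg ϖ∣a²))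

    ⊤-subring : Subring (λ _ → ⊤)
    ⊤-subring = record { 0∈ˢ = tt ; 1∈ˢ = tt ; +∈ˢ = λ _ _ → tt ; *∈ˢ = λ _ _ → tt ; neg∈ˢ = λ _ → tt }

    fixed-subring : ∀ φ → Subring (λ x → ⟪ φ ⟫ x ≡ x)
    fixed-subring φ = record
      { 0∈ˢ = 0-hom φ ; 1∈ˢ = 1-hom φ
      ; +∈ˢ = λ {x} {y} p q → +-hom φ x y ∙ (cong₂ _+_ p q)
      ; *∈ˢ = λ {x} {y} p q → *-hom φ x y ∙ (cong₂ _*_ p q)
      ; neg∈ˢ = λ {x} p → neg-hom φ x ∙ (cong -_ p) }

    -- Each quadratic step of the tower has an anti-invariant element that is a unit of R: I between
    -- the real field and ℚ(z₀), then z (j + 1). Such an element cancels, so squarefreeness of ϖ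
    -- lifts from the bottom to K.
    separable : (∀ {y} → R y → Fixed 0 y → Real y → ϖ ∣ᴿ y * y → ϖ ∣ᴿ y) → Separable ϖ
    separable base {y} Ry d = tower J ℕ.≤-refl Ry (G-top y) d
      where
      tower : ∀ j → j ℕ.≤ J → ∀ {y} → R y → Fixed j y → ϖ ∣ᴿ y * y → ϖ ∣ᴿ y
      tower zero _ {y} Ry fy d =
        descend conj (Fixed 0) (fixed-subring g) (ι-hom g ½) (λ {x} fx → G-conj 0 x ∙ (cong _*̄ fx)) R-conj
        ϖ-real
        I (R-^ (quarterOf shape) R-ζ) (G-I 0) conj-I
          (Unit-cancel (unitary⇒Unit (R-^ (quarterOf shape) R-ζ) (ζ^-unitary (quarterOf shape)))) base Ry fy
          (conj-involutive y) d
      tower (suc j) j<J {y} Ry fy d =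
        descend (G j) (λ _ → ⊤) ⊤-subring tt (λ _ → tt) (G-R j) (ϖ-Fixed j) (z (suc j)) (R-z (suc j)) tt
        (G-neg j j<J)
        (Unit-cancel (unitary⇒Unit (R-z (suc j)) (z-unitary (suc j))))
          (λ Ry _ fy d → tower j (ℕ.<⇒≤ j<J) Ry fy d) Ry tt fy d

  abs-square : ∀ a → num a * num a ≡ nat (ℤ.∣ a ∣ ℕ.* ℤ.∣ a ∣)
  abs-square a = sym (num-* a a) ∙ cong num (square-abs a)

  abs-∣ : ∀ {p} a → p ℕ∣.∣ ℤ.∣ a ∣ → ∃ λ b → a ≡ b ℤ.* ℤ.+ p
  abs-∣ {p} (ℤ.+ n) (ℕ∣.divides q eq) = ℤ.+ q , cong (ℤ.+_) eq ∙ ℤ.pos-* q p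
  abs-∣ {p} -[1+ n ] (ℕ∣.divides q eq) = ℤ.- ℤ.+ q , cong (λ k → ℤ.- ℤ.+ k) eq ∙ (cong ℤ.-_ (ℤ.pos-* q p))
    ∙ ℤ.neg-distribˡ-* (ℤ.+ q) (ℤ.+ p)

  rational-R : ∀ {q} → R (ι q) → IsDyadic q
  rational-R Rq = In-ι⁻¹ (0∈ dyadic-subring) Rq

  rational-separable : ∀ {p} → IsPrime p → p ≢ 2 → ∀ {q} → IsDyadic q → nat p ∣ᴿ ι q * ι q → nat p ∣ᴿ ι q
  rational-separable {p} pp p≢2 {q} dq d = go (dyadic⇒ {q} dq)
    where
    go : (∃ λ k → IsInt (2^ k ℚ.* q)) → nat p ∣ᴿ ι q
    go (k , a , eq) = Unit-cancel {u = 2# ^ k}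
      (R-^ k (R-nat 2) , h ^ k , R-^ k R-h , sym (^-distrib-* 2# h k) ∙ cong (_^ k) (*-comm 2# h ∙ h*2)
      ∙ 1^k≡1 k) (R-ι dq)
       (∣ᴿ-≡ (sym a≡) (divide (abs-∣ a p∣a)))
      where
      a≡ : 2# ^ k * ι q ≡ num a
      a≡ = cong (_* ι q) (2^≡ k) ∙ sym (ι-* (2^ k) q) ∙ cong ι eq ∙ sym (num≡ι a)
      p∣a² : p ℕ∣.∣ ℤ.∣ a ∣ ℕ.* ℤ.∣ a ∣
      p∣a² = nat-∣ (odd-prime pp p≢2)
        (∣ᴿ-≡ (solve 2 (λ t q → (t :* t) :* (q :* q) := (t :* q) :* (t :* q)) refl (2# ^ k) (ι q)
        ∙ (cong₂ _*_ a≡ a≡) ∙ abs-square a)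
        (∣ᴿ-*ʳ (2# ^ k * 2# ^ k) (R-* (R-^ k (R-nat 2)) (R-^ k (R-nat 2))) d))
      p∣a : p ℕ∣.∣ ℤ.∣ a ∣
      p∣a = Sum.[ (λ x → x) , (λ x → x) ]′ (euclidsLemma ℤ.∣ a ∣ ℤ.∣ a ∣ pp p∣a²)
      divide : (∃ λ b → a ≡ b ℤ.* ℤ.+ p) → nat p ∣ᴿ num a
      divide (b , refl) = num b , R-num b , num-* b (ℤ.+ p) ∙ (*-comm _ _)

  -- The odd primes unramified in K.
  Good : ℕ → Set
  Good p = IsPrime p × p ≢ 2 × (p ≡ 3 → c ≡ 0ℚ)

  nat-separable : ∀ {p} → Good p → Separable (nat p)
  nat-separable {p} (pp , p≢2 , p3) = separable (base shape)
    where
    open Separability (nat p) (num-hom g (ℤ.+ p)) (num-real (ℤ.+ p))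
    rational : ∀ {y} → R y → (∃ λ q → y ≡ ι q) → nat p ∣ᴿ y * y → nat p ∣ᴿ y
    rational Ry (q , refl) d = rational-separable pp p≢2 (rational-R Ry) d
    base : Shape c m J → ∀ {y} → R y → Fixed 0 y → Real y → nat p ∣ᴿ y * y → nat p ∣ᴿ y
    base (gaussian c≡ m≡) Ry fy ry d = rational Ry (F₀-gaussian c≡ m≡ fy ry) d
    base (eisenstein c≡ m≡) Ry fy ry d = descend τ V V-subring (ι-hom g ½ , ι-hom conj ½)
        (λ {x} (fx , rx) → sym (τ-g x) ∙ cong ⟪ τ ⟫ fx , sym (τ-conj x) ∙ cong ⟪ τ ⟫ rx) τ-R (num-hom τ (ℤ.+ p))
        √3 R-√3 (√3-fixed 0 , √3-real) τ-√3
        -- √3 is not a unit of R, but √3 · √3 = 3 is prime to p, so it can still be cancelled.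
        (λ {y} Ry d → coprime-cancel ∣ᴿ-refl (prime∤⇒coprime pp (prime≢⇒∤ pp prime[3] p≢3)) Ry
          (∣ᴿ-≡ (sym (*-assoc √3 √3 y) ∙ cong (_* y) √3²) (∣ᴿ-*ʳ √3 R-√3 d)))
        (λ Ry (fy , ry) τy d → rational Ry (τ-rational fy ry τy) d) Ry (fy , ry) (τ-involutive fy ry) d
      where
      open Eisenstein c≡ m≡
      R-√3 : R √3
      R-√3 = R-+ (R-z 0) (R-conj (R-z 0))
      p≢3 : p ≢ 3
      p≢3 eq with () ← sym c≡ ∙ p3 eq
      V : K → Set
      V x = Fixed 0 x × Real x
      V-subring : Subring V
      V-subring = record
        { 0∈ˢ = 0-hom g , 0-hom conj ; 1∈ˢ = 1-hom g , 1-hom conj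
        ; +∈ˢ = λ (p , p') (q , q') → Subring.+∈ˢ (fixed-subring g) p q , Subring.+∈ˢ (fixed-subring conj) p' q'
        ; *∈ˢ = λ (p , p') (q , q') → Subring.*∈ˢ (fixed-subring g) p q , Subring.*∈ˢ (fixed-subring conj) p' q'
        ; neg∈ˢ = λ (p , p') → Subring.neg∈ˢ (fixed-subring g) p , Subring.neg∈ˢ (fixed-subring conj) p' }

  ≢0-cancel : ∀ {a x y} → a ≢ 0# → a * x ≡ a * y → x ≡ y
  ≢0-cancel {a} {x} {y} a≢0 eq = Sum.[ (λ e → ⊥-elim (a≢0 e)) ,
    (λ e → solve 2 (λ a b → a := (a :- b) :+ b) refl x y ∙ cong (_+ y) e ∙ +-identityˡ y) ]′
    (domain (solve 3 (λ w a b → w :* (a :- b) := w :* a :- w :* b) refl a x y ∙ cong (_- a * y) eq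
      ∙ (-‿inverseʳ _)))

  -- The class of κ modulo squares of K contains a unit of R. Units themselves are not preserved by
  -- the descent, this property is.
  UnitClass : K → Set
  UnitClass κ = ∃ λ x → x ≢ 0# × Unit (κ * (x * x))

  -- No element of odd ϖ-valuation is a unit up to squares.
  ramification : ∀ {ϖ ν} p → ϖ ≢ 0# → R ϖ → R ν → Separable ϖ → (∀ {y} → R y → ϖ ∣ᴿ ν * y → ϖ ∣ᴿ y) →
    IsPrime p → p ≢ 2 → (∀ k → nat p ^ k ∣ᴿ ϖ ^ (2 ℕ.* k)) → ¬ UnitClass (ϖ * ν)
  ramification {ϖ} {ν} p ϖ≢0 Rϖ Rν sep cancel-ν pp p≢2 p^k∣ (x , x≢0 , Uκ) = go (clear-K x)
    where
    u = ϖ * ν * (x * x)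
    Ru : R u
    Ru = proj₁ Uκ
    -- In ϖ ν y² = v² u the factor u is a unit, so ϖ divides v² and hence v; then it divides ν y²
    -- and hence y. Division by ϖ² gives the same equation for the quotients.
    step : ∀ {v y} → R v → R y → ϖ * ν * (y * y) ≡ v * v * u → ∃ λ v' → R v' × v ≡ ϖ * v' × ∃ λ y' →
      R y' × ϖ * ν * (y' * y') ≡ v' * v' * u
    step {v} {y} Rv Ry eq = step₂
      (sep Rv (Unit-cancel Uκ (R-* Rv Rv)
      (∣ᴿ-≡ (sym (*-assoc ϖ ν (y * y)) ∙ eq ∙ (*-comm _ u)) (∣ᴿ-x* (R-* Rν (R-* Ry Ry))))))
      where
      step₂ : ϖ ∣ᴿ v → ∃ λ v' → R v' × v ≡ ϖ * v' × ∃ λ y' → R y' × ϖ * ν * (y' * y') ≡ v' * v' * u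
      step₂ (v' , Rv' , v≡) = v' , Rv' , v≡ ,
        step₃ (sep Ry (cancel-ν (R-* Ry Ry) (∣ᴿ-≡ (sym eq₁) (∣ᴿ-x* (R-* (R-* Rv' Rv') Ru)))))
        where
        eq₁ : ν * (y * y) ≡ ϖ * (v' * v' * u)
        eq₁ = ≢0-cancel ϖ≢0 (sym (*-assoc ϖ ν (y * y)) ∙ eq ∙ cong (λ e → e * e * u) v≡
          ∙ solve 3 (λ w v u → (w :* v) :* (w :* v) :* u := w :* (w :* (v :* v :* u))) refl ϖ v' u)
        step₃ : ϖ ∣ᴿ y → ∃ λ y' → R y' × ϖ * ν * (y' * y') ≡ v' * v' * u
        step₃ (y' , Ry' , y≡) = y' , Ry' ,
          ≢0-cancel ϖ≢0 (solve 3 (λ w n y → w :* (w :* n :* (y :* y)) := n :* ((w :* y) :* (w :* y))) refl ϖ ν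
          y' ∙ cong (λ e → ν * (e * e)) (sym y≡) ∙ eq₁)
    infinite : ∀ k {v y} → R v → R y → ϖ * ν * (y * y) ≡ v * v * u → ϖ ^ k ∣ᴿ v
    infinite zero {v} Rv _ _ = v , Rv , sym (*-identityˡ v)
    infinite (suc k) {v} Rv Ry eq = go (step Rv Ry eq)
      where
      go : (∃ λ v' → R v' × v ≡ ϖ * v' × ∃ λ y' → R y' × ϖ * ν * (y' * y') ≡ v' * v' * u) → ϖ ^ suc k ∣ᴿ v
      go (v' , Rv' , v≡ , y' , Ry' , eq') = ∣ᴿ-≡ (sym v≡) (∣ᴿ-* ∣ᴿ-refl (infinite k Rv' Ry' eq'))
    -- Infinite descent starts from v = n and y = n x. After 2 n rounds ϖ²ⁿ divides n, so pⁿ divides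
    -- n, against n < pⁿ.
    go : (∃ λ n → 0 ℕ.< n × O (nat n * x)) → ⊥
    go (n , n>0 , Oy) = ℕ.<⇒≱ (n<p^n n)
      (ℕ∣.∣⇒≤ {{ℕ.>-nonZero n>0}}
      (nat-∣ (odd-^ n (odd-prime pp p≢2))
      (subst (_∣ᴿ nat n) (sym (nat-^ p n)) (∣ᴿ-trans (p^k∣ n) (infinite (2 ℕ.* n) (R-nat n) (O⇒R Oy)
        (solve 4 (λ w v n x → w :* v :* ((n :* x) :* (n :* x)) := n :* n :* (w :* v :* (x :* x))) refl ϖ ν
          (nat n) x))))))
      where
      n<p^n : ∀ n → n ℕ.< p ℕ.^ n
      n<p^n n = ℕ.<-≤-trans (n<2^n n) (ℕ.^-monoˡ-≤ n (ℕ.nonTrivial⇒n>1 p {{Primality.prime⇒nonTrivial pp}}))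

  nat≢0 : ∀ {n} → 0 ℕ.< n → nat n ≢ 0#
  nat≢0 n>0 eq = 1≢0 (nat-cancel n>0 (*-identityʳ _ ∙ eq))

  prime>0 : ∀ {p} → IsPrime p → 0 ℕ.< p
  prime>0 {p} pp = ℕ.>-nonZero⁻¹ p {{prime⇒nonZero pp}}

  module Ramified3 (c≡ : c ≡ 1ℚ) (m≡ : m ≡ 2 ℕ.^ J ℕ.+ 2 ℕ.^ J) where
    open Eisenstein c≡ m≡ public

    R-√3 : R √3
    R-√3 = R-+ (R-z 0) (R-conj (R-z 0))

    √3≢0 : √3 ≢ 0#
    √3≢0 eq = nat≢0 {3} ℕ.z<s (sym √3² ∙ cong (_* √3) eq ∙ zeroˡ √3)

    √3∣3 : √3 ∣ᴿ nat 3
    √3∣3 = √3 , R-√3 , sym √3²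

    -- √3 = 2 z₀ - z₀³, and z₀³ belongs to the power basis of K. This coordinate lets the dyadic
    -- number b be read off from b √3.
    coef-√3 : coef (2 ℕ.^ J ℕ.* 3) √3 ≡ ℚ.- 1ℚ
    coef-√3 = cong (coef k3) (√3≡
      ∙ (cong₂ _+_ refl ((cong -_ (^-assocʳ ζ k 3)) ∙ solve 1 (λ x → :- x := (:- :nat 1) :* x) refl (ζ ^ k3)
      ∙ cong (_* ζ ^ k3) (sym (ι-neg 1ℚ ∙ (cong -_ ι-1))))))
      ∙ (coef-+ k3 _ _) ∙ (cong₂ ℚ._+_
        (coef-ι* k3 (int (ℤ.+ 2)) (ζ ^ k) ∙ cong (int (ℤ.+ 2) ℚ.*_) (coef-ζ^ k3 k<2m ∙ at-monomial-≢ k3 k k3≢k))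
        (coef-ι* k3 (ℚ.- 1ℚ) (ζ ^ k3) ∙ cong ((ℚ.- 1ℚ) ℚ.*_) (coef-ζ^ k3 k3<2m ∙ at-monomial-≡ k3))) ∙ refl
      where
      k = 2 ℕ.^ J
      k3 = k ℕ.* 3
      k>0 : 0 ℕ.< k
      k>0 = ℕ.m^n>0 2 J
      2m≡ : m ℕ.+ m ≡ k ℕ.* 4
      2m≡ = (cong₂ ℕ._+_ m≡ m≡) ∙ ℕS.solve 1 (λ k → (k ℕS.:+ k) ℕS.:+ (k ℕS.:+ k) ℕS.:= k ℕS.:* ℕS.con 4) refl k
      k3<2m : k3 ℕ.< m ℕ.+ m
      k3<2m = subst (k3 ℕ.<_) (sym 2m≡) (ℕ.*-monoʳ-< k {{ℕ.>-nonZero k>0}} (ℕ.n<1+n 3))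
      k<k3 : k ℕ.< k3
      k<k3 = subst (ℕ._< k3) (ℕ.*-identityʳ k) (ℕ.*-monoʳ-< k {{ℕ.>-nonZero k>0}} (ℕ.s≤s (ℕ.s≤s ℕ.z≤n)))
      k<2m : k ℕ.< m ℕ.+ m
      k<2m = ℕ.<-trans k<k3 k3<2m
      k3≢k : k3 ≢ k
      k3≢k = ℕ.>⇒≢ k<k3

    -- For y = a + b √3 the numbers a and b are dyadic, and √3 ∣ y² gives √3 ∣ a². Then 3 divides
    -- a⁴, so 3 divides a by the rational case, and √3 divides y.
    √3-separable : Separable √3
    √3-separable = separable base
      where
      open Separability √3 (√3-fixed 0) √3-real
      base : ∀ {y} → R y → Fixed 0 y → Real y → √3 ∣ᴿ y * y → √3 ∣ᴿ y
      base {y} Ry fy ry d = go (F₀-eisenstein fy ry)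
        where
        go : (∃ λ a → ∃ λ b → y ≡ ι a + ι b * √3) → √3 ∣ᴿ y
        go (a , b , y≡) = ∣ᴿ-≡ (sym y≡) (∣ᴿ-+ √3∣a (∣ᴿ-*ʳ (ι b) (R-ι db) ∣ᴿ-refl))
          where
          τy : ⟪ τ ⟫ y ≡ ι a - ι b * √3
          τy = cong ⟪ τ ⟫ y≡ ∙ τ-F₀ a b
          Rτ : R (⟪ τ ⟫ y)
          Rτ = τ-R Ry
          double : ∀ x → h * (x + x) ≡ x
          double x = solve 2 (λ h a → h :* (a :+ a) := (h :* :nat 2) :* a) refl h x ∙ cong (_* x) h*2
            ∙ *-identityˡ x
          Ra : R (ι a)
          Ra = subst R (cong (h *_)
            ((cong₂ _+_ y≡ τy) ∙ solve 2 (λ a s → (a :+ s) :+ (a :- s) := a :+ a) refl (ι a) (ι b * √3))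
            ∙ (double _)) (R-* R-h (R-+ Ry Rτ))
          Rb : R (ι b * √3)
          Rb = subst R (cong (h *_)
            ((cong₂ _-_ y≡ τy) ∙ solve 2 (λ a s → (a :+ s) :- (a :- s) := s :+ s) refl (ι a) (ι b * √3))
            ∙ (double _)) (R-* R-h (R-− Ry Rτ))
          db : IsDyadic b
          db = subst IsDyadic ((cong ℚ.-_
            (coef-ι* k3 b √3 ∙ cong (b ℚ.*_) coef-√3 ∙ sym (ℚ.neg-distribʳ-* b 1ℚ)
            ∙ (cong ℚ.-_ (ℚ.*-identityʳ b)))) ∙ neg-neg b)
            (neg∈ dyadic-subring {coef (2 ℕ.^ J ℕ.* 3) (ι b * √3)} (at-all k3 (0∈ dyadic-subring) Rb))
            where
            k3 = 2 ℕ.^ J ℕ.* 3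
            neg-neg : ∀ q → ℚ.- (ℚ.- q) ≡ q
            neg-neg q = ℚS.solve 1 (λ q → ℚS.:- (ℚS.:- q) ℚS.:= q) refl q
          da : IsDyadic a
          da = rational-R Ra
          √3∣a² : √3 ∣ᴿ ι a * ι a
          √3∣a² = ∣ᴿ-≡ (cong (λ e → e * e + - ((2# * ι a * ι b + ι b * ι b * √3) * √3)) y≡
            ∙ solve 3 (λ a b s → (a :+ b :* s) :* (a :+ b :* s) :+ :- ((:nat 2 :* a :* b :+ b :* b :* s) :* s)
            := a :* a) refl (ι a) (ι b) √3)
            (∣ᴿ-+ d (∣ᴿ-neg (∣ᴿ-*ʳ (2# * ι a * ι b + ι b * ι b * √3)
              (R-+ (R-* (R-* (R-nat 2) Ra) (R-ι db)) (R-* (R-* (R-ι db) (R-ι db)) R-√3)) ∣ᴿ-refl)))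
          3∣a² : nat 3 ∣ᴿ ι a * ι a
          3∣a² = ∣ᴿ-≡ (ι-* a a) (rational-separable prime[3] (λ ()) (*∈ dyadic-subring {a} {a} da da)
            (∣ᴿ-≡ (sym (cong₂ _*_ (ι-* a a) (ι-* a a)))
            (subst (_∣ᴿ (ι a * ι a) * (ι a * ι a)) √3² (∣ᴿ-* √3∣a² √3∣a²))))
          √3∣a : √3 ∣ᴿ ι a
          √3∣a = ∣ᴿ-trans √3∣3 (rational-separable prime[3] (λ ()) da 3∣a²)

  x^2k : ∀ x k → x ^ (2 ℕ.* k) ≡ (x * x) ^ k
  x^2k x k = sym (^-assocʳ x 2 k) ∙ cong (_^ k) (^2 x)

  good-ramification : ∀ {p k} → Good p → UnitClass (nat p * nat k) → p ℕ∣.∣ k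
  good-ramification {p} {k} good@(pp , p≢2 , _) U with p ℕ∣.∣? k
  ... | yes d = d
  ... | no p∤k = ⊥-elim (ramification p (nat≢0 (prime>0 pp)) (R-nat p) (R-nat k) (nat-separable good)
    (coprime-cancel ∣ᴿ-refl (prime∤⇒coprime pp p∤k)) pp p≢2
      (λ k → ∣ᴿ-≡ (sym (x^2k (nat p) k ∙ ^-distrib-* (nat p) (nat p) k)) (∣ᴿ-x* (R-^ k (R-nat p)))) U)

  data PrimeKind (p : ℕ) : Set where
    is2  : p ≡ 2 → PrimeKind p
    is3  : p ≡ 3 → c ≡ 1ℚ → m ≡ 2 ℕ.^ J ℕ.+ 2 ℕ.^ J → PrimeKind p
    good : Good p → PrimeKind p

  kind : ∀ {p} → IsPrime p → PrimeKind p
  kind {p} pp = go (p ℕ.≟ 2) (p ℕ.≟ 3) shape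
    where
    go : Dec (p ≡ 2) → Dec (p ≡ 3) → Shape c m J → PrimeKind p
    go (yes p≡2) _ _ = is2 p≡2
    go (no p≢2) (no p≢3) _ = good (pp , p≢2 , λ p≡3 → ⊥-elim (p≢3 p≡3))
    go (no p≢2) (yes p≡3) (gaussian c≡ _) = good (pp , p≢2 , λ _ → c≡)
    go (no p≢2) (yes p≡3) (eisenstein c≡ m≡) = is3 p≡3 c≡ m≡

  -- 2 is a unit and unramified primes are squarefree; when 3 ramifies, a factor √3 is extracted
  -- from y twice.
  ∣ᴿ-square : ∀ {p} → IsPrime p → ∀ {y} → R y → nat p * nat p ∣ᴿ y * y → nat p ∣ᴿ y
  ∣ᴿ-square {p} pp {y} Ry d = go (kind pp)
    where
    go : PrimeKind p → nat p ∣ᴿ y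
    go (is2 refl) = h * y , R-* R-h Ry , sym (*-identityˡ y) ∙ cong (_* y) (sym h*2 ∙ *-comm h 2#)
      ∙ *-assoc 2# h y
    go (good gp) = nat-separable gp Ry (∣ᴿ-trans (∣ᴿ-x* (R-nat p)) d)
    go (is3 refl c≡ m≡) = through (√3-separable Ry (∣ᴿ-trans (∣ᴿ-trans √3∣3 (∣ᴿ-x* (R-nat 3))) d))
      where
      open Ramified3 c≡ m≡
      through : √3 ∣ᴿ y → nat 3 ∣ᴿ y
      through (w , Rw , y≡) = ∣ᴿ-≡ (sym y≡)
        (subst (_∣ᴿ √3 * w) √3² (∣ᴿ-* ∣ᴿ-refl (√3-separable Rw (quotient d))))
        where
        quotient : nat 3 * nat 3 ∣ᴿ y * y → √3 ∣ᴿ w * w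
        quotient (v , Rv , y²) = √3 * v , R-* R-√3 Rv ,
          ≢0-cancel (nat≢0 {3} ℕ.z<s)
          (cong (_* (w * w)) (sym √3²)
          ∙ solve 2 (λ s w → (s :* s) :* (w :* w) := (s :* w) :* (s :* w)) refl √3 w
          ∙ (cong₂ _*_ (sym y≡) (sym y≡)) ∙ y² ∙ cong (λ e → nat 3 * e * v) (sym √3²)
            ∙ solve 3 (λ t s v → t :* (s :* s) :* v := t :* (s :* (s :* v))) refl (nat 3) √3 v)

  integral-quotient : ∀ {ps} → All IsPrime ps → ∀ {y u} → R y → R u →
    y * y ≡ nat (product ps) * nat (product ps) * u → nat (product ps) ∣ᴿ y
  integral-quotient [] {y} Ry _ _ = y , Ry , sym (*-identityˡ y)
  integral-quotient {p ∷ ps} (pp ∷ pps) {y} {u} Ry Ru eq =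
    go (∣ᴿ-square pp Ry (n * n * u , R-* (R-* (R-nat (product ps)) (R-nat (product ps))) Ru , eq
    ∙ cong (λ e → e * e * u) (nat-* p (product ps))
       ∙ solve 3 (λ p n u → (p :* n) :* (p :* n) :* u := (p :* p) :* (n :* n :* u)) refl (nat p) n u))
    where
    n = nat (product ps)
    go : nat p ∣ᴿ y → nat (p ℕ.* product ps) ∣ᴿ y
    go (w , Rw , y≡) = subst (_∣ᴿ y) (sym (nat-* p (product ps)))
      (∣ᴿ-≡ (sym y≡) (∣ᴿ-* ∣ᴿ-refl (integral-quotient pps Rw Ru (≢0-cancel p≢0 (≢0-cancel p≢0
        (solve 2 (λ p w → p :* (p :* (w :* w)) := (p :* w) :* (p :* w)) refl (nat p) w
          ∙ (cong₂ _*_ (sym y≡) (sym y≡)) ∙ eq ∙ cong (λ e → e * e * u) (nat-* p (product ps))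
          ∙ solve 3 (λ p n u → (p :* n) :* (p :* n) :* u := p :* (p :* (n :* n :* u))) refl (nat p) n u))))))
      where
      p≢0 = nat≢0 (prime>0 pp)

  -- The case of square roots in the statement that R is integrally closed: if n f lies in R, the
  -- primes of n are divided out of n f one at a time, using that (n f)² is divisible by n².
  square-absegral : ∀ {f} → R (f * f) → R f
  square-absegral {f} Rff = go (clear-K f)
    where
    go : (∃ λ n → 0 ℕ.< n × O (nat n * f)) → R f
    go (n , n>0 , Oy) = finish
      (integral-quotient (PrimeFactorisation.factorsPrime F) (O⇒R Oy) Rff
      (subst (λ k → (nat n * f) * (nat n * f) ≡ nat k * nat k * (f * f)) isF
        (solve 2 (λ n f → (n :* f) :* (n :* f) := n :* n :* (f :* f)) refl (nat n) f)))
      where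
      instance nz = ℕ.>-nonZero n>0
      F = factorise n
      isF : n ≡ product (PrimeFactorisation.factors F)
      isF = PrimeFactorisation.isFactorisation F
      finish : nat (product (PrimeFactorisation.factors F)) ∣ᴿ nat n * f → R f
      finish (w , Rw , eq) = subst R (sym (≢0-cancel (nat≢0 n>0) (eq ∙ cong (λ k → nat k * w) (sym isF)))) Rw

-- Weber's theorem: arithmetic modulo 3, sums of norms and rational classes.

square-mod-3 : ∀ x → 3 ℕ∣.∣ x ⊎ ∃ λ k → x ℕ.* x ≡ 1 ℕ.+ 3 ℕ.* k
square-mod-3 0 = inj₁ (3 ℕ∣.∣0)
square-mod-3 1 = inj₂ (0 , refl)
square-mod-3 2 = inj₂ (1 , refl)
square-mod-3 (suc (suc (suc x))) with square-mod-3 x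
... | inj₁ d = inj₁ (ℕ∣.∣m∣n⇒∣m+n (ℕ∣.∣-refl {3}) d)
... | inj₂ (k , eq) = inj₂
  (k ℕ.+ 2 ℕ.* x ℕ.+ 3 , ℕS.solve 1
  (λ x → (ℕS.con 3 ℕS.:+ x) ℕS.:* (ℕS.con 3 ℕS.:+ x) ℕS.:= x ℕS.:* x ℕS.:+ ℕS.con 3 ℕS.:*
  (ℕS.con 2 ℕS.:* x ℕS.:+ ℕS.con 3)) refl x
   ∙ cong (ℕ._+ 3 ℕ.* (2 ℕ.* x ℕ.+ 3)) eq
     ∙ ℕS.solve 2 (λ k x → ℕS.con 1 ℕS.:+ ℕS.con 3 ℕS.:* k ℕS.:+ ℕS.con 3 ℕS.:*
     (ℕS.con 2 ℕS.:* x ℕS.:+ ℕS.con 3) ℕS.:= ℕS.con 1 ℕS.:+ ℕS.con 3 ℕS.:*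
     (k ℕS.:+ ℕS.con 2 ℕS.:* x ℕS.:+ ℕS.con 3)) refl k x)

3∣square⇒3∣ : ∀ x → 3 ℕ∣.∣ x ℕ.* x → 3 ℕ∣.∣ x
3∣square⇒3∣ x d = Sum.[ (λ e → e) , (λ e → e) ]′ (euclidsLemma x x prime[3] d)

1≢2-mod-3 : ∀ a b → 1 ℕ.+ 3 ℕ.* a ≢ 2 ℕ.+ 3 ℕ.* b
1≢2-mod-3 a b eq = bad (ℕ∣.∣m+n∣m⇒∣n (subst (3 ℕ∣.∣_) (ℕ.suc-injective eq ∙ ℕ.+-comm 1 (3 ℕ.* b)) (ℕ∣.m∣m*n a))
  (ℕ∣.m∣m*n b))
  where
  bad : ¬ 3 ℕ∣.∣ 1
  bad d with ℕ∣.∣1⇒≡1 d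
  ... | ()

-- 2 is not a square modulo 3, and α² would be congruent to 2 t².
twice-square≢norm : ∀ α β t → ¬ 3 ℕ∣.∣ α → 2 ℕ.* (t ℕ.* t) ℕ.+ 3 ℕ.* (β ℕ.* β) ≢ α ℕ.* α
twice-square≢norm α β t 3∤α eq with square-mod-3 α | square-mod-3 t
... | inj₁ d | _ = 3∤α d
... | inj₂ _ | inj₁ d = 3∤α
  (3∣square⇒3∣ α (subst (3 ℕ∣.∣_) eq (ℕ∣.∣m∣n⇒∣m+n (ℕ∣.∣n⇒∣m*n 2 (ℕ∣.∣n⇒∣m*n t d)) (ℕ∣.m∣m*n (β ℕ.* β)))))
... | inj₂ (k , α²) | inj₂ (l , t²) =
  1≢2-mod-3 k (2 ℕ.* l ℕ.+ β ℕ.* β) (sym α² ∙ sym eq ∙ cong (λ e → 2 ℕ.* e ℕ.+ 3 ℕ.* (β ℕ.* β)) t²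
    ∙ ℕS.solve 2 (λ l b → ℕS.con 2 ℕS.:* (ℕS.con 1 ℕS.:+ ℕS.con 3 ℕS.:* l) ℕS.:+ ℕS.con 3 ℕS.:* b ℕS.:= ℕS.con 2
      ℕS.:+ ℕS.con 3 ℕS.:* (ℕS.con 2 ℕS.:* l ℕS.:+ b)) refl l (β ℕ.* β))

module WeberTheorem (C : Cyclotomic) where
  open Ramification C public

  SumOfNorms : K → Set
  SumOfNorms κ = ∃ λ x → ∃ λ y → κ ≡ x * x *̄ + y * y *̄

  -- Multiplicativity of the reduced norm of quaternions, Euler's four-square identity in complex
  -- form.
  Sum-* : ∀ {κ κ'} → SumOfNorms κ → SumOfNorms κ' → SumOfNorms (κ * κ')
  Sum-* (a , b , refl) (x , y , refl) = a * x + b * y , a * y *̄ - b * x *̄ ,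
    sym (cong₂ (λ p q → (a * x + b * y) * p + (a * y *̄ - b * x *̄) * q)
      (+-hom conj _ _ ∙ (cong₂ _+_ (*-hom conj a x) (*-hom conj b y)))
      (−-hom conj _ _ ∙ (cong₂ _-_ (*-hom conj a (y *̄) ∙ cong (a *̄ *_) (conj-involutive y))
        (*-hom conj b (x *̄) ∙ cong (b *̄ *_) (conj-involutive x))))
      ∙ solve 8 (λ a b x y a' b' x' y' →
        (a :* x :+ b :* y) :* (a' :* x' :+ b' :* y') :+ (a :* y' :- b :* x') :* (a' :* y :- b' :* x) :=
        (a :* a' :+ b :* b') :* (x :* x' :+ y :* y')) refl a b x y (a *̄) (b *̄) (x *̄) (y *̄))

  Sum-norm : ∀ x → SumOfNorms (x * x *̄)
  Sum-norm x = x , 0# , sym (cong (x * x *̄ +_) (zeroˡ _) ∙ (+-identityʳ _))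

  Sum-square : ∀ {x} → Real x → SumOfNorms (x * x)
  Sum-square {x} rx = subst SumOfNorms (cong (x *_) rx) (Sum-norm x)

  Sum-Endo : ∀ φ → (∀ x → ⟪ φ ⟫ (x *̄) ≡ (⟪ φ ⟫ x) *̄) → ∀ {κ} → SumOfNorms κ → SumOfNorms (⟪ φ ⟫ κ)
  Sum-Endo φ φ-conj (x , y , refl) = ⟪ φ ⟫ x , ⟪ φ ⟫ y , (+-hom φ _ _)
    ∙ (cong₂ _+_ (*-hom φ x _ ∙ cong (⟪ φ ⟫ x *_) (φ-conj x)) (*-hom φ y _ ∙ cong (⟪ φ ⟫ y *_) (φ-conj y)))

  Endo-≢0 : ∀ φ {x} → x ≢ 0# → ⟪ φ ⟫ x ≢ 0#
  Endo-≢0 φ {x} x≢0 eq = go (invertible x≢0)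
    where
    go : Invertible x → ⊥
    go (y , xy) = 1≢0 (sym (1-hom φ) ∙ cong ⟪ φ ⟫ (sym xy) ∙ *-hom φ x y ∙ cong (_* ⟪ φ ⟫ y) eq ∙ (zeroˡ _))

  UC-* : ∀ {κ κ'} → UnitClass κ → UnitClass κ' → UnitClass (κ * κ')
  UC-* {κ} {κ'} (x , x≢0 , U) (y , y≢0 , V) = x * y , ≢0-* x≢0 y≢0 ,
    subst Unit (solve 4 (λ k k' x y → (k :* (x :* x)) :* (k' :* (y :* y)) :=
    (k :* k') :* ((x :* y) :* (x :* y))) refl κ κ' x y) (Unit-* U V)

  UC-Endo : ∀ φ → (∀ {x} → R x → R (⟪ φ ⟫ x)) → ∀ {κ} → UnitClass κ → UnitClass (⟪ φ ⟫ κ)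
  UC-Endo φ Rφ {κ} (x , x≢0 , (RU , v , Rv , eq)) = ⟪ φ ⟫ x , Endo-≢0 φ x≢0 ,
    subst Unit (*-hom φ κ _ ∙ cong (⟪ φ ⟫ κ *_) (*-hom φ x x))
    (Rφ RU , ⟪ φ ⟫ v , Rφ Rv , sym (*-hom φ _ v) ∙ cong ⟪ φ ⟫ eq ∙ 1-hom φ)

  UC-square : ∀ {s} → s ≢ 0# → UnitClass (s * s)
  UC-square {s} s≢0 = go (invertible s≢0)
    where
    go : Invertible s → UnitClass (s * s)
    go (t , st) = t , (λ { refl → 1≢0 (sym st ∙ zeroʳ s) }) ,
      subst Unit (sym (solve 2 (λ s t → (s :* s) :* (t :* t) := (s :* t) :* (s :* t)) refl s t
      ∙ (cong₂ _*_ st st) ∙ *-identityˡ 1#))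
      (R-1 , 1# , R-1 , *-identityˡ 1#)

  UC-absorb : ∀ {κ s} → s ≢ 0# → UnitClass (κ * (s * s)) → UnitClass κ
  UC-absorb {κ} {s} s≢0 (x , x≢0 , U) = s * x , ≢0-* s≢0 x≢0 ,
    subst Unit (solve 3 (λ k s x → (k :* (s :* s)) :* (x :* x) := k :* ((s :* x) :* (s :* x))) refl κ s x) U

  record Positive (κ : K) : Set where
    constructor positive
    field
      ≢0   : κ ≢ 0#
      sum  : SumOfNorms κ
      unit : UnitClass κ

  Positive-* : ∀ {κ κ'} → Positive κ → Positive κ' → Positive (κ * κ')
  Positive-* (positive n s u) (positive n' s' u') = positive (≢0-* n n') (Sum-* s s') (UC-* u u')

  Positive-Endo : ∀ φ → (∀ x → ⟪ φ ⟫ (x *̄) ≡ (⟪ φ ⟫ x) *̄) → (∀ {x} → R x → R (⟪ φ ⟫ x)) → ∀ {κ} → Positive κ →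
    Positive (⟪ φ ⟫ κ)
  Positive-Endo φ φ-conj Rφ (positive n s u) = positive (Endo-≢0 φ n) (Sum-Endo φ φ-conj s) (UC-Endo φ Rφ u)

  Positive-square : ∀ {s} → s ≢ 0# → Real s → Positive (s * s)
  Positive-square s≢0 rs = positive (≢0-* s≢0 s≢0) (Sum-square rs) (UC-square s≢0)

  inverse-Real : ∀ {x y} → Real x → x * y ≡ 1# → Real y
  inverse-Real {x} {y} rx eq =
    inverse-unique {x} (cong (_* y *̄) (sym rx) ∙ sym (*-hom conj x y) ∙ (cong _*̄ eq) ∙ 1-hom conj) eq

  inverse-fixed : ∀ φ {x y} → ⟪ φ ⟫ x ≡ x → x * y ≡ 1# → ⟪ φ ⟫ y ≡ y
  inverse-fixed φ {x} {y} fx eq =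
    inverse-unique {x} (cong (_* ⟪ φ ⟫ y) (sym fx) ∙ sym (*-hom φ x y) ∙ cong ⟪ φ ⟫ eq ∙ 1-hom φ) eq

  -- κ' = y²/κ = κ (y/κ)², so κ' differs from κ by the square of a real element.
  Positive-quotient : ∀ {κ κ' y} → Positive κ → Real κ → κ' ≢ 0# → Real y → κ * κ' ≡ y * y → Positive κ'
  Positive-quotient {κ} {κ'} {y} P rκ κ'≢0 ry eq = go (invertible (Positive.≢0 P))
    where
    go : Invertible κ → Positive κ'
    go (t , κt) = subst Positive κ'≡
      (Positive-* P (Positive-square (≢0-* y≢0 t≢0) (*-hom conj y t ∙ (cong₂ _*_ ry (inverse-Real rκ κt)))))
      where
      y≢0 : y ≢ 0#
      y≢0 e = ≢0-* (Positive.≢0 P) κ'≢0 (eq ∙ cong (_* y) e ∙ zeroˡ y)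
      t≢0 : t ≢ 0#
      t≢0 e = 1≢0 (sym κt ∙ cong (κ *_) e ∙ zeroʳ κ)
      κ'≡ : κ * ((y * t) * (y * t)) ≡ κ'
      κ'≡ = solve 3 (λ k y t → k :* ((y :* t) :* (y :* t)) := (y :* y) :* (k :* t :* t)) refl κ y t
        ∙ cong₂ (λ p q → p * (q * t)) (sym eq) κt
        ∙ solve 3 (λ k k' t → (k :* k') :* (:nat 1 :* t) := (k :* t) :* k') refl κ κ' t ∙ cong (_* κ') κt
          ∙ *-identityˡ κ'

  Sq : ℕ → K → Set
  Sq j κ = ∃ λ y → Fixed j y × Real y × κ ≡ y * y

  Sq-* : ∀ j {a b} → Sq j a → Sq j b → Sq j (a * b)
  Sq-* j (x , fx , rx , refl) (y , fy , ry , refl) = x * y , *-hom (G j) x y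
    ∙ (cong₂ _*_ fx fy) , *-hom conj x y
    ∙ (cong₂ _*_ rx ry) , solve 2 (λ x y → (x :* x) :* (y :* y) := (x :* y) :* (x :* y)) refl x y

  Sq-suc : ∀ j {a} → Sq j a → Sq (suc j) a
  Sq-suc j (x , fx , rx , eq) = x , Fixed-suc j fx , rx , eq

  Sq-div : ∀ j {a b} → b ≢ 0# → Sq j (a * b) → Sq j b → Sq j a
  Sq-div j {a} b≢0 (y , fy , ry , eq) (w , fw , rw , refl) = go (invertible λ { refl → b≢0 (zeroˡ 0#) })
    where
    go : Invertible w → Sq j a
    go (t , wt) = y * t , *-hom (G j) y t ∙ (cong₂ _*_ fy (inverse-fixed (G j) fw wt)) , *-hom conj y t
      ∙ (cong₂ _*_ ry (inverse-Real rw wt)) ,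
      sym (solve 2 (λ y t → (y :* t) :* (y :* t) := (y :* y) :* (t :* t)) refl y t ∙ cong (_* (t * t)) (sym eq)
        ∙ solve 3 (λ a w t → (a :* (w :* w)) :* (t :* t) := a :* ((w :* t) :* (w :* t))) refl a w t
        ∙ cong (a *_) ((cong₂ _*_ wt wt) ∙ *-identityˡ 1#) ∙ *-identityʳ a)

  -- Hilbert 90 for a quadratic extension: an element whose norm is a square δ² is, up to squares, the element
  -- κ + φ κ + 2 δ of the smaller field.
  quadratic-descent : ∀ φ {κ δ} → κ ≢ 0# → ⟪ φ ⟫ (⟪ φ ⟫ κ) ≡ κ → ⟪ φ ⟫ δ ≡ δ → κ * ⟪ φ ⟫ κ ≡ δ * δ →
    (V : K → Set) → (∀ {x y} → V x → V y → V (x + y)) → V κ → V (⟪ φ ⟫ κ) → V δ →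
    ∃ λ κ' → ∃ λ y → κ' ≢ 0# × ⟪ φ ⟫ κ' ≡ κ' × V κ' × V y × κ * κ' ≡ y * y
  quadratic-descent φ {κ} {δ} κ≢0 φφ φδ norm V V+ Vκ Vφκ Vδ = go (⟪ φ ⟫ κ ≟ κ)
    where
    κ' = ⟪ φ ⟫ κ
    T = κ + κ' + (δ + δ)
    go : Dec (κ' ≡ κ) → ∃ λ κ' → ∃ λ y → κ' ≢ 0# × ⟪ φ ⟫ κ' ≡ κ' × V κ' × V y × κ * κ' ≡ y * y
    -- If κ is fixed then δ = ±κ and `T` may be zero; here κ itself already lies in the smaller
    -- field.
    go (yes eq) = κ , κ , κ≢0 , eq , Vκ , Vκ , refl
    go (no ne) = T , κ + δ , T≢0 , φT , V+ (V+ Vκ Vφκ) (V+ Vδ Vδ) , V+ Vκ Vδ , square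
      where
      square : κ * T ≡ (κ + δ) * (κ + δ)
      square = solve 3 (λ k k' d → k :* (k :+ k' :+ (d :+ d)) := k :* k :+ k :* d :+ k :* d :+ k :* k') refl κ
        κ' δ ∙ cong (κ * κ + κ * δ + κ * δ +_) norm
        ∙ solve 2 (λ k d → k :* k :+ k :* d :+ k :* d :+ d :* d := (k :+ d) :* (k :+ d)) refl κ δ
      φT : ⟪ φ ⟫ T ≡ T
      φT = +-hom φ _ _ ∙ (cong₂ _+_ (+-hom φ κ κ' ∙ cong (κ' +_) φφ ∙ +-comm κ' κ)
        (+-hom φ δ δ ∙ (cong₂ _+_ φδ φδ)))
      -- This factorisation contains `T`, so its vanishing would force κ' = κ.
      difference² : (κ' - κ) * (κ' - κ) ≡ T * (κ + κ' - (δ + δ))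
      difference² = solve 2 (λ k k' → (k' :- k) :* (k' :- k) := (k :+ k') :* (k :+ k') :- :nat 4 :* (k :* k'))
        refl κ κ' ∙ cong (λ e → (κ + κ') * (κ + κ') - nat 4 * e) norm
        ∙ solve 3 (λ k k' d → (k :+ k') :* (k :+ k') :- :nat 4 :* (d :* d) :=
          (k :+ k' :+ (d :+ d)) :* (k :+ k' :- (d :+ d))) refl κ κ' δ
      diff≢0 : κ' - κ ≢ 0#
      diff≢0 e = ne (solve 2 (λ a b → a := (a :- b) :+ b) refl κ' κ ∙ cong (_+ κ) e ∙ +-identityˡ κ)
      T≢0 : T ≢ 0#
      T≢0 e = ≢0-* diff≢0 diff≢0 (difference² ∙ cong (_* (κ + κ' - (δ + δ))) e ∙ (zeroˡ _))

  Class : ℕ → Set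
  Class n = ∃ λ a → ∃ λ b → ∃ λ r → n ≡ 2 ℕ.^ a ℕ.* 3 ℕ.^ b ℕ.* (r ℕ.* r) × (c ≡ 0ℚ → b ≡ 0)

  -- Strong induction, removing one prime factor: 2 is a unit, a ramified 3 is the square of √3, and
  -- any other prime has even valuation by `good-ramification`, so it can be removed together with a
  -- second copy of itself.
  class : ∀ n → 0 ℕ.< n → UnitClass (nat n) → Class n
  class = <-rec _ step
    where
    step : ∀ n → (∀ {k} → k ℕ.< n → 0 ℕ.< k → UnitClass (nat k) → Class k) → 0 ℕ.< n → UnitClass (nat n) →
      Class n
    step n rec n>0 U = go (PrimeFactorisation.factors F) (PrimeFactorisation.isFactorisation F)
      (PrimeFactorisation.factorsPrime F)
      where
      instance nz = ℕ.>-nonZero n>0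
      F = factorise n
      go : ∀ ps → n ≡ product ps → All IsPrime ps → Class n
      go [] eq _ = 0 , 0 , 1 , eq , λ _ → refl
      go (p ∷ ps) eq (pp ∷ _) = split (kind pp)
        where
        k = product ps
        U' : UnitClass (nat p * nat k)
        U' = subst UnitClass (cong nat eq ∙ nat-* p k) U
        pos : ∀ {x y} → 0 ℕ.< x ℕ.* y → 0 ℕ.< y
        pos {x} {zero} lt = ⊥-elim (ℕ.<-irrefl (sym (ℕ.*-zeroʳ x)) lt)
        pos {x} {suc y} _ = ℕ.z<s
        k>0 : 0 ℕ.< k
        k>0 = pos {p} (subst (0 ℕ.<_) eq n>0)
        p>1 : 1 ℕ.< p
        p>1 = ℕ.nonTrivial⇒n>1 p {{Primality.prime⇒nonTrivial pp}}
        k<n : k ℕ.< n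
        k<n = subst (k ℕ.<_) (sym (eq ∙ ℕ.*-comm p k)) (ℕ.m<m*n k p {{ℕ.>-nonZero k>0}} p>1)
        split : PrimeKind p → Class n
        split (is2 refl) = extend (rec k<n k>0 (UC-unit U'))
          where
          UC-unit : UnitClass (2# * nat k) → UnitClass (nat k)
          UC-unit (x , x≢0 , (Rκ , v , Rv , e)) = x , x≢0 ,
            subst Unit simplify (Unit-* (R-h , 2# , R-nat 2 , h*2) (Rκ , v , Rv , e))
            where
            simplify : h * (2# * nat k * (x * x)) ≡ nat k * (x * x)
            simplify = solve 4 (λ h t k x → h :* (t :* k :* x) := (h :* t) :* (k :* x)) refl h 2# (nat k)
              (x * x) ∙ cong (_* (nat k * (x * x))) h*2 ∙ (*-identityˡ _)
          extend : Class k → Class n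
          extend (a , b , r , k≡ , c0) = suc a , b , r , eq ∙ cong (2 ℕ.*_) k≡
            ∙ ℕS.solve 3 (λ x y z → ℕS.con 2 ℕS.:* (x ℕS.:* y ℕS.:* z) ℕS.:= ℕS.con 2 ℕS.:* x ℕS.:* y ℕS.:* z)
            refl (2 ℕ.^ a) (3 ℕ.^ b) (r ℕ.* r) , c0
        split (is3 refl c≡ m≡) = extend
          (rec k<n k>0 (UC-absorb √3≢0 (subst UnitClass (*-comm _ _ ∙ cong (nat k *_) (sym √3²)) U')))
          where
          open Ramified3 c≡ m≡
          extend : Class k → Class n
          extend (a , b , r , k≡ , c0) = a , suc b , r , eq ∙ cong (3 ℕ.*_) k≡
            ∙ ℕS.solve 3 (λ x y z → ℕS.con 3 ℕS.:* (x ℕS.:* y ℕS.:* z) ℕS.:= x ℕS.:* (ℕS.con 3 ℕS.:* y) ℕS.:* z)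
            refl (2 ℕ.^ a) (3 ℕ.^ b) (r ℕ.* r) ,
            λ c≡0 → ⊥-elim (ℚ.1≢0 (sym c≡ ∙ c≡0))
        split (good gp) = divide (good-ramification gp U')
          where
          divide : p ℕ∣.∣ k → Class n
          divide (ℕ∣.divides l k≡) =
            extend (rec (ℕ.<-trans l<k k<n) l>0 (UC-absorb (nat≢0 (prime>0 pp)) (subst UnitClass nat-eq U')))
            where
            l>0 : 0 ℕ.< l
            l>0 = pos {p} (subst (0 ℕ.<_) (k≡ ∙ ℕ.*-comm l p) k>0)
            l<k : l ℕ.< k
            l<k = subst (l ℕ.<_) (sym k≡) (ℕ.m<m*n l p {{ℕ.>-nonZero l>0}} p>1)
            nat-eq : nat p * nat k ≡ nat l * (nat p * nat p)
            nat-eq = cong (nat p *_) (cong nat k≡ ∙ nat-* l p)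
              ∙ solve 2 (λ p l → p :* (l :* p) := l :* (p :* p)) refl (nat p) (nat l)
            extend : Class l → Class n
            extend (a , b , r , l≡ , c0) = a , b , r ℕ.* p , eq ∙ cong (p ℕ.*_) (k≡ ∙ cong (ℕ._* p) l≡)
              ∙ ℕS.solve 4 (λ x y r p →
                p ℕS.:* (x ℕS.:* y ℕS.:* (r ℕS.:* r) ℕS.:* p) ℕS.:= x ℕS.:* y ℕS.:*
                ((r ℕS.:* p) ℕS.:* (r ℕS.:* p))) refl (2 ℕ.^ a) (3 ℕ.^ b) r p , c0

  Rational : K → Set
  Rational x = ∃ λ q → x ≡ ι q

  -- The trace form excludes a negative sign. Multiplying numerator/d by d² makes κ a natural number
  -- without changing its class.
  rational-class : ∀ {κ} → Rational κ → Positive κ → ∃ λ a → ∃ λ b → ∃ λ s →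
    Rational s × κ ≡ 2# ^ a * nat 3 ^ b * (s * s) × (c ≡ 0ℚ → b ≡ 0)
  rational-class {κ} (q , κ≡) (positive κ≢0 sum U) = finish (nonneg-int (subst (0ℚ ℚ.≤_) (clear q) q↧≥0))
    where
    d = ↧ₙ q
    d>0 : 0 ℕ.< d
    d>0 = ℕ.z<s {ℚ.denominator-1 q}
    q≥0 : 0ℚ ℚ.≤ q
    q≥0 = norm-sum≥0 (sym κ≡ ∙ proj₂ (proj₂ sum))
    q↧≥0 : 0ℚ ℚ.≤ q ℚ.* int (↧ q)
    q↧≥0 = subst (ℚ._≤ q ℚ.* int (↧ q)) (ℚ.*-zeroʳ q)
      (ℚ.*-monoˡ-≤-nonNeg q {{ℚ.nonNegative q≥0}} (ℚ.*≤* (ℤ.+≤+ ℕ.z≤n)))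
    finish : (∃ λ n → ↥ q ≡ ℤ.+ n) → _
    finish (n , ↥≡) = conclude (class k k>0 (subst UnitClass κd² (UC-* U (UC-square (nat≢0 d>0)))))
      where
      k = n ℕ.* d
      κd : κ * nat d ≡ nat n
      κd = (cong₂ _*_ κ≡ (num≡ι (↧ q))) ∙ sym (ι-* q (int (↧ q))) ∙ cong ι (clear q ∙ cong int ↥≡)
        ∙ sym (num≡ι (ℤ.+ n))
      κd² : κ * (nat d * nat d) ≡ nat k
      κd² = sym (*-assoc κ (nat d) (nat d)) ∙ cong (_* nat d) κd ∙ sym (nat-* n d)
      k>0 : 0 ℕ.< k
      k>0 = ℕ.n≢0⇒n>0 λ k≡0 → ≢0-* κ≢0 (≢0-* (nat≢0 d>0) (nat≢0 d>0)) (κd² ∙ cong nat k≡0)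
      conclude : Class k → _
      conclude (a , b , r , k≡ , c0) = a , b , nat r * ι d⁻¹ ,
        (int (ℤ.+ r) ℚ.* d⁻¹ , cong (_* ι d⁻¹) (num≡ι (ℤ.+ r)) ∙ sym (ι-* (int (ℤ.+ r)) d⁻¹)) , κ≡′ , c0
        where
        d⁻¹ = ℚ.1/ int (↧ q)
        inv : nat d * ι d⁻¹ ≡ 1#
        inv = cong (_* ι d⁻¹) (num≡ι (↧ q)) ∙ sym (ι-* (int (↧ q)) d⁻¹) ∙ cong ι (ℚ.*-inverseʳ (int (↧ q)))
          ∙ ι-1
        natk : nat k ≡ 2# ^ a * nat 3 ^ b * (nat r * nat r)
        natk = cong nat k≡ ∙ nat-* (2 ℕ.^ a ℕ.* 3 ℕ.^ b) (r ℕ.* r)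
          ∙ (cong₂ _*_ (nat-* (2 ℕ.^ a) (3 ℕ.^ b) ∙ (cong₂ _*_ (nat-^ 2 a) (nat-^ 3 b))) (nat-* r r))
        κ≡′ : κ ≡ 2# ^ a * nat 3 ^ b * ((nat r * ι d⁻¹) * (nat r * ι d⁻¹))
        κ≡′ = ≢0-cancel (≢0-* (nat≢0 d>0) (nat≢0 d>0))
          (*-comm _ κ ∙ κd² ∙ natk
          ∙ sym (solve 4 (λ d i t r → (d :* d) :* (t :* ((r :* i) :* (r :* i))) :=
          (t :* (r :* r)) :* ((d :* i) :* (d :* i))) refl (nat d) (ι d⁻¹) (2# ^ a * nat 3 ^ b) (nat r)
           ∙ cong (2# ^ a * nat 3 ^ b * (nat r * nat r) *_) ((cong₂ _*_ inv inv) ∙ *-identityˡ 1#)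
             ∙ (*-identityʳ _)))

  Rational⇒Real : ∀ {x} → Rational x → Real x
  Rational⇒Real (q , refl) = ι-hom conj q

  Rational⇒Fixed : ∀ {x} j → Rational x → Fixed j x
  Rational⇒Fixed j (q , refl) = ι-hom (G j) q

  even-power : ∀ {x} → Fixed 0 x → Real x → ∀ k → Sq 0 (x ^ (k ℕ.+ k))
  even-power {x} fx rx k = x ^ k , ^-hom g x k ∙ cong (_^ k) fx , ^-hom conj x k
    ∙ cong (_^ k) rx , ^-homo-* x k k

  e : ℕ → K
  e j = z j + z j *̄

  D : ℕ → K
  D j = (1# + z j) * (1# + z j) *̄

  D≡2+e : ∀ j → D j ≡ 2# + e j
  D≡2+e j = cong ((1# + z j) *_) (+-hom conj 1# (z j) ∙ cong (_+ z j *̄) (1-hom conj))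
    ∙ solve 2 (λ x y → (:nat 1 :+ x) :* (:nat 1 :+ y) := :nat 1 :+ x :+ y :+ x :* y) refl (z j) (z j *̄)
    ∙ cong (1# + z j + z j *̄ +_) (z-unitary j)
      ∙ solve 2 (λ x y → :nat 1 :+ x :+ y :+ :nat 1 := :nat 2 :+ (x :+ y)) refl (z j) (z j *̄)

  -- `D 0` is 2 when c = 0 and 2 + √3 when c = 1, and 2 (2 + √3) = (1 + √3)²; so 2 and `D 0` have
  -- the same class.
  Sq-2D : Sq 0 (2# * D 0)
  Sq-2D = go shape
    where
    go : Shape c m J → Sq 0 (2# * D 0)
    go (gaussian c≡ m≡) = 2# , num-hom g (ℤ.+ 2) , num-real (ℤ.+ 2) ,
      cong (2# *_) (D≡2+e 0 ∙ cong (λ y → 2# + (z₀ + y)) (conj-z₀-gaussian c≡ m≡)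
      ∙ solve 1 (λ x → :nat 2 :+ (x :+ :- x) := :nat 2) refl z₀)
    go (eisenstein c≡ m≡) = 1# + √3 , +-hom g 1# √3 ∙ (cong₂ _+_ (1-hom g) (√3-fixed 0)) , +-hom conj 1# √3
      ∙ (cong₂ _+_ (1-hom conj) √3-real) ,
        cong (2# *_) (D≡2+e 0) ∙ sym
          (solve 1 (λ s → (:nat 1 :+ s) :* (:nat 1 :+ s) := :nat 1 :+ :nat 2 :* s :+ s :* s) refl √3
          ∙ cong (1# + 2# * √3 +_) √3²
          ∙ solve 1 (λ s → :nat 1 :+ :nat 2 :* s :+ :nat 3 := :nat 2 :* (:nat 2 :+ s)) refl √3)
      where open Ramified3 c≡ m≡

  Claim : ℕ → Set
  Claim j = ∀ {κ} → Fixed j κ → Real κ → Positive κ → Sq j κ ⊎ Sq j (κ * D j)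

  Sq-3^ : ∀ b → (c ≡ 0ℚ → b ≡ 0) → Sq 0 (nat 3 ^ b)
  Sq-3^ b c0 = go shape
    where
    go : Shape c m J → Sq 0 (nat 3 ^ b)
    go (gaussian c≡ _) = 1# , 1-hom g , 1-hom conj , cong (nat 3 ^_) (c0 c≡) ∙ sym (*-identityˡ 1#)
    go (eisenstein c≡ m≡) = √3 ^ b , ^-hom g √3 b ∙ cong (_^ b) (√3-fixed 0) , ^-hom conj √3 b
      ∙ cong (_^ b) √3-real , cong (_^ b) (sym √3²) ∙ ^-distrib-* √3 √3 b
      where open Ramified3 c≡ m≡

  rational-claim : ∀ {κ} → Rational κ → Positive κ → Sq 0 κ ⊎ Sq 0 (κ * D 0)
  rational-claim {κ} rκ P = go (rational-class rκ P)
    where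
    go : (∃ λ a → ∃ λ b → ∃ λ s → Rational s × κ ≡ 2# ^ a * nat 3 ^ b * (s * s) × (c ≡ 0ℚ → b ≡ 0)) →
      Sq 0 κ ⊎ Sq 0 (κ * D 0)
    go (a , b , s , rs , κ≡ , c0) = split (parityℕ a)
      where
      rest : Sq 0 (nat 3 ^ b * (s * s))
      rest = Sq-* 0 (Sq-3^ b c0) (s , Rational⇒Fixed 0 rs , Rational⇒Real rs , refl)
      split : (∃ λ w → (a ≡ w ℕ.+ w) ⊎ (a ≡ suc (w ℕ.+ w))) → Sq 0 κ ⊎ Sq 0 (κ * D 0)
      split (w , inj₁ eq) = inj₁
        (subst (Sq 0) (sym (κ≡ ∙ *-assoc _ _ _ ∙ cong (λ k → 2# ^ k * (nat 3 ^ b * (s * s))) eq))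
        (Sq-* 0 (even-power (num-hom g (ℤ.+ 2)) (num-real (ℤ.+ 2)) w) rest))
      split (w , inj₂ eq) = inj₂
        (subst (Sq 0) (sym (cong (_* D 0) (κ≡ ∙ cong (λ k → 2# ^ k * nat 3 ^ b * (s * s)) eq)
           ∙ solve 5 (λ t p q r d → t :* p :* q :* r :* d := (t :* d) :* (p :* (q :* r))) refl 2#
             (2# ^ (w ℕ.+ w)) (nat 3 ^ b) (s * s) (D 0)))
           (Sq-* 0 Sq-2D (Sq-* 0 (even-power (num-hom g (ℤ.+ 2)) (num-real (ℤ.+ 2)) w) rest)))

  -- The base of the induction over ℚ(√3).

  module EisensteinBase (c≡ : c ≡ 1ℚ) (m≡ : m ≡ 2 ℕ.^ J ℕ.+ 2 ℕ.^ J) where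
    open Ramified3 c≡ m≡

    abs-cancel : ∀ {ϖ y} a → R y → ϖ ∣ᴿ num a * y → ϖ ∣ᴿ nat ℤ.∣ a ∣ * y
    abs-cancel (ℤ.+ n) Ry d = d
    abs-cancel {ϖ} {y} -[1+ n ] Ry d =
      ∣ᴿ-≡ (solve 2 (λ x y → :- (x :* y) := (:- x) :* y) refl (num -[1+ n ]) y
      ∙ cong (_* y) (sym (num-neg -[1+ n ]))) (∣ᴿ-neg d)

    -- The trailing `√3` is part of the operator's name, not the element.
    _⊞_√3 : ℤ → ℤ → K
    a ⊞ b √3 = num a + num b * √3

    τ-⊞ : ∀ a b → ⟪ τ ⟫ (a ⊞ b √3) ≡ num a - num b * √3
    τ-⊞ a b = +-hom τ _ _ ∙ (cong₂ _+_ (num-hom τ a) (*-hom τ _ _ ∙ (cong₂ _*_ (num-hom τ b) τ-√3)))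
      ∙ solve 3 (λ a b s → a :+ b :* (:- s) := a :- b :* s) refl (num a) (num b) √3

    norm-⊞ : ∀ a b → (a ⊞ b √3) * ⟪ τ ⟫ (a ⊞ b √3) + nat 3 * (num b * num b) ≡ num a * num a
    norm-⊞ a b = cong (λ t → (a ⊞ b √3) * t + nat 3 * (num b * num b)) (τ-⊞ a b)
      ∙ cong (λ t → (a ⊞ b √3) * (num a - num b * √3) + t * (num b * num b)) (sym √3²)
      ∙ solve 3 (λ a b s → (a :+ b :* s) :* (a :- b :* s) :+ (s :* s) :* (b :* b) := a :* a) refl (num a)
        (num b) √3

    norm-nat : ∀ {n a b} → n ℕ.+ 3 ℕ.* (ℤ.∣ b ∣ ℕ.* ℤ.∣ b ∣) ≡ ℤ.∣ a ∣ ℕ.* ℤ.∣ a ∣ →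
      (a ⊞ b √3) * ⟪ τ ⟫ (a ⊞ b √3) ≡ nat n
    norm-nat {n} {a} {b} eq = (solve 2 (λ x y → x := (x :+ y) :- y) refl _ (nat 3 * (num b * num b)))
      ∙ cong (_- nat 3 * (num b * num b)) (norm-⊞ a b ∙ abs-square a ∙ cong nat (sym eq)
      ∙ (nat-+ n _) ∙ cong (nat n +_) (nat-* 3 (ℤ.∣ b ∣ ℕ.* ℤ.∣ b ∣) ∙ cong (nat 3 *_) (sym (abs-square b))))
      ∙ solve 2 (λ x y → (x :+ y) :- y := x) refl (nat n) (nat 3 * (num b * num b))

    UC-norm : ∀ {κ} → UnitClass κ → UnitClass (κ * ⟪ τ ⟫ κ)
    UC-norm U = UC-* U (UC-Endo τ τ-R U)

    -- √3 divides a + b √3 exactly once when 3 divides a but not b.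
    odd-valuation : ∀ a' b → ¬ 3 ℕ∣.∣ ℤ.∣ b ∣ → ¬ UnitClass (√3 * (b ⊞ a' √3))
    odd-valuation a' b 3∤b = ramification 3 √3≢0 R-√3 (R-+ (R-num b) (R-* (R-num a') R-√3)) √3-separable cancel
      prime[3] (λ ())
        (λ k → ∣ᴿ-≡ (cong (_^ k) (sym √3²) ∙ sym (x^2k √3 k)) ∣ᴿ-refl)
      where
      cancel : ∀ {y} → R y → √3 ∣ᴿ (b ⊞ a' √3) * y → √3 ∣ᴿ y
      cancel {y} Ry d = coprime-cancel √3∣3 (prime∤⇒coprime prime[3] 3∤b) Ry (abs-cancel b Ry
        (∣ᴿ-≡ (solve 4 (λ a b s y → (b :+ a :* s) :* y :+ :- ((a :* y) :* s) := b :* y) refl (num a') (num b) √3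
          y) (∣ᴿ-+ d (∣ᴿ-neg (∣ᴿ-*ʳ (num a' * y) (R-* (R-num a') Ry) ∣ᴿ-refl)))))

    -- The equation is a² - 3 b² = n, arranged without subtraction so that it lives in ℕ.
    NormSquare : ℕ → Set
    NormSquare n = 0 ℕ.< n → ∀ a b → n ℕ.+ 3 ℕ.* (ℤ.∣ b ∣ ℕ.* ℤ.∣ b ∣) ≡ ℤ.∣ a ∣ ℕ.* ℤ.∣ a ∣ →
      UnitClass (a ⊞ b √3) → ∃ λ s → n ≡ s ℕ.* s

    -- A common factor 3 of a and b is removed by induction. If 3 divides a alone, the valuation at
    -- √3 is odd, which is impossible. If 3 does not divide a, it does not divide n either, so
    -- `class` leaves n = 2ᵏ r², and k is even by reduction modulo 3.
    norm-square : ∀ n → NormSquare n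
    norm-square = <-rec NormSquare step
      where
      step : ∀ n → (∀ {k} → k ℕ.< n → NormSquare k) → NormSquare n
      step n rec n>0 a b eq U = cases (3 ℕ∣.∣? ℤ.∣ a ∣) (3 ℕ∣.∣? ℤ.∣ b ∣)
        where
        α = ℤ.∣ a ∣
        β = ℤ.∣ b ∣
        cases : Dec (3 ℕ∣.∣ α) → Dec (3 ℕ∣.∣ β) → ∃ λ s → n ≡ s ℕ.* s
        cases (yes 3∣α) (yes 3∣β) = both (abs-∣ a 3∣α) (abs-∣ b 3∣β)
          where
          9∣n : 9 ℕ∣.∣ n
          9∣n = ℕ∣.∣m+n∣m⇒∣n (subst (9 ℕ∣.∣_) (sym eq ∙ ℕ.+-comm n (3 ℕ.* (β ℕ.* β))) (ℕ∣.*-pres-∣ 3∣α 3∣α))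
            (ℕ∣.∣n⇒∣m*n 3 (ℕ∣.*-pres-∣ 3∣β 3∣β))
          both : (∃ λ a' → a ≡ a' ℤ.* ℤ.+ 3) → (∃ λ b' → b ≡ b' ℤ.* ℤ.+ 3) → ∃ λ s → n ≡ s ℕ.* s
          both (a' , a≡) (b' , b≡) = ninth 9∣n
            where
            α≡ : α ≡ ℤ.∣ a' ∣ ℕ.* 3
            α≡ = cong ℤ.∣_∣ a≡ ∙ ℤ.abs-* a' (ℤ.+ 3)
            β≡ : β ≡ ℤ.∣ b' ∣ ℕ.* 3
            β≡ = cong ℤ.∣_∣ b≡ ∙ ℤ.abs-* b' (ℤ.+ 3)
            U' : UnitClass (a' ⊞ b' √3)
            U' = UC-absorb √3≢0 (subst UnitClass
              (cong₂ (λ p q → num p + num q * √3) a≡ b≡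
              ∙ cong₂ (λ p q → p + q * √3) (num-* a' (ℤ.+ 3)) (num-* b' (ℤ.+ 3))
              ∙ solve 4 (λ a b t s → a :* t :+ b :* t :* s := (a :+ b :* s) :* t) refl (num a') (num b') (nat 3)
                √3 ∙ cong ((a' ⊞ b' √3) *_) (sym √3²)) U)
            ninth : 9 ℕ∣.∣ n → ∃ λ s → n ≡ s ℕ.* s
            ninth (ℕ∣.divides n' n≡) = back (rec n'<n n'>0 a' b' eq' U')
              where
              n'>0 : 0 ℕ.< n'
              n'>0 = ℕ.n≢0⇒n>0 λ n'≡0 → ℕ.<-irrefl (sym (n≡ ∙ cong (ℕ._* 9) n'≡0)) n>0
              n'<n : n' ℕ.< n
              n'<n = subst (n' ℕ.<_) (sym n≡) (ℕ.m<m*n n' 9 {{ℕ.>-nonZero n'>0}} (ℕ.s≤s (ℕ.s≤s ℕ.z≤n)))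
              eq' : n' ℕ.+ 3 ℕ.* (ℤ.∣ b' ∣ ℕ.* ℤ.∣ b' ∣) ≡ ℤ.∣ a' ∣ ℕ.* ℤ.∣ a' ∣
              eq' = ℕ.*-cancelʳ-≡ _ _ 9
                ((ℕS.solve 2 (λ n b → (n ℕS.:+ ℕS.con 3 ℕS.:* (b ℕS.:* b)) ℕS.:* ℕS.con 9 ℕS.:= n ℕS.:* ℕS.con 9
                ℕS.:+ ℕS.con 3 ℕS.:* ((b ℕS.:* ℕS.con 3) ℕS.:* (b ℕS.:* ℕS.con 3))) refl n' ℤ.∣ b' ∣)
                ∙ sym (cong₂ (λ x y → x ℕ.+ 3 ℕ.* (y ℕ.* y)) n≡ β≡) ∙ eq ∙ (cong₂ ℕ._*_ α≡ α≡)
                  ∙ (ℕS.solve 1 (λ a → (a ℕS.:* ℕS.con 3) ℕS.:* (a ℕS.:* ℕS.con 3) ℕS.:= (a ℕS.:* a) ℕS.:*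
                  ℕS.con 9) refl ℤ.∣ a' ∣))
              back : (∃ λ s → n' ≡ s ℕ.* s) → ∃ λ s → n ≡ s ℕ.* s
              back (s , n'≡) = s ℕ.* 3 , n≡ ∙ cong (ℕ._* 9) n'≡
                ∙ ℕS.solve 1 (λ s → (s ℕS.:* s) ℕS.:* ℕS.con 9 ℕS.:= (s ℕS.:* ℕS.con 3) ℕS.:*
                (s ℕS.:* ℕS.con 3)) refl s
        cases (yes 3∣α) (no 3∤β) = contradict (abs-∣ a 3∣α)
          where
          contradict : (∃ λ a' → a ≡ a' ℤ.* ℤ.+ 3) → ∃ λ s → n ≡ s ℕ.* s
          contradict (a' , a≡) = ⊥-elim
            (odd-valuation a' b 3∤β (subst UnitClass
            (cong (λ t → t + num b * √3) (cong num a≡ ∙ num-* a' (ℤ.+ 3) ∙ cong (num a' *_) (sym √3²))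
            ∙ solve 3 (λ a b s → a :* (s :* s) :+ b :* s := s :* (b :+ a :* s)) refl (num a') (num b) √3) U))
        cases (no 3∤α) _ = go (class n n>0 (subst UnitClass (norm-nat {n} {a} {b} eq) (UC-norm U)))
          where
          3∤n : ¬ 3 ℕ∣.∣ n
          3∤n d = 3∤α (3∣square⇒3∣ α (subst (3 ℕ∣.∣_) eq (ℕ∣.∣m∣n⇒∣m+n d (ℕ∣.m∣m*n (β ℕ.* β)))))
          go : Class n → ∃ λ s → n ≡ s ℕ.* s
          go (k , suc l , r , n≡ , _) =
            ⊥-elim (3∤n (subst (3 ℕ∣.∣_) (sym n≡)
            (ℕ∣.∣m⇒∣m*n (r ℕ.* r) (ℕ∣.∣n⇒∣m*n (2 ℕ.^ k) (ℕ∣.m∣m*n (3 ℕ.^ l))))))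
          go (k , zero , r , n≡ , _) = split (parityℕ k)
            where
            split : (∃ λ w → (k ≡ w ℕ.+ w) ⊎ (k ≡ suc (w ℕ.+ w))) → ∃ λ s → n ≡ s ℕ.* s
            split (w , inj₁ k≡) = 2 ℕ.^ w ℕ.* r , n≡
              ∙ cong (λ t → t ℕ.* 1 ℕ.* (r ℕ.* r)) (cong (2 ℕ.^_) k≡ ∙ ℕ.^-distribˡ-+-* 2 w w)
              ∙ ℕS.solve 2 (λ t r → (t ℕS.:* t) ℕS.:* ℕS.con 1 ℕS.:* (r ℕS.:* r) ℕS.:= (t ℕS.:* r) ℕS.:*
                (t ℕS.:* r)) refl (2 ℕ.^ w) r
            split (w , inj₂ k≡) = ⊥-elim
              (twice-square≢norm α β (2 ℕ.^ w ℕ.* r) 3∤α (cong (ℕ._+ 3 ℕ.* (β ℕ.* β)) (sym twice) ∙ eq))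
              where
              twice : n ≡ 2 ℕ.* ((2 ℕ.^ w ℕ.* r) ℕ.* (2 ℕ.^ w ℕ.* r))
              twice = n≡ ∙ cong (λ t → t ℕ.* 1 ℕ.* (r ℕ.* r))
                (cong (2 ℕ.^_) k≡ ∙ cong (2 ℕ.*_) (ℕ.^-distribˡ-+-* 2 w w))
                ∙ ℕS.solve 2 (λ t r → (ℕS.con 2 ℕS.:* (t ℕS.:* t)) ℕS.:* ℕS.con 1 ℕS.:* (r ℕS.:* r) ℕS.:= ℕS.con
                  2 ℕS.:* ((t ℕS.:* r) ℕS.:* (t ℕS.:* r))) refl (2 ℕ.^ w) r

    -- The norm to ℚ is a positive integer, and a square by `norm-square`; descent along τ then
    -- replaces κ by a rational number of the same class.
    scaled-claim : ∀ a b → Positive (a ⊞ b √3) → Fixed 0 (a ⊞ b √3) → Real (a ⊞ b √3) →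
      Sq 0 (a ⊞ b √3) ⊎ Sq 0 ((a ⊞ b √3) * D 0)
    scaled-claim a b P fκ rκ = finish (nonneg-int (norm-sum≥0 (sym normℤ ∙ proj₂ (proj₂ (Positive.sum PN)))))
      where
      κ = a ⊞ b √3
      PN : Positive (κ * ⟪ τ ⟫ κ)
      PN = Positive-* P (Positive-Endo τ τ-conj τ-R P)
      ν = a ℤ.* a ℤ.- ℤ.+ 3 ℤ.* (b ℤ.* b)
      normℤ′ : κ * ⟪ τ ⟫ κ ≡ num ν
      normℤ′ = (solve 2 (λ x y → x := (x :+ y) :- y) refl _ (nat 3 * (num b * num b)))
        ∙ cong (_- nat 3 * (num b * num b)) (norm-⊞ a b)
        ∙ sym (num-+ (a ℤ.* a) (ℤ.- (ℤ.+ 3 ℤ.* (b ℤ.* b)))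
          ∙ (cong₂ _+_ (num-* a a) (num-neg (ℤ.+ 3 ℤ.* (b ℤ.* b))
          ∙ (cong -_ (num-* (ℤ.+ 3) (b ℤ.* b) ∙ cong (nat 3 *_) (num-* b b))))))
      normℤ : κ * ⟪ τ ⟫ κ ≡ ι (int ν)
      normℤ = normℤ′ ∙ num≡ι ν
      finish : (∃ λ n → ν ≡ ℤ.+ n) → Sq 0 κ ⊎ Sq 0 (κ * D 0)
      finish (n , ν≡) = go (norm-square n n>0 a b eqℕ (Positive.unit P))
        where
        norm-n : κ * ⟪ τ ⟫ κ ≡ nat n
        norm-n = normℤ′ ∙ cong num ν≡
        n>0 : 0 ℕ.< n
        n>0 = ℕ.n≢0⇒n>0 λ n≡0 → Positive.≢0 PN (norm-n ∙ cong nat n≡0)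
        eqℕ : n ℕ.+ 3 ℕ.* (ℤ.∣ b ∣ ℕ.* ℤ.∣ b ∣) ≡ ℤ.∣ a ∣ ℕ.* ℤ.∣ a ∣
        eqℕ = ℤ.+-injective ((ℤ.pos-+ n _)
          ∙ (cong₂ ℤ._+_ (sym ν≡) (ℤ.pos-* 3 (ℤ.∣ b ∣ ℕ.* ℤ.∣ b ∣)
          ∙ cong (λ t → ℤ.+ 3 ℤ.* t) (sym (square-abs b))))
          ∙ ℤ.+-assoc (a ℤ.* a) (ℤ.- (ℤ.+ 3 ℤ.* (b ℤ.* b))) (ℤ.+ 3 ℤ.* (b ℤ.* b))
            ∙ cong (λ t → a ℤ.* a ℤ.+ t) (ℤ.+-inverseˡ (ℤ.+ 3 ℤ.* (b ℤ.* b))) ∙ ℤ.+-identityʳ (a ℤ.* a)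
            ∙ square-abs a)
        V : K → Set
        V x = Fixed 0 x × Real x
        V+ : ∀ {x y} → V x → V y → V (x + y)
        V+ {x} {y} (f , r) (f' , r') = +-hom g x y ∙ (cong₂ _+_ f f') , +-hom conj x y ∙ (cong₂ _+_ r r')
        Vτ : ∀ {x} → V x → V (⟪ τ ⟫ x)
        Vτ {x} (f , r) = sym (τ-g x) ∙ cong ⟪ τ ⟫ f , sym (τ-conj x) ∙ cong ⟪ τ ⟫ r
        go : (∃ λ s → n ≡ s ℕ.* s) → Sq 0 κ ⊎ Sq 0 (κ * D 0)
        go (s , n≡) = conclude (quadratic-descent τ (Positive.≢0 P) (τ-involutive fκ rκ) (num-hom τ (ℤ.+ s))
          (norm-n ∙ cong nat n≡ ∙ nat-* s s)
             V V+ (fκ , rκ) (Vτ (fκ , rκ)) (num-hom g (ℤ.+ s) , num-real (ℤ.+ s)))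
          where
          conclude : (∃ λ κ' → ∃ λ y → κ' ≢ 0# × ⟪ τ ⟫ κ' ≡ κ' × V κ' × V y × κ * κ' ≡ y * y) →
            Sq 0 κ ⊎ Sq 0 (κ * D 0)
          conclude (κ' , y , κ'≢0 , τκ' , (fκ' , rκ') , (fy , ry) , eq) =
            Sum.map same twist (rational-claim (τ-rational fκ' rκ' τκ') (Positive-quotient P rκ κ'≢0 ry eq))
            where
            sq : Sq 0 (κ * κ')
            sq = y , fy , ry , eq
            same : Sq 0 κ' → Sq 0 κ
            same = Sq-div 0 κ'≢0 sq
            twist : Sq 0 (κ' * D 0) → Sq 0 (κ * D 0)
            twist sq' = Sq-div 0 (≢0-* κ'≢0 κ'≢0)
              (subst (Sq 0) (solve 3 (λ k k' d → (k :* k') :* (k' :* d) := (k :* d) :* (k' :* k')) refl κ κ'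
              (D 0)) (Sq-* 0 sq sq')) (κ' , fκ' , rκ' , refl)

    base : Claim 0
    base {κ} fκ rκ P = go (F₀-eisenstein fκ rκ)
      where
      go : (∃ λ a → ∃ λ b → κ ≡ ι a + ι b * √3) → Sq 0 κ ⊎ Sq 0 (κ * D 0)
      go (a , b , κ≡) = cleared (clear-all (a ∷ b ∷ []))
        where
        cleared : (∃ λ n → 0 ℕ.< n × All IsInt (int (ℤ.+ n) ℚ.* a ∷ int (ℤ.+ n) ℚ.* b ∷ [])) →
          Sq 0 κ ⊎ Sq 0 (κ * D 0)
        cleared (n , n>0 , (A , a≡) ∷ (B , b≡) ∷ []) =
          -- Coefficients are multiplied by n², and not only by n, so that the class modulo squares
          -- is kept.
          Sum.map same twist (scaled-claim A' B'
          (subst Positive (sym κn²) (Positive-* P (Positive-square n≢0 rn)))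
             (subst (Fixed 0) (sym κn²) (*-hom g κ _ ∙ (cong₂ _*_ fκ (*-hom g _ _ ∙ (cong₂ _*_ fn fn)))))
               (subst Real (sym κn²) ((*-hom conj κ _)
               ∙ (cong₂ _*_ rκ (*-hom conj _ _ ∙ (cong₂ _*_ rn rn))))))
          where
          N′ = nat n
          n≢0 = nat≢0 n>0
          rn = num-real (ℤ.+ n)
          fn : Fixed 0 N′
          fn = num-hom g (ℤ.+ n)
          A' = ℤ.+ n ℤ.* A
          B' = ℤ.+ n ℤ.* B
          lift : ∀ {q z} → int (ℤ.+ n) ℚ.* q ≡ int z → N′ * ι q ≡ num z
          lift {q} {w} eq = cong (_* ι q) (num≡ι (ℤ.+ n)) ∙ sym (ι-* (int (ℤ.+ n)) q) ∙ cong ι eq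
            ∙ sym (num≡ι w)
          κn² : A' ⊞ B' √3 ≡ κ * (N′ * N′)
          κn² = cong₂ (λ p q → p + q * √3) (num-* (ℤ.+ n) A ∙ cong (N′ *_) (sym (lift a≡)))
            (num-* (ℤ.+ n) B ∙ cong (N′ *_) (sym (lift b≡)))
            ∙ solve 4 (λ n a b s → n :* (n :* a) :+ n :* (n :* b) :* s := (a :+ b :* s) :* (n :* n)) refl N′
              (ι a) (ι b) √3 ∙ cong (_* (N′ * N′)) (sym κ≡)
          n²Sq : Sq 0 (N′ * N′)
          n²Sq = N′ , fn , rn , refl
          same : Sq 0 (A' ⊞ B' √3) → Sq 0 κ
          same sq = Sq-div 0 (≢0-* n≢0 n≢0) (subst (Sq 0) κn² sq) n²Sq
          twist : Sq 0 ((A' ⊞ B' √3) * D 0) → Sq 0 (κ * D 0)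
          twist sq = Sq-div 0 (≢0-* n≢0 n≢0)
            (subst (Sq 0) (cong (_* D 0) κn²
            ∙ solve 3 (λ k n d → (k :* n) :* d := (k :* d) :* n) refl κ (N′ * N′) (D 0)) sq) n²Sq

  base-claim : Claim 0
  base-claim = go shape
    where
    go : Shape c m J → Claim 0
    go (gaussian c≡ m≡) fκ rκ P = rational-claim (F₀-gaussian c≡ m≡ fκ rκ) P
    go (eisenstein c≡ m≡) = EisensteinBase.base c≡ m≡

  -- Units of the tower and the induction step; square roots of norms.

  Unit-1±z : ∀ j → j ℕ.≤ J → Unit (1# - z j) × Unit (1# + z j)
  Unit-1±z zero _ = Unit-factor (R-− R-1 Rz) (R-* (R-+ R-1 Rz) Rq)
    (subst Unit (two ∙ solve 3 (λ a b q → b :* (a :* q) := a :* (b :* q)) refl (1# - z₀) (1# + z₀) q) Unit-2) ,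
                    Unit-factor (R-+ R-1 Rz) (R-* (R-− R-1 Rz) Rq) (subst Unit two Unit-2)
    where
    Rz = R-z 0
    q = 1# + z₀ ^ 2 + z₀ ^ 4
    Rq : R q
    Rq = R-+ (R-+ R-1 (R-^ 2 Rz)) (R-^ 4 Rz)
    -- 2 = 1 - z₀⁶, so 1 + z₀ and 1 - z₀ divide the unit 2 of R. Upper levels follow from 1 - z j =
    -- (1 - w)(1 + w) with w = z (j + 1).
    two : 2# ≡ (1# + z₀) * ((1# - z₀) * q)
    two = solve 0 (:nat 2 := :nat 1 :- (:- :nat 1)) refl ∙ cong (λ t → 1# - t) (sym z₀⁶)
      ∙ solve 1 (λ x → :nat 1 :- x :^ 6 := (:nat 1 :+ x) :* ((:nat 1 :- x) :* (:nat 1 :+ x :^ 2 :+ x :^ 4)))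
      refl z₀
  Unit-1±z (suc j) j<J = Unit-factor R₋ R₊ U , Unit-factor R₊ R₋ (subst Unit (*-comm _ _) U)
    where
    w = z (suc j)
    R₋ = R-− R-1 (R-z (suc j))
    R₊ = R-+ R-1 (R-z (suc j))
    U : Unit ((1# - w) * (1# + w))
    U = subst Unit (cong (λ t → 1# - t) (sym (z² j<J))
      ∙ solve 1 (λ x → :nat 1 :- x :* x := (:nat 1 :- x) :* (:nat 1 :+ x)) refl w)
      (proj₁ (Unit-1±z j (ℕ.<⇒≤ j<J)))

  Unit-D : ∀ j → j ℕ.≤ J → Unit (D j)
  Unit-D j le = Unit-* (proj₂ (Unit-1±z j le)) (Unit-conj (proj₂ (Unit-1±z j le)))

  Positive-D : ∀ j → j ℕ.≤ J → Positive (D j)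
  Positive-D j le = positive (Unit⇒≢0 (Unit-D j le)) (Sum-norm (1# + z j))
    (1# , 1≢0 , subst Unit (sym (cong (D j *_) (*-identityˡ 1#) ∙ (*-identityʳ _))) (Unit-D j le))

  D-real : ∀ j → Real (D j)
  D-real j = *-hom conj _ _ ∙ cong ((1# + z j) *̄ *_) (conj-involutive _) ∙ (*-comm _ _)

  e-fixed : ∀ j → j ℕ.≤ J → Fixed j (e j)
  e-fixed j le = (+-hom (G j) _ _) ∙ (cong₂ _+_ (G-z j le) (G-conj j _ ∙ (cong _*̄ (G-z j le))))

  D-fixed : ∀ j → j ℕ.≤ J → Fixed j (D j)
  D-fixed j le = subst (Fixed j) (sym (D≡2+e j))
    ((+-hom (G j) _ _) ∙ (cong₂ _+_ (num-hom (G j) (ℤ.+ 2)) (e-fixed j le)))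

  e²≡D : ∀ j → j ℕ.< J → e (suc j) * e (suc j) ≡ D j
  e²≡D j j<J = solve 2 (λ x y → (x :+ y) :* (x :+ y) := x :* x :+ y :* y :+ :nat 2 :* (x :* y)) refl w (w *̄)
    ∙ cong₂ (λ p q → p + w *̄ * w *̄ + 2# * q) (z² j<J) (z-unitary (suc j))
      ∙ cong (λ p → z j + p + 2# * 1#) (sym (*-hom conj w w) ∙ (cong _*̄ (z² j<J)))
        ∙ solve 2 (λ x y → x :+ y :+ :nat 2 :* :nat 1 := :nat 2 :+ (x :+ y)) refl (z j) (z j *̄) ∙ sym (D≡2+e j)
    where w = z (suc j)

  Sq-D : ∀ j → j ℕ.< J → Sq (suc j) (D j)
  Sq-D j j<J = e (suc j) , e-fixed (suc j) j<J , +-hom conj _ _ ∙ cong (z (suc j) *̄ +_) (conj-involutive _)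
    ∙ (+-comm _ _) , sym (e²≡D j j<J)

  -- With D = 2 + e the product is 4 - e² = -(z - z̄)², and multiplying z̄ - z by I gives a real
  -- square root. It identifies the class of 4 - `D j`, the norm of `D (suc j)`, with that of `D j`.
  Sq-[4-D]D : ∀ j → j ℕ.≤ J → Sq j ((nat 4 - D j) * D j)
  Sq-[4-D]D j le = f , (*-hom (G j) _ _)
    ∙ (cong₂ _*_ (G-I j) ((−-hom (G j) _ _) ∙ (cong₂ _-_ (G-conj j _ ∙ (cong _*̄ (G-z j le))) (G-z j le)))) ,
      (*-hom conj _ _) ∙ (cong₂ _*_ conj-I (−-hom conj _ _ ∙ (cong₂ _-_ (conj-involutive _) refl)))
        ∙ solve 3 (λ i x y → (:- i) :* (x :- y) := i :* (y :- x)) refl I x y ,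
      cong (λ d → (nat 4 - d) * d) (D≡2+e j)
        ∙ sym (solve 3 (λ i x y → (i :* (y :- x)) :* (i :* (y :- x)) :=
        (i :* i) :* ((x :+ y) :* (x :+ y) :- :nat 4 :* (x :* y))) refl I x y
        ∙ cong₂ (λ p q → p * ((x + y) * (x + y) - nat 4 * q)) I² (z-unitary j)
          ∙ solve 1 (λ e → (:- :nat 1) :* (e :* e :- :nat 4 :* :nat 1) :=
          (:nat 4 :- (:nat 2 :+ e)) :* (:nat 2 :+ e)) refl (x + y))
    where
    x = z j
    y = z j *̄
    f = I * (y - x)

  -- If the norm of κ has the class of `D j`, the twist by `D (suc j)`, whose norm has the same
  -- class, reduces to a square norm. Either class found after the descent is trivial upstairs,
  -- because `D j` becomes the square of `e (suc j)`.
  claim-step : ∀ j → j ℕ.< J → Claim j → Claim (suc j)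
  claim-step j j<J ih {κ} fκ rκ P = split (ih (N-fixed fκ) (N-real rκ) (PN P))
    where
    φ = G j
    N-fixed : ∀ {κ} → Fixed (suc j) κ → Fixed j (κ * ⟪ φ ⟫ κ)
    N-fixed {κ} f = *-hom φ κ _ ∙ cong (⟪ φ ⟫ κ *_) f ∙ (*-comm _ _)
    φ-real : ∀ {κ} → Real κ → Real (⟪ φ ⟫ κ)
    φ-real r = sym (G-conj j _) ∙ cong ⟪ φ ⟫ r
    N-real : ∀ {κ} → Real κ → Real (κ * ⟪ φ ⟫ κ)
    N-real {κ} r = *-hom conj _ _ ∙ (cong₂ _*_ r (φ-real r))
    PN : ∀ {κ} → Positive κ → Positive (κ * ⟪ φ ⟫ κ)
    PN P = Positive-* P (Positive-Endo φ (G-conj j) (G-R j) P)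
    V : K → Set
    V x = Fixed (suc j) x × Real x
    V+ : ∀ {x y} → V x → V y → V (x + y)
    V+ {x} {y} (f , r) (f' , r') = +-hom (G (suc j)) x y ∙ (cong₂ _+_ f f') , +-hom conj x y ∙ (cong₂ _+_ r r')
    D≢0 = Positive.≢0 (Positive-D j (ℕ.<⇒≤ j<J))
    square-norm : ∀ {κ} → Fixed (suc j) κ → Real κ → Positive κ → Sq j (κ * ⟪ φ ⟫ κ) → Sq (suc j) κ
    square-norm {κ} f r P (δ , fδ , rδ , norm) =
      conclude (quadratic-descent φ (Positive.≢0 P) f fδ norm V V+ (f , r) (cong ⟪ φ ⟫ f , φ-real r)
      (Fixed-suc j fδ , rδ))
      where
      conclude : (∃ λ κ' → ∃ λ y → κ' ≢ 0# × ⟪ φ ⟫ κ' ≡ κ' × V κ' × V y × κ * κ' ≡ y * y) → Sq (suc j) κ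
      conclude (κ' , y , κ'≢0 , fκ' , (_ , rκ') , (fy , ry) , eq) = Sq-div (suc j) κ'≢0 (y , fy , ry , eq)
        (Sum.[ Sq-suc j , (λ sq → Sq-div (suc j) D≢0 (Sq-suc j sq) (Sq-D j j<J)) ]′
          (ih fκ' rκ' (Positive-quotient P r κ'≢0 ry eq)))
    split : Sq j (κ * ⟪ φ ⟫ κ) ⊎ Sq j (κ * ⟪ φ ⟫ κ * D j) → Sq (suc j) κ ⊎ Sq (suc j) (κ * D (suc j))
    split (inj₁ sq) = inj₁ (square-norm fκ rκ P sq)
    split (inj₂ sq) = inj₂ (square-norm (*-hom (G (suc j)) κ D' ∙ (cong₂ _*_ fκ (D-fixed (suc j) j<J)))
      (*-hom conj κ D' ∙ (cong₂ _*_ rκ (D-real (suc j)))) (Positive-* P (Positive-D (suc j) j<J))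
        (subst (Sq j) (sym norm) (Sq-div j (≢0-* D≢0 D≢0)
          (subst (Sq j) (solve 3 (λ n d f → (n :* d) :* (f :* d) := (n :* f) :* (d :* d)) refl (κ * ⟪ φ ⟫ κ)
          (D j) (nat 4 - D j)) (Sq-* j sq (Sq-[4-D]D j (ℕ.<⇒≤ j<J))))
          (D j , D-fixed j (ℕ.<⇒≤ j<J) , D-real j , refl))))
      where
      D' = D (suc j)
      E = e (suc j)
      φE : ⟪ φ ⟫ E ≡ - E
      φE = +-hom φ _ _ ∙ (cong₂ _+_ (G-neg j j<J)
        (G-conj j _ ∙ (cong _*̄ (G-neg j j<J)) ∙ (neg-hom conj _)))
        ∙ solve 2 (λ x y → (:- x) :+ (:- y) := :- (x :+ y)) refl (z (suc j)) (z (suc j) *̄)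
      D'φD' : D' * ⟪ φ ⟫ D' ≡ nat 4 - D j
      D'φD' = (cong₂ _*_ (D≡2+e (suc j))
        (cong ⟪ φ ⟫ (D≡2+e (suc j)) ∙ +-hom φ _ _ ∙ (cong₂ _+_ (num-hom φ (ℤ.+ 2)) φE)))
        ∙ solve 1 (λ e → (:nat 2 :+ e) :* (:nat 2 :+ :- e) := :nat 4 :- e :* e) refl E
          ∙ cong (λ t → nat 4 - t) (e²≡D j j<J)
      norm : κ * D' * ⟪ φ ⟫ (κ * D') ≡ κ * ⟪ φ ⟫ κ * (nat 4 - D j)
      norm = cong (κ * D' *_) (*-hom φ κ D')
        ∙ solve 4 (λ k d k' d' → k :* d :* (k' :* d') := k :* k' :* (d :* d')) refl κ D' (⟪ φ ⟫ κ) (⟪ φ ⟫ D')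
        ∙ cong (κ * ⟪ φ ⟫ κ *_) D'φD'

  claim : ∀ j → j ℕ.≤ J → Claim j
  claim zero _ = base-claim
  claim (suc j) j<J = claim-step j j<J (claim j (ℕ.<⇒≤ j<J))

  -- Weber's theorem on totally positive units; being a sum of norms replaces total positivity.
  unit-norm : ∀ {κ} → Real κ → Unit κ → SumOfNorms κ → ∃ λ β → Unit β × β * β *̄ ≡ κ
  unit-norm {κ} rκ Uκ sum =
    split (claim J ℕ.≤-refl (G-top κ) rκ
    (positive (Unit⇒≢0 Uκ) sum (1# , 1≢0 , subst Unit (sym (cong (κ *_) (*-identityˡ 1#) ∙ *-identityʳ κ)) Uκ)))
    where
    Unit-√ : ∀ {f} → Unit (f * f) → Unit f
    Unit-√ {f} U@(Rff , _) = Unit-factor (square-absegral Rff) (square-absegral Rff) U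
    split : Sq J κ ⊎ Sq J (κ * D J) → ∃ λ β → Unit β × β * β *̄ ≡ κ
    split (inj₁ (f , _ , rf , eq)) = f , Unit-√ (subst Unit eq Uκ) , cong (f *_) rf ∙ sym eq
    split (inj₂ (f , _ , rf , eq)) = go (proj₂ (Unit-1±z J ℕ.≤-refl))
      where
      w = 1# + z J
      go : Unit w → ∃ λ β → Unit β × β * β *̄ ≡ κ
      -- `D J` = w w̄ with w = 1 + ζ, so κ w w̄ = f² with f real, and β = f/w has β β̄ = κ.
      go (Rw , v , Rv , wv) = f * v ,
        Unit-* (Unit-√ (subst Unit eq (Unit-* Uκ (Unit-D J ℕ.≤-refl)))) (Rv , w , Rw , *-comm v w ∙ wv) ,
        cong (f * v *_) (*-hom conj f v ∙ cong (_* v *̄) rf)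
          ∙ solve 3 (λ f v v' → f :* v :* (f :* v') := (f :* f) :* (v :* v')) refl f v (v *̄)
          ∙ cong (_* (v * v *̄)) (sym eq)
        ∙ solve 5 (λ k w w' v v' → (k :* (w :* w')) :* (v :* v') := k :* ((w :* v) :* (w' :* v'))) refl κ w
          (w *̄) v (v *̄) ∙ cong (κ *_)
          ((cong₂ _*_ wv (sym (*-hom conj w v) ∙ (cong _*̄ wv) ∙ 1-hom conj)) ∙ *-identityˡ 1#) ∙ *-identityʳ κ

  hilbert90 : ∀ {α} → R α → α * α *̄ ≡ 1# → ∃ λ β → Unit β × β * α ≡ β *̄
  hilbert90 {α} Rα eq = go (norm1-root Rα eq)
    where
    conj-ζ̄^ : ∀ k → (ζ̄ ^ k) *̄ ≡ ζ ^ k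
    conj-ζ̄^ k = ^-hom conj ζ̄ k ∙ cong (_^ k) ((cong _*̄ (sym conj-ζ)) ∙ conj-involutive ζ)
    Rζ̄^ : ∀ k → R (ζ̄ ^ k)
    Rζ̄^ k = R-^ k (R-^ (ord ℕ.∸ 1) R-ζ)
    Unit-ζ̄^ : ∀ k → Unit (ζ̄ ^ k)
    Unit-ζ̄^ k = Rζ̄^ k , ζ ^ k , R-^ k R-ζ , *-comm _ _ ∙ ζ^ζ̄^ k
    Unit-1+ζ : Unit (1# + ζ)
    Unit-1+ζ = subst (λ t → Unit (1# + t)) z-top (proj₂ (Unit-1±z J ℕ.≤-refl))
    go : IsRoot α → ∃ λ β → Unit β × β * α ≡ β *̄
    go (j , α≡) = split (parityℕ j)
      where
      cancel : ∀ k → ζ̄ ^ k * (ζ ^ k * ζ ^ k) ≡ ζ ^ k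
      cancel k = solve 2 (λ x y → y :* (x :* x) := (x :* y) :* x) refl (ζ ^ k) (ζ̄ ^ k)
        ∙ cong (_* ζ ^ k) (ζ^ζ̄^ k) ∙ (*-identityˡ _)
      split : (∃ λ w → (j ≡ w ℕ.+ w) ⊎ (j ≡ suc (w ℕ.+ w))) → ∃ λ β → Unit β × β * α ≡ β *̄
      split (k , inj₁ j≡) = ζ̄ ^ k , Unit-ζ̄^ k , cong (ζ̄ ^ k *_) (α≡ ∙ cong (ζ ^_) j≡ ∙ ^-homo-* ζ k k)
        ∙ cancel k ∙ sym (conj-ζ̄^ k)
      -- (1 + ζ̄) ζ = 1 + ζ is the conjugate of 1 + ζ̄, which accounts for the odd factor ζ.
      split (k , inj₂ j≡) = ζ̄ ^ k * (1# + ζ) *̄ , Unit-* (Unit-ζ̄^ k) (Unit-conj Unit-1+ζ) ,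
          cong₂ (λ p q → ζ̄ ^ k * p * q) conj-1+ζ (α≡ ∙ cong (ζ ^_) j≡ ∙ cong (ζ *_) (^-homo-* ζ k k))
          ∙ solve 4 (λ p z z' x → p :* (:nat 1 :+ z') :* (z :* x) := (p :* x) :* (z :+ z :* z')) refl (ζ̄ ^ k) ζ
            ζ̄ (ζ ^ k * ζ ^ k)
          ∙ cong₂ (λ p q → p * (ζ + q)) (cancel k) ζζ̄
            ∙ sym (*-hom conj _ _ ∙ (cong₂ _*_ (conj-ζ̄^ k) (conj-involutive _))
            ∙ cong (ζ ^ k *_) (+-comm 1# ζ))
        where
        conj-1+ζ : (1# + ζ) *̄ ≡ 1# + ζ̄
        conj-1+ζ = +-hom conj 1# ζ ∙ (cong₂ _+_ (1-hom conj) conj-ζ)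

-- Unitary matrices, quaternions and the map φ.

module UnitaryGroup (C : Cyclotomic) (i : Cyclotomic.K C)
  (i² : Cyclotomic._*_ C i i ≡ Cyclotomic.-_ C (Cyclotomic.1# C))
  (conj-i : Basics._*̄ C i ≡ Cyclotomic.-_ C i)
  (R-i : WeberTheorem.R C i) where
  open WeberTheorem C hiding (A; I; I²; conj-I)

  -- Both 2 × 2 matrices (row by row) and quaternions.
  record Quad : Set where
    constructor quad
    field
      ₁ ₂ ₃ ₄ : K
  open Quad

  quad-≡ : ∀ {a b c d a' b' c' d'} → a ≡ a' → b ≡ b' → c ≡ c' → d ≡ d' → quad a b c d ≡ quad a' b' c' d'
  quad-≡ refl refl refl refl = refl

  infixl 7 _*ᴹ_ _*ᴴ_
  _*ᴹ_ : Quad → Quad → Quad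
  A *ᴹ B = quad (₁ A * ₁ B + ₂ A * ₃ B) (₁ A * ₂ B + ₂ A * ₄ B) (₃ A * ₁ B + ₄ A * ₃ B) (₃ A * ₂ B + ₄ A * ₄ B)

  _*ᴴ_ : Quad → Quad → Quad
  x *ᴴ y = quad (₁ x * ₁ y - ₂ x * ₂ y - ₃ x * ₃ y - ₄ x * ₄ y) (₁ x * ₂ y + ₂ x * ₁ y + ₃ x * ₄ y - ₄ x * ₃ y)
                (₁ x * ₃ y - ₂ x * ₄ y + ₃ x * ₁ y + ₄ x * ₂ y) (₁ x * ₄ y + ₂ x * ₃ y - ₃ x * ₂ y + ₄ x * ₁ y)

  scale : K → Quad → Quad
  scale k x = quad (k * ₁ x) (k * ₂ x) (k * ₃ x) (k * ₄ x)

  adjoint : Quad → Quad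
  adjoint A = quad (₁ A *̄) (₃ A *̄) (₂ A *̄) (₄ A *̄)

  det : Quad → K
  det A = ₁ A * ₄ A - ₂ A * ₃ A

  idᴹ 1ᴴ 0ᴴ : Quad
  idᴹ = quad 1# 0# 0# 1#
  1ᴴ  = quad 1# 0# 0# 0#
  0ᴴ  = quad 0# 0# 0# 0#

  Each : (K → Set) → Quad → Set
  Each P x = P (₁ x) × P (₂ x) × P (₃ x) × P (₄ x)

  RealR : K → Set
  RealR x = R x × Real x

  record U₂ (A : Quad) : Set where
    field
      entries : Each R A
      AA*     : A *ᴹ adjoint A ≡ idᴹ
      A*A     : adjoint A *ᴹ A ≡ idᴹ

  infix 4 _~ᴴ_
  _~ᴴ_ : Quad → Quad → Set
  x ~ᴴ y = ∃ λ k → Real k × k ≢ 0# × y ≡ scale k x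

  infix 4 _~ᵁ_
  _~ᵁ_ : Quad → Quad → Set
  A ~ᵁ B = ∃ λ ℓ → R ℓ × ℓ * ℓ *̄ ≡ 1# × B ≡ scale ℓ A

  -- `i` is a parameter of the module, and not `I`, so that in the concrete field this is
  -- definitionally the matrix written with `sqrt-1`.
  matrix : K → K → K → K → Quad
  matrix r t u v = quad (r + v * i) (t + u * i) (- t + u * i) (r - v * i)

  quaternion : K → K → K → K → Quad
  quaternion r t u v = quad r (- u) (- t) (- v)

  record Φ (A x : Quad) : Set where
    constructor Φ-intro
    field
      β          : K
      β≢0        : β ≢ 0#
      β-det      : β * det A ≡ β *̄
      r t u v    : K
      Fr         : Real r
      Ft         : Real t
      Fu         : Real u
      Fv         : Real v
      βA         : scale β A ≡ matrix r t u v
      similar    : quaternion r t u v ~ᴴ x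

  Real-+ : ∀ {x y} → Real x → Real y → Real (x + y)
  Real-+ {x} {y} p q = +-hom conj x y ∙ (cong₂ _+_ p q)

  Real-* : ∀ {x y} → Real x → Real y → Real (x * y)
  Real-* {x} {y} p q = *-hom conj x y ∙ (cong₂ _*_ p q)

  Real-neg : ∀ {x} → Real x → Real (- x)
  Real-neg {x} p = neg-hom conj x ∙ (cong -_ p)

  Real-− : ∀ {x y} → Real x → Real y → Real (x - y)
  Real-− p q = Real-+ p (Real-neg q)

  *ᴴ-closed : ∀ {P : K → Set} → (∀ {x y} → P x → P y → P (x + y)) → (∀ {x y} → P x → P y → P (x * y)) →
    (∀ {x} → P x → P (- x)) →
    ∀ {x y} → Each P x → Each P y → Each P (x *ᴴ y)
  *ᴴ-closed P+ P* P- (a , b , c , d) (a' , b' , c' , d') =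
    P+ (P+ (P+ (P* a a') (P- (P* b b'))) (P- (P* c c'))) (P- (P* d d')) ,
      P+ (P+ (P+ (P* a b') (P* b a')) (P* c d')) (P- (P* d c')) ,
    P+ (P+ (P+ (P* a c') (P- (P* b d'))) (P* c a')) (P* d b') ,
      P+ (P+ (P+ (P* a d') (P* b c')) (P- (P* c b'))) (P* d a')

  module _ {A : Quad} (U : U₂ A) where
    open U₂ U
    private
      a = ₁ A
      b = ₂ A
      c′ = ₃ A
      d = ₄ A

    det-R : R (det A)
    det-R = let (Ra , Rb , Rc , Rd) = entries in R-− (R-* Ra Rd) (R-* Rb Rc)

    det-unitary : det A * det A *̄ ≡ 1#
    det-unitary = cong (det A *_) (−-hom conj _ _ ∙ (cong₂ _-_ (*-hom conj a d) (*-hom conj b c′)))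
      ∙ solve 8 (λ a b c d a' b' c' d' → (a :* d :- b :* c) :* (a' :* d' :- b' :* c') :=
        (a :* a' :+ b :* b') :* (c :* c' :+ d :* d') :- (a :* c' :+ b :* d') :* (c :* a' :+ d :* b')) refl a b
        c′ d (a *̄) (b *̄) (c′ *̄) (d *̄)
      ∙ (cong₂ _-_ (cong₂ _*_ (cong ₁ AA*) (cong ₄ AA*)) (cong₂ _*_ (cong ₂ AA*) (cong ₃ AA*)))
        ∙ solve 0 (:nat 1 :* :nat 1 :- :nat 0 :* :nat 0 := :nat 1) refl

    -- The adjoint of a unitary matrix is its inverse, so Cramer's rule expresses the second row
    -- through the conjugate of the first; likewise for `det-b̄`.
    det-ā : det A * a *̄ ≡ d
    det-ā = solve 6 (λ a b c d a' c' → (a :* d :- b :* c) :* a' :=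
      d :* (a' :* a :+ c' :* c) :- c :* (a' :* b :+ c' :* d)) refl a b c′ d (a *̄) (c′ *̄)
      ∙ cong₂ (λ p q → d * p - c′ * q) (cong ₁ A*A) (cong ₂ A*A)
        ∙ solve 2 (λ d c → d :* :nat 1 :- c :* :nat 0 := d) refl d c′

    det-b̄ : det A * b *̄ ≡ - c′
    det-b̄ = solve 6 (λ a b c d b' d' → (a :* d :- b :* c) :* b' :=
      d :* (b' :* a :+ d' :* c) :- c :* (b' :* b :+ d' :* d)) refl a b c′ d (b *̄) (d *̄)
      ∙ cong₂ (λ p q → d * p - c′ * q) (cong ₃ A*A) (cong ₄ A*A)
        ∙ solve 2 (λ d c → d :* :nat 0 :- c :* :nat 1 := :- c) refl d c′

  re im : K → K
  re x = h * (x + x *̄)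
  im x = - (h * i * (x - x *̄))

  h-real : Real h
  h-real = ι-hom conj _

  re-real : ∀ x → Real (re x)
  re-real x = Real-* h-real (+-hom conj x (x *̄) ∙ cong (x *̄ +_) (conj-involutive x) ∙ (+-comm _ _))

  im-real : ∀ x → Real (im x)
  im-real x = (neg-hom conj _)
    ∙ (cong -_ ((*-hom conj _ _)
    ∙ (cong₂ _*_ (*-hom conj h i ∙ (cong₂ _*_ h-real conj-i))
    (−-hom conj x (x *̄) ∙ cong (λ e → x *̄ - e) (conj-involutive x)))))
    ∙ solve 4 (λ h i x y → :- (h :* (:- i) :* (y :- x)) := :- (h :* i :* (x :- y))) refl h i x (x *̄)

  2h : ∀ x → (h * 2#) * x ≡ x
  2h x = cong (_* x) h*2 ∙ *-identityˡ x

  x≡re+im : ∀ x → x ≡ re x + im x * i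
  x≡re+im x = sym (solve 4 (λ h i x y → h :* (x :+ y) :+ (:- (h :* i :* (x :- y))) :* i :=
    h :* (x :+ y) :- h :* (i :* i) :* (x :- y)) refl h i x (x *̄)
    ∙ cong (λ e → h * (x + x *̄) - h * e * (x - x *̄)) i²
      ∙ solve 3 (λ h x y → h :* (x :+ y) :- h :* (:- :nat 1) :* (x :- y) := (h :* :nat 2) :* x) refl h x (x *̄)
      ∙ 2h x)

  x̄≡re-im : ∀ x → x *̄ ≡ re x - im x * i
  x̄≡re-im x = sym (solve 4
    (λ h i x y → h :* (x :+ y) :- (:- (h :* i :* (x :- y))) :* i := h :* (x :+ y) :+ h :* (i :* i) :* (x :- y))
    refl h i x (x *̄)
    ∙ cong (λ e → h * (x + x *̄) + h * e * (x - x *̄)) i²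
      ∙ solve 3 (λ h x y → h :* (x :+ y) :+ h :* (:- :nat 1) :* (x :- y) := (h :* :nat 2) :* y) refl h x (x *̄)
      ∙ 2h (x *̄))

  R-re : ∀ {x} → R x → R (re x)
  R-re Rx = R-* R-h (R-+ Rx (R-conj Rx))

  R-im : ∀ {x} → R x → R (im x)
  R-im Rx = R-neg (R-* (R-* R-h R-i) (R-− Rx (R-conj Rx)))

  ~ᴴ-refl : ∀ x → x ~ᴴ x
  ~ᴴ-refl x = 1# , 1-hom conj , 1≢0 ,
    sym (quad-≡ (*-identityˡ _) (*-identityˡ _) (*-identityˡ _) (*-identityˡ _))

  φ-of : Quad → K → Quad
  φ-of A β = quaternion (re (β * ₁ A)) (re (β * ₂ A)) (im (β * ₂ A)) (im (β * ₁ A))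

  -- Because β det A = β̄, Cramer's rule turns the second row of βA into -w̄, z̄ when the first row
  -- is z, w. Real and imaginary parts of z and w are the four coordinates.
  φ-graph : ∀ {A} → U₂ A → ∀ {β} → β ≢ 0# → β * det A ≡ β *̄ → Φ A (φ-of A β)
  φ-graph {A} U {β} β≢0 eq = Φ-intro β β≢0 eq _ _ _ _ (re-real z₁) (re-real w₁) (im-real w₁) (im-real z₁)
      (quad-≡ (x≡re+im z₁) (x≡re+im w₁) third (fourth ∙ x̄≡re-im z₁)) (~ᴴ-refl _)
    where
    z₁ = β * ₁ A
    w₁ = β * ₂ A
    fourth : β * ₄ A ≡ z₁ *̄
    fourth = cong (β *_) (sym (det-ā U)) ∙ sym (*-assoc β _ _) ∙ cong (_* ₁ A *̄) eq ∙ sym (*-hom conj β (₁ A))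
    third : β * ₃ A ≡ - re w₁ + im w₁ * i
    third = solve 2 (λ b c → b :* c := :- (b :* (:- c))) refl β (₃ A)
      ∙ (cong -_ (cong (β *_) (sym (det-b̄ U)) ∙ sym (*-assoc β _ _) ∙ cong (_* ₂ A *̄) eq
      ∙ sym (*-hom conj β (₂ A))))
      ∙ (cong -_ (x̄≡re-im w₁)) ∙ solve 2 (λ x y → :- (x :- y) := :- x :+ y) refl (re w₁) (im w₁ * i)

  φ-exists : ∀ {A} → U₂ A → ∃ λ x → Φ A x
  φ-exists {A} U = go (hilbert90 (det-R U) (det-unitary U))
    where
    go : (∃ λ β → Unit β × β * det A ≡ β *̄) → ∃ λ x → Φ A x
    go (β , Uβ , eq) = φ-of A β , φ-graph U (Unit⇒≢0 Uβ) eq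

  i≢0 : i ≢ 0#
  i≢0 eq = 1≢0 (solve 0 (:nat 1 := :- (:- :nat 1)) refl ∙ (cong -_ (sym i² ∙ cong (_* i) eq ∙ zeroˡ i))
    ∙ -0#≈0#)

  2-cancel′ : ∀ {x y} → x + x ≡ y + y → x ≡ y
  2-cancel′ {x} {y} eq = halve eq ∙ sym (halve refl)

  matrix-injective : ∀ {r t u v r' t' u' v'} → matrix r t u v ≡ matrix r' t' u' v' →
    (r ≡ r') × (t ≡ t') × (u ≡ u') × (v ≡ v')
  matrix-injective {r} {t} {u} {v} {r'} {t'} {u'} {v'} eq =
    2-cancel′ (solve 2 (λ x y → x :+ x := (x :+ y) :+ (x :- y)) refl r (v * i)
      ∙ (cong₂ _+_ (cong ₁ eq) (cong ₄ eq)) ∙ solve 2 (λ x y → (x :+ y) :+ (x :- y) := x :+ x) refl r' (v' * i))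
      ,
    2-cancel′ (solve 2 (λ x y → x :+ x := (x :+ y) :- (:- x :+ y)) refl t (u * i)
      ∙ (cong₂ _-_ (cong ₂ eq) (cong ₃ eq))
      ∙ solve 2 (λ x y → (x :+ y) :- (:- x :+ y) := x :+ x) refl t' (u' * i)) ,
    i-cancel (2-cancel′ (solve 2 (λ x y → y :+ y := (x :+ y) :+ (:- x :+ y)) refl t (u * i)
      ∙ (cong₂ _+_ (cong ₂ eq) (cong ₃ eq))
      ∙ solve 2 (λ x y → (x :+ y) :+ (:- x :+ y) := y :+ y) refl t' (u' * i))) ,
    i-cancel (2-cancel′ (solve 2 (λ x y → y :+ y := (x :+ y) :- (x :- y)) refl r (v * i)
      ∙ (cong₂ _-_ (cong ₁ eq) (cong ₄ eq))
      ∙ solve 2 (λ x y → (x :+ y) :- (x :- y) := y :+ y) refl r' (v' * i)))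
    where
    i-cancel : ∀ {x y} → x * i ≡ y * i → x ≡ y
    i-cancel {x} {y} eq = ≢0-cancel i≢0 (*-comm i x ∙ eq ∙ *-comm y i)

  scale-matrix : ∀ k r t u v → scale k (matrix r t u v) ≡ matrix (k * r) (k * t) (k * u) (k * v)
  scale-matrix k r t u v = quad-≡
    (solve 4 (λ k x y i → k :* (x :+ y :* i) := k :* x :+ (k :* y) :* i) refl k r v i)
    (solve 4 (λ k x y i → k :* (x :+ y :* i) := k :* x :+ (k :* y) :* i) refl k t u i)
    (solve 4 (λ k x y i → k :* (:- x :+ y :* i) := :- (k :* x) :+ (k :* y) :* i) refl k t u i)
      (solve 4 (λ k x y i → k :* (x :- y :* i) := k :* x :- (k :* y) :* i) refl k r v i)

  scale-quaternion : ∀ k r t u v → scale k (quaternion r t u v) ≡ quaternion (k * r) (k * t) (k * u) (k * v)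
  scale-quaternion k r t u v = quad-≡ refl (neg u) (neg t) (neg v)
    where
    neg : ∀ x → k * (- x) ≡ - (k * x)
    neg x = solve 2 (λ k x → k :* (:- x) := :- (k :* x)) refl k x

  scale-scale : ∀ j k x → scale j (scale k x) ≡ scale (j * k) x
  scale-scale j k x = sym (quad-≡ (*-assoc j k _) (*-assoc j k _) (*-assoc j k _) (*-assoc j k _))

  scale-1 : ∀ x → scale 1# x ≡ x
  scale-1 x = quad-≡ (*-identityˡ _) (*-identityˡ _) (*-identityˡ _) (*-identityˡ _)

  ~ᴴ-trans : ∀ {x y w} → x ~ᴴ y → y ~ᴴ w → x ~ᴴ w
  ~ᴴ-trans {x} (k , Fk , k≢0 , refl) (l , Fl , l≢0 , refl) = l * k , Real-* Fl Fk , ≢0-* l≢0 k≢0 ,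
    scale-scale l k x

  ~ᴴ-sym : ∀ {x y} → x ~ᴴ y → y ~ᴴ x
  ~ᴴ-sym {x} (k , Fk , k≢0 , refl) = go (invertible k≢0)
    where
    go : Invertible k → scale k x ~ᴴ x
    go (l , kl) = l , inverse-Real Fk kl , (λ e → 1≢0 (sym kl ∙ cong (k *_) e ∙ zeroʳ k)) ,
      sym (scale-scale l k x ∙ cong (λ e → scale e x) (*-comm l k ∙ kl) ∙ scale-1 x)

  -- A zero quaternion would make the first row of βA vanish, whereas the first row of A has norm 1
  -- and β is nonzero.
  φ-nonzero : ∀ {A x} → U₂ A → Φ A x → Each Real x × x ≢ 0ᴴ
  φ-nonzero {A} {x} U (Φ-intro β β≢0 _ r t u v Fr Ft Fu Fv βA (k , Fk , k≢0 , x≡)) =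
    subst (Each Real) (sym x≡)
    (Real-* Fk Fr , Real-* Fk (Real-neg Fu) , Real-* Fk (Real-neg Ft) , Real-* Fk (Real-neg Fv)) , λ x≡0 →
    contradiction-0 (sym x≡ ∙ x≡0)
    where
    contradiction-0 : scale k (quaternion r t u v) ≡ 0ᴴ → ⊥
    contradiction-0 eq = β≢0 (sym (*-identityʳ β) ∙ cong (β *_) (sym (cong ₁ (U₂.AA* U)))
      ∙ solve 5 (λ β a a' b b' → β :* (a :* a' :+ b :* b') := (β :* a) :* a' :+ (β :* b) :* b') refl β (₁ A)
      (₁ A *̄) (₂ A) (₂ A *̄)
        ∙ cong₂ (λ p q → p * ₁ A *̄ + q * ₂ A *̄) (cong ₁ βA ∙ zero₂ r≡0 v≡0) (cong ₂ βA ∙ zero₂ t≡0 u≡0)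
          ∙ solve 2 (λ x y → :nat 0 :* x :+ :nat 0 :* y := :nat 0) refl (₁ A *̄) (₂ A *̄))
      where
      kill : ∀ {y} → k * y ≡ 0# → y ≡ 0#
      kill e = Sum.[ (λ k≡0 → ⊥-elim (k≢0 k≡0)) , (λ y≡0 → y≡0) ]′ (domain e)
      unneg : ∀ {y} → - y ≡ 0# → y ≡ 0#
      unneg {y} e = solve 1 (λ y → y := :- (:- y)) refl y ∙ (cong -_ e) ∙ -0#≈0#
      r≡0 = kill (cong ₁ eq)
      u≡0 = unneg (kill (cong ₂ eq))
      t≡0 = unneg (kill (cong ₃ eq))
      v≡0 = unneg (kill (cong ₄ eq))
      zero₂ : ∀ {x y} → x ≡ 0# → y ≡ 0# → x + y * i ≡ 0#
      zero₂ refl refl = solve 1 (λ i → :nat 0 :+ :nat 0 :* i := :nat 0) refl i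

  det-scale : ∀ ℓ A → det (scale ℓ A) ≡ ℓ * ℓ * det A
  det-scale ℓ A = solve 5 (λ l a b c d → (l :* a) :* (l :* d) :- (l :* b) :* (l :* c) :=
    l :* l :* (a :* d :- b :* c)) refl ℓ (₁ A) (₂ A) (₃ A) (₄ A)

  -- With B = ℓA one has γB = ε βA for ε = γℓ/β. The two determinant conditions together with ℓ ℓ̄ =
  -- 1 say that ε is its own conjugate, so the quaternions differ by a factor from F.
  φ-well-defined : ∀ {A B x y} → A ~ᵁ B → Φ A x → Φ B y → x ~ᴴ y
  φ-well-defined {A} {_} {x} {y} (ℓ , _ , ℓℓ̄ , refl) (Φ-intro β β≢0 βα r t u v Fr Ft Fu Fv βA sim)
    (Φ-intro γ γ≢0 γα r' t' u' v' _ _ _ _ γB sim') =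
      go (invertible β≢0)
    where
    go : Invertible β → x ~ᴴ y
    go (β⁻¹ , ββ⁻¹) = ~ᴴ-trans (~ᴴ-sym sim)
      (~ᴴ-trans (ε , ε-real , ε≢0 , sym (scale-quaternion ε r t u v ∙ quaternions)) sim')
      where
      ε = γ * ℓ * β⁻¹
      εβ : ε * β ≡ γ * ℓ
      εβ = *-assoc _ _ _ ∙ cong (γ * ℓ *_) (*-comm _ _ ∙ ββ⁻¹) ∙ (*-identityʳ _)
      ℓ≢0 : ℓ ≢ 0#
      ℓ≢0 e = 1≢0 (sym ℓℓ̄ ∙ cong (_* ℓ *̄) e ∙ (zeroˡ _))
      ε≢0 : ε ≢ 0#
      ε≢0 e = ≢0-* γ≢0 ℓ≢0 (sym εβ ∙ cong (_* β) e ∙ zeroˡ β)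
      ε-real : Real ε
      ε-real = ≢0-cancel (Endo-≢0 conj β≢0)
        (*-comm _ _ ∙ sym (*-hom conj ε β) ∙ (cong _*̄ εβ) ∙ *-hom conj γ ℓ
        ∙ cong (_* ℓ *̄) (sym γα ∙ cong (γ *_) (det-scale ℓ A))
          ∙ solve 4 (λ g l a l' → g :* (l :* l :* a) :* l' := (g :* l) :* a :* (l :* l')) refl γ ℓ (det A)
          (ℓ *̄)
        ∙ cong (γ * ℓ * det A *_) ℓℓ̄ ∙ *-identityʳ _ ∙ cong (_* det A) (sym εβ) ∙ (*-assoc ε β _)
          ∙ cong (ε *_) βα ∙ (*-comm _ _))
      matrices : matrix (ε * r) (ε * t) (ε * u) (ε * v) ≡ matrix r' t' u' v'
      matrices = sym (scale-matrix ε r t u v) ∙ cong (scale ε) (sym βA) ∙ scale-scale ε β A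
        ∙ cong (λ k → scale k A) εβ ∙ sym (scale-scale γ ℓ A) ∙ γB
      quaternions : quaternion (ε * r) (ε * t) (ε * u) (ε * v) ≡ quaternion r' t' u' v'
      quaternions = let (p , q , p' , q') = matrix-injective matrices in quad-≡ p (cong -_ p') (cong -_ q)
        (cong -_ q')

  i²+1 : i * i + 1# ≡ 0#
  i²+1 = cong (_+ 1#) i² ∙ -‿inverseˡ 1#

  -- The ring solver treats `i` as a variable; identities that rely on i² = -1 are stated with an
  -- explicit multiple of i² + 1, which is discarded here.
  drop-i² : ∀ x y → x + y * (i * i + 1#) ≡ x
  drop-i² x y = cong (λ e → x + y * e) i²+1 ∙ cong (x +_) (zeroʳ y) ∙ +-identityʳ x

  -- The matrices multiply as the quaternions r - u i - t j - v k do. Reading r, t, u, v back off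
  -- the product exchanges the second and third coordinates and changes the signs.
  matrix-* : ∀ r t u v r' t' u' v' → let q = quaternion r t u v *ᴴ quaternion r' t' u' v' in
    matrix r t u v *ᴹ matrix r' t' u' v' ≡ matrix (₁ q) (- ₃ q) (- ₂ q) (- ₄ q)
  matrix-* r t u v r' t' u' v' = quad-≡
    (solve 9 (λ r t u v r' t' u' v' i →
      (r :+ v :* i) :* (r' :+ v' :* i) :+ (t :+ u :* i) :* (:- t' :+ u' :* i) :=
       ((r :* r' :- (:- u) :* (:- u') :- (:- t) :* (:- t') :- (:- v) :* (:- v')) :+
         (:- (r :* (:- v') :+ (:- u) :* (:- t') :- (:- t) :* (:- u') :+ (:- v) :* r')) :* i) :+
         (v :* v' :+ u :* u') :* (i :* i :+ :nat 1)) refl r t u v r' t' u' v' i ∙ (drop-i² _ _))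
    (solve 9 (λ r t u v r' t' u' v' i → (r :+ v :* i) :* (t' :+ u' :* i) :+ (t :+ u :* i) :* (r' :- v' :* i) :=
       ((:- (r :* (:- t') :- (:- u) :* (:- v') :+ (:- t) :* r' :+ (:- v) :* (:- u'))) :+
         (:- (r :* (:- u') :+ (:- u) :* r' :+ (:- t) :* (:- v') :- (:- v) :* (:- t'))) :* i) :+
         (v :* u' :- u :* v') :* (i :* i :+ :nat 1)) refl r t u v r' t' u' v' i ∙ (drop-i² _ _))
    (solve 9 (λ r t u v r' t' u' v' i →
      (:- t :+ u :* i) :* (r' :+ v' :* i) :+ (r :- v :* i) :* (:- t' :+ u' :* i) :=
       ((:- (:- (r :* (:- t') :- (:- u) :* (:- v') :+ (:- t) :* r' :+ (:- v) :* (:- u')))) :+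
         (:- (r :* (:- u') :+ (:- u) :* r' :+ (:- t) :* (:- v') :- (:- v) :* (:- t'))) :* i) :+
         (u :* v' :- v :* u') :* (i :* i :+ :nat 1)) refl r t u v r' t' u' v' i ∙ (drop-i² _ _))
    (solve 9 (λ r t u v r' t' u' v' i →
      (:- t :+ u :* i) :* (t' :+ u' :* i) :+ (r :- v :* i) :* (r' :- v' :* i) :=
       ((r :* r' :- (:- u) :* (:- u') :- (:- t) :* (:- t') :- (:- v) :* (:- v')) :-
         (:- (r :* (:- v') :+ (:- u) :* (:- t') :- (:- t) :* (:- u') :+ (:- v) :* r')) :* i) :+
         (u :* u' :+ v :* v') :* (i :* i :+ :nat 1)) refl r t u v r' t' u' v' i ∙ (drop-i² _ _))

  scale-*ᴹ : ∀ j k A B → scale (j * k) (A *ᴹ B) ≡ scale j A *ᴹ scale k B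
  scale-*ᴹ j k A B = quad-≡ (distr (₁ A) (₁ B) (₂ A) (₃ B)) (distr (₁ A) (₂ B) (₂ A) (₄ B))
    (distr (₃ A) (₁ B) (₄ A) (₃ B)) (distr (₃ A) (₂ B) (₄ A) (₄ B))
    where
    distr : ∀ a b c d → (j * k) * (a * b + c * d) ≡ (j * a) * (k * b) + (j * c) * (k * d)
    distr a b c d = solve 6 (λ j k a b c d → (j :* k) :* (a :* b :+ c :* d) :=
      (j :* a) :* (k :* b) :+ (j :* c) :* (k :* d)) refl j k a b c d

  scale-*ᴴ : ∀ j k x y → scale (j * k) (x *ᴴ y) ≡ scale j x *ᴴ scale k y
  scale-*ᴴ j k (quad a b c d) (quad a' b' c' d') = quad-≡
    (solve 10 (λ j k a b c d a' b' c' d' → (j :* k) :* (a :* a' :- b :* b' :- c :* c' :- d :* d') :=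
      (j :* a) :* (k :* a') :- (j :* b) :* (k :* b') :- (j :* c) :* (k :* c') :- (j :* d) :* (k :* d')) refl j k
      a b c d a' b' c' d')
    (solve 10 (λ j k a b c d a' b' c' d' → (j :* k) :* (a :* b' :+ b :* a' :+ c :* d' :- d :* c') :=
      (j :* a) :* (k :* b') :+ (j :* b) :* (k :* a') :+ (j :* c) :* (k :* d') :- (j :* d) :* (k :* c')) refl j k
      a b c d a' b' c' d')
    (solve 10 (λ j k a b c d a' b' c' d' → (j :* k) :* (a :* c' :- b :* d' :+ c :* a' :+ d :* b') :=
      (j :* a) :* (k :* c') :- (j :* b) :* (k :* d') :+ (j :* c) :* (k :* a') :+ (j :* d) :* (k :* b')) refl j k
      a b c d a' b' c' d')
    (solve 10 (λ j k a b c d a' b' c' d' → (j :* k) :* (a :* d' :+ b :* c' :- c :* b' :+ d :* a') :=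
      (j :* a) :* (k :* d') :+ (j :* b) :* (k :* c') :- (j :* c) :* (k :* b') :+ (j :* d) :* (k :* a')) refl j k
      a b c d a' b' c' d')

  det-*ᴹ : ∀ A B → det (A *ᴹ B) ≡ det A * det B
  det-*ᴹ (quad a b c d) (quad a' b' c' d') =
    solve 8 (λ a b c d a' b' c' d' →
    (a :* a' :+ b :* c') :* (c :* b' :+ d :* d') :- (a :* b' :+ b :* d') :* (c :* a' :+ d :* c') :=
    (a :* d :- b :* c) :* (a' :* d' :- b' :* c')) refl a b c d a' b' c' d'

  φ-homomorphic : ∀ {A B x y} → Φ A x → Φ B y → Φ (A *ᴹ B) (x *ᴴ y)
  φ-homomorphic {A} {B} (Φ-intro β β≢0 βα r t u v Fr Ft Fu Fv βA (k , Fk , k≢0 , refl))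
    (Φ-intro γ γ≢0 γα r' t' u' v' Fr' Ft' Fu' Fv' γB (l , Fl , l≢0 , refl)) =
    let (F₁ , F₂ , F₃ , F₄) = *ᴴ-closed {Real} Real-+ Real-* Real-neg {quaternion r t u v} {quaternion r' t' u' v'} (Fr , Real-neg Fu , Real-neg Ft , Real-neg Fv) (Fr' , Real-neg Fu' , Real-neg Ft' , Real-neg Fv') in
    Φ-intro (β * γ) (≢0-* β≢0 γ≢0)
      (cong (β * γ *_) (det-*ᴹ A B)
        ∙ solve 4 (λ b g a a' → b :* g :* (a :* a') := (b :* a) :* (g :* a')) refl β γ (det A) (det B)
        ∙ (cong₂ _*_ βα γα) ∙ sym (*-hom conj β γ))
      (₁ q) (- ₃ q) (- ₂ q) (- ₄ q) F₁ (Real-neg F₃) (Real-neg F₂) (Real-neg F₄)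
      (scale-*ᴹ β γ A B ∙ (cong₂ _*ᴹ_ βA γB) ∙ matrix-* r t u v r' t' u' v')
      (k * l , Real-* Fk Fl , ≢0-* k≢0 l≢0 , sym (scale-*ᴴ k l (quaternion r t u v) (quaternion r' t' u' v'))
        ∙ cong (scale (k * l)) (quad-≡ refl (negneg (₂ q)) (negneg (₃ q)) (negneg (₄ q))))
    where
    q = quaternion r t u v *ᴴ quaternion r' t' u' v'
    negneg : ∀ x → x ≡ - (- x)
    negneg x = solve 1 (λ x → x := :- (:- x)) refl x

  -- From γB = ε βA one gets B = ℓA with ℓ = εβ/γ. That ℓ lies in R and has norm 1 is seen from the
  -- rows: ℓ is the top left entry of B times the adjoint of A.
  φ-injective : ∀ {A B x y} → U₂ A → U₂ B → Φ A x → Φ B y → x ~ᴴ y → A ~ᵁ B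
  φ-injective {A} {B} {x} {y} UA UB (Φ-intro β β≢0 _ r t u v _ _ _ _ βA sim)
    (Φ-intro γ γ≢0 _ r' t' u' v' _ _ _ _ γB sim') x~y =
    go (~ᴴ-trans sim (~ᴴ-trans x~y (~ᴴ-sym sim'))) (invertible γ≢0)
    where
    go : quaternion r t u v ~ᴴ quaternion r' t' u' v' → Invertible γ → A ~ᵁ B
    go (ε , _ , _ , q'≡) (γ⁻¹ , γγ⁻¹) = ℓ , R-ℓ , ℓ-unitary , B≡
      where
      neg-inj : ∀ {x y} → - x ≡ - y → x ≡ y
      neg-inj {x} {y} e = solve 1 (λ x → x := :- (:- x)) refl x ∙ (cong -_ e)
        ∙ solve 1 (λ y → :- (:- y) := y) refl y
      q'≡′ : quaternion r' t' u' v' ≡ quaternion (ε * r) (ε * t) (ε * u) (ε * v)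
      q'≡′ = q'≡ ∙ scale-quaternion ε r t u v
      same : matrix r' t' u' v' ≡ matrix (ε * r) (ε * t) (ε * u) (ε * v)
      same = matrix-cong (cong ₁ q'≡′) (neg-inj (cong ₃ q'≡′)) (neg-inj (cong ₂ q'≡′)) (neg-inj (cong ₄ q'≡′))
        where
        matrix-cong : ∀ {r t u v r' t' u' v'} → r ≡ r' → t ≡ t' → u ≡ u' → v ≡ v' →
          matrix r t u v ≡ matrix r' t' u' v'
        matrix-cong refl refl refl refl = refl
      ℓ = γ⁻¹ * (ε * β)
      γB≡ : scale γ B ≡ scale (ε * β) A
      γB≡ = γB ∙ same ∙ sym (scale-matrix ε r t u v) ∙ cong (scale ε) (sym βA) ∙ scale-scale ε β A
      B≡ : B ≡ scale ℓ A
      B≡ = sym (scale-1 B) ∙ cong (λ e → scale e B) (sym γγ⁻¹ ∙ *-comm γ γ⁻¹) ∙ sym (scale-scale γ⁻¹ γ B)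
        ∙ cong (scale γ⁻¹) γB≡ ∙ scale-scale γ⁻¹ (ε * β) A
      ℓ≡ : ₁ B * ₁ A *̄ + ₂ B * ₂ A *̄ ≡ ℓ
      ℓ≡ = cong₂ (λ p q → p * ₁ A *̄ + q * ₂ A *̄) (cong ₁ B≡) (cong ₂ B≡)
        ∙ solve 5 (λ l a a' b b' → (l :* a) :* a' :+ (l :* b) :* b' := l :* (a :* a' :+ b :* b')) refl ℓ (₁ A)
        (₁ A *̄) (₂ A) (₂ A *̄) ∙ cong (ℓ *_) (cong ₁ (U₂.AA* UA)) ∙ *-identityʳ ℓ
      R-ℓ : R ℓ
      R-ℓ = subst R ℓ≡ (let (Ra , Rb , _) = U₂.entries UA ; (Ra' , Rb' , _) = U₂.entries UB in R-+
        (R-* Ra' (R-conj Ra)) (R-* Rb' (R-conj Rb)))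
      ℓ-unitary : ℓ * ℓ *̄ ≡ 1#
      ℓ-unitary = sym (*-identityʳ _) ∙ cong (ℓ * ℓ *̄ *_) (sym (cong ₁ (U₂.AA* UA)))
          ∙ solve 6 (λ l l' a a' b b' → (l :* l') :* (a :* a' :+ b :* b') :=
            (l :* a) :* (l' :* a') :+ (l :* b) :* (l' :* b')) refl ℓ (ℓ *̄) (₁ A) (₁ A *̄) (₂ A) (₂ A *̄)
          ∙ (cong₂ _+_ (cong₂ _*_ (sym (cong ₁ B≡)) (sym (*-hom conj ℓ (₁ A)) ∙ (cong _*̄ (sym (cong ₁ B≡)))))
            (cong₂ _*_ (sym (cong ₂ B≡)) (sym (*-hom conj ℓ (₂ A)) ∙ (cong _*̄ (sym (cong ₂ B≡))))))
        ∙ cong ₁ (U₂.AA* UB)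

  -- Since 1/2 lies in R, the generator (1 + i + j + k)/2 adds nothing to the quaternions with
  -- coordinates in R ∩ F, and these are the whole order.
  M : Quad → Set
  M = Each RealR

  record Mˣ (x : Quad) : Set where
    constructor Mˣ-intro
    field
      member  : M x
      inverse : Quad
      inverse-member : M inverse
      inverseʳ : x *ᴴ inverse ≡ 1ᴴ
      inverseˡ : inverse *ᴴ x ≡ 1ᴴ

  N : Quad → K
  N (quad a b c d) = a * a + b * b + c * c + d * d

  N-* : ∀ x y → N (x *ᴴ y) ≡ N x * N y
  N-* (quad a b c d) (quad a' b' c' d') = solve 8 (λ a b c d a' b' c' d' →
      (a :* a' :- b :* b' :- c :* c' :- d :* d') :* (a :* a' :- b :* b' :- c :* c' :- d :* d') :+
      (a :* b' :+ b :* a' :+ c :* d' :- d :* c') :* (a :* b' :+ b :* a' :+ c :* d' :- d :* c') :+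
      (a :* c' :- b :* d' :+ c :* a' :+ d :* b') :* (a :* c' :- b :* d' :+ c :* a' :+ d :* b') :+
      (a :* d' :+ b :* c' :- c :* b' :+ d :* a') :* (a :* d' :+ b :* c' :- c :* b' :+ d :* a') :=
      (a :* a :+ b :* b :+ c :* c :+ d :* d) :* (a' :* a' :+ b' :* b' :+ c' :* c' :+ d' :* d')) refl a b c d a'
        b' c' d'

  N-R : ∀ {x} → Each R x → R (N x)
  N-R (a , b , c , d) = R-+ (R-+ (R-+ (R-* a a) (R-* b b)) (R-* c c)) (R-* d d)

  N-real : ∀ {x} → Each Real x → Real (N x)
  N-real (a , b , c , d) = Real-+ (Real-+ (Real-+ (Real-* a a) (Real-* b b)) (Real-* c c)) (Real-* d d)

  M⇒R : ∀ {x} → M x → Each R x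
  M⇒R ((a , _) , (b , _) , (c , _) , (d , _)) = a , b , c , d

  M⇒Real : ∀ {x} → M x → Each Real x
  M⇒Real ((_ , a) , (_ , b) , (_ , c) , (_ , d)) = a , b , c , d

  conjugate : K → Quad → Quad
  conjugate k (quad a b c d) = quad (k * a) (k * (- b)) (k * (- c)) (k * (- d))

  conjugateʳ : ∀ k x → N x * k ≡ 1# → x *ᴴ conjugate k x ≡ 1ᴴ
  conjugateʳ k (quad a b c d) eq = quad-≡
    (solve 5 (λ k a b c d → a :* (k :* a) :- b :* (k :* (:- b)) :- c :* (k :* (:- c)) :- d :* (k :* (:- d)) :=
      (a :* a :+ b :* b :+ c :* c :+ d :* d) :* k) refl k a b c d ∙ eq)
    (solve 5 (λ k a b c d → a :* (k :* (:- b)) :+ b :* (k :* a) :+ c :* (k :* (:- d)) :- d :* (k :* (:- c)) :=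
      :nat 0) refl k a b c d)
    (solve 5 (λ k a b c d → a :* (k :* (:- c)) :- b :* (k :* (:- d)) :+ c :* (k :* a) :+ d :* (k :* (:- b)) :=
      :nat 0) refl k a b c d)
    (solve 5 (λ k a b c d → a :* (k :* (:- d)) :+ b :* (k :* (:- c)) :- c :* (k :* (:- b)) :+ d :* (k :* a) :=
      :nat 0) refl k a b c d)

  conjugateˡ : ∀ k x → N x * k ≡ 1# → conjugate k x *ᴴ x ≡ 1ᴴ
  conjugateˡ k (quad a b c d) eq = quad-≡
    (solve 5 (λ k a b c d → (k :* a) :* a :- (k :* (:- b)) :* b :- (k :* (:- c)) :* c :- (k :* (:- d)) :* d :=
      (a :* a :+ b :* b :+ c :* c :+ d :* d) :* k) refl k a b c d ∙ eq)
    (solve 5 (λ k a b c d → (k :* a) :* b :+ (k :* (:- b)) :* a :+ (k :* (:- c)) :* d :- (k :* (:- d)) :* c :=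
      :nat 0) refl k a b c d)
    (solve 5 (λ k a b c d → (k :* a) :* c :- (k :* (:- b)) :* d :+ (k :* (:- c)) :* a :+ (k :* (:- d)) :* b :=
      :nat 0) refl k a b c d)
    (solve 5 (λ k a b c d → (k :* a) :* d :+ (k :* (:- b)) :* c :- (k :* (:- c)) :* b :+ (k :* (:- d)) :* a :=
      :nat 0) refl k a b c d)

  M-unit : ∀ {x} → M x → Unit (N x) → Mˣ x
  M-unit {x} Mx (_ , k , Rk , Nk) =
    Mˣ-intro Mx (conjugate k x) (let ((a , a') , (b , b') , (c , c') , (d , d')) = Mx in
      (R-* Rk a , Real-* Fk a') , (R-* Rk (R-neg b) , Real-* Fk (Real-neg b')) ,
        (R-* Rk (R-neg c) , Real-* Fk (Real-neg c')) , (R-* Rk (R-neg d) , Real-* Fk (Real-neg d')))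
      (conjugateʳ k x Nk) (conjugateˡ k x Nk)
    where
    Fk : Real k
    Fk = inverse-Real (N-real (M⇒Real Mx)) Nk

  re²+im² : ∀ x → re x * re x + im x * im x ≡ x * x *̄
  re²+im² x = sym ((cong₂ _*_ (x≡re+im x) (x̄≡re-im x))
    ∙ solve 3 (λ r s i → (r :+ s :* i) :* (r :- s :* i) :=
    (r :* r :+ s :* s) :+ (:- (s :* s)) :* (i :* i :+ :nat 1)) refl (re x) (im x) i ∙ (drop-i² _ _))

  -- `hilbert90` supplies a β that is a unit of R. The resulting quaternion has coordinates in R and
  -- norm β β̄, a unit; any other choice of β gives the same class.
  φ-in-M : ∀ {A x} → U₂ A → Φ A x → ∃ λ μ → Mˣ μ × μ ~ᴴ x
  φ-in-M {A} {x} U Φx = go (hilbert90 (det-R U) (det-unitary U))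
    where
    go : (∃ λ β → Unit β × β * det A ≡ β *̄) → ∃ λ μ → Mˣ μ × μ ~ᴴ x
    go (β , Uβ@(Rβ , _) , eq) = μ , M-unit Mμ (subst Unit (sym Nμ) (Unit-* Uβ (Unit-conj Uβ))) ,
        φ-well-defined {A} {A} (1# , R-1 , cong (1# *_) (1-hom conj) ∙ *-identityˡ 1# , sym (scale-1 A))
          (φ-graph U (Unit⇒≢0 Uβ) eq) Φx
      where
      μ = φ-of A β
      z₁ = β * ₁ A
      w₁ = β * ₂ A
      Rz : R z₁
      Rz = R-* Rβ (proj₁ (U₂.entries U))
      Rw : R w₁
      Rw = R-* Rβ (proj₁ (proj₂ (U₂.entries U)))
      Mμ : M μ
      Mμ = (R-re Rz , re-real z₁) , (R-neg (R-im Rw) , Real-neg (im-real w₁)) ,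
        (R-neg (R-re Rw) , Real-neg (re-real w₁)) , (R-neg (R-im Rz) , Real-neg (im-real z₁))
      Nμ : N μ ≡ β * β *̄
      Nμ = solve 4 (λ r t u v → r :* r :+ (:- u) :* (:- u) :+ (:- t) :* (:- t) :+ (:- v) :* (:- v) :=
        (r :* r :+ v :* v) :+ (t :* t :+ u :* u)) refl (re z₁) (re w₁) (im w₁) (im z₁)
        ∙ (cong₂ _+_ (re²+im² z₁) (re²+im² w₁))
          ∙ cong₂ (λ p q → z₁ * p + w₁ * q) (*-hom conj β (₁ A)) (*-hom conj β (₂ A))
        ∙ solve 6 (λ β β' a a' b b' → (β :* a) :* (β' :* a') :+ (β :* b) :* (β' :* b') :=
          (β :* β') :* (a :* a' :+ b :* b')) refl β (β *̄) (₁ A) (₁ A *̄) (₂ A) (₂ A *̄)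
          ∙ cong (β * β *̄ *_) (cong ₁ (U₂.AA* U)) ∙ (*-identityʳ _)

  -- The matrix of μ has determinant `N μ` and is unitary up to this factor, which is a sum of two
  -- norms and a unit. Writing it as β β̄ by `unit-norm` and dividing by β gives a unitary matrix
  -- with determinant β̄/β.
  φ-onto-M : ∀ {μ} → Mˣ μ → ∃ λ A → U₂ A × Φ A μ
  φ-onto-M {μ} (Mˣ-intro Mμ μ' Mμ' μμ' _) = go (unit-norm (N-real (M⇒Real Mμ)) UN (Z , W , sum))
    where
    r = ₁ μ
    u = - ₂ μ
    t = - ₃ μ
    v = - ₄ μ
    F = M⇒Real Mμ
    Fr : Real r
    Fr = proj₁ F
    Fu : Real u
    Fu = Real-neg (proj₁ (proj₂ F))
    Ft : Real t
    Ft = Real-neg (proj₁ (proj₂ (proj₂ F)))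
    Fv : Real v
    Fv = Real-neg (proj₂ (proj₂ (proj₂ F)))
    Z = r + v * i
    W = t + u * i
    conj-lin : ∀ {x y} → Real x → Real y → (x + y * i) *̄ ≡ x - y * i
    conj-lin {x} {y} Fx Fy = +-hom conj _ _ ∙ (cong₂ _+_ Fx (*-hom conj y i ∙ (cong₂ _*_ Fy conj-i)))
      ∙ solve 3 (λ x y i → x :+ y :* (:- i) := x :- y :* i) refl x y i
    Z̄ : Z *̄ ≡ r - v * i
    Z̄ = conj-lin Fr Fv
    W̄ : W *̄ ≡ t - u * i
    W̄ = conj-lin Ft Fu
    sum : N μ ≡ Z * Z *̄ + W * W *̄
    sum = sym (cong₂ (λ p q → Z * p + W * q) Z̄ W̄
      ∙ solve 5 (λ a b c d i → (a :+ (:- d) :* i) :* (a :- (:- d) :* i) :+ ((:- c) :+ (:- b) :* i) :*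
      ((:- c) :- (:- b) :* i) :=
      (a :* a :+ b :* b :+ c :* c :+ d :* d) :+ (:- (d :* d :+ b :* b)) :* (i :* i :+ :nat 1)) refl (₁ μ) (₂ μ)
      (₃ μ) (₄ μ) i ∙ (drop-i² _ _))
    UN : Unit (N μ)
    UN = N-R (M⇒R Mμ) , N μ' , N-R (M⇒R Mμ') , sym (N-* μ μ') ∙ cong N μμ'
      ∙ solve 0 (:nat 1 :* :nat 1 :+ :nat 0 :* :nat 0 :+ :nat 0 :* :nat 0 :+ :nat 0 :* :nat 0 := :nat 1) refl
    go : (∃ λ β → Unit β × β * β *̄ ≡ N μ) → ∃ λ A → U₂ A × Φ A μ
    go (β , Uβ@(Rβ , γ , Rγ , βγ) , ββ̄) = A ,
      record { entries = R-* Rγ RZ , R-* Rγ RW , R-* Rγ R₃ , R-* Rγ R₄ ; AA* = AA* ; A*A = A*A } ,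
        Φ-intro β (Unit⇒≢0 Uβ) βdet r t u v Fr Ft Fu Fv
          (scale-scale β γ (matrix r t u v) ∙ cong (λ e → scale e (matrix r t u v)) βγ ∙ (scale-1 _))
          (1# , 1-hom conj , 1≢0 , sym (scale-1 _ ∙ quad-≡ refl (negneg (₂ μ)) (negneg (₃ μ)) (negneg (₄ μ))))
      where
      negneg : ∀ x → - (- x) ≡ x
      negneg x = solve 1 (λ x → :- (:- x) := x) refl x
      A = scale γ (matrix r t u v)
      RM = M⇒R Mμ
      Rr = proj₁ RM
      Ru = R-neg (proj₁ (proj₂ RM))
      Rt = R-neg (proj₁ (proj₂ (proj₂ RM)))
      Rv = R-neg (proj₂ (proj₂ (proj₂ RM)))
      RZ = R-+ Rr (R-* Rv R-i)
      RW = R-+ Rt (R-* Ru R-i)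
      R₃ = R-+ (R-neg Rt) (R-* Ru R-i)
      R₄ = R-− Rr (R-* Rv R-i)
      γ̄β̄ : γ *̄ * β *̄ ≡ 1#
      γ̄β̄ = sym (*-hom conj γ β) ∙ (cong _*̄ (*-comm γ β ∙ βγ)) ∙ 1-hom conj
      γγ̄N : γ * γ *̄ * (Z * Z *̄ + W * W *̄) ≡ 1#
      γγ̄N = cong (γ * γ *̄ *_) (sym sum ∙ sym ββ̄)
        ∙ solve 4 (λ g g' b b' → g :* g' :* (b :* b') := (b :* g) :* (g' :* b')) refl γ (γ *̄) β (β *̄)
        ∙ (cong₂ _*_ βγ γ̄β̄) ∙ *-identityˡ 1#
      m₃ : - t + u * i ≡ - W *̄
      m₃ = sym ((cong -_ W̄) ∙ solve 2 (λ x y → :- (x :- y) := :- x :+ y) refl t (u * i))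
      A≡ : A ≡ quad (γ * Z) (γ * W) (γ * (- W *̄)) (γ * Z *̄)
      A≡ = quad-≡ refl refl (cong (γ *_) m₃) (cong (γ *_) (sym Z̄))
      adjoint≡ : adjoint A ≡ quad (γ *̄ * Z *̄) (γ *̄ * (- W)) (γ *̄ * W *̄) (γ *̄ * Z)
      adjoint≡ = cong adjoint A≡
        ∙ quad-≡ (*-hom conj γ Z)
        (*-hom conj γ _ ∙ cong (γ *̄ *_) (neg-hom conj _ ∙ (cong -_ (conj-involutive W)))) (*-hom conj γ W)
        (*-hom conj γ _ ∙ cong (γ *̄ *_) (conj-involutive Z))
      AA* : A *ᴹ adjoint A ≡ idᴹ
      AA* = (cong₂ _*ᴹ_ A≡ adjoint≡) ∙ quad-≡
        (solve 6 (λ g g' z z' w w' → (g :* z) :* (g' :* z') :+ (g :* w) :* (g' :* w') :=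
          g :* g' :* (z :* z' :+ w :* w')) refl γ (γ *̄) Z (Z *̄) W (W *̄) ∙ γγ̄N)
        (solve 4 (λ g g' z w → (g :* z) :* (g' :* (:- w)) :+ (g :* w) :* (g' :* z) := :nat 0) refl γ (γ *̄) Z W)
        (solve 4 (λ g g' z' w' → (g :* (:- w')) :* (g' :* z') :+ (g :* z') :* (g' :* w') := :nat 0) refl γ
          (γ *̄) (Z *̄) (W *̄))
        (solve 6 (λ g g' z z' w w' → (g :* (:- w')) :* (g' :* (:- w)) :+ (g :* z') :* (g' :* z) :=
          g :* g' :* (z :* z' :+ w :* w')) refl γ (γ *̄) Z (Z *̄) W (W *̄) ∙ γγ̄N)
      A*A : adjoint A *ᴹ A ≡ idᴹ
      A*A = (cong₂ _*ᴹ_ adjoint≡ A≡) ∙ quad-≡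
        (solve 6 (λ g g' z z' w w' → (g' :* z') :* (g :* z) :+ (g' :* (:- w)) :* (g :* (:- w')) :=
          g :* g' :* (z :* z' :+ w :* w')) refl γ (γ *̄) Z (Z *̄) W (W *̄) ∙ γγ̄N)
        (solve 4 (λ g g' z' w → (g' :* z') :* (g :* w) :+ (g' :* (:- w)) :* (g :* z') := :nat 0) refl γ (γ *̄)
          (Z *̄) W)
        (solve 4 (λ g g' z w' → (g' :* w') :* (g :* z) :+ (g' :* z) :* (g :* (:- w')) := :nat 0) refl γ (γ *̄) Z
          (W *̄))
        (solve 6 (λ g g' z z' w w' → (g' :* w') :* (g :* w) :+ (g' :* z) :* (g :* z') :=
          g :* g' :* (z :* z' :+ w :* w')) refl γ (γ *̄) Z (Z *̄) W (W *̄) ∙ γγ̄N)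
      βdet : β * det A ≡ β *̄
      βdet = cong (β *_) (cong det A≡
        ∙ solve 5 (λ g z z' w w' → (g :* z) :* (g :* z') :- (g :* w) :* (g :* (:- w')) :=
        g :* g :* (z :* z' :+ w :* w')) refl γ Z (Z *̄) W (W *̄))
        ∙ cong (λ e → β * (γ * γ * e)) (sym sum ∙ sym ββ̄)
          ∙ solve 3 (λ b g b' → b :* (g :* g :* (b :* b')) := (b :* g) :* (b :* g) :* b') refl β γ (β *̄)
          ∙ cong (λ e → e * e * β *̄) βγ ∙ cong (_* β *̄) (*-identityˡ 1#) ∙ (*-identityˡ _)

  -- k is the first coordinate of μ' times the inverse of μ, a product of two elements with
  -- coordinates in R.
  scalar-in-R : ∀ {μ μ' k} → Mˣ μ → M μ' → μ' ≡ scale k μ → R k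
  scalar-in-R {μ} {μ'} {k} (Mˣ-intro _ ν Mν μν _) Mμ' eq =
    subst R first (proj₁ (*ᴴ-closed {R} R-+ R-* R-neg {μ'} {ν} (M⇒R Mμ') (M⇒R Mν)))
    where
    first : ₁ (μ' *ᴴ ν) ≡ k
    first = cong (λ q → ₁ (q *ᴴ ν)) eq
      ∙ solve 9 (λ k a b c d a' b' c' d' →
      (k :* a) :* a' :- (k :* b) :* b' :- (k :* c) :* c' :- (k :* d) :* d' :=
      k :* (a :* a' :- b :* b' :- c :* c' :- d :* d')) refl k (₁ μ) (₂ μ) (₃ μ) (₄ μ) (₁ ν) (₂ ν) (₃ ν) (₄ ν)
      ∙ cong (k *_) (cong ₁ μν) ∙ *-identityʳ k

  M-inclusion : ∀ {μ μ'} → Mˣ μ → Mˣ μ' → μ ~ᴴ μ' → ∃ λ k →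
    RealR k × (∃ λ l → RealR l × k * l ≡ 1#) × μ' ≡ scale k μ
  M-inclusion {μ} {μ'} U U' (k , Fk , k≢0 , eq) = go (invertible k≢0)
    where
    go : Invertible k → ∃ λ k → RealR k × (∃ λ l → RealR l × k * l ≡ 1#) × μ' ≡ scale k μ
    go (l , kl) = k , (scalar-in-R U (Mˣ.member U') eq , Fk) ,
      (l , (scalar-in-R U' (Mˣ.member U) back , inverse-Real Fk kl) , kl) , eq
      where
      back : μ ≡ scale l μ'
      back = sym (cong (scale l) eq ∙ scale-scale l k μ ∙ cong (λ e → scale e μ) (*-comm l k ∙ kl) ∙ scale-1 μ)

-- The two families of levels, and transfer to the concrete definitions.

all-toList : ∀ {P : ℚ → Set} {d} (v : Vec ℚ d) → (∀ i → P (V.lookup v i)) → All P (V.toList v)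
all-toList [] p = []
all-toList (x ∷ v) p = p zero ∷ all-toList v (λ i → p (suc i))

toList-all : ∀ {P : ℚ → Set} {d} (v : Vec ℚ d) → All P (V.toList v) → ∀ i → P (V.lookup v i)
toList-all (x ∷ v) (p ∷ ps) zero = p
toList-all (x ∷ v) (p ∷ ps) (suc i) = toList-all v ps i

record Level (f : Family) (s : ℕ) : Set where
  open Reduction f s
  open Algebra′ algebra using (ι; _^_; _*_; _-_; 1#; ev)
  field
    c             : ℚ
    m J           : ℕ
    shape         : Shape c m J
    deg≡          : deg f s ≡ m ℕ.+ m
    level≡        : level f s ≡ halfOf shape ℕ.+ halfOf shape
    quarter≡      : level f s ℕ./ 4 ≡ quarterOf shape
    ev-correction : ∀ z o → ev z (V.toList (correction f s o)) ≡ ι o * (ι c * z ^ m - 1#)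

module Instance (f : Family) (s : ℕ) (lev : Level f s) where
  open Level lev
  open Reduction f s
  private
    module B = Basis m (shape>0 shape) deg≡ c ev-correction

  cyclotomic : Cyclotomic
  cyclotomic = record
    { A = algebra
    ; _≟_ = V.≡-dec ℚ._≟_
    ; c = c ; m = m ; J = J ; shape = shape
    ; ζ = ζ
    ; coeffs = V.toList
    ; coeffs-length = λ x → V.length-toList x ∙ deg≡
    ; ev-coeffs = λ x → sym (reduce≡ev (V.toList x)) ∙ reduce-toList x
    ; coeffs-ev = λ p j eq → cong V.toList (sym (reduce≡ev p)) ∙ toList-reduce p j (eq ∙ sym deg≡)
    ; coeffs-all = λ {P} sub {p} ps →
      subst (λ v → All P (V.toList v)) (reduce≡ev p) (all-toList (reduce f s p) (reduce-all sub ps))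
    ; relation = B.relation
    ; substitution = λ z root p → cong (λ v → Algebra′.ev algebra z (V.toList v)) (sym (reduce≡ev p))
      ∙ B.substitution z root p
    }

  open WeberTheorem cyclotomic public hiding (K; ζ; c; m; J; shape; X)

  reduce-monomial : ∀ k → reduce f s (monomial k) ≡ ζ ^ k
  reduce-monomial k = reduce≡ev (monomial k) ∙ ev-monomial ζ k

  -- The fold in `conjK` is Horner's scheme at ζⁿ⁻¹, and n - 1 is the exponent that defines ζ̄.
  conjK≡ : ∀ a → conjK f s a ≡ a *̄
  conjK≡ a = horner (V.toList a) ∙ cong (λ k → ev (ζ ^ (k ∸ 1)) (V.toList a)) level≡
    where
    k = Defs.n f s ∸ 1
    horner : ∀ l → reduce f s (L.foldr (λ c acc → (c ∷ []) +P (monomial k *P acc)) [] l) ≡ ev (ζ ^ k) l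
    horner [] = refl
    horner (x ∷ l) = reduce≡ev ((x ∷ []) +P (monomial k *P acc)) ∙ ev-+P ζ (x ∷ []) (monomial k *P acc)
        ∙ (cong₂ _+_ (cong (ι x +_) (zeroʳ ζ) ∙ +-identityʳ (ι x))
          (ev-*P ζ (monomial k) acc ∙ (cong₂ _*_ (ev-monomial ζ k) (sym (reduce≡ev acc) ∙ horner l))))
      where acc = L.foldr (λ c acc → (c ∷ []) +P (monomial k *P acc)) [] l

  sqrt-1≡ : sqrt-1 f s ≡ I
  sqrt-1≡ = reduce-monomial (Defs.n f s ℕ./ 4) ∙ cong (ζ ^_) quarter≡

  InR⇒R : ∀ {a} → InR f s a → R a
  InR⇒R {a} = all-toList a

  R⇒InR : ∀ {a} → R a → InR f s a
  R⇒InR {a} = toList-all a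

  ½·≡ : ∀ a → _·K_ f s ½ a ≡ h * a
  ½·≡ a = sym (⊛-comm h a ∙ ⊛-⊙ ½ a 𝟙 ∙ cong (½ ⊙_) (⊛-identityʳ a))

level-pow2 : ∀ s → Level pow2 (suc (suc (suc s)))
level-pow2 s = record
  -- n = 2^(s + 3) = 4 · 2^(s + 1).
  { c = 0ℚ ; m = m ; J = suc s
  ; shape = gaussian refl refl
  ; deg≡ = cong (m ℕ.+_) (ℕ.+-identityʳ m)
  ; level≡ = ℕS.solve 1 (λ m → ℕS.con 2 ℕS.:* (ℕS.con 2 ℕS.:* m) ℕS.:= (m ℕS.:+ m) ℕS.:+ (m ℕS.:+ m)) refl m
  ; quarter≡ = cong (ℕ._/ 4)
    (ℕS.solve 1 (λ m → ℕS.con 2 ℕS.:* (ℕS.con 2 ℕS.:* m) ℕS.:= m ℕS.:* ℕS.con 4) refl m) ∙ ℕ.m*n/n≡m m 4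
  ; ev-correction = λ z o → ev-delta z 0 (ℚ.- o) (ℕ.m^n>0 2 (suc (suc s))) ∙ cong (_* 1#) (ι-neg o)
      ∙ solve 2 (λ o w → (:- o) :* :nat 1 := o :* (:nat 0 :* w :- :nat 1)) refl (ι o) (z ^ m)
        ∙ cong (λ t → ι o * (t * z ^ m - 1#)) (sym ι-0)
  }
  where
  m = 2 ℕ.^ suc s
  open Reduction pow2 (suc (suc (suc s)))
  open Algebra′ algebra

level-3pow2 : ∀ s → Level 3pow2 (suc (suc s))
level-3pow2 s = record
  -- n = 3 · 2^(s + 2) = 12 · 2ˢ, and m = n/6.
  { c = 1ℚ ; m = m ; J = s
  ; shape = eisenstein refl m≡
  ; deg≡ = cong (m ℕ.+_) (ℕ.+-identityʳ m)
  ; level≡ = ℕS.solve 1 (λ m →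
    ℕS.con 3 ℕS.:* (ℕS.con 2 ℕS.:* m) ℕS.:= (m ℕS.:+ (m ℕS.:+ m)) ℕS.:+ (m ℕS.:+ (m ℕS.:+ m))) refl m
  ; quarter≡ = cong (ℕ._/ 4)
    (ℕS.solve 1 (λ k → ℕS.con 3 ℕS.:* (ℕS.con 2 ℕS.:* (ℕS.con 2 ℕS.:* k)) ℕS.:= (ℕS.con 3 ℕS.:* k) ℕS.:* ℕS.con
    4) refl (2 ℕ.^ s)) ∙ ℕ.m*n/n≡m (3 ℕ.* 2 ℕ.^ s) 4
  ; ev-correction = λ z o → cong (λ v → ev z (V.toList v)) (sym (zipWith-tabulate {F = low o} {G = high o}))
    ∙ cong (ev z) (toList-⊕ (V.tabulate (low o)) (V.tabulate (high o)))
    ∙ ev-+P z (V.toList (V.tabulate (low o))) (V.toList (V.tabulate (high o)))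
      ∙ (cong₂ _+_ (ev-delta z 0 (ℚ.- o) (ℕ.m^n>0 2 (suc (suc s))) ∙ cong (_* 1#) (ι-neg o))
        (ev-delta z m o m<2m))
      ∙ solve 2 (λ o w → (:- o) :* :nat 1 :+ o :* w := o :* (:nat 1 :* w :- :nat 1)) refl (ι o) (z ^ m)
        ∙ cong (λ t → ι o * (t * z ^ m - 1#)) (sym ι-1)
  }
  where
  m = 2 ℕ.^ suc s
  m≡ : m ≡ 2 ℕ.^ s ℕ.+ 2 ℕ.^ s
  m≡ = cong (2 ℕ.^ s ℕ.+_) (ℕ.+-identityʳ (2 ℕ.^ s))
  m<2m : m ℕ.< 2 ℕ.* m
  m<2m = ℕ.^-monoʳ-< 2 (ℕ.s≤s (ℕ.s≤s ℕ.z≤n)) (ℕ.n<1+n (suc s))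
  open Reduction 3pow2 (suc (suc s))
  open Algebra′ algebra
  low high : ℚ → Fin (deg 3pow2 (suc (suc s))) → ℚ
  low o i = if toℕ i ≡ᵇ 0 then ℚ.- o else 0ℚ
  high o i = if toℕ i ≡ᵇ m then o else 0ℚ

-- The bound leaves 2ˢ with s ≥ 3 and 3 · 2ˢ with s ≥ 2, so that 4 divides n in every case.
levelOf : ∀ f s → 8 ≤ level f s → Level f s
levelOf pow2 (suc (suc (suc s))) _ = level-pow2 s
levelOf pow2 0 (ℕ.s≤s ())
levelOf pow2 1 (ℕ.s≤s (ℕ.s≤s ()))
levelOf pow2 2 (ℕ.s≤s (ℕ.s≤s (ℕ.s≤s (ℕ.s≤s ()))))
levelOf 3pow2 (suc (suc s)) _ = level-3pow2 s
levelOf 3pow2 0 (ℕ.s≤s (ℕ.s≤s (ℕ.s≤s ())))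
levelOf 3pow2 1 (ℕ.s≤s (ℕ.s≤s (ℕ.s≤s (ℕ.s≤s (ℕ.s≤s (ℕ.s≤s ()))))))

module Transfer (f : Family) (s : ℕ) (lev : Level f s) where
  open Instance f s lev

  i : Defs.K f s
  i = sqrt-1 f s

  i² : i * i ≡ - 1#
  i² = (cong₂ _*_ sqrt-1≡ sqrt-1≡) ∙ I²

  conj-i : i *̄ ≡ - i
  conj-i = (cong _*̄ sqrt-1≡) ∙ conj-I ∙ (cong -_ (sym sqrt-1≡))

  R-i : R i
  R-i = subst R (sym sqrt-1≡) (R-^ (quarterOf (Level.shape lev)) R-ζ)

  open UnitaryGroup cyclotomic i i² conj-i R-i

  fromM : Mat f s → Quad
  fromM (mat a b c d) = quad a b c d

  toM : Quad → Mat f s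
  toM (quad a b c d) = mat a b c d

  fromQ : Quat f s → Quad
  fromQ (quat a b c d) = quad a b c d

  toQ : Quad → Quat f s
  toQ (quad a b c d) = quat a b c d

  F⇒Real : ∀ {a} → InF f s a → Real a
  F⇒Real {a} p = sym (conjK≡ a) ∙ p

  Real⇒F : ∀ {a} → Real a → InF f s a
  Real⇒F {a} p = conjK≡ a ∙ p

  adj≡ : ∀ A → fromM (adj f s A) ≡ adjoint (fromM A)
  adj≡ A = quad-≡ (conjK≡ (m11 A)) (conjK≡ (m21 A)) (conjK≡ (m12 A)) (conjK≡ (m22 A))

  U⇒ : ∀ {A} → IsU2R f s A → U₂ (fromM A)
  U⇒ {A} ((a , b , c , d) , AA* , A*A) = record
    { entries = InR⇒R a , InR⇒R b , InR⇒R c , InR⇒R d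
    ; AA* = cong (fromM A *ᴹ_) (sym (adj≡ A)) ∙ cong fromM AA*
    ; A*A = cong (_*ᴹ fromM A) (sym (adj≡ A)) ∙ cong fromM A*A }

  ⇒U : ∀ {A} → U₂ A → IsU2R f s (toM A)
  ⇒U {A} U = let (a , b , c , d) = U₂.entries U in (R⇒InR a , R⇒InR b , R⇒InR c , R⇒InR d) ,
    cong toM (cong (A *ᴹ_) (adj≡ (toM A)) ∙ U₂.AA* U) , cong toM (cong (_*ᴹ A) (adj≡ (toM A)) ∙ U₂.A*A U)

  ~H⇒ : ∀ {x y} → _≈HF_ f s x y → fromQ x ~ᴴ fromQ y
  ~H⇒ (c , Fc , c≢0 , eq) = c , F⇒Real Fc , c≢0 , cong fromQ eq

  ⇒~H : ∀ {x y} → x ~ᴴ y → _≈HF_ f s (toQ x) (toQ y)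
  ⇒~H (c , Fc , c≢0 , eq) = c , Real⇒F Fc , c≢0 , cong toQ eq

  Φ⇒ : ∀ {A x} → Phi f s A x → Φ (fromM A) (fromQ x)
  Φ⇒ (β , β≢0 , βα , r , t , u , v , Fr , Ft , Fu , Fv , βA , sim) =
    Φ-intro β β≢0 (βα ∙ conjK≡ β) r t u v (F⇒Real Fr) (F⇒Real Ft) (F⇒Real Fu) (F⇒Real Fv) (cong fromM βA)
      (~H⇒ sim)

  ⇒Φ : ∀ {A x} → Φ A x → Phi f s (toM A) (toQ x)
  ⇒Φ (Φ-intro β β≢0 βα r t u v Fr Ft Fu Fv βA sim) =
    β , β≢0 , βα ∙ sym (conjK≡ β) , r , t , u , v , Real⇒F Fr , Real⇒F Ft , Real⇒F Fu , Real⇒F Fv ,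
      cong toM βA , ⇒~H sim

  RF⇒ : ∀ {a} → InRF f s a → RealR a
  RF⇒ (Ra , Fa) = InR⇒R Ra , F⇒Real Fa

  ⇒RF : ∀ {a} → RealR a → InRF f s a
  ⇒RF (Ra , Fa) = R⇒InR Ra , Real⇒F Fa

  RealR-+ : ∀ {x y} → RealR x → RealR y → RealR (x + y)
  RealR-+ (R₁ , F₁) (R₂ , F₂) = R-+ R₁ R₂ , Real-+ F₁ F₂

  RealR-h : ∀ {x} → RealR x → RealR (h * x)
  RealR-h (R₁ , F₁) = R-* R-h R₁ , Real-* h-real F₁

  M⇒ : ∀ {x} → InM f s x → M (fromQ x)
  M⇒ (a , b , c , d , Ra , Rb , Rc , Rd , refl) = RealR-+ (RF⇒ Ra) D′ , RealR-+ (RF⇒ Rb) D′ ,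
    RealR-+ (RF⇒ Rc) D′ , D′
    where
    D′ : RealR (_·K_ f s ½ d)
    D′ = subst RealR (sym (½·≡ d)) (RealR-h (RF⇒ Rd))

  -- The last coordinate can come only from the generator (1 + i + j + k)/2, which therefore gets
  -- the coefficient 2 d; its contribution d is subtracted from the other three.
  ⇒M : ∀ {x} → M x → InM f s (toQ x)
  ⇒M {quad a b c d} (Ma , Mb , Mc , Md) = a - d , b - d , c - d , 2# * d , ⇒RF (minus Ma) , ⇒RF (minus Mb) ,
    ⇒RF (minus Mc) ,
      ⇒RF (R-* (R-nat 2) (proj₁ Md) , Real-* (num-real (ℤ.+ 2)) (proj₂ Md)) ,
        cong toQ (quad-≡ (back a) (back b) (back c) (sym ½2d))
    where
    minus : ∀ {x} → RealR x → RealR (x - d)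
    minus (Rx , Fx) = R-− Rx (proj₁ Md) , Real-− Fx (proj₂ Md)
    ½2d : _·K_ f s ½ (2# * d) ≡ d
    ½2d = ½·≡ (2# * d) ∙ sym (*-assoc h 2# d) ∙ 2h d
    back : ∀ x → x ≡ (x - d) + _·K_ f s ½ (2# * d)
    back x = sym (cong ((x - d) +_) ½2d ∙ +-assoc x (- d) d ∙ cong (x +_) (-‿inverseˡ d) ∙ +-identityʳ x)

  Mx⇒ : ∀ {x} → InMx f s x → Mˣ (fromQ x)
  Mx⇒ (Mx , y , My , xy , yx) = Mˣ-intro (M⇒ Mx) (fromQ y) (M⇒ My) (cong fromQ xy) (cong fromQ yx)

  ⇒Mx : ∀ {x} → Mˣ x → InMx f s (toQ x)
  ⇒Mx (Mˣ-intro Mx y My xy yx) = ⇒M Mx , toQ y , ⇒M My , cong toQ xy , cong toQ yx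

  defined : ∀ A → IsU2R f s A → ∃ λ x → Phi f s A x
  defined A U = let (x , Φx) = φ-exists (U⇒ {A} U) in toQ x , ⇒Φ Φx

  nonzero : ∀ A x → IsU2R f s A → Phi f s A x → InHx f s x
  nonzero A x U Φx = let ((a , b , c , d) , x≢0) = φ-nonzero (U⇒ {A} U) (Φ⇒ {A} {x} Φx) in
    (Real⇒F a , Real⇒F b , Real⇒F c , Real⇒F d) , λ eq → x≢0 (cong fromQ eq)

  well-defined : ∀ A B x y → IsU2R f s A → IsU2R f s B → _≈PU_ f s A B → Phi f s A x → Phi f s B y →
    _≈HF_ f s x y
  well-defined A B x y _ _ (ℓ , Rℓ , ℓℓ̄ , eq) Φx Φy =
    ⇒~H (φ-well-defined {fromM A} {fromM B} (ℓ , InR⇒R Rℓ , cong (ℓ *_) (sym (conjK≡ ℓ)) ∙ ℓℓ̄ , cong fromM eq)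
      (Φ⇒ {A} {x} Φx) (Φ⇒ {B} {y} Φy))

  homomorphic : ∀ A B x y → IsU2R f s A → IsU2R f s B → Phi f s A x → Phi f s B y →
    Phi f s (_*M_ f s A B) (_*H_ f s x y)
  homomorphic A B x y _ _ Φx Φy = ⇒Φ (φ-homomorphic (Φ⇒ {A} {x} Φx) (Φ⇒ {B} {y} Φy))

  injective : ∀ A B x y → IsU2R f s A → IsU2R f s B → Phi f s A x → Phi f s B y → _≈HF_ f s x y → _≈PU_ f s A B
  injective A B x y U V Φx Φy x~y =
    let (ℓ , Rℓ , ℓℓ̄ , eq) = φ-injective (U⇒ {A} U) (U⇒ {B} V) (Φ⇒ {A} {x} Φx) (Φ⇒ {B} {y} Φy) (~H⇒ x~y) in
    ℓ , R⇒InR Rℓ , cong (ℓ *_) (conjK≡ ℓ) ∙ ℓℓ̄ , cong toM eq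

  image : ∀ A x → IsU2R f s A → Phi f s A x → ∃ λ m → InMx f s m × _≈HF_ f s m x
  image A x U Φx = let (μ , Mμ , μ~x) = φ-in-M (U⇒ {A} U) (Φ⇒ {A} {x} Φx) in toQ μ , ⇒Mx Mμ , ⇒~H μ~x

  surjective : ∀ m → InMx f s m → ∃ λ A → IsU2R f s A × Phi f s A m
  surjective m Mm = let (A , U , ΦA) = φ-onto-M (Mx⇒ Mm) in toM A , ⇒U U , ⇒Φ ΦA

  inclusion : ∀ m m' → InMx f s m → InMx f s m' → _≈HF_ f s m m' → _≈MR_ f s m m'
  inclusion m m' Mm Mm' m~m' = let (k , Rk , (l , Rl , kl) , eq) = M-inclusion (Mx⇒ Mm) (Mx⇒ Mm') (~H⇒ m~m') in
    k , ⇒RF Rk , (l , ⇒RF Rl , kl) , cong toQ eq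

theorem3p25 : (f : Family) (s : ℕ) → 8 ≤ level f s →
  -- φ_n is defined on all of PU_2(R_n), with values in H_n^×
  (∀ A → IsU2R f s A → ∃ λ x → Phi f s A x) ×
  (∀ A x → IsU2R f s A → Phi f s A x → InHx f s x) ×
  -- well defined on classes
  (∀ A B x y → IsU2R f s A → IsU2R f s B → _≈PU_ f s A B →
     Phi f s A x → Phi f s B y → _≈HF_ f s x y) ×
  -- group homomorphism
  (∀ A B x y → IsU2R f s A → IsU2R f s B → Phi f s A x → Phi f s B y →
     Phi f s (_*M_ f s A B) (_*H_ f s x y)) ×
  -- injective
  (∀ A B x y → IsU2R f s A → IsU2R f s B → Phi f s A x → Phi f s B y →
     _≈HF_ f s x y → _≈PU_ f s A B) ×
  -- image lies in M̃_n^×/R̲_n^×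
  (∀ A x → IsU2R f s A → Phi f s A x → ∃ λ m → InMx f s m × _≈HF_ f s m x) ×
  -- and is all of it
  (∀ m → InMx f s m → ∃ λ A → IsU2R f s A × Phi f s A m) ×
  -- M̃_n^×/R̲_n^× ⊆ H_n^×/F_n^×  (the inclusion is injective)
  (∀ m m' → InMx f s m → InMx f s m' → _≈HF_ f s m m' → _≈MR_ f s m m')
theorem3p25 f s 8≤n = defined , nonzero , well-defined , homomorphic , injective , image , surjective ,
  inclusion
  where open Transfer f s (levelOf f s 8≤n)
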